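{- Suppose $V_0\subseteq V_1$ are models of set theory, $\kappa$ is an infinite ordinal, $X,\mathscr{L}\in V_0$ with $X$ infinite and $\mathscr{L}$ a relational language, and let $\mu\in V_0$ be an invariant measure on $[\mathrm{Str}^\kappa_{\mathscr{L}}(X)]^{V_0}$. Then $\mu$ is ergodic in $V_0$ if and only if $\mu^{V_1}$ is ergodic in $V_1$.
   Context: A model of set theory is a transitive model of ZFC (contained in a fixed background model); $\kappa\in V_0$ need not be a cardinal in any given model. Structures and measures: $\mathrm{Str}_{\mathscr{L}}(X)$ is the set of $\mathscr{L}$-structures with underlying set $X$. An $\mathscr{L}$-literal is an atomic formula or a (possibly iterated) negation of one. $\sigma_\kappa(\mathrm{Str}_{\mathscr{L}}(X))$ is the smallest family of subsets of $\mathrm{Str}_{\mathscr{L}}(X)$ closed under complements and under unions of size $\le\kappa$ and containing all sets $\{\mathcal{M}:\mathcal{M}\models\varphi(\bar a)\}$ for $\varphi$ a literal and $\bar a$ a tuple from $X$. $\mathrm{Str}^\kappa_{\mathscr{L}}(X)$ is $\mathrm{Str}_{\mathscr{L}}(X)$ with this family of measurable sets. A probability $\kappa$-measure on it is a probability measure $\mu$ with $\mu(\bigcup_{i\in\kappa}A_i)=\sum_{i\in\kappa}\mu(A_i)$ for pairwise disjoint measurable $A_i$. $\mathrm{Sym}(X)$ acts by $g\mathcal{M}\models R(g(a_0),\dots)$ iff $\mathcal{M}\models R(a_0,\dots)$; $\mu$ is invariant if $\mu(g[A])=\mu(A)$ for all $g\in\mathrm{Sym}(X)$ and measurable $A$.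 "Invariant measure" means invariant probability $\kappa$-measure. A measurable set $A$ is $\mu$-almost invariant if $\mu(g[A]\,\triangle\,A)=0$ for all $g\in\mathrm{Sym}(X)$. An invariant measure $\mu$ is ergodic if every $\mu$-almost invariant measurable set $A$ has $\mu(A)\in\{0,1\}$. Relativization: $\mu^{V_1}$ denotes the relativization of $\mu$ to $V_1$, i.e. the unique probability $\kappa$-measure in $V_1$ on $[\mathrm{Str}^\kappa_{\mathscr{L}}(X)]^{V_1}$ such that for every finite conjunction $\varphi$ of $\mathscr{L}$-literals and tuple $\bar a$ from $X$, the set $\{\mathcal{M}:\mathcal{M}\models\varphi(\bar a)\}$ computed in $V_1$ has the same $\mu^{V_1}$-measure as the $\mu$-measure of that set computed in $V_0$. -}

module Defs where

open import Level using (Level; suc)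
open import Data.Nat.Base as ℕ using (ℕ)
open import Data.Fin.Base using (Fin)
open import Data.Vec.Base using (Vec; []; _∷_; lookup)
open import Data.Product.Base using (Σ; ∃; ∃-syntax; _×_; _,_; proj₁; proj₂)
open import Data.Sum.Base using (_⊎_)
open import Function.Base using (_on_)
open import Function.Bundles using (_⇔_)
open import Relation.Binary.Core using (Rel)
open import Relation.Nullary.Negation.Core using (¬_)
open import Relation.Binary.PropositionalEquality.Core using (_≡_)
open import Relation.Unary using (Pred)

record ∈-Structure (ℓ : Level) : Set (suc ℓ) where
  infix 4 _≈_ _∈_
  field
    Carrier : Set ℓ
    _≈_     : Rel Carrier ℓ
    _∈_     : Rel Carrier ℓ

-- First-order formulas over {∈, =}, with de Bruijn variables.  The schemas of
-- ZFC must range over these: quantifying over arbitrary Agda predicates would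
-- give second-order set theory, whose inner models contain all subsets of
-- their elements.
data Formula (n : ℕ) : Set where
  _∈̇_ _≐_         : Fin n → Fin n → Formula n
  ¬̇_              : Formula n → Formula n
  _∧̇_ _∨̇_ _⇒̇_    : Formula n → Formula n → Formula n
  ∀̇_ ∃̇_           : Formula (ℕ.suc n) → Formula n

module _ {ℓ} (S : ∈-Structure ℓ) where
  open ∈-Structure S

  Sat : ∀ {n} → Formula n → Vec Carrier n → Set ℓ
  Sat (i ∈̇ j) ρ = lookup ρ i ∈ lookup ρ j
  Sat (i ≐ j) ρ = lookup ρ i ≈ lookup ρ j
  Sat (¬̇ φ)   ρ = ¬ Sat φ ρ
  Sat (φ ∧̇ ψ) ρ = Sat φ ρ × Sat ψ ρ
  Sat (φ ∨̇ ψ) ρ = Sat φ ρ ⊎ Sat ψ ρ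
  Sat (φ ⇒̇ ψ) ρ = Sat φ ρ → Sat ψ ρ
  Sat (∀̇ φ)   ρ = ∀ x → Sat φ (x ∷ ρ)
  Sat (∃̇ φ)   ρ = ∃[ x ] Sat φ (x ∷ ρ)

  record IsZFC : Set ℓ where
    field
      extensionality : ∀ a b → (∀ x → x ∈ a ⇔ x ∈ b) → a ≈ b
      foundation     : ∀ a → (∃[ x ] x ∈ a) →
                       ∃[ x ] x ∈ a × (∀ y → y ∈ x → ¬ y ∈ a)
      pairing        : ∀ a b → ∃[ c ] (∀ x → x ∈ c ⇔ (x ≈ a ⊎ x ≈ b))
      union          : ∀ a → ∃[ b ] (∀ x → x ∈ b ⇔ (∃[ y ] y ∈ a × x ∈ y))
      powerSet       : ∀ a → ∃[ b ] (∀ x → x ∈ b ⇔ (∀ y → y ∈ x → y ∈ a))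
      infinity       : ∃[ e ] (∀ x → ¬ x ∈ e) × ∃[ I ] e ∈ I ×
                       (∀ x → x ∈ I → ∃[ s ] s ∈ I × (∀ y → y ∈ s ⇔ (y ∈ x ⊎ y ≈ x)))
      choice         : ∀ a → (∀ x → x ∈ a → ∃[ y ] y ∈ x) →
                       (∀ x y z → x ∈ a → y ∈ a → z ∈ x → z ∈ y → x ≈ y) →
                       ∃[ c ] (∀ x → x ∈ a →
                         ∃[ y ] (y ∈ x × y ∈ c) × (∀ z → z ∈ x → z ∈ c → z ≈ y))
      separation     : ∀ {n} (φ : Formula (1 ℕ.+ n)) (ρ : Vec Carrier n) a →
                       ∃[ b ] (∀ x → x ∈ b ⇔ (x ∈ a × Sat φ (x ∷ ρ)))
      replacement    : ∀ {n} (φ : Formula (2 ℕ.+ n)) (ρ : Vec Carrier n) a →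
                       (∀ x → x ∈ a → ∃[ y ] Sat φ (x ∷ y ∷ ρ) ×
                         (∀ z → Sat φ (x ∷ z ∷ ρ) → z ≈ y)) →
                       ∃[ b ] (∀ y → y ∈ b ⇔ (∃[ x ] x ∈ a × Sat φ (x ∷ y ∷ ρ)))

record BackgroundModel (ℓ : Level) : Set (suc ℓ) where
  field
    Universe : Set ℓ
    _∈_      : Rel Universe ℓ
    isZFC    : IsZFC (record { Carrier = Universe ; _≈_ = _≡_ ; _∈_ = _∈_ })

-- A proof of V x is irrelevant to the identity of x in the substructure.
subStructure : ∀ {ℓ} (𝔹 : BackgroundModel ℓ) → Pred (BackgroundModel.Universe 𝔹) ℓ → ∈-Structure ℓ
subStructure 𝔹 V = record
  { Carrier = Σ Universe V
  ; _≈_     = _≡_ on proj₁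
  ; _∈_     = _∈_ on proj₁
  } where open BackgroundModel 𝔹

-- A model of set theory: a transitive model of ZFC, of set or class size,
-- contained in the background model.
record TransitiveModel {ℓ} (𝔹 : BackgroundModel ℓ) : Set (suc ℓ) where
  open BackgroundModel 𝔹 using (Universe; _∈_)
  field
    Class      : Pred Universe ℓ
    transitive : ∀ x y → Class x → y ∈ x → Class y
    zfc        : IsZFC (subStructure 𝔹 Class)

  Element : Set ℓ
  Element = Σ Universe Class

module _ {ℓ} {𝔹 : BackgroundModel ℓ} where
  open TransitiveModel

  record _⊑_ (V₀ V₁ : TransitiveModel 𝔹) : Set ℓ where
    field
      inclusion : ∀ x → Class V₀ x → Class V₁ x

  ι : ∀ {V₀ V₁} → V₀ ⊑ V₁ → Element V₀ → Element V₁
  ι V₀⊑V₁ (x , x∈V₀) = x , _⊑_.inclusion V₀⊑V₁ x x∈V₀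

-- The notions below are read inside a transitive model V: every quantifier over
-- sets ranges over the elements of V.
module Internal {ℓ} {𝔹 : BackgroundModel ℓ} (V : TransitiveModel 𝔹) where
  open TransitiveModel V using (Class; zfc)
  open ∈-Structure (subStructure 𝔹 Class) renaming (Carrier to 𝕍) public
  open IsZFC zfc

  infix  4 _⊆_ _[_]=_ _∶_⟶_
  infixr 6 _∪_

  _⊆_ : Rel 𝕍 ℓ
  a ⊆ b = ∀ x → x ∈ a → x ∈ b

  ∅ : 𝕍
  ∅ = proj₁ infinity

  ⁅_,_⁆ : 𝕍 → 𝕍 → 𝕍
  ⁅ a , b ⁆ = proj₁ (pairing a b)

  ⟨_,_⟩ : 𝕍 → 𝕍 → 𝕍
  ⟨ a , b ⟩ = ⁅ ⁅ a , a ⁆ , ⁅ a , b ⁆ ⁆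

  _∪_ : 𝕍 → 𝕍 → 𝕍
  a ∪ b = proj₁ (union ⁅ a , b ⁆)

  succ : 𝕍 → 𝕍
  succ a = a ∪ ⁅ a , a ⁆

  _[_]=_ : 𝕍 → 𝕍 → 𝕍 → Set ℓ
  f [ x ]= y = ⟨ x , y ⟩ ∈ f

  IsFunctionOn : 𝕍 → 𝕍 → Set ℓ
  IsFunctionOn f a =
    (∀ p → p ∈ f → ∃[ x ] ∃[ y ] p ≈ ⟨ x , y ⟩ × x ∈ a) ×
    (∀ x → x ∈ a → ∃[ y ] f [ x ]= y × (∀ z → f [ x ]= z → z ≈ y))

  _∶_⟶_ : 𝕍 → 𝕍 → 𝕍 → Set ℓ
  f ∶ a ⟶ b = IsFunctionOn f a × (∀ x y → f [ x ]= y → y ∈ b)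

  Injective : 𝕍 → Set ℓ
  Injective f = ∀ x x′ y → f [ x ]= y → f [ x′ ]= y → x ≈ x′

  IsBijection : 𝕍 → 𝕍 → 𝕍 → Set ℓ
  IsBijection f a b = f ∶ a ⟶ b × Injective f × (∀ y → y ∈ b → ∃[ x ] f [ x ]= y)

  IsComposite : 𝕍 → 𝕍 → 𝕍 → Set ℓ
  IsComposite h g f = ∀ p → p ∈ h ⇔ (∃[ x ] ∃[ y ] ∃[ z ] p ≈ ⟨ x , z ⟩ × f [ x ]= y × g [ y ]= z)

  Inductive : 𝕍 → Set ℓ
  Inductive I = ∅ ∈ I × (∀ x → x ∈ I → succ x ∈ I)

  IsNat : 𝕍 → Set ℓ
  IsNat n = ∀ I → Inductive I → n ∈ I

  Isω : 𝕍 → Set ℓ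
  Isω w = ∀ n → n ∈ w ⇔ IsNat n

  Infinite : 𝕍 → Set ℓ
  Infinite a = ∀ n f → IsNat n → ¬ IsBijection f n a

  IsTransitive : 𝕍 → Set ℓ
  IsTransitive a = ∀ x → x ∈ a → x ⊆ a

  IsOrdinal : 𝕍 → Set ℓ
  IsOrdinal α = IsTransitive α × (∀ x → x ∈ α → IsTransitive x)

  -- Iterate Step a n b: some sequence a = s₀, s₁, …, sₙ = b has Step i sᵢ sᵢ₊₁
  -- for all i < n.
  Iterate : (𝕍 → 𝕍 → 𝕍 → Set ℓ) → 𝕍 → 𝕍 → 𝕍 → Set ℓ
  Iterate Step a n b = ∃[ s ] IsFunctionOn s (succ n) × s [ ∅ ]= a × s [ n ]= b ×
    (∀ i x y → i ∈ n → s [ i ]= x → s [ succ i ]= y → Step i x y)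

  Add : 𝕍 → 𝕍 → 𝕍 → Set ℓ
  Add m = Iterate (λ _ x y → y ≈ succ x) m

  Mul : 𝕍 → 𝕍 → 𝕍 → Set ℓ
  Mul m = Iterate (λ _ x y → Add x m y) ∅

  Even : 𝕍 → Set ℓ
  Even k = ∃[ m ] IsNat m × Add m m k

  -- Non-negative rationals are represented by fractions p / q, which are not
  -- identified when they have the same value.
  Frac : 𝕍 → 𝕍 → 𝕍 → Set ℓ
  Frac x p q = x ≈ ⟨ p , q ⟩ × IsNat p × IsNat q × ¬ q ≈ ∅

  IsFrac : 𝕍 → Set ℓ
  IsFrac x = ∃[ p ] ∃[ q ] Frac x p q

  CompareFrac : Rel 𝕍 ℓ → Rel 𝕍 ℓ
  CompareFrac _R_ x y = ∃[ p ] ∃[ q ] ∃[ p′ ] ∃[ q′ ] ∃[ u ] ∃[ v ]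
    Frac x p q × Frac y p′ q′ × Mul p q′ u × Mul p′ q v × u R v

  _<Q_ _≤Q_ : Rel 𝕍 ℓ
  _<Q_ = CompareFrac _∈_
  _≤Q_ = CompareFrac (λ u v → u ∈ v ⊎ u ≈ v)

  AddFrac : 𝕍 → 𝕍 → 𝕍 → Set ℓ
  AddFrac x y z = ∃[ p ] ∃[ q ] ∃[ p′ ] ∃[ q′ ] ∃[ u ] ∃[ v ] ∃[ n ] ∃[ d ]
    Frac x p q × Frac y p′ q′ × Mul p q′ u × Mul p′ q v × Add u v n × Mul q q′ d × Frac z n d

  -- Non-negative reals are open lower cuts r = { x ∈ ℚ≥0 : x < r }.  In
  -- particular 0 is ∅, and r ≤ r′ is r ⊆ r′.
  IsReal : 𝕍 → Set ℓ
  IsReal r =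
    (∀ x → x ∈ r → IsFrac x) ×
    (∀ x y → x ∈ r → y ≤Q x → y ∈ r) ×
    (∀ x → x ∈ r → ∃[ y ] y ∈ r × x <Q y) ×
    (∃[ x ] IsFrac x × ¬ x ∈ r)

  IsOne : 𝕍 → Set ℓ
  IsOne r = ∀ x → x ∈ r ⇔ (∃[ p ] ∃[ q ] Frac x p q × p ∈ q)

  -- The first two cases are needed because the cut of 0 is empty.
  AddReal : 𝕍 → 𝕍 → 𝕍 → Set ℓ
  AddReal r s t = ∀ x → x ∈ t ⇔
    (x ∈ r ⊎ x ∈ s ⊎ (∃[ y ] ∃[ z ] ∃[ w ] y ∈ r × z ∈ s × AddFrac y z w × x ≤Q w))

  -- t = f(i₀) + … + f(iₙ₋₁) for some distinct i₀, …, iₙ₋₁ in I, where F is the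
  -- graph of f.
  IsFinitePartialSum : 𝕍 → Rel 𝕍 ℓ → 𝕍 → Set ℓ
  IsFinitePartialSum I F t = ∃[ n ] ∃[ e ] IsNat n × e ∶ n ⟶ I × Injective e ×
    Iterate (λ k r s → ∃[ i ] ∃[ v ] e [ k ]= i × F i v × AddReal r v s) ∅ n t

  HasSum : 𝕍 → Rel 𝕍 ℓ → 𝕍 → Set ℓ
  HasSum I F r = IsReal r ×
    (∀ t → IsFinitePartialSum I F t → t ⊆ r) ×
    (∀ s → IsReal s → (∀ t → IsFinitePartialSum I F t → t ⊆ s) → r ⊆ s)

  -- A relational language is its arity function; arity 0 is allowed.
  IsRelationalLanguage : 𝕍 → Set ℓ
  IsRelationalLanguage 𝓛 = ∃[ Rels ] IsFunctionOn 𝓛 Rels × (∀ R n → 𝓛 [ R ]= n → IsNat n)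

  module Structures (κ X 𝓛 : 𝕍) where

    -- A structure with underlying set X is the function R ↦ Rᴹ ⊆ Xⁿ, where n is
    -- the arity of R and Xⁿ is the set of functions n → X.
    IsStructure : 𝕍 → Set ℓ
    IsStructure M =
      (∀ p → p ∈ M → ∃[ R ] ∃[ n ] ∃[ P ] p ≈ ⟨ R , P ⟩ × 𝓛 [ R ]= n) ×
      (∀ R n → 𝓛 [ R ]= n →
        ∃[ P ] M [ R ]= P × (∀ Q → M [ R ]= Q → Q ≈ P) × (∀ t → t ∈ P → t ∶ n ⟶ X))

    IsStr : 𝕍 → Set ℓ
    IsStr S = ∀ M → M ∈ S ⇔ IsStructure M

    Holds : 𝕍 → 𝕍 → 𝕍 → Set ℓ
    Holds M R t = ∃[ P ] M [ R ]= P × t ∈ P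

    zeroTag oneTag : 𝕍
    zeroTag = ∅
    oneTag  = succ ∅

    -- Formulas in the variables x₀, …, xₙ₋₁.  The code ⟨ 0 , ⟨ i , j ⟩ ⟩ stands
    -- for xᵢ = xⱼ, the code ⟨ 1 , ⟨ R , s ⟩ ⟩ for R(x_{s(0)}, x_{s(1)}, …), and
    -- ⟨ k , α ⟩ for the k-fold negation of α.
    IsAtomic : 𝕍 → 𝕍 → Set ℓ
    IsAtomic n α =
      (∃[ i ] ∃[ j ] α ≈ ⟨ zeroTag , ⟨ i , j ⟩ ⟩ × i ∈ n × j ∈ n) ⊎
      (∃[ R ] ∃[ s ] ∃[ m ] α ≈ ⟨ oneTag , ⟨ R , s ⟩ ⟩ × 𝓛 [ R ]= m × s ∶ m ⟶ n)

    IsLiteral : 𝕍 → 𝕍 → Set ℓ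
    IsLiteral n φ = ∃[ k ] ∃[ α ] φ ≈ ⟨ k , α ⟩ × IsNat k × IsAtomic n α

    IsConjunction : 𝕍 → 𝕍 → Set ℓ
    IsConjunction n c = ∃[ m ] IsNat m × IsFunctionOn c m × (∀ j φ → c [ j ]= φ → IsLiteral n φ)

    SatAtomic : 𝕍 → 𝕍 → 𝕍 → Set ℓ
    SatAtomic M a α =
      (∃[ i ] ∃[ j ] ∃[ x ] α ≈ ⟨ zeroTag , ⟨ i , j ⟩ ⟩ × a [ i ]= x × a [ j ]= x) ⊎
      (∃[ R ] ∃[ s ] ∃[ t ] α ≈ ⟨ oneTag , ⟨ R , s ⟩ ⟩ × IsComposite t a s × Holds M R t)

    SatLiteral : 𝕍 → 𝕍 → 𝕍 → Set ℓ
    SatLiteral M a φ = ∃[ k ] ∃[ α ] φ ≈ ⟨ k , α ⟩ × (Even k ⇔ SatAtomic M a α)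

    SatConjunction : 𝕍 → 𝕍 → 𝕍 → Set ℓ
    SatConjunction M a c = ∀ j φ → c [ j ]= φ → SatLiteral M a φ

    IsTuple : 𝕍 → 𝕍 → Set ℓ
    IsTuple n a = IsNat n × a ∶ n ⟶ X

    IsLiteralSet : 𝕍 → Set ℓ
    IsLiteralSet A = ∃[ n ] ∃[ a ] ∃[ φ ] IsTuple n a × IsLiteral n φ ×
      (∀ M → M ∈ A ⇔ (IsStructure M × SatLiteral M a φ))

    IsConjunctionSet : 𝕍 → 𝕍 → 𝕍 → Set ℓ
    IsConjunctionSet a c A = ∀ M → M ∈ A ⇔ (IsStructure M × SatConjunction M a c)

    IsComplement : 𝕍 → 𝕍 → Set ℓ
    IsComplement A B = ∀ M → M ∈ B ⇔ (IsStructure M × ¬ M ∈ A)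

    IsUnion : 𝕍 → 𝕍 → Set ℓ
    IsUnion F B = ∀ M → M ∈ B ⇔ (∃[ A ] A ∈ F × M ∈ A)

    IsClosedFamily : 𝕍 → Set ℓ
    IsClosedFamily F =
      (∀ A → A ∈ F → ∀ M → M ∈ A → IsStructure M) ×
      (∀ A → IsLiteralSet A → A ∈ F) ×
      (∀ A B → A ∈ F → IsComplement A B → B ∈ F) ×
      (∀ G g B → G ⊆ F → g ∶ G ⟶ κ → Injective g → IsUnion G B → B ∈ F)

    Measurable : 𝕍 → Set ℓ
    Measurable A = ∀ F → IsClosedFamily F → A ∈ F

    MeasureOf : 𝕍 → 𝕍 → Rel 𝕍 ℓ
    MeasureOf μ f i v = ∃[ A ] f [ i ]= A × μ [ A ]= v

    IsAdditive : 𝕍 → 𝕍 → Set ℓ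
    IsAdditive μ I = ∀ f B r → IsFunctionOn f I →
      (∀ i A → f [ i ]= A → Measurable A) →
      (∀ i j A C M → f [ i ]= A → f [ j ]= C → M ∈ A → M ∈ C → i ≈ j) →
      (∀ M → M ∈ B ⇔ (∃[ i ] ∃[ A ] f [ i ]= A × M ∈ A)) →
      μ [ B ]= r → HasSum I (MeasureOf μ f) r

    record IsProbabilityκMeasure (μ : 𝕍) : Set ℓ where
      field
        domain     : ∀ p → p ∈ μ → ∃[ A ] ∃[ r ] p ≈ ⟨ A , r ⟩ × Measurable A × IsReal r
        function   : ∀ A → Measurable A → ∃[ r ] μ [ A ]= r × (∀ s → μ [ A ]= s → s ≈ r)
        total      : ∀ S r → IsStr S → μ [ S ]= r → IsOne r
        σ-additive : ∀ w → Isω w → IsAdditive μ w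
        κ-additive : IsAdditive μ κ

    IsSym : 𝕍 → Set ℓ
    IsSym g = IsBijection g X X

    IsAction : 𝕍 → 𝕍 → 𝕍 → Set ℓ
    IsAction g M N = IsStructure N ×
      (∀ R n t u → 𝓛 [ R ]= n → t ∶ n ⟶ X → IsComposite u g t → Holds N R u ⇔ Holds M R t)

    IsImage : 𝕍 → 𝕍 → 𝕍 → Set ℓ
    IsImage g A B = ∀ N → N ∈ B ⇔ (∃[ M ] M ∈ A × IsAction g M N)

    IsSymmetricDifference : 𝕍 → 𝕍 → 𝕍 → Set ℓ
    IsSymmetricDifference A B D = ∀ M → M ∈ D ⇔ ((M ∈ A × ¬ M ∈ B) ⊎ (M ∈ B × ¬ M ∈ A))

    IsInvariant : 𝕍 → Set ℓ
    IsInvariant μ = ∀ g A B r → IsSym g → Measurable A → IsImage g A B → μ [ A ]= r → μ [ B ]= r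

    IsInvariantMeasure : 𝕍 → Set ℓ
    IsInvariantMeasure μ = IsProbabilityκMeasure μ × IsInvariant μ

    IsAlmostInvariant : 𝕍 → 𝕍 → Set ℓ
    IsAlmostInvariant μ A = ∀ g B D → IsSym g → IsImage g A B →
      IsSymmetricDifference B A D → μ [ D ]= ∅

    IsErgodic : 𝕍 → Set ℓ
    IsErgodic μ = IsInvariantMeasure μ × (∀ A → Measurable A → IsAlmostInvariant μ A →
      μ [ A ]= ∅ ⊎ (∃[ r ] IsOne r × μ [ A ]= r))

-- ν is the measure μ^{V₁}.  Codes of conjunctions, tuples, and the lower cuts of
-- V₀ are themselves elements of V₁, so the two measures are compared by ι.
module _ {ℓ} {𝔹 : BackgroundModel ℓ} {V₀ V₁ : TransitiveModel 𝔹} (V₀⊑V₁ : V₀ ⊑ V₁)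
         (κ X 𝓛 : TransitiveModel.Element V₀) where
  private
    i = ι V₀⊑V₁
    module I₀ = Internal V₀
    module I₁ = Internal V₁
    module S₀ = I₀.Structures κ X 𝓛
    module S₁ = I₁.Structures (i κ) (i X) (i 𝓛)

  IsRelativization : TransitiveModel.Element V₀ → TransitiveModel.Element V₁ → Set ℓ
  IsRelativization μ ν = S₁.IsProbabilityκMeasure ν ×
    (∀ n a c A₀ A₁ r → S₀.IsTuple n a → S₀.IsConjunction n c →
      S₀.IsConjunctionSet a c A₀ → S₁.IsConjunctionSet (i a) (i c) A₁ →
      μ I₀.[ A₀ ]= r → ν I₁.[ A₁ ]= i r)

module Submission where

-- Call a sequence b of sets generated by finitely many atoms a path if μ(b(n) △ g b(n)) ≤ δ(n) for all permutations g,
-- μ(b(n) △ b(n + 1)) ≤ δ(n), the δ(n) are positive and at least halve in each step, and b(0) and its complement have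
-- measure more than 3 δ(0).  The limit superior of a path is an almost invariant set of measure neither 0 nor 1; conversely,
-- approximating such a set by finitely generated ones yields a path.  So μ is not ergodic iff there is a path.
-- In V₁ the finitely generated sets are determined by finitely many atoms, hence have traces in V₀, of the same measure,
-- and a permutation moves them like one from V₀.  Thus a path of V₀ gives one of V₁.  For the converse, a
-- nonergodic measure of V₁ yields a branch of a tree that lies in V₀; if V₀ had no branch, it would contain a rank
-- function for the tree, and the tree would have no branch in V₁ either.

open import Level using (_⊔_)
open import Axiom.ExcludedMiddle using (ExcludedMiddle)
open import Algebra.Bundles using (CommutativeSemiring)
open import Algebra.Structures.Biased using (isCommutativeSemiringˡ)
import Algebra.Solver.Ring.NaturalCoefficients.Default as NatSolver
open import Data.Nat.Base as ℕ using (ℕ; zero; suc)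
open import Data.Fin.Base using (Fin; zero; suc; _↑ˡ_; _↑ʳ_)
open import Data.Fin.Patterns
open import Data.Vec.Base as Vec using (Vec; []; _∷_; lookup; _++_)
open import Data.Vec.Properties using (lookup-++ˡ; lookup-++ʳ)
open import Data.Product.Base using (Σ; ∃-syntax; _×_; _,_; proj₁; proj₂)
open import Data.Sum.Base as Sum using (_⊎_; inj₁; inj₂; [_,_]′)
open import Data.Empty using (⊥; ⊥-elim)
open import Function.Base using (_∘_; id)
open import Function.Bundles using (_⇔_; mk⇔; Equivalence)
open import Relation.Nullary.Negation.Core using (¬_)
open import Relation.Nullary.Decidable.Core using (Dec; yes; no; recompute)
open Equivalence using (to; from)

-- Fractions over a semiring that is linearly ordered by x < y :⇔ y = x + (1 + k).
module OrderedSemiring {c ℓ} (R : CommutativeSemiring c ℓ) where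
  open CommutativeSemiring R
  open NatSolver R using (solve; _:+_; _:*_; _:=_; con)
  open import Relation.Binary.Reasoning.Setoid setoid

  infix 4 _<_ _≤_
  _<_ _≤_ : Carrier → Carrier → Set (c ⊔ ℓ)
  x < y = ∃[ k ] y ≈ x + (1# + k)
  x ≤ y = ∃[ k ] y ≈ x + k

  module Linear (compare : ∀ x y → x < y ⊎ x ≈ y ⊎ y < x) (irreflexive : ∀ x y → x < y → ¬ x ≈ y) where

    ≈⇒≤ : ∀ {x y} → x ≈ y → x ≤ y
    ≈⇒≤ e = 0# , trans (sym e) (sym (+-identityʳ _))

    <⇒≤ : ∀ {x y} → x < y → x ≤ y
    <⇒≤ (k , e) = 1# + k , e

    ≤-or-> : ∀ x y → x ≤ y ⊎ y < x
    ≤-or-> x y = [ (λ h → inj₁ (<⇒≤ h)) , [ (λ e → inj₁ (≈⇒≤ e)) , inj₂ ]′ ]′ (compare x y)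

    ≤⇒≯ : ∀ {x y} → x ≤ y → ¬ y < x
    ≤⇒≯ {x} {y} (k , e) (l , e′) = irreflexive x x (k + l , trans e′ (trans (+-congʳ e)
      (solve 3 (λ x k l → (x :+ k) :+ (con 1 :+ l) := x :+ (con 1 :+ (k :+ l))) refl x k l))) refl

    Positive : Carrier → Set (c ⊔ ℓ)
    Positive x = ∃[ j ] x ≈ 1# + j

    *-mono-< : ∀ {x y z} → Positive z → x < y → x * z < y * z
    *-mono-< {x} {y} {z} (j , e) (k , h) = j + k * (1# + j) , (begin
      y * z ≈⟨ *-cong h e ⟩
      (x + (1# + k)) * (1# + j) ≈⟨ solve 3 (λ x k j → (x :+ (con 1 :+ k)) :* (con 1 :+ j) :=
        x :* (con 1 :+ j) :+ (con 1 :+ (j :+ k :* (con 1 :+ j)))) refl x k j ⟩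
      x * (1# + j) + (1# + (j + k * (1# + j))) ≈⟨ +-congʳ (*-congˡ (sym e)) ⟩
      x * z + (1# + (j + k * (1# + j))) ∎)

    *-cancel-≤ : ∀ {x y z} → Positive z → x * z ≤ y * z → x ≤ y
    *-cancel-≤ p h = [ id , (λ q → ⊥-elim (≤⇒≯ h (*-mono-< p q))) ]′ (≤-or-> _ _)

    *-mono-≤ : ∀ {x y} z → x ≤ y → x * z ≤ y * z
    *-mono-≤ {x} z (k , h) = k * z , trans (*-congʳ h) (distribʳ z x k)

    *-cancel-< : ∀ {x y z} → x * z < y * z → x < y
    *-cancel-< {z = z} h = [ (λ q → ⊥-elim (≤⇒≯ (*-mono-≤ z q) h)) , id ]′ (≤-or-> _ _)

    infix 5 _/_⟨_⟩
    record Fraction : Set (c ⊔ ℓ) where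
      constructor _/_⟨_⟩
      field
        num den : Carrier
        den>0   : Positive den
    open Fraction

    infix 4 _≤q_ _<q_
    infixl 6 _⊕_
    infix 7 _·_
    opaque
      _≤q_ _<q_ : Fraction → Fraction → Set (c ⊔ ℓ)
      x ≤q y = num x * den y ≤ num y * den x
      x <q y = num x * den y < num y * den x

      ≤q-or-> : ∀ x y → x ≤q y ⊎ y <q x
      ≤q-or-> x y = ≤-or-> _ _

      ≤q⇒≯ : ∀ {x y} → x ≤q y → ¬ y <q x
      ≤q⇒≯ = ≤⇒≯

      <q⇒≤q : ∀ {x y} → x <q y → x ≤q y
      <q⇒≤q = <⇒≤

      ≤q-refl : ∀ {x} → x ≤q x
      ≤q-refl = ≈⇒≤ refl

      ≤q-trans : ∀ {x y z} → x ≤q y → y ≤q z → x ≤q z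
      ≤q-trans {p / q ⟨ q>0 ⟩} {p′ / q′ ⟨ q′>0 ⟩} {p″ / q″ ⟨ _ ⟩} (k , h) (l , h′) =
        *-cancel-≤ q′>0 (k * q″ + l * q , (begin
          (p″ * q) * q′ ≈⟨ solve 3 (λ a b c → (a :* b) :* c := (a :* c) :* b) refl p″ q q′ ⟩
          (p″ * q′) * q ≈⟨ *-congʳ h′ ⟩
          (p′ * q″ + l) * q ≈⟨ solve 4 (λ a b c d → (a :* b :+ c) :* d := (a :* d) :* b :+ c :* d) refl p′ q″ l q ⟩
          (p′ * q) * q″ + l * q ≈⟨ +-congʳ (*-congʳ h) ⟩
          (p * q′ + k) * q″ + l * q ≈⟨ solve 6 (λ p q′ k q″ l q → (p :* q′ :+ k) :* q″ :+ l :* q :=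
            (p :* q″) :* q′ :+ (k :* q″ :+ l :* q)) refl p q′ k q″ l q ⟩
          (p * q″) * q′ + (k * q″ + l * q) ∎))

      <q-≤q-trans : ∀ {x y z} → x <q y → y ≤q z → x <q z
      <q-≤q-trans {x} {y} {z} h k = [ (λ m → ⊥-elim (≤⇒≯ (≤q-trans {y} {z} {x} k m) h)) , id ]′ (≤-or-> _ _)

      ≤q-<q-trans : ∀ {x y z} → x ≤q y → y <q z → x <q z
      ≤q-<q-trans {x} {y} {z} h k = [ (λ m → ⊥-elim (≤⇒≯ (≤q-trans {z} {x} {y} m h) k)) , id ]′ (≤-or-> _ _)

      *-positive : ∀ {x y} → Positive x → Positive y → Positive (x * y)
      *-positive (j , e) (k , e′) = j + k * (1# + j) , trans (*-cong e e′)
        (solve 2 (λ j k → (con 1 :+ j) :* (con 1 :+ k) := con 1 :+ (j :+ k :* (con 1 :+ j))) refl j k)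

      _⊕_ : Fraction → Fraction → Fraction
      (p / q ⟨ q>0 ⟩) ⊕ (p′ / q′ ⟨ q′>0 ⟩) = (p * q′ + p′ * q) / (q * q′) ⟨ *-positive q>0 q′>0 ⟩

      ⊕-comm : ∀ x y → x ⊕ y ≤q y ⊕ x
      ⊕-comm (p / q ⟨ _ ⟩) (p′ / q′ ⟨ _ ⟩) = ≈⇒≤ (solve 4 (λ p q p′ q′ →
        (p :* q′ :+ p′ :* q) :* (q′ :* q) := (p′ :* q :+ p :* q′) :* (q :* q′)) refl p q p′ q′)

      ⊕-monoˡ-≤ : ∀ {x y} z → x ≤q y → x ⊕ z ≤q y ⊕ z
      ⊕-monoˡ-≤ {p / q ⟨ _ ⟩} {p′ / q′ ⟨ _ ⟩} (a / b ⟨ _ ⟩) (k , h) = k * (b * b) , (begin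
        (p′ * b + a * q′) * (q * b) ≈⟨ solve 5 (λ p′ q q′ a b → (p′ :* b :+ a :* q′) :* (q :* b) :=
          (p′ :* q) :* (b :* b) :+ a :* q′ :* q :* b) refl p′ q q′ a b ⟩
        (p′ * q) * (b * b) + a * q′ * q * b ≈⟨ +-congʳ (*-congʳ h) ⟩
        (p * q′ + k) * (b * b) + a * q′ * q * b ≈⟨ solve 6 (λ p q q′ a b k → (p :* q′ :+ k) :* (b :* b) :+ a :* q′ :* q :* b :=
          (p :* b :+ a :* q) :* (q′ :* b) :+ k :* (b :* b)) refl p q q′ a b k ⟩
        (p * b + a * q) * (q′ * b) + k * (b * b) ∎)

      ⊕-mono-≤ : ∀ {x y x′ y′} → x ≤q y → x′ ≤q y′ → x ⊕ x′ ≤q y ⊕ y′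
      ⊕-mono-≤ {x} {y} {x′} {y′} h h′ = ≤q-trans {x ⊕ x′} {y ⊕ x′} {y ⊕ y′} (⊕-monoˡ-≤ {x} {y} x′ h)
        (≤q-trans {y ⊕ x′} {x′ ⊕ y} {y ⊕ y′} (⊕-comm y x′)
        (≤q-trans {x′ ⊕ y} {y′ ⊕ y} {y ⊕ y′} (⊕-monoˡ-≤ {x′} {y′} y h′) (⊕-comm y′ y)))

      ⊕-assoc : ∀ x y z → (x ⊕ y) ⊕ z ≤q x ⊕ (y ⊕ z)
      ⊕-assoc (p / q ⟨ _ ⟩) (p′ / q′ ⟨ _ ⟩) (p″ / q″ ⟨ _ ⟩) = ≈⇒≤ (solve 6 (λ p q p′ q′ p″ q″ →
        ((p :* q′ :+ p′ :* q) :* q″ :+ p″ :* (q :* q′)) :* (q :* (q′ :* q″)) :=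
        (p :* (q′ :* q″) :+ (p′ :* q″ :+ p″ :* q′) :* q) :* ((q :* q′) :* q″)) refl p q p′ q′ p″ q″)

      ⊕-assoc⁻ : ∀ x y z → x ⊕ (y ⊕ z) ≤q (x ⊕ y) ⊕ z
      ⊕-assoc⁻ (p / q ⟨ _ ⟩) (p′ / q′ ⟨ _ ⟩) (p″ / q″ ⟨ _ ⟩) = ≈⇒≤ (solve 6 (λ p q p′ q′ p″ q″ →
        (p :* (q′ :* q″) :+ (p′ :* q″ :+ p″ :* q′) :* q) :* ((q :* q′) :* q″) :=
        ((p :* q′ :+ p′ :* q) :* q″ :+ p″ :* (q :* q′)) :* (q :* (q′ :* q″))) refl p q p′ q′ p″ q″)

      PositiveQ : Fraction → Set (c ⊔ ℓ)
      PositiveQ x = Positive (num x)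

      x<x⊕ε : ∀ x {ε} → PositiveQ ε → x <q x ⊕ ε
      x<x⊕ε (p / q ⟨ q>0 ⟩) {e / d ⟨ _ ⟩} e>0 = let (j , h) = *-positive e>0 (*-positive q>0 q>0) in j , (begin
        (p * d + e * q) * q ≈⟨ solve 4 (λ p q e d → (p :* d :+ e :* q) :* q := p :* (q :* d) :+ e :* (q :* q)) refl p q e d ⟩
        p * (q * d) + e * (q * q) ≈⟨ +-congˡ h ⟩
        p * (q * d) + (1# + j) ∎)

      0q : Fraction
      0q = 0# / 1# ⟨ 0# , sym (+-identityʳ 1#) ⟩

      0≤q : ∀ x → 0q ≤q x
      0≤q (p / q ⟨ _ ⟩) = p , solve 2 (λ p q → p :* con 1 := con 0 :* q :+ p) refl p q

      ⊕-0 : ∀ x → x ⊕ 0q ≤q x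
      ⊕-0 (p / q ⟨ _ ⟩) = ≈⇒≤ (solve 2 (λ p q → (p :* con 1 :+ con 0 :* q) :* q := p :* (q :* con 1)) refl p q)

      ⊕-0⁻ : ∀ x → x ≤q x ⊕ 0q
      ⊕-0⁻ (p / q ⟨ _ ⟩) = ≈⇒≤ (solve 2 (λ p q → p :* (q :* con 1) := (p :* con 1 :+ con 0 :* q) :* q) refl p q)

      x≤x⊕y : ∀ x y → x ≤q x ⊕ y
      x≤x⊕y x y = ≤q-trans {x} {x ⊕ 0q} {x ⊕ y} (⊕-0⁻ x) (⊕-mono-≤ {x} {x} {0q} {y} (≤q-refl {x}) (0≤q y))

      y≤x⊕y : ∀ x y → y ≤q x ⊕ y
      y≤x⊕y x y = ≤q-trans {y} {y ⊕ x} {x ⊕ y} (x≤x⊕y y x) (⊕-comm y x)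

      half : Fraction → Fraction
      half (p / q ⟨ q>0 ⟩) = p / q + q ⟨ (let (j , e) = q>0 in j + q , trans (+-congʳ e) (+-assoc 1# j q)) ⟩

      half-⊕ : ∀ x → half x ⊕ half x ≤q x
      half-⊕ (p / q ⟨ _ ⟩) = ≈⇒≤ (solve 2 (λ p q → (p :* (q :+ q) :+ p :* (q :+ q)) :* q := p :* ((q :+ q) :* (q :+ q))) refl p q)

      half-⊕⁻ : ∀ x → x ≤q half x ⊕ half x
      half-⊕⁻ (p / q ⟨ _ ⟩) = ≈⇒≤ (solve 2 (λ p q → p :* ((q :+ q) :* (q :+ q)) := (p :* (q :+ q) :+ p :* (q :+ q)) :* q) refl p q)

      gap : ∀ {x y} → x <q y → ∃[ ε ] PositiveQ ε × x ⊕ ε ≤q y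
      gap {p / q ⟨ q>0 ⟩} {p′ / q′ ⟨ q′>0 ⟩} (k , h) =
        (1# + k) / q * q′ ⟨ *-positive q>0 q′>0 ⟩ , (k , refl) , ≈⇒≤ (begin
          (p * (q * q′) + (1# + k) * q) * q′ ≈⟨ solve 4 (λ p q q′ k → (p :* (q :* q′) :+ (con 1 :+ k) :* q) :* q′ :=
            (p :* q′ :+ (con 1 :+ k)) :* (q :* q′)) refl p q q′ k ⟩
          (p * q′ + (1# + k)) * (q * q′) ≈⟨ *-congʳ (sym h) ⟩
          (p′ * q) * (q * q′) ≈⟨ solve 3 (λ p′ q q′ → (p′ :* q) :* (q :* q′) := p′ :* (q :* (q :* q′))) refl p′ q q′ ⟩
          p′ * (q * (q * q′)) ∎)

      _·_ : Carrier → Fraction → Fraction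
      n · (p / q ⟨ q>0 ⟩) = (n * p) / q ⟨ q>0 ⟩

      ·-suc : ∀ n x → (1# + n) · x ≤q n · x ⊕ x
      ·-suc n (p / q ⟨ _ ⟩) = ≈⇒≤ (solve 3 (λ n p q → ((con 1 :+ n) :* p) :* (q :* q) := (n :* p :* q :+ p :* q) :* q) refl n p q)

      ·-0 : ∀ x → 0# · x ≤q 0q
      ·-0 (p / q ⟨ _ ⟩) = ≈⇒≤ (solve 2 (λ p q → (con 0 :* p) :* con 1 := con 0 :* q) refl p q)

      archimedes : ∀ x {ε} → PositiveQ ε → x ≤q (num x * den ε) · ε
      archimedes (p / q ⟨ (k , q≈) ⟩) {e / d ⟨ _ ⟩} (j , e≈) = (p * d) * (j + k * (1# + j)) , (begin
        ((p * d) * e) * q ≈⟨ *-cong (*-congˡ e≈) q≈ ⟩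
        ((p * d) * (1# + j)) * (1# + k) ≈⟨ solve 4 (λ p d j k → ((p :* d) :* (con 1 :+ j)) :* (con 1 :+ k) :=
          p :* d :+ (p :* d) :* (j :+ k :* (con 1 :+ j))) refl p d j k ⟩
        p * d + (p * d) * (j + k * (1# + j)) ∎)

      ⊕-monoˡ-< : ∀ {x y} z → x <q y → x ⊕ z <q y ⊕ z
      ⊕-monoˡ-< {x} {y} z h = let (ε , ε>0 , k) = gap {x} {y} h in
        <q-≤q-trans {x ⊕ z} {(x ⊕ z) ⊕ ε} {y ⊕ z} (x<x⊕ε (x ⊕ z) {ε} ε>0)
          (≤q-trans {(x ⊕ z) ⊕ ε} {x ⊕ (z ⊕ ε)} {y ⊕ z} (⊕-assoc x z ε)
          (≤q-trans {x ⊕ (z ⊕ ε)} {x ⊕ (ε ⊕ z)} {y ⊕ z} (⊕-mono-≤ {x} {x} {z ⊕ ε} {ε ⊕ z} (≤q-refl {x}) (⊕-comm z ε))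
          (≤q-trans {x ⊕ (ε ⊕ z)} {(x ⊕ ε) ⊕ z} {y ⊕ z} (⊕-assoc⁻ x ε z) (⊕-monoˡ-≤ {x ⊕ ε} {y} z k))))

      ⊕-mono-<-≤ : ∀ {x y x′ y′} → x <q y → x′ ≤q y′ → x ⊕ x′ <q y ⊕ y′
      ⊕-mono-<-≤ {x} {y} {x′} {y′} h h′ = <q-≤q-trans {x ⊕ x′} {y ⊕ x′} {y ⊕ y′} (⊕-monoˡ-< {x} {y} x′ h)
        (⊕-mono-≤ {y} {y} {x′} {y′} (≤q-refl {y}) h′)

      half-positive : ∀ {ε} → PositiveQ ε → PositiveQ (half ε)
      half-positive h = h

      positive-above : ∀ {x y} → x <q y → PositiveQ y
      positive-above {p / q ⟨ _ ⟩} {p′ / q′ ⟨ _ ⟩} (k , h) = [ (λ (j , e) → j , trans e (+-identityˡ _)) , [ (λ e → ⊥-elim (zero-case e))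
        , (λ h′ → ⊥-elim (≤⇒≯ (p′ , sym (+-identityˡ p′)) h′)) ]′ ]′ (compare 0# p′)
        where
        zero-case : ¬ 0# ≈ p′
        zero-case e = irreflexive (0#) (0#) (p * q′ + k , (begin
          0# ≈⟨ sym (zeroˡ q) ⟩
          0# * q ≈⟨ *-congʳ e ⟩
          p′ * q ≈⟨ h ⟩
          p * q′ + (1# + k) ≈⟨ solve 3 (λ p q k → p :* q :+ (con 1 :+ k) := con 0 :+ (con 1 :+ (p :* q :+ k))) refl p q′ k ⟩
          0# + (1# + (p * q′ + k)) ∎)) refl

open import Relation.Binary.PropositionalEquality.Core using (_≡_; refl; sym; trans; cong; cong₂; subst; subst₂)
open import Relation.Binary.PropositionalEquality.Properties using (module ≡-Reasoning)
open import Defs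

-- Set-theoretic notions as syntax.  In contrast to Formula there are set-builder
-- terms, and the semantics below unfolds definitionally to the notions of Defs.
infix  7 _∈ᶠ_ _≈ᶠ_
infixr 6 _∧ᶠ_
infixr 5 _∨ᶠ_
infixr 4 _⇒ᶠ_ _⇔ᶠ_
infixr 3 ∀ᶠ_ ∃ᶠ_
infixr 8 _∪ᵗ_
mutual
  data Tm (n : ℕ) : Set where
    var       : Fin n → Tm n
    ∅ᵗ        : Tm n
    ⁅_,_⁆ᵗ    : Tm n → Tm n → Tm n
    _∪ᵗ_      : Tm n → Tm n → Tm n
    compr     : ∀ {k} → Fm (suc k) → Vec (Tm n) k → Tm n → Tm n

  data Fm (n : ℕ) : Set where
    _∈ᶠ_ _≈ᶠ_                : Tm n → Tm n → Fm n
    ¬ᶠ_                      : Fm n → Fm n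
    _∧ᶠ_ _∨ᶠ_ _⇒ᶠ_ _⇔ᶠ_      : Fm n → Fm n → Fm n
    ∀ᶠ_ ∃ᶠ_                  : Fm (suc n) → Fm n
    call                     : ∀ {k} → Fm k → Vec (Tm n) k → Fm n

rename : ∀ {m n} → (Fin m → Fin n) → Formula m → Formula n
rename r (i ∈̇ j) = r i ∈̇ r j
rename r (i ≐ j) = r i ≐ r j
rename r (¬̇ φ)   = ¬̇ rename r φ
rename r (φ ∧̇ ψ) = rename r φ ∧̇ rename r ψ
rename r (φ ∨̇ ψ) = rename r φ ∨̇ rename r ψ
rename r (φ ⇒̇ ψ) = rename r φ ⇒̇ rename r ψ
rename r (∀̇ φ)   = ∀̇ rename (λ { zero → zero ; (suc i) → suc (r i) }) φ
rename r (∃̇ φ)   = ∃̇ rename (λ { zero → zero ; (suc i) → suc (r i) }) φ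

insert : ∀ {n} k → Fin (suc n) → Fin (suc (k ℕ.+ n))
insert k zero    = zero
insert k (suc i) = suc (k ↑ʳ i)

insert₂ : ∀ {n} k d → Fin (suc n) → Fin (suc (k ℕ.+ (d ℕ.+ n)))
insert₂ k d zero    = zero
insert₂ k d (suc i) = suc (k ↑ʳ (d ↑ʳ i))

toEnd : ∀ {n} k → Fin (suc k) → Fin (k ℕ.+ suc n)
toEnd k zero    = k ↑ʳ zero
toEnd k (suc j) = j ↑ˡ _

_⇔̇_ : ∀ {n} → Formula n → Formula n → Formula n
φ ⇔̇ ψ = (φ ⇒̇ ψ) ∧̇ (ψ ⇒̇ φ)

isPair isUnion : ∀ {n} → Formula (3 ℕ.+ n)
isPair  = ∀̇ ((zero ∈̇ suc (suc (suc zero))) ⇔̇ ((zero ≐ suc (suc zero)) ∨̇ (zero ≐ suc zero)))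
isUnion = ∀̇ ((zero ∈̇ suc (suc (suc zero))) ⇔̇ ((zero ∈̇ suc (suc zero)) ∨̇ (zero ∈̇ suc zero)))

-- valueIs t defines the graph of t: the variable 0 stands for the value.
mutual
  valueIs : ∀ {n} → Tm n → Formula (suc n)
  valueIs (var i)        = zero ≐ suc i
  valueIs ∅ᵗ             = ∀̇ (¬̇ (zero ∈̇ suc zero))
  valueIs ⁅ t , u ⁆ᵗ     = both 1 t u
    isPair
  valueIs (t ∪ᵗ u)       = both 1 t u
    isUnion
  valueIs (compr {k} φ ts t) = ∃̇ (rename (insert 1) (valueIs t) ∧̇
    (∀̇ ((zero ∈̇ suc (suc zero)) ⇔̇ ((zero ∈̇ suc zero) ∧̇
      values 3 ts (rename (toEnd k) (translate φ))))))

  both : ∀ {n} k → Tm n → Tm n → Formula (2 ℕ.+ (k ℕ.+ n)) → Formula (k ℕ.+ n)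
  both k t u φ = ∃̇ (rename (insert k) (valueIs t) ∧̇
    (∃̇ (rename (insert (suc k)) (valueIs u) ∧̇ φ)))

  values : ∀ {n k} d → Vec (Tm n) k → Formula (k ℕ.+ (d ℕ.+ n)) → Formula (d ℕ.+ n)
  values d []               φ = φ
  values {n} {suc k} d (t ∷ ts) φ = values d ts (∃̇ (rename (insert₂ k d) (valueIs t) ∧̇ φ))

  translate : ∀ {n} → Fm n → Formula n
  translate (t ∈ᶠ u) = both 0 t u (suc zero ∈̇ zero)
  translate (t ≈ᶠ u) = both 0 t u (suc zero ≐ zero)
  translate (¬ᶠ φ)   = ¬̇ translate φ
  translate (φ ∧ᶠ ψ) = translate φ ∧̇ translate ψ
  translate (φ ∨ᶠ ψ) = translate φ ∨̇ translate ψ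
  translate (φ ⇒ᶠ ψ) = translate φ ⇒̇ translate ψ
  translate (φ ⇔ᶠ ψ) = translate φ ⇔̇ translate ψ
  translate (∀ᶠ φ)   = ∀̇ translate φ
  translate (∃ᶠ φ)   = ∃̇ translate φ
  translate (call φ ts) = values 0 ts (rename (_↑ˡ _) (translate φ))

module _ {ℓ} (S : ∈-Structure ℓ) where
 open ∈-Structure S

 Sat-rename : ∀ {m n} (r : Fin m → Fin n) φ (ρ : Vec Carrier n) (σ : Vec Carrier m) →
   (∀ i → lookup ρ (r i) ≡ lookup σ i) → Sat S (rename r φ) ρ ⇔ Sat S φ σ
 Sat-rename r (i ∈̇ j) ρ σ h rewrite h i | h j = mk⇔ id id
 Sat-rename r (i ≐ j) ρ σ h rewrite h i | h j = mk⇔ id id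
 Sat-rename r (¬̇ φ) ρ σ h = let e = Sat-rename r φ ρ σ h in
   mk⇔ (λ p q → p (from e q)) (λ p q → p (to e q))
 Sat-rename r (φ ∧̇ ψ) ρ σ h = let e = Sat-rename r φ ρ σ h ; f = Sat-rename r ψ ρ σ h in
   mk⇔ (λ (p , q) → to e p , to f q) (λ (p , q) → from e p , from f q)
 Sat-rename r (φ ∨̇ ψ) ρ σ h = let e = Sat-rename r φ ρ σ h ; f = Sat-rename r ψ ρ σ h in
   mk⇔ (Sum.map (to e) (to f)) (Sum.map (from e) (from f))
 Sat-rename r (φ ⇒̇ ψ) ρ σ h = let e = Sat-rename r φ ρ σ h ; f = Sat-rename r ψ ρ σ h in
   mk⇔ (λ p q → to f (p (from e q))) (λ p q → from f (p (to e q)))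
 Sat-rename r (∀̇ φ) ρ σ h =
   let e = λ x → Sat-rename _ φ (x ∷ ρ) (x ∷ σ) (λ { zero → refl ; (suc i) → h i }) in
   mk⇔ (λ p x → to (e x) (p x)) (λ p x → from (e x) (p x))
 Sat-rename r (∃̇ φ) ρ σ h =
   let e = λ x → Sat-rename _ φ (x ∷ ρ) (x ∷ σ) (λ { zero → refl ; (suc i) → h i }) in
   mk⇔ (λ (x , p) → x , to (e x) p) (λ (x , p) → x , from (e x) p)

module Semantics {ℓ} (S : ∈-Structure ℓ) (zfc : IsZFC S) where
  open ∈-Structure S
  open IsZFC zfc

  ∅ˢ : Carrier
  ∅ˢ = proj₁ infinity

  pairˢ ∪ˢ : Carrier → Carrier → Carrier
  pairˢ a b = proj₁ (pairing a b)
  ∪ˢ a b    = proj₁ (union (pairˢ a b))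

  opaque
    sepˢ : ∀ {k} → Fm (suc k) → Vec Carrier k → Carrier → Carrier
    sepˢ φ ρ a = proj₁ (separation (translate φ) ρ a)

    sepˢ-spec : ∀ {k} (φ : Fm (suc k)) ρ a x → x ∈ sepˢ φ ρ a ⇔ (x ∈ a × Sat S (translate φ) (x ∷ ρ))
    sepˢ-spec φ ρ a = proj₂ (separation (translate φ) ρ a)

  mutual
    ⟦_⟧ᵗ : ∀ {n} → Tm n → Vec Carrier n → Carrier
    ⟦ var i ⟧ᵗ ρ          = lookup ρ i
    ⟦ ∅ᵗ ⟧ᵗ ρ             = ∅ˢ
    ⟦ ⁅ t , u ⁆ᵗ ⟧ᵗ ρ     = pairˢ (⟦ t ⟧ᵗ ρ) (⟦ u ⟧ᵗ ρ)
    ⟦ t ∪ᵗ u ⟧ᵗ ρ         = ∪ˢ (⟦ t ⟧ᵗ ρ) (⟦ u ⟧ᵗ ρ)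
    ⟦ compr φ ts t ⟧ᵗ ρ   = sepˢ φ (⟦ ts ⟧ᵗˢ ρ) (⟦ t ⟧ᵗ ρ)

    ⟦_⟧ᵗˢ : ∀ {n k} → Vec (Tm n) k → Vec Carrier n → Vec Carrier k
    ⟦ [] ⟧ᵗˢ ρ     = []
    ⟦ t ∷ ts ⟧ᵗˢ ρ = ⟦ t ⟧ᵗ ρ ∷ ⟦ ts ⟧ᵗˢ ρ

  ⟦_⟧ : ∀ {n} → Fm n → Vec Carrier n → Set ℓ
  ⟦ t ∈ᶠ u ⟧ ρ = ⟦ t ⟧ᵗ ρ ∈ ⟦ u ⟧ᵗ ρ
  ⟦ t ≈ᶠ u ⟧ ρ = ⟦ t ⟧ᵗ ρ ≈ ⟦ u ⟧ᵗ ρ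
  ⟦ ¬ᶠ φ ⟧ ρ   = ¬ ⟦ φ ⟧ ρ
  ⟦ φ ∧ᶠ ψ ⟧ ρ = ⟦ φ ⟧ ρ × ⟦ ψ ⟧ ρ
  ⟦ φ ∨ᶠ ψ ⟧ ρ = ⟦ φ ⟧ ρ ⊎ ⟦ ψ ⟧ ρ
  ⟦ φ ⇒ᶠ ψ ⟧ ρ = ⟦ φ ⟧ ρ → ⟦ ψ ⟧ ρ
  ⟦ φ ⇔ᶠ ψ ⟧ ρ = ⟦ φ ⟧ ρ ⇔ ⟦ ψ ⟧ ρ
  ⟦ ∀ᶠ φ ⟧ ρ   = ∀ x → ⟦ φ ⟧ (x ∷ ρ)
  ⟦ ∃ᶠ φ ⟧ ρ   = ∃[ x ] ⟦ φ ⟧ (x ∷ ρ)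
  ⟦ call φ ts ⟧ ρ = ⟦ φ ⟧ (⟦ ts ⟧ᵗˢ ρ)

module Correctness {ℓ} (𝕄 : BackgroundModel ℓ) where
  open BackgroundModel 𝕄 using (_∈_; isZFC) renaming (Universe to 𝕍)
  open IsZFC isZFC

  𝔖 : ∈-Structure ℓ
  𝔖 = record { Carrier = 𝕍 ; _≈_ = _≡_ ; _∈_ = _∈_ }

  open Semantics 𝔖 isZFC

  ext : ∀ {a b} → (∀ x → x ∈ a → x ∈ b) → (∀ x → x ∈ b → x ∈ a) → a ≡ b
  ext f g = extensionality _ _ λ x → mk⇔ (f x) (g x)

  _≣_ : ∀ {a b c} {A : Set a} {B : Set b} {C : Set c} → A ⇔ B → B ⇔ C → A ⇔ C
  e ≣ f = mk⇔ (to f ∘ to e) (from e ∘ from f)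

  private
    insert-ok : ∀ {n} k y (σ : Vec 𝕍 k) (ρ : Vec 𝕍 n) i → lookup (y ∷ (σ ++ ρ)) (insert k i) ≡ lookup (y ∷ ρ) i
    insert-ok k y σ ρ zero    = refl
    insert-ok k y σ ρ (suc i) = lookup-++ʳ σ ρ i

    module _ {A : 𝕍 → Set ℓ} where
      one-point : ∀ {t} (P : 𝕍 → Set ℓ) → (∀ y → y ≡ t ⇔ A y) → P t ⇔ (∃[ y ] A y × P y)
      one-point {t} P h = mk⇔ (λ p → t , to (h t) refl , p)
        (λ (y , q , p) → subst P (from (h y) q) p)

  same-elements : ∀ {a y : 𝕍} {P : 𝕍 → Set ℓ} → (∀ x → x ∈ a ⇔ P x) →
    y ≡ a ⇔ (∀ x → (x ∈ y → P x) × (P x → x ∈ y))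
  same-elements {a} {y} e = mk⇔ (λ { refl x → to (e x) , from (e x) })
    (λ h → ext (λ x p → from (e x) (proj₁ (h x) p)) (λ x p → proj₂ (h x) (to (e x) p)))

  ∈∪⇔ : ∀ a b x → x ∈ (∪ˢ a b) ⇔ (x ∈ a ⊎ x ∈ b)
  ∈∪⇔ a b x = mk⇔
    (λ p → let (z , z∈ , x∈z) = to (proj₂ (union (pairˢ a b)) x) p in
      Sum.map (λ e → subst (x ∈_) e x∈z) (λ e → subst (x ∈_) e x∈z)
        (to (proj₂ (pairing a b) z) z∈))
    (λ { (inj₁ p) → from (proj₂ (union (pairˢ a b)) x) (a , from (proj₂ (pairing a b) a) (inj₁ refl) , p)
       ; (inj₂ p) → from (proj₂ (union (pairˢ a b)) x) (b , from (proj₂ (pairing a b) b) (inj₂ refl) , p) })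

  mutual
    valueIs-ok : ∀ {n} (t : Tm n) ρ y → y ≡ ⟦ t ⟧ᵗ ρ ⇔ Sat 𝔖 (valueIs t) (y ∷ ρ)
    valueIs-ok (var i) ρ y = mk⇔ id id
    valueIs-ok ∅ᵗ ρ y = mk⇔ (λ { refl x → proj₁ (proj₂ infinity) x })
      (λ h → ext (λ x p → ⊥-elim (h x p)) (λ x p → ⊥-elim (proj₁ (proj₂ infinity) x p)))
    valueIs-ok ⁅ t , u ⁆ᵗ ρ y = same-elements {pairˢ (⟦ t ⟧ᵗ ρ) (⟦ u ⟧ᵗ ρ)} {y} (proj₂ (pairing (⟦ t ⟧ᵗ ρ) (⟦ u ⟧ᵗ ρ))) ≣ both-ok (y ∷ []) t u ρ isPair
    valueIs-ok (t ∪ᵗ u) ρ y   = same-elements {∪ˢ (⟦ t ⟧ᵗ ρ) (⟦ u ⟧ᵗ ρ)} {y} (∈∪⇔ (⟦ t ⟧ᵗ ρ) (⟦ u ⟧ᵗ ρ)) ≣ both-ok (y ∷ []) t u ρ isUnion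
    valueIs-ok (compr {k} φ ts t) ρ y =
      same-elements {s} {y} (λ x → sep-ok x ≣ inner x y)
      ≣ one-point _ (λ a → valueIs-ok t ρ a ≣ flip⇔ (Sat-rename 𝔖 _ (valueIs t) _ _ (insert-ok 1 a (y ∷ []) ρ)))
      where
      flip⇔ : ∀ {A B : Set ℓ} → A ⇔ B → B ⇔ A
      flip⇔ e = mk⇔ (from e) (to e)
      a s : 𝕍
      a = ⟦ t ⟧ᵗ ρ
      s = ⟦ compr φ ts t ⟧ᵗ ρ
      sep-ok : ∀ x → x ∈ s ⇔ (x ∈ a × Sat 𝔖 (translate φ) (x ∷ ⟦ ts ⟧ᵗˢ ρ))
      sep-ok = sepˢ-spec φ (⟦ ts ⟧ᵗˢ ρ) a
      inner : ∀ x y → (x ∈ a × Sat 𝔖 (translate φ) (x ∷ ⟦ ts ⟧ᵗˢ ρ)) ⇔ (x ∈ a × Sat 𝔖 (values 3 ts _) (x ∷ a ∷ y ∷ ρ))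
      inner x y =
        let e = Sat-rename 𝔖 (toEnd k) (translate φ)
                  (⟦ ts ⟧ᵗˢ ρ ++ (x ∷ a ∷ y ∷ ρ)) (x ∷ ⟦ ts ⟧ᵗˢ ρ)
                  (λ { zero → lookup-++ʳ (⟦ ts ⟧ᵗˢ ρ) _ zero ; (suc j) → lookup-++ˡ (⟦ ts ⟧ᵗˢ ρ) _ j })
            f = flip⇔ e ≣ values-ok (x ∷ a ∷ y ∷ []) ts ρ _
        in mk⇔ (λ (p , q) → p , to f q) (λ (p , q) → p , from f q)

    both-ok : ∀ {n k} (σ : Vec 𝕍 k) (t u : Tm n) ρ φ →
      Sat 𝔖 φ (⟦ u ⟧ᵗ ρ ∷ ⟦ t ⟧ᵗ ρ ∷ (σ ++ ρ)) ⇔ Sat 𝔖 (both k t u φ) (σ ++ ρ)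
    both-ok {k = k} σ t u ρ φ =
      one-point _ (λ y → valueIs-ok u ρ y ≣ renamed (suc k) (⟦ t ⟧ᵗ ρ ∷ σ) u y)
      ≣ one-point _ (λ y → valueIs-ok t ρ y ≣ renamed k σ t y)
      where
      renamed : ∀ k (σ : Vec 𝕍 k) t y → Sat 𝔖 (valueIs t) (y ∷ ρ) ⇔ Sat 𝔖 (rename (insert k) (valueIs t)) (y ∷ (σ ++ ρ))
      renamed k σ t y = let e = Sat-rename 𝔖 (insert k) (valueIs t) (y ∷ (σ ++ ρ)) (y ∷ ρ) (insert-ok k y σ ρ) in mk⇔ (from e) (to e)

    values-ok : ∀ {n k d} (σ : Vec 𝕍 d) (ts : Vec (Tm n) k) ρ φ →
      Sat 𝔖 φ (⟦ ts ⟧ᵗˢ ρ ++ (σ ++ ρ)) ⇔ Sat 𝔖 (values d ts φ) (σ ++ ρ)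
    values-ok σ [] ρ φ = mk⇔ id id
    values-ok {k = suc k} {d} σ (t ∷ ts) ρ φ =
      one-point _ (λ y → valueIs-ok t ρ y ≣
        (let e = Sat-rename 𝔖 _ (valueIs t) (y ∷ (⟦ ts ⟧ᵗˢ ρ ++ (σ ++ ρ))) (y ∷ ρ)
                   (λ { zero → refl ; (suc i) → trans (lookup-++ʳ (⟦ ts ⟧ᵗˢ ρ) _ (d ↑ʳ i)) (lookup-++ʳ σ ρ i) })
         in mk⇔ (from e) (to e)))
      ≣ values-ok σ ts ρ _

    translate-ok : ∀ {n} (φ : Fm n) ρ → ⟦ φ ⟧ ρ ⇔ Sat 𝔖 (translate φ) ρ
    translate-ok (t ∈ᶠ u) ρ = both-ok [] t u ρ (suc zero ∈̇ zero)
    translate-ok (t ≈ᶠ u) ρ = both-ok [] t u ρ (suc zero ≐ zero)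
    translate-ok (¬ᶠ φ) ρ = let e = translate-ok φ ρ in mk⇔ (λ p q → p (from e q)) (λ p q → p (to e q))
    translate-ok (φ ∧ᶠ ψ) ρ = let e = translate-ok φ ρ ; f = translate-ok ψ ρ in
      mk⇔ (λ (p , q) → to e p , to f q) (λ (p , q) → from e p , from f q)
    translate-ok (φ ∨ᶠ ψ) ρ = let e = translate-ok φ ρ ; f = translate-ok ψ ρ in
      mk⇔ (Sum.map (to e) (to f)) (Sum.map (from e) (from f))
    translate-ok (φ ⇒ᶠ ψ) ρ = let e = translate-ok φ ρ ; f = translate-ok ψ ρ in
      mk⇔ (λ p q → to f (p (from e q))) (λ p q → from f (p (to e q)))
    translate-ok (φ ⇔ᶠ ψ) ρ = let e = translate-ok φ ρ ; f = translate-ok ψ ρ in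
      mk⇔ (λ p → (λ q → to f (to p (from e q))) , (λ q → to e (from p (from f q))))
          (λ (p , p') → mk⇔ (λ q → from f (p (to e q))) (λ q → from e (p' (to f q))))
    translate-ok (∀ᶠ φ) ρ = let e = λ x → translate-ok φ (x ∷ ρ) in
      mk⇔ (λ p x → to (e x) (p x)) (λ p x → from (e x) (p x))
    translate-ok (∃ᶠ φ) ρ = let e = λ x → translate-ok φ (x ∷ ρ) in
      mk⇔ (λ (x , p) → x , to (e x) p) (λ (x , p) → x , from (e x) p)
    translate-ok (call φ ts) ρ = translate-ok φ (⟦ ts ⟧ᵗˢ ρ) ≣
      (let e = Sat-rename 𝔖 (_↑ˡ _) (translate φ) (⟦ ts ⟧ᵗˢ ρ ++ ρ) (⟦ ts ⟧ᵗˢ ρ) (lookup-++ˡ (⟦ ts ⟧ᵗˢ ρ) ρ) in mk⇔ (from e) (to e) ≣ values-ok [] ts ρ _)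

  abstract
    separate : ∀ {k} (φ : Fm (suc k)) (ρ : Vec 𝕍 k) (a : 𝕍) →
      ∀ x → x ∈ sepˢ φ ρ a ⇔ (x ∈ a × ⟦ φ ⟧ (x ∷ ρ))
    separate φ ρ a x = let e = sepˢ-spec φ ρ a x ; f = translate-ok φ (x ∷ ρ) in
      mk⇔ (λ p → proj₁ (to e p) , from f (proj₂ (to e p))) (λ (p , q) → from e (p , to f q))

    replace : ∀ {k} (φ : Fm (2 ℕ.+ k)) (ρ : Vec 𝕍 k) a →
              (∀ x → x ∈ a → ∃[ y ] ⟦ φ ⟧ (x ∷ y ∷ ρ) × (∀ z → ⟦ φ ⟧ (x ∷ z ∷ ρ) → z ≡ y)) →
              ∃[ b ] (∀ y → y ∈ b ⇔ (∃[ x ] x ∈ a × ⟦ φ ⟧ (x ∷ y ∷ ρ)))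
    replace φ ρ a h =
      let f = λ x y → translate-ok φ (x ∷ y ∷ ρ)
          (b , e) = replacement (translate φ) ρ a (λ x p → let (y , q , u) = h x p in
                      y , to (f x y) q , λ z r → u z (from (f x z) r))
      in b , λ y → mk⇔ (λ p → let (x , q , r) = to (e y) p in x , q , from (f x y) r)
                       (λ (x , q , r) → from (e y) (x , q , to (f x y) r))

mutual
  ↑ : ∀ {n} → Tm n → Tm (suc n)
  ↑ (var i)        = var (suc i)
  ↑ ∅ᵗ             = ∅ᵗ
  ↑ ⁅ t , u ⁆ᵗ     = ⁅ ↑ t , ↑ u ⁆ᵗ
  ↑ (t ∪ᵗ u)       = ↑ t ∪ᵗ ↑ u
  ↑ (compr φ ts t) = compr φ (↑ˢ ts) (↑ t)

  ↑ˢ : ∀ {n k} → Vec (Tm n) k → Vec (Tm (suc n)) k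
  ↑ˢ []       = []
  ↑ˢ (t ∷ ts) = ↑ t ∷ ↑ˢ ts

↑² ↑³ ↑⁴ ↑⁵ ↑⁶ : ∀ {n} → Tm n → Tm _
↑² t = ↑ (↑ t)
↑³ t = ↑ (↑² t)
↑⁴ t = ↑ (↑³ t)
↑⁵ t = ↑ (↑⁴ t)
↑⁶ t = ↑ (↑⁵ t)

pattern v0 = var 0F
pattern v1 = var 1F
pattern v2 = var 2F
pattern v3 = var 3F
pattern v4 = var 4F
pattern v5 = var 5F
pattern v6 = var 6F
pattern v7 = var 7F
pattern v8 = var 8F

module _ {n : ℕ} where
 infix  7 _⊆ᶠ_ _[_]ᶠ=_

 _⊆ᶠ_ : Tm n → Tm n → Fm n
 a ⊆ᶠ b = ∀ᶠ v0 ∈ᶠ ↑ a ⇒ᶠ v0 ∈ᶠ ↑ b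

 ⟨_,_⟩ᵗ : Tm n → Tm n → Tm n
 ⟨ a , b ⟩ᵗ = ⁅ ⁅ a , a ⁆ᵗ , ⁅ a , b ⁆ᵗ ⁆ᵗ

 succᵗ : Tm n → Tm n
 succᵗ a = a ∪ᵗ ⁅ a , a ⁆ᵗ

 _[_]ᶠ=_ : Tm n → Tm n → Tm n → Fm n
 f [ x ]ᶠ= y = ⟨ x , y ⟩ᵗ ∈ᶠ f

module _ {n : ℕ} where
 isFunctionOn : Tm n → Tm n → Fm n
 isFunctionOn f a =
   (∀ᶠ v0 ∈ᶠ ↑ f ⇒ᶠ (∃ᶠ ∃ᶠ v2 ≈ᶠ ⟨ v1 , v0 ⟩ᵗ ∧ᶠ v1 ∈ᶠ ↑³ a)) ∧ᶠ
   (∀ᶠ v0 ∈ᶠ ↑ a ⇒ᶠ (∃ᶠ ↑² f [ v1 ]ᶠ= v0 ∧ᶠ (∀ᶠ ↑³ f [ v2 ]ᶠ= v0 ⇒ᶠ v0 ≈ᶠ v1)))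

 isMap : Tm n → Tm n → Tm n → Fm n
 isMap f a b = isFunctionOn f a ∧ᶠ (∀ᶠ ∀ᶠ ↑² f [ v1 ]ᶠ= v0 ⇒ᶠ v0 ∈ᶠ ↑² b)

 injective : Tm n → Fm n
 injective f = ∀ᶠ ∀ᶠ ∀ᶠ ↑³ f [ v2 ]ᶠ= v0 ⇒ᶠ ↑³ f [ v1 ]ᶠ= v0 ⇒ᶠ v2 ≈ᶠ v1

 isBijection : Tm n → Tm n → Tm n → Fm n
 isBijection f a b = isMap f a b ∧ᶠ injective f ∧ᶠ (∀ᶠ v0 ∈ᶠ ↑ b ⇒ᶠ (∃ᶠ ↑² f [ v0 ]ᶠ= v1))

 isComposite : Tm n → Tm n → Tm n → Fm n
 isComposite h g f = ∀ᶠ v0 ∈ᶠ ↑ h ⇔ᶠ (∃ᶠ ∃ᶠ ∃ᶠ v3 ≈ᶠ ⟨ v2 , v0 ⟩ᵗ ∧ᶠ ↑⁴ f [ v2 ]ᶠ= v1 ∧ᶠ ↑⁴ g [ v1 ]ᶠ= v0)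

 isInductive : Tm n → Fm n
 isInductive I = ∅ᵗ ∈ᶠ I ∧ᶠ (∀ᶠ v0 ∈ᶠ ↑ I ⇒ᶠ succᵗ v0 ∈ᶠ ↑ I)

module _ {n : ℕ} where
 isNat isω : Tm n → Fm n
 isNat m = ∀ᶠ isInductive v0 ⇒ᶠ ↑ m ∈ᶠ v0
 isω w   = ∀ᶠ v0 ∈ᶠ ↑ w ⇔ᶠ (∀ᶠ isInductive v0 ⇒ᶠ v1 ∈ᶠ v0)

 isTransitive : Tm n → Fm n
 isTransitive a = ∀ᶠ v0 ∈ᶠ ↑ a ⇒ᶠ v0 ⊆ᶠ ↑ a

 iterate : (∀ {m} → (Tm n → Tm m) → Tm m → Tm m → Tm m → Fm m) → Tm n → Tm n → Tm n → Fm n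
 iterate Step a k b = ∃ᶠ isFunctionOn v0 (succᵗ (↑ k)) ∧ᶠ v0 [ ∅ᵗ ]ᶠ= ↑ a ∧ᶠ v0 [ ↑ k ]ᶠ= ↑ b ∧ᶠ
   (∀ᶠ ∀ᶠ ∀ᶠ v2 ∈ᶠ ↑⁴ k ⇒ᶠ v3 [ v2 ]ᶠ= v1 ⇒ᶠ v3 [ succᵗ v2 ]ᶠ= v0 ⇒ᶠ Step ↑⁴ v2 v1 v0)

module _ {n : ℕ} where
 isOrdinal : Tm n → Fm n
 isOrdinal α = isTransitive α ∧ᶠ (∀ᶠ v0 ∈ᶠ ↑ α ⇒ᶠ isTransitive v0)

 infinite : Tm n → Fm n
 infinite a = ∀ᶠ ∀ᶠ isNat v1 ⇒ᶠ ¬ᶠ isBijection v0 v1 (↑² a)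

 add : Tm n → Tm n → Tm n → Fm n
 add m = iterate (λ _ _ x y → y ≈ᶠ succᵗ x) m

module _ {n : ℕ} where
 mul : Tm n → Tm n → Tm n → Fm n
 mul m = iterate (λ ↑ᵏ _ x y → add x (↑ᵏ m) y) ∅ᵗ

 even : Tm n → Fm n
 even k = ∃ᶠ isNat v0 ∧ᶠ add v0 v0 (↑ k)

 frac : Tm n → Tm n → Tm n → Fm n
 frac x p q = x ≈ᶠ ⟨ p , q ⟩ᵗ ∧ᶠ isNat p ∧ᶠ isNat q ∧ᶠ ¬ᶠ (q ≈ᶠ ∅ᵗ)

module _ {n : ℕ} where
 isFrac : Tm n → Fm n
 isFrac x = ∃ᶠ ∃ᶠ frac (↑² x) v1 v0

 compareFrac : (Tm (6 ℕ.+ n) → Tm (6 ℕ.+ n) → Fm (6 ℕ.+ n)) → Tm n → Tm n → Fm n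
 compareFrac R x y = ∃ᶠ ∃ᶠ ∃ᶠ ∃ᶠ ∃ᶠ ∃ᶠ
   frac (↑⁶ x) v5 v4 ∧ᶠ frac (↑⁶ y) v3 v2 ∧ᶠ mul v5 v2 v1 ∧ᶠ mul v3 v4 v0 ∧ᶠ R v1 v0

opaque
  lessᶠ leqᶠ : Fm 2
  lessᶠ = compareFrac _∈ᶠ_ v0 v1
  leqᶠ  = compareFrac (λ u v → u ∈ᶠ v ∨ᶠ u ≈ᶠ v) v0 v1

  addFracᶠ : Fm 3
  addFracᶠ = ∃ᶠ ∃ᶠ ∃ᶠ ∃ᶠ ∃ᶠ ∃ᶠ ∃ᶠ ∃ᶠ
    frac v8 v7 v6 ∧ᶠ frac (var 9F) v5 v4 ∧ᶠ mul v7 v4 v3 ∧ᶠ mul v5 v6 v2 ∧ᶠ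
    add v3 v2 v1 ∧ᶠ mul v6 v4 v0 ∧ᶠ frac (var (suc 9F)) v1 v0

module _ {n : ℕ} where
 less leq : Tm n → Tm n → Fm n
 less x y = call lessᶠ (x ∷ y ∷ [])
 leq  x y = call leqᶠ (x ∷ y ∷ [])

 addFrac : Tm n → Tm n → Tm n → Fm n
 addFrac x y z = call addFracᶠ (x ∷ y ∷ z ∷ [])

module _ {n : ℕ} where
 infix 7 _<ᶠ_ _≤ᶠ_
 _<ᶠ_ _≤ᶠ_ : Tm n → Tm n → Fm n
 _<ᶠ_ = less
 _≤ᶠ_ = leq

opaque
  isRealᶠ : Fm 1
  isRealᶠ =
    (∀ᶠ v0 ∈ᶠ v1 ⇒ᶠ isFrac v0) ∧ᶠ
    (∀ᶠ ∀ᶠ v1 ∈ᶠ v2 ⇒ᶠ v0 ≤ᶠ v1 ⇒ᶠ v0 ∈ᶠ v2) ∧ᶠ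
    (∀ᶠ v0 ∈ᶠ v1 ⇒ᶠ (∃ᶠ v0 ∈ᶠ v2 ∧ᶠ v1 <ᶠ v0)) ∧ᶠ
    (∃ᶠ isFrac v0 ∧ᶠ ¬ᶠ (v0 ∈ᶠ v1))

  addRealᶠ : Fm 3
  addRealᶠ = ∀ᶠ v0 ∈ᶠ v3 ⇔ᶠ
    (v0 ∈ᶠ v1 ∨ᶠ v0 ∈ᶠ v2 ∨ᶠ
     (∃ᶠ ∃ᶠ ∃ᶠ v2 ∈ᶠ v4 ∧ᶠ v1 ∈ᶠ v5 ∧ᶠ addFrac v2 v1 v0 ∧ᶠ v3 ≤ᶠ v0))

module _ {n : ℕ} where
 isReal : Tm n → Fm n
 isReal r = call isRealᶠ (r ∷ [])

 isOne : Tm n → Fm n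
 isOne r = ∀ᶠ v0 ∈ᶠ ↑ r ⇔ᶠ (∃ᶠ ∃ᶠ frac v2 v1 v0 ∧ᶠ v1 ∈ᶠ v0)

 addReal : Tm n → Tm n → Tm n → Fm n
 addReal r s t = call addRealᶠ (r ∷ s ∷ t ∷ [])

module _ {n : ℕ} where
 isFinitePartialSum : (∀ {m} → (Tm n → Tm m) → Tm m → Tm m → Fm m) → Tm n → Tm n → Fm n
 isFinitePartialSum F I t = ∃ᶠ ∃ᶠ isNat v1 ∧ᶠ isMap v0 v1 (↑² I) ∧ᶠ injective v0 ∧ᶠ
   (∃ᶠ isFunctionOn v0 (succᵗ v2) ∧ᶠ v0 [ ∅ᵗ ]ᶠ= ∅ᵗ ∧ᶠ v0 [ v2 ]ᶠ= ↑³ t ∧ᶠ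
     (∀ᶠ ∀ᶠ ∀ᶠ v2 ∈ᶠ v5 ⇒ᶠ v3 [ v2 ]ᶠ= v1 ⇒ᶠ v3 [ succᵗ v2 ]ᶠ= v0 ⇒ᶠ
       (∃ᶠ ∃ᶠ v6 [ v4 ]ᶠ= v1 ∧ᶠ F (λ t → ↑² (↑⁶ t)) v1 v0 ∧ᶠ addReal v3 v0 v2)))

module _ {n : ℕ} where
 hasSum : (∀ {m} → (Tm n → Tm m) → Tm m → Tm m → Fm m) → Tm n → Tm n → Fm n
 hasSum F I r = isReal r ∧ᶠ
   (∀ᶠ isFinitePartialSum (λ ↑ᵏ → F (λ t → ↑ᵏ (↑ t))) (↑ I) v0 ⇒ᶠ v0 ⊆ᶠ ↑ r) ∧ᶠ
   (∀ᶠ isReal v0 ⇒ᶠ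
     (∀ᶠ isFinitePartialSum (λ ↑ᵏ → F (λ t → ↑ᵏ (↑² t))) (↑² I) v0 ⇒ᶠ v0 ⊆ᶠ v1) ⇒ᶠ ↑ r ⊆ᶠ v0)

 isRelationalLanguage : Tm n → Fm n
 isRelationalLanguage 𝓛 = ∃ᶠ isFunctionOn (↑ 𝓛) v0 ∧ᶠ (∀ᶠ ∀ᶠ ↑³ 𝓛 [ v1 ]ᶠ= v0 ⇒ᶠ isNat v0)

opaque
  isStructureᶠ : Fm 3
  isStructureᶠ =
    (∀ᶠ v0 ∈ᶠ v3 ⇒ᶠ (∃ᶠ ∃ᶠ ∃ᶠ v3 ≈ᶠ ⟨ v2 , v0 ⟩ᵗ ∧ᶠ v5 [ v2 ]ᶠ= v1)) ∧ᶠ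
    (∀ᶠ ∀ᶠ v3 [ v1 ]ᶠ= v0 ⇒ᶠ
      (∃ᶠ v5 [ v2 ]ᶠ= v0 ∧ᶠ (∀ᶠ v6 [ v3 ]ᶠ= v0 ⇒ᶠ v0 ≈ᶠ v1) ∧ᶠ (∀ᶠ v0 ∈ᶠ v1 ⇒ᶠ isMap v0 v2 v4)))

module _ {n : ℕ} (X 𝓛 : Tm n) where
 isStructure : Tm n → Fm n
 isStructure M = call isStructureᶠ (X ∷ 𝓛 ∷ M ∷ [])

module _ {n : ℕ} where
 holds : Tm n → Tm n → Tm n → Fm n
 holds M R t = ∃ᶠ ↑ M [ ↑ R ]ᶠ= v0 ∧ᶠ ↑ t ∈ᶠ v0

module _ {n : ℕ} where
 isAtomic : (𝓛 m α : Tm n) → Fm n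
 isAtomic 𝓛 m α =
   (∃ᶠ ∃ᶠ ↑² α ≈ᶠ ⟨ ∅ᵗ , ⟨ v1 , v0 ⟩ᵗ ⟩ᵗ ∧ᶠ v1 ∈ᶠ ↑² m ∧ᶠ v0 ∈ᶠ ↑² m) ∨ᶠ
   (∃ᶠ ∃ᶠ ∃ᶠ ↑³ α ≈ᶠ ⟨ succᵗ ∅ᵗ , ⟨ v2 , v1 ⟩ᵗ ⟩ᵗ ∧ᶠ ↑³ 𝓛 [ v2 ]ᶠ= v0 ∧ᶠ isMap v1 v0 (↑³ m))

 satAtomic : (M a α : Tm n) → Fm n
 satAtomic M a α =
   (∃ᶠ ∃ᶠ ∃ᶠ ↑³ α ≈ᶠ ⟨ ∅ᵗ , ⟨ v2 , v1 ⟩ᵗ ⟩ᵗ ∧ᶠ ↑³ a [ v2 ]ᶠ= v0 ∧ᶠ ↑³ a [ v1 ]ᶠ= v0) ∨ᶠ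
   (∃ᶠ ∃ᶠ ∃ᶠ ↑³ α ≈ᶠ ⟨ succᵗ ∅ᵗ , ⟨ v2 , v1 ⟩ᵗ ⟩ᵗ ∧ᶠ isComposite v0 (↑³ a) v1 ∧ᶠ holds (↑³ M) v2 v0)

module _ {n : ℕ} where
 isLiteral : (𝓛 m φ : Tm n) → Fm n
 isLiteral 𝓛 m φ = ∃ᶠ ∃ᶠ ↑² φ ≈ᶠ ⟨ v1 , v0 ⟩ᵗ ∧ᶠ isNat v1 ∧ᶠ isAtomic (↑² 𝓛) (↑² m) v0

 satLiteral : (M a φ : Tm n) → Fm n
 satLiteral M a φ = ∃ᶠ ∃ᶠ ↑² φ ≈ᶠ ⟨ v1 , v0 ⟩ᵗ ∧ᶠ (even v1 ⇔ᶠ satAtomic (↑² M) (↑² a) v0)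

module _ {n : ℕ} where
 isConjunction : (𝓛 m c : Tm n) → Fm n
 isConjunction 𝓛 m c = ∃ᶠ isNat v0 ∧ᶠ isFunctionOn (↑ c) v0 ∧ᶠ (∀ᶠ ∀ᶠ ↑³ c [ v1 ]ᶠ= v0 ⇒ᶠ isLiteral (↑³ 𝓛) (↑³ m) v0)

 satConjunction : (M a c : Tm n) → Fm n
 satConjunction M a c = ∀ᶠ ∀ᶠ ↑² c [ v1 ]ᶠ= v0 ⇒ᶠ satLiteral (↑² M) (↑² a) v0

 isTuple : (X m a : Tm n) → Fm n
 isTuple X m a = isNat m ∧ᶠ isMap a m X

opaque
  isLiteralSetᶠ : Fm 3
  isLiteralSetᶠ = ∃ᶠ ∃ᶠ ∃ᶠ isTuple v3 v2 v1 ∧ᶠ isLiteral v4 v2 v0 ∧ᶠ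
    (∀ᶠ v0 ∈ᶠ v6 ⇔ᶠ isStructure v4 v5 v0 ∧ᶠ satLiteral v0 v2 v1)

  isConjunctionSetᶠ : Fm 5
  isConjunctionSetᶠ = ∀ᶠ v0 ∈ᶠ v5 ⇔ᶠ isStructure v1 v2 v0 ∧ᶠ satConjunction v0 v3 v4

  isActionᶠ : Fm 5
  isActionᶠ = isStructure v0 v1 v4 ∧ᶠ
    (∀ᶠ ∀ᶠ ∀ᶠ ∀ᶠ v5 [ v3 ]ᶠ= v2 ⇒ᶠ isMap v1 v2 v4 ⇒ᶠ isComposite v0 v6 v1 ⇒ᶠ
      (holds v8 v3 v0 ⇔ᶠ holds v7 v3 v1))

module _ {n : ℕ} (X 𝓛 : Tm n) where
 isLiteralSet : Tm n → Fm n
 isLiteralSet A = call isLiteralSetᶠ (X ∷ 𝓛 ∷ A ∷ [])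

 isConjunctionSet : (a c A : Tm n) → Fm n
 isConjunctionSet a c A = call isConjunctionSetᶠ (X ∷ 𝓛 ∷ a ∷ c ∷ A ∷ [])

 isComplement : Tm n → Tm n → Fm n
 isComplement A B = ∀ᶠ v0 ∈ᶠ ↑ B ⇔ᶠ isStructure (↑ X) (↑ 𝓛) v0 ∧ᶠ ¬ᶠ (v0 ∈ᶠ ↑ A)

 isAction : (g M N : Tm n) → Fm n
 isAction g M N = call isActionᶠ (X ∷ 𝓛 ∷ g ∷ M ∷ N ∷ [])

 isStr : Tm n → Fm n
 isStr S = ∀ᶠ v0 ∈ᶠ ↑ S ⇔ᶠ isStructure (↑ X) (↑ 𝓛) v0

module _ {n : ℕ} where
 isUnion′ : (F B : Tm n) → Fm n
 isUnion′ F B = ∀ᶠ v0 ∈ᶠ ↑ B ⇔ᶠ (∃ᶠ v0 ∈ᶠ ↑² F ∧ᶠ v1 ∈ᶠ v0)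

 isSymmetricDifference : (A B D : Tm n) → Fm n
 isSymmetricDifference A B D = ∀ᶠ v0 ∈ᶠ ↑ D ⇔ᶠ (v0 ∈ᶠ ↑ A ∧ᶠ ¬ᶠ (v0 ∈ᶠ ↑ B)) ∨ᶠ (v0 ∈ᶠ ↑ B ∧ᶠ ¬ᶠ (v0 ∈ᶠ ↑ A))

opaque
  isClosedFamilyᶠ : Fm 4
  isClosedFamilyᶠ =
    (∀ᶠ v0 ∈ᶠ v4 ⇒ᶠ (∀ᶠ v0 ∈ᶠ v1 ⇒ᶠ isStructure v3 v4 v0)) ∧ᶠ
    (∀ᶠ isLiteralSet v2 v3 v0 ⇒ᶠ v0 ∈ᶠ v4) ∧ᶠ
    (∀ᶠ ∀ᶠ v1 ∈ᶠ v5 ⇒ᶠ isComplement v3 v4 v1 v0 ⇒ᶠ v0 ∈ᶠ v5) ∧ᶠ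
    (∀ᶠ ∀ᶠ ∀ᶠ v2 ⊆ᶠ v6 ⇒ᶠ isMap v1 v2 v3 ⇒ᶠ injective v1 ⇒ᶠ isUnion′ v2 v0 ⇒ᶠ v0 ∈ᶠ v6)

  measurableᶠ : Fm 4
  measurableᶠ = ∀ᶠ call isClosedFamilyᶠ (v1 ∷ v2 ∷ v3 ∷ v0 ∷ []) ⇒ᶠ v4 ∈ᶠ v0

module _ {n : ℕ} (κ X 𝓛 : Tm n) where
 isClosedFamily measurable : Tm n → Fm n
 isClosedFamily F = call isClosedFamilyᶠ (κ ∷ X ∷ 𝓛 ∷ F ∷ [])
 measurable A     = call measurableᶠ (κ ∷ X ∷ 𝓛 ∷ A ∷ [])

module _ {n : ℕ} (κ X 𝓛 : Tm n) where
 isImage : (g A B : Tm n) → Fm n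
 isImage g A B = ∀ᶠ v0 ∈ᶠ ↑ B ⇔ᶠ (∃ᶠ v0 ∈ᶠ ↑² A ∧ᶠ isAction (↑² X) (↑² 𝓛) (↑² g) v0 v1)

opaque
  isAdditiveᶠ : Fm 5
  isAdditiveᶠ = ∀ᶠ ∀ᶠ ∀ᶠ isFunctionOn v2 v7 ⇒ᶠ
    (∀ᶠ ∀ᶠ v4 [ v1 ]ᶠ= v0 ⇒ᶠ measurable v5 v6 v7 v0) ⇒ᶠ
    (∀ᶠ ∀ᶠ ∀ᶠ ∀ᶠ ∀ᶠ v7 [ v4 ]ᶠ= v2 ⇒ᶠ v7 [ v3 ]ᶠ= v1 ⇒ᶠ v0 ∈ᶠ v2 ⇒ᶠ v0 ∈ᶠ v1 ⇒ᶠ v4 ≈ᶠ v3) ⇒ᶠ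
    (∀ᶠ v0 ∈ᶠ v2 ⇔ᶠ (∃ᶠ ∃ᶠ v5 [ v1 ]ᶠ= v0 ∧ᶠ v2 ∈ᶠ v0)) ⇒ᶠ
    v6 [ v1 ]ᶠ= v0 ⇒ᶠ hasSum (λ ↑ᵏ i v → ∃ᶠ ↑ (↑ᵏ v2) [ ↑ i ]ᶠ= v0 ∧ᶠ ↑ (↑ᵏ v6) [ v0 ]ᶠ= ↑ v) v7 v0

module _ {n : ℕ} (κ X 𝓛 : Tm n) where
 isAdditive : (μ I : Tm n) → Fm n
 isAdditive μ I = call isAdditiveᶠ (κ ∷ X ∷ 𝓛 ∷ μ ∷ I ∷ [])

module _ {n : ℕ} (κ X 𝓛 : Tm n) where
 isProbabilityκMeasure : Tm n → Fm n
 isProbabilityκMeasure μ =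
   (∀ᶠ v0 ∈ᶠ ↑ μ ⇒ᶠ (∃ᶠ ∃ᶠ v2 ≈ᶠ ⟨ v1 , v0 ⟩ᵗ ∧ᶠ measurable (↑³ κ) (↑³ X) (↑³ 𝓛) v1 ∧ᶠ isReal v0)) ∧ᶠ
   (∀ᶠ measurable (↑ κ) (↑ X) (↑ 𝓛) v0 ⇒ᶠ (∃ᶠ ↑² μ [ v1 ]ᶠ= v0 ∧ᶠ (∀ᶠ ↑³ μ [ v2 ]ᶠ= v0 ⇒ᶠ v0 ≈ᶠ v1))) ∧ᶠ
   (∀ᶠ ∀ᶠ isStr (↑² X) (↑² 𝓛) v1 ⇒ᶠ ↑² μ [ v1 ]ᶠ= v0 ⇒ᶠ isOne v0) ∧ᶠ
   (∀ᶠ isω v0 ⇒ᶠ isAdditive (↑ κ) (↑ X) (↑ 𝓛) (↑ μ) v0) ∧ᶠ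
   isAdditive κ X 𝓛 μ κ

 isInvariant : Tm n → Fm n
 isInvariant μ = ∀ᶠ ∀ᶠ ∀ᶠ ∀ᶠ isBijection v3 (↑⁴ X) (↑⁴ X) ⇒ᶠ measurable (↑⁴ κ) (↑⁴ X) (↑⁴ 𝓛) v2 ⇒ᶠ
   isImage (↑⁴ κ) (↑⁴ X) (↑⁴ 𝓛) v3 v2 v1 ⇒ᶠ ↑⁴ μ [ v2 ]ᶠ= v0 ⇒ᶠ ↑⁴ μ [ v1 ]ᶠ= v0

 isAlmostInvariant : (μ A : Tm n) → Fm n
 isAlmostInvariant μ A = ∀ᶠ ∀ᶠ ∀ᶠ isBijection v2 (↑³ X) (↑³ X) ⇒ᶠ isImage (↑³ κ) (↑³ X) (↑³ 𝓛) v2 (↑³ A) v1 ⇒ᶠ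
   isSymmetricDifference v1 (↑³ A) v0 ⇒ᶠ ↑³ μ [ v0 ]ᶠ= ∅ᵗ

opaque
  isErgodicᶠ : Fm 4
  isErgodicᶠ = (isProbabilityκMeasure v0 v1 v2 v3 ∧ᶠ isInvariant v0 v1 v2 v3) ∧ᶠ
    (∀ᶠ measurable v1 v2 v3 v0 ⇒ᶠ isAlmostInvariant v1 v2 v3 v4 v0 ⇒ᶠ
      (v4 [ v0 ]ᶠ= ∅ᵗ ∨ᶠ (∃ᶠ isOne v0 ∧ᶠ v5 [ v1 ]ᶠ= v0)))

module _ {n : ℕ} (κ X 𝓛 : Tm n) where
 isErgodic : Tm n → Fm n
 isErgodic μ = call isErgodicᶠ (κ ∷ X ∷ 𝓛 ∷ μ ∷ [])

record Squash {ℓ} (A : Set ℓ) : Set ℓ where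
  constructor squash
  field .unsquash : A

-- Extensionally equal structures whose carriers need not be isomorphic types.
record Bisimulation {ℓ} (S T : ∈-Structure ℓ) : Set (Level.suc ℓ) where
  private
    module S = ∈-Structure S
    module T = ∈-Structure T
  field
    _~_   : S.Carrier → T.Carrier → Set ℓ
    forth : S.Carrier → T.Carrier
    back  : T.Carrier → S.Carrier
    ~forth : ∀ x → x ~ forth x
    back~  : ∀ y → back y ~ y
    ∈⇔ : ∀ {x y a b} → x ~ y → a ~ b → x S.∈ a ⇔ y T.∈ b
    ≈⇔ : ∀ {x y a b} → x ~ y → a ~ b → x S.≈ a ⇔ y T.≈ b
    ~≈ : ∀ {x y z} → x ~ y → y T.≈ z → x ~ z

  data _~*_ : ∀ {n} → Vec S.Carrier n → Vec T.Carrier n → Set ℓ where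
    []  : [] ~* []
    _∷_ : ∀ {n x y} {ρ : Vec _ n} {σ} → x ~ y → ρ ~* σ → (x ∷ ρ) ~* (y ∷ σ)

  ~-lookup : ∀ {n ρ σ} → ρ ~* σ → (i : Fin n) → lookup ρ i ~ lookup σ i
  ~-lookup (e ∷ h) zero    = e
  ~-lookup (e ∷ h) (suc i) = ~-lookup h i

  Sat-transport : ∀ {n} (φ : Formula n) {ρ σ} → ρ ~* σ → Sat S φ ρ ⇔ Sat T φ σ
  Sat-transport (i ∈̇ j) h = ∈⇔ (~-lookup h i) (~-lookup h j)
  Sat-transport (i ≐ j) h = ≈⇔ (~-lookup h i) (~-lookup h j)
  Sat-transport (¬̇ φ) h = let e = Sat-transport φ h in mk⇔ (_∘ from e) (_∘ to e)
  Sat-transport (φ ∧̇ ψ) h = let e = Sat-transport φ h ; e′ = Sat-transport ψ h in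
    mk⇔ (λ (p , q) → to e p , to e′ q) (λ (p , q) → from e p , from e′ q)
  Sat-transport (φ ∨̇ ψ) h = let e = Sat-transport φ h ; e′ = Sat-transport ψ h in
    mk⇔ (Sum.map (to e) (to e′)) (Sum.map (from e) (from e′))
  Sat-transport (φ ⇒̇ ψ) h = let e = Sat-transport φ h ; e′ = Sat-transport ψ h in
    mk⇔ (λ p → to e′ ∘ p ∘ from e) (λ p → from e′ ∘ p ∘ to e)
  Sat-transport (∀̇ φ) h =
    mk⇔ (λ p y → to (Sat-transport φ (back~ y ∷ h)) (p (back y)))
        (λ p x → from (Sat-transport φ (~forth x ∷ h)) (p (forth x)))
  Sat-transport (∃̇ φ) h =
    mk⇔ (λ (x , p) → forth x , to (Sat-transport φ (~forth x ∷ h)) p)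
        (λ (y , p) → back y , from (Sat-transport φ (back~ y ∷ h)) p)

  back* : ∀ {n} → Vec T.Carrier n → Vec S.Carrier n
  back* = Vec.map back

  back*~ : ∀ {n} (σ : Vec T.Carrier n) → back* σ ~* σ
  back*~ []      = []
  back*~ (x ∷ σ) = back~ x ∷ back*~ σ

  module Values (zS : IsZFC S) (zT : IsZFC T) where
    private
      module zS = IsZFC zS
      module zT = IsZFC zT
    open Semantics S zS renaming (⟦_⟧ to ⟦_⟧S; ⟦_⟧ᵗ to ⟦_⟧ᵗS; ⟦_⟧ᵗˢ to ⟦_⟧ᵗˢS; pairˢ to pairS; ∪ˢ to ∪S)
    open Semantics T zT renaming (⟦_⟧ to ⟦_⟧T; ⟦_⟧ᵗ to ⟦_⟧ᵗT; ⟦_⟧ᵗˢ to ⟦_⟧ᵗˢT; pairˢ to pairT; ∪ˢ to ∪T)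

    same : ∀ {a b} → (∀ {x y} → x ~ y → x S.∈ a → y T.∈ b) → (∀ {x y} → x ~ y → y T.∈ b → x S.∈ a) → a ~ b
    same {a} h k = ~≈ (~forth a) (zT.extensionality _ _ λ y →
      mk⇔ (λ p → h (back~ y) (from (∈⇔ (back~ y) (~forth a)) p))
          (λ p → to (∈⇔ (back~ y) (~forth a)) (k (back~ y) p)))

    pair~ : ∀ {a b a′ b′} → a ~ a′ → b ~ b′ → pairS a b ~ pairT a′ b′
    pair~ {a} {b} {a′} {b′} h k = same
      (λ e p → from (proj₂ (zT.pairing a′ b′) _) (Sum.map (to (≈⇔ e h)) (to (≈⇔ e k)) (to (proj₂ (zS.pairing a b) _) p)))
      (λ e p → from (proj₂ (zS.pairing a b) _) (Sum.map (from (≈⇔ e h)) (from (≈⇔ e k)) (to (proj₂ (zT.pairing a′ b′) _) p)))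

    union~ : ∀ {a a′} → a ~ a′ → proj₁ (zS.union a) ~ proj₁ (zT.union a′)
    union~ {a} {a′} h = same
      (λ e p → let (y , q , r) = to (proj₂ (zS.union a) _) p in
         from (proj₂ (zT.union a′) _) (forth y , to (∈⇔ (~forth y) h) q , to (∈⇔ e (~forth y)) r))
      (λ e p → let (y , q , r) = to (proj₂ (zT.union a′) _) p in
         from (proj₂ (zS.union a) _) (back y , from (∈⇔ (back~ y) h) q , from (∈⇔ e (back~ y)) r))

    mutual
      term~ : ∀ {n} (t : Tm n) {ρ σ} → ρ ~* σ → ⟦ t ⟧ᵗS ρ ~ ⟦ t ⟧ᵗT σ
      term~ (var i) h = ~-lookup h i
      term~ ∅ᵗ h = same (λ {x} _ p → ⊥-elim (proj₁ (proj₂ zS.infinity) x p))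
        (λ {_} {y} _ p → ⊥-elim (proj₁ (proj₂ zT.infinity) y p))
      term~ ⁅ t , u ⁆ᵗ h = pair~ (term~ t h) (term~ u h)
      term~ (t ∪ᵗ u) h = union~ (pair~ (term~ t h) (term~ u h))
      term~ (compr φ ts t) {ρ} {σ} h = same
        (λ e p → let (q , r) = to (sS _) p in
           from (sT _) (to (∈⇔ e (term~ t h)) q , to (Sat-transport (translate φ) (e ∷ terms~ ts h)) r))
        (λ e p → let (q , r) = to (sT _) p in
           from (sS _) (from (∈⇔ e (term~ t h)) q , from (Sat-transport (translate φ) (e ∷ terms~ ts h)) r))
        where
        sS = Semantics.sepˢ-spec S zS φ (⟦ ts ⟧ᵗˢS ρ) (⟦ t ⟧ᵗS ρ)
        sT = Semantics.sepˢ-spec T zT φ (⟦ ts ⟧ᵗˢT σ) (⟦ t ⟧ᵗT σ)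

      terms~ : ∀ {n k} (ts : Vec (Tm n) k) {ρ σ} → ρ ~* σ → ⟦ ts ⟧ᵗˢS ρ ~* ⟦ ts ⟧ᵗˢT σ
      terms~ []       h = []
      terms~ (t ∷ ts) h = term~ t h ∷ terms~ ts h

    ⟦⟧-transport : ∀ {n} (φ : Fm n) {ρ σ} → ρ ~* σ → ⟦ φ ⟧S ρ ⇔ ⟦ φ ⟧T σ
    ⟦⟧-transport (t ∈ᶠ u) h = ∈⇔ (term~ t h) (term~ u h)
    ⟦⟧-transport (t ≈ᶠ u) h = ≈⇔ (term~ t h) (term~ u h)
    ⟦⟧-transport (¬ᶠ φ) h = let e = ⟦⟧-transport φ h in mk⇔ (_∘ from e) (_∘ to e)
    ⟦⟧-transport (φ ∧ᶠ ψ) h = let e = ⟦⟧-transport φ h ; e′ = ⟦⟧-transport ψ h in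
      mk⇔ (λ (p , q) → to e p , to e′ q) (λ (p , q) → from e p , from e′ q)
    ⟦⟧-transport (φ ∨ᶠ ψ) h = let e = ⟦⟧-transport φ h ; e′ = ⟦⟧-transport ψ h in
      mk⇔ (Sum.map (to e) (to e′)) (Sum.map (from e) (from e′))
    ⟦⟧-transport (φ ⇒ᶠ ψ) h = let e = ⟦⟧-transport φ h ; e′ = ⟦⟧-transport ψ h in
      mk⇔ (λ p → to e′ ∘ p ∘ from e) (λ p → from e′ ∘ p ∘ to e)
    ⟦⟧-transport (φ ⇔ᶠ ψ) h = let e = ⟦⟧-transport φ h ; e′ = ⟦⟧-transport ψ h in
      mk⇔ (λ p → mk⇔ (to e′ ∘ to p ∘ from e) (to e ∘ from p ∘ from e′))
          (λ p → mk⇔ (from e′ ∘ to p ∘ to e) (from e ∘ from p ∘ to e′))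
    ⟦⟧-transport (∀ᶠ φ) h =
      mk⇔ (λ p y → to (⟦⟧-transport φ (back~ y ∷ h)) (p (back y)))
          (λ p x → from (⟦⟧-transport φ (~forth x ∷ h)) (p (forth x)))
    ⟦⟧-transport (∃ᶠ φ) h =
      mk⇔ (λ (x , p) → forth x , to (⟦⟧-transport φ (~forth x ∷ h)) p)
          (λ (y , p) → back y , from (⟦⟧-transport φ (back~ y ∷ h)) p)
    ⟦⟧-transport (call φ ts) h = ⟦⟧-transport φ (terms~ ts h)

-- A transitive model as a structure of its own, with propositional equality.
module Strictification {ℓ} (em : ExcludedMiddle ℓ) {𝔹 : BackgroundModel ℓ} (V : TransitiveModel 𝔹) where
  open BackgroundModel 𝔹 using () renaming (Universe to U; _∈_ to _∈ᵇ_)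
  open TransitiveModel V

  unsq : ∀ {A : Set ℓ} → Squash A → A
  unsq (squash a) = recompute em a

  Strict : Set ℓ
  Strict = Σ U (λ x → Squash (Class x))

  strict : Element → Strict
  strict (x , c) = x , squash c

  unstrict : Strict → Element
  unstrict (x , c) = x , unsq c

  ≈⇒≡ : {x y : Strict} → proj₁ x ≡ proj₁ y → x ≡ y
  ≈⇒≡ refl = refl

  ≡⇒≈ : {x y : Strict} → x ≡ y → proj₁ x ≡ proj₁ y
  ≡⇒≈ refl = refl

  strictStructure : ∈-Structure ℓ
  strictStructure = record { Carrier = Strict ; _≈_ = _≡_ ; _∈_ = λ x y → proj₁ x ∈ᵇ proj₁ y }

  bisimulation : Bisimulation (subStructure 𝔹 Class) strictStructure
  bisimulation = record
    { _~_ = λ x y → proj₁ x ≡ proj₁ y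
    ; forth = strict ; back = unstrict ; ~forth = λ _ → refl ; back~ = λ _ → refl
    ; ∈⇔ = λ { refl refl → mk⇔ id id }
    ; ≈⇔ = λ { {y = y} {b = b} refl refl → mk⇔ ≈⇒≡ ≡⇒≈ }
    ; ~≈ = λ { refl refl → refl }
    }

  open Bisimulation bisimulation

  strictZFC : IsZFC strictStructure
  strictZFC = record
    { extensionality = λ a b h → ≈⇒≡ (extensionality (unstrict a) (unstrict b) (λ x → h (strict x)))
    ; foundation = λ a (x , p) → let (m , q , r) = foundation (unstrict a) (unstrict x , p) in
        strict m , q , λ y → r (unstrict y)
    ; pairing = λ a b → let (c , h) = pairing (unstrict a) (unstrict b) in strict c , λ x →
        mk⇔ (λ p → Sum.map ≈⇒≡ ≈⇒≡ (to (h (unstrict x)) p)) (λ q → from (h (unstrict x)) (Sum.map ≡⇒≈ ≡⇒≈ q))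
    ; union = λ a → let (b , h) = union (unstrict a) in strict b , λ x →
        mk⇔ (λ p → let (y , q) = to (h (unstrict x)) p in strict y , q) (λ (y , q) → from (h (unstrict x)) (unstrict y , q))
    ; powerSet = λ a → let (b , h) = powerSet (unstrict a) in strict b , λ x →
        mk⇔ (λ p y → to (h (unstrict x)) p (unstrict y)) (λ q → from (h (unstrict x)) (λ y → q (strict y)))
    ; infinity = let (e , p , I , q , h) = infinity in strict e , (λ x → p (unstrict x)) , strict I , q ,
        λ x r → let (s , t , u) = h (unstrict x) r in strict s , t , λ y →
          mk⇔ (λ v → Sum.map₂ ≈⇒≡ (to (u (unstrict y)) v)) (λ v → from (u (unstrict y)) (Sum.map₂ ≡⇒≈ v))
    ; choice = λ a h k → let (c , q) = choice (unstrict a) (λ x p → let (y , r) = h (strict x) p in unstrict y , r)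
                                         (λ x y z p p′ q q′ → ≡⇒≈ (k (strict x) (strict y) (strict z) p p′ q q′)) in
        strict c , λ x p → let (y , r , u) = q (unstrict x) p in strict y , r , λ w v v′ → ≈⇒≡ (u (unstrict w) v v′)
    ; separation = λ φ ρ a → let (b , h) = separation φ (back* ρ) (unstrict a) in strict b , λ x →
        let e = Sat-transport φ (refl ∷ back*~ ρ) in
        mk⇔ (λ p → let (q , r) = to (h (unstrict x)) p in q , to e r) (λ (q , r) → from (h (unstrict x)) (q , from e r))
    ; replacement = λ φ ρ a h →
        let e  = λ (x y : Strict) → Sat-transport φ {unstrict x ∷ unstrict y ∷ back* ρ} {x ∷ y ∷ ρ} (refl ∷ refl ∷ back*~ ρ)
            e⁻ = λ (x y : Element) → Sat-transport φ {x ∷ y ∷ back* ρ} {strict x ∷ strict y ∷ ρ} (refl ∷ refl ∷ back*~ ρ)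
            (b , k) = replacement φ (back* ρ) (unstrict a)
              (λ x p → let (y , q , u) = h (strict x) p in
                unstrict y , from (Sat-transport φ (refl ∷ refl ∷ back*~ ρ)) q , λ w r → ≡⇒≈ (u (strict w) (to (e⁻ x w) r)))
        in strict b , λ y → mk⇔
          (λ p → let (x , q , r) = to (k (unstrict y)) p in strict x , q , to (Sat-transport φ (refl ∷ refl ∷ back*~ ρ)) r)
          (λ (x , q , r) → from (k (unstrict y)) (unstrict x , q , from (e x y) r))
    }
    where open IsZFC zfc

  𝕄 : BackgroundModel ℓ
  𝕄 = record { Universe = Strict ; _∈_ = λ x y → proj₁ x ∈ᵇ proj₁ y ; isZFC = strictZFC }

  private
    same* : ∀ {n} (ρ : Vec Element n) (σ : Vec Strict n) → Vec.map proj₁ ρ ≡ Vec.map proj₁ σ → ρ ~* σ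
    same* []      []      e = []
    same* (x ∷ ρ) (y ∷ σ) e = cong Vec.head e ∷ same* ρ σ (cong Vec.tail e)

  transport : ∀ {n} (φ : Fm n) (ρ : Vec Element n) (σ : Vec Strict n) → Vec.map proj₁ ρ ≡ Vec.map proj₁ σ →
    Semantics.⟦_⟧ (subStructure 𝔹 Class) zfc φ ρ ⇔ Semantics.⟦_⟧ strictStructure strictZFC φ σ
  transport φ ρ σ e = Values.⟦⟧-transport zfc strictZFC φ (same* ρ σ e)

module Unfolding {ℓ} {𝔹 : BackgroundModel ℓ} (V : TransitiveModel 𝔹) (κ X 𝓛 : TransitiveModel.Element V) where
  open Internal V
  open Structures κ X 𝓛
  open Semantics (subStructure 𝔹 (TransitiveModel.Class V)) (TransitiveModel.zfc V)

  opaque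
    unfolding isStructureᶠ
    structure⇔ : ∀ M → IsStructure M ⇔ ⟦ isStructureᶠ ⟧ (X ∷ 𝓛 ∷ M ∷ [])
    structure⇔ M = mk⇔ id id

  opaque
    unfolding isStructureᶠ isActionᶠ
    action⇔ : ∀ g M N → IsAction g M N ⇔ ⟦ isActionᶠ ⟧ (X ∷ 𝓛 ∷ g ∷ M ∷ N ∷ [])
    action⇔ g M N = mk⇔ id id

  opaque
    unfolding isStructureᶠ isLiteralSetᶠ isClosedFamilyᶠ measurableᶠ
    measurable⇔ : ∀ A → Measurable A ⇔ ⟦ measurableᶠ ⟧ (κ ∷ X ∷ 𝓛 ∷ A ∷ [])
    measurable⇔ A = mk⇔ id id

  opaque
    unfolding lessᶠ leqᶠ addFracᶠ isRealᶠ addRealᶠ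
    real⇔ : ∀ r → IsReal r ⇔ ⟦ isRealᶠ ⟧ (r ∷ [])
    real⇔ r = mk⇔ id id

  module _ (μ : 𝕍) where
    opaque
      unfolding lessᶠ leqᶠ addFracᶠ isRealᶠ addRealᶠ isAdditiveᶠ
      additive⇔ : ∀ I → IsAdditive μ I ⇔ ⟦ isAdditiveᶠ ⟧ (κ ∷ X ∷ 𝓛 ∷ μ ∷ I ∷ [])
      additive⇔ I = mk⇔ (λ h f B r F m → h f B r F λ i A p → from (measurable⇔ A) (m i A p))
        (λ h f B r F m → h f B r F λ i A p → to (measurable⇔ A) (m i A p))

    ρ : Vec 𝕍 4
    ρ = κ ∷ X ∷ 𝓛 ∷ μ ∷ []

    probability⇔ : IsProbabilityκMeasure μ ⇔ ⟦ isProbabilityκMeasure v0 v1 v2 v3 ⟧ ρ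
    probability⇔ = mk⇔
      (λ P → let open IsProbabilityκMeasure P in
        (λ p q → let (A , r , e , m , R) = domain p q in A , r , e , to (measurable⇔ A) m , to (real⇔ r) R) ,
        (λ A m → function A (from (measurable⇔ A) m)) ,
        (λ S r h p → total S r (λ M → mk⇔ (λ q → from (structure⇔ M) (to (h M) q)) (λ q → from (h M) (to (structure⇔ M) q))) p) ,
        (λ w h → to (additive⇔ w) (σ-additive w h)) , to (additive⇔ κ) κ-additive)
      (λ (d , f , t , s , k) → record
        { domain = λ p q → let (A , r , e , m , R) = d p q in A , r , e , from (measurable⇔ A) m , from (real⇔ r) R
        ; function = λ A m → f A (to (measurable⇔ A) m)
        ; total = λ S r h p → t S r (λ M → mk⇔ (λ q → to (structure⇔ M) (to (h M) q)) (λ q → from (h M) (from (structure⇔ M) q))) p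
        ; σ-additive = λ w h → from (additive⇔ w) (s w h)
        ; κ-additive = from (additive⇔ κ) k })

    private
      Imageᶠ : 𝕍 → 𝕍 → 𝕍 → Set ℓ
      Imageᶠ g A B = ∀ N → N ∈ B ⇔ (∃[ M ] M ∈ A × ⟦ isActionᶠ ⟧ (X ∷ 𝓛 ∷ g ∷ M ∷ N ∷ []))

      image⇒ : ∀ {g A B} → IsImage g A B → Imageᶠ g A B
      image⇒ {g} h N = mk⇔ (λ p → let (M , q , a) = to (h N) p in M , q , to (action⇔ g M N) a)
                           (λ (M , q , a) → from (h N) (M , q , from (action⇔ g M N) a))

      image⇐ : ∀ {g A B} → Imageᶠ g A B → IsImage g A B
      image⇐ {g} h N = mk⇔ (λ p → let (M , q , a) = to (h N) p in M , q , from (action⇔ g M N) a)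
                           (λ (M , q , a) → from (h N) (M , q , to (action⇔ g M N) a))

    invariant⇔ : IsInvariant μ ⇔ ⟦ isInvariant v0 v1 v2 v3 ⟧ ρ
    invariant⇔ = mk⇔ (λ h g A B r G m i → h g A B r G (from (measurable⇔ A) m) (image⇐ {g} {A} {B} i))
      (λ h g A B r G m i → h g A B r G (to (measurable⇔ A) m) (image⇒ {g} {A} {B} i))

    opaque
      unfolding isErgodicᶠ
      ergodic⇔ : IsErgodic μ ⇔ ⟦ isErgodic v0 v1 v2 v3 ⟧ ρ
      ergodic⇔ = mk⇔
        (λ ((P , I) , e) → (to probability⇔ P , to invariant⇔ I) ,
          λ A m a → e A (from (measurable⇔ A) m) (λ g B D G i d → a g B D G (image⇒ {g} {A} {B} i) d))
        (λ ((P , I) , e) → (from probability⇔ P , from invariant⇔ I) ,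
          λ A m a → e A (to (measurable⇔ A) m) (λ g B D G i d → a g B D G (image⇐ {g} {A} {B} i) d))

  tuple⇐ : ∀ n a → ⟦ isTuple v0 v1 v2 ⟧ (X ∷ n ∷ a ∷ []) → IsTuple n a
  tuple⇐ n a h = h

  conjunction⇐ : ∀ n c → ⟦ isConjunction v0 v1 v2 ⟧ (𝓛 ∷ n ∷ c ∷ []) → IsConjunction n c
  conjunction⇐ n c h = h

  value⇔ : ∀ μ A r → μ [ A ]= r ⇔ ⟦ v0 [ v1 ]ᶠ= v2 ⟧ (μ ∷ A ∷ r ∷ [])
  value⇔ μ A r = mk⇔ id id

  opaque
    unfolding isConjunctionSetᶠ
    conjunctionSet⇐ : ∀ a c A → ⟦ isConjunctionSet v0 v1 v2 v3 v4 ⟧ (X ∷ 𝓛 ∷ a ∷ c ∷ A ∷ []) → IsConjunctionSet a c A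
    conjunctionSet⇐ a c A h M = mk⇔ (λ p → let (s , q) = to (h M) p in from (structure⇔ M) s , q) (λ (s , q) → from (h M) (to (structure⇔ M) s , q))

module Model {ℓ} (em : ExcludedMiddle ℓ) (𝕄 : BackgroundModel ℓ) where
 open BackgroundModel 𝕄 public using (isZFC) renaming (Universe to 𝕍; _∈_ to infix 4 _∈_)
 open Correctness 𝕄 public
 open Semantics 𝔖 isZFC public renaming (∅ˢ to ∅; sepˢ to sep; pairˢ to ⁅_,_⁆; ∪ˢ to infixr 6 _∪_)
 open IsZFC isZFC public using (pairing; union; powerSet; foundation; infinity; choice)

 dec : (A : Set ℓ) → Dec A
 dec A = em {A}

 by-contradiction : {A : Set ℓ} → ¬ ¬ A → A
 by-contradiction {A} h with dec A
 ... | yes a = a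
 ... | no ¬a = ⊥-elim (h ¬a)

 ≡⇒⇔ : {A B : Set ℓ} → A ≡ B → A ⇔ B
 ≡⇒⇔ refl = mk⇔ id id

 infix 4 _⊆_ _∉_
 _⊆_ _∉_ : 𝕍 → 𝕍 → Set ℓ
 a ⊆ b = ∀ x → x ∈ a → x ∈ b
 a ∉ b = ¬ a ∈ b

 ⟨_,_⟩ : 𝕍 → 𝕍 → 𝕍
 ⟨ a , b ⟩ = ⁅ ⁅ a , a ⁆ , ⁅ a , b ⁆ ⁆

 succ : 𝕍 → 𝕍
 succ a = a ∪ ⁅ a , a ⁆

 infix 4 _[_]=_ _∶_⟶_
 _[_]=_ : 𝕍 → 𝕍 → 𝕍 → Set ℓ
 f [ x ]= y = ⟨ x , y ⟩ ∈ f

 IsFunctionOn : 𝕍 → 𝕍 → Set ℓ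
 IsFunctionOn f a = ⟦ isFunctionOn v0 v1 ⟧ (f ∷ a ∷ [])

 _∶_⟶_ : 𝕍 → 𝕍 → 𝕍 → Set ℓ
 f ∶ a ⟶ b = ⟦ isMap v0 v1 v2 ⟧ (f ∷ a ∷ b ∷ [])

 Injective : 𝕍 → Set ℓ
 Injective f = ⟦ injective v0 ⟧ (f ∷ [])

 module _ {k} (φ : Fm (suc k)) (ρ : Vec 𝕍 k) {a x : 𝕍} where
   ∈sep⁻ : x ∈ sep φ ρ a → x ∈ a × ⟦ φ ⟧ (x ∷ ρ)
   ∈sep⁻ = to (separate φ ρ a x)
   ∈sep : x ∈ a → ⟦ φ ⟧ (x ∷ ρ) → x ∈ sep φ ρ a
   ∈sep p q = from (separate φ ρ a x) (p , q)

 ∉∅ : ∀ {x} → ¬ x ∈ ∅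
 ∉∅ {x} = proj₁ (proj₂ infinity) x

 nonempty : ∀ {a} → ¬ a ≡ ∅ → ∃[ x ] x ∈ a
 nonempty h = by-contradiction λ k → h (ext (λ x p → ⊥-elim (k (x , p))) (λ x p → ⊥-elim (∉∅ p)))

 ≡∅ : ∀ {a} → (∀ x → ¬ x ∈ a) → a ≡ ∅
 ≡∅ h = ext (λ x p → ⊥-elim (h x p)) (λ x p → ⊥-elim (∉∅ p))

 module _ {a b x : 𝕍} where
   ∈⁅⁆ : x ≡ a ⊎ x ≡ b → x ∈ ⁅ a , b ⁆
   ∈⁅⁆ = from (proj₂ (pairing a b) x)
   ∈⁅⁆⁻ : x ∈ ⁅ a , b ⁆ → x ≡ a ⊎ x ≡ b
   ∈⁅⁆⁻ = to (proj₂ (pairing a b) x)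
   ∈∪⁻ : x ∈ a ∪ b → x ∈ a ⊎ x ∈ b
   ∈∪⁻ = to (∈∪⇔ a b x)
   ∈∪ : x ∈ a ⊎ x ∈ b → x ∈ a ∪ b
   ∈∪ = from (∈∪⇔ a b x)

 ∈⁅⁆₁ : ∀ {a b} → a ∈ ⁅ a , b ⁆
 ∈⁅⁆₁ = ∈⁅⁆ (inj₁ refl)
 ∈⁅⁆₂ : ∀ {a b} → b ∈ ⁅ a , b ⁆
 ∈⁅⁆₂ = ∈⁅⁆ (inj₂ refl)

 ∈⁅a⁆ : ∀ {a x} → x ∈ ⁅ a , a ⁆ → x ≡ a
 ∈⁅a⁆ p = [ id , id ]′ (∈⁅⁆⁻ p)

 ⋃ : 𝕍 → 𝕍
 ⋃ a = proj₁ (union a)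
 ∈⋃⁻ : ∀ {a x} → x ∈ ⋃ a → ∃[ y ] y ∈ a × x ∈ y
 ∈⋃⁻ {a} {x} = to (proj₂ (union a) x)
 ∈⋃ : ∀ {a x y} → y ∈ a → x ∈ y → x ∈ ⋃ a
 ∈⋃ {a} {x} {y} p q = from (proj₂ (union a) x) (y , p , q)

 𝒫 : 𝕍 → 𝕍
 𝒫 a = proj₁ (powerSet a)
 ∈𝒫⁻ : ∀ {a x} → x ∈ 𝒫 a → x ⊆ a
 ∈𝒫⁻ {a} {x} = to (proj₂ (powerSet a) x)
 ∈𝒫 : ∀ {a x} → x ⊆ a → x ∈ 𝒫 a
 ∈𝒫 {a} {x} = from (proj₂ (powerSet a) x)

 ∈succ : ∀ {a x} → x ∈ a ⊎ x ≡ a → x ∈ succ a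
 ∈succ (inj₁ p)    = ∈∪ (inj₁ p)
 ∈succ (inj₂ refl) = ∈∪ (inj₂ ∈⁅⁆₁)
 ∈succ⁻ : ∀ {a x} → x ∈ succ a → x ∈ a ⊎ x ≡ a
 ∈succ⁻ p = Sum.map₂ ∈⁅a⁆ (∈∪⁻ p)

 least : ∀ {a x} → x ∈ a → ∃[ m ] m ∈ a × (∀ y → y ∈ m → y ∉ a)
 least {a} {x} p = foundation a (x , p)

 ∈-irrefl : ∀ {a} → ¬ a ∈ a
 ∈-irrefl {a} p with least {⁅ a , a ⁆} ∈⁅⁆₁
 ... | m , q , h with ∈⁅a⁆ q
 ... | refl = h a p ∈⁅⁆₁

 ∈-asym : ∀ {a b} → a ∈ b → ¬ b ∈ a
 ∈-asym {a} {b} p q with least {⁅ a , b ⁆} ∈⁅⁆₁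
 ... | m , r , h with ∈⁅⁆⁻ r
 ... | inj₁ refl = h b q ∈⁅⁆₂
 ... | inj₂ refl = h a p ∈⁅⁆₁

 -- Ordered pairs and functions

 ⟨⟩-injective : ∀ {a b c d} → ⟨ a , b ⟩ ≡ ⟨ c , d ⟩ → a ≡ c × b ≡ d
 ⟨⟩-injective e = a≡c e , b≡d (a≡c e) e
   where
   a≡c : ∀ {a b c d} → ⟨ a , b ⟩ ≡ ⟨ c , d ⟩ → a ≡ c
   a≡c {a} {b} {c} {d} e with ∈⁅⁆⁻ (subst (⁅ a , a ⁆ ∈_) e ∈⁅⁆₁)
   ... | inj₁ q = ∈⁅a⁆ (subst (a ∈_) q ∈⁅⁆₁)
   ... | inj₂ q = sym (∈⁅a⁆ (subst (c ∈_) (sym q) ∈⁅⁆₁))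
   b≡d : ∀ {a b c d} → a ≡ c → ⟨ a , b ⟩ ≡ ⟨ c , d ⟩ → b ≡ d
   b≡d {a} {b} {c} {d} refl e with ∈⁅⁆⁻ (subst (⁅ a , b ⁆ ∈_) e ∈⁅⁆₂)
     | ∈⁅⁆⁻ (subst (⁅ a , d ⁆ ∈_) (sym e) ∈⁅⁆₂)
   ... | inj₁ q | inj₁ r = trans (∈⁅a⁆ (subst (b ∈_) q ∈⁅⁆₂)) (sym (∈⁅a⁆ (subst (d ∈_) r ∈⁅⁆₂)))
   ... | inj₁ q | inj₂ r = trans (∈⁅a⁆ (subst (b ∈_) q ∈⁅⁆₂)) (sym (∈⁅a⁆ (subst (d ∈_) (trans r q) ∈⁅⁆₂)))
   ... | inj₂ q | _ with ∈⁅⁆⁻ (subst (b ∈_) q ∈⁅⁆₂) | ∈⁅⁆⁻ (subst (d ∈_) (sym q) ∈⁅⁆₂)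
   ...   | inj₂ s | _ = s
   ...   | inj₁ s | inj₁ t = trans s (sym t)
   ...   | inj₁ s | inj₂ t = sym t

 infixr 7 _⊗_
 _⊗_ : 𝕍 → 𝕍 → 𝕍
 a ⊗ b = sep (∃ᶠ ∃ᶠ v2 ≈ᶠ ⟨ v1 , v0 ⟩ᵗ ∧ᶠ v1 ∈ᶠ v3 ∧ᶠ v0 ∈ᶠ v4) (a ∷ b ∷ []) (𝒫 (𝒫 (a ∪ b)))

 module _ {a b : 𝕍} where
   ∈⊗ : ∀ {x y} → x ∈ a → y ∈ b → ⟨ x , y ⟩ ∈ a ⊗ b
   ∈⊗ {x} {y} p q = ∈sep _ _
     (∈𝒫 λ z r → ∈𝒫 λ w s → ∈∪ ([ (λ { refl → [ (λ { refl → inj₁ p }) , (λ { refl → inj₁ p }) ]′ (∈⁅⁆⁻ s) })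
       , (λ { refl → [ (λ { refl → inj₁ p }) , (λ { refl → inj₂ q }) ]′ (∈⁅⁆⁻ s) }) ]′ (∈⁅⁆⁻ r)))
     (x , y , refl , p , q)

   ∈⊗⁻ : ∀ {p} → p ∈ a ⊗ b → ∃[ x ] ∃[ y ] p ≡ ⟨ x , y ⟩ × x ∈ a × y ∈ b
   ∈⊗⁻ h = proj₂ (∈sep⁻ _ _ h)

   ⟨⟩∈⊗⁻ : ∀ {x y} → ⟨ x , y ⟩ ∈ a ⊗ b → x ∈ a × y ∈ b
   ⟨⟩∈⊗⁻ h with ∈⊗⁻ h
   ... | x , y , e , p , q with ⟨⟩-injective e
   ... | refl , refl = p , q

 module _ {f a : 𝕍} (F : IsFunctionOn f a) where
   dom : ∀ {x y} → f [ x ]= y → x ∈ a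
   dom p with proj₁ F _ p
   ... | x′ , y′ , e , q with ⟨⟩-injective e
   ... | refl , _ = q

   value : ∀ {x} → x ∈ a → ∃[ y ] f [ x ]= y
   value p = let (y , q , _) = proj₂ F _ p in y , q

   functional : ∀ {x y z} → f [ x ]= y → f [ x ]= z → y ≡ z
   functional p q = let (w , _ , u) = proj₂ F _ (dom p) in trans (u _ p) (sym (u _ q))

 isFunctionOn-intro : ∀ {f a} → (∀ p → p ∈ f → ∃[ x ] ∃[ y ] p ≡ ⟨ x , y ⟩ × x ∈ a) →
   (∀ x → x ∈ a → ∃[ y ] f [ x ]= y) → (∀ x y z → f [ x ]= y → f [ x ]= z → y ≡ z) → IsFunctionOn f a
 isFunctionOn-intro h k u = h , λ x p → let (y , q) = k x p in y , q , λ z r → u x z y r q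

 function-ext : ∀ {f g a} → IsFunctionOn f a → IsFunctionOn g a →
   (∀ x y → f [ x ]= y → g [ x ]= y) → f ≡ g
 function-ext {f} {g} F G h = ext forth back
   where
   forth : ∀ p → p ∈ f → p ∈ g
   forth p q with proj₁ F p q
   ... | x , y , refl , _ = h x y q
   back : ∀ p → p ∈ g → p ∈ f
   back p q with proj₁ G p q
   ... | x , y , refl , r with value F r
   ... | z , s with functional G (h x z s) q
   ... | refl = s

 -- In φ the variables 0, 1 and 2 stand for the value y, the argument x and ⟨ x , y ⟩.
 graph : ∀ {k} → Fm (3 ℕ.+ k) → Vec 𝕍 k → 𝕍 → 𝕍 → 𝕍
 graph φ ρ a b = sep (∃ᶠ ∃ᶠ v2 ≈ᶠ ⟨ v1 , v0 ⟩ᵗ ∧ᶠ φ) ρ (a ⊗ b)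

 module Graph {k} (φ : Fm (3 ℕ.+ k)) (ρ : Vec 𝕍 k) (a b : 𝕍) where
   fun : 𝕍
   fun = graph φ ρ a b

   fun-intro : ∀ {x y} → x ∈ a → y ∈ b → ⟦ φ ⟧ (y ∷ x ∷ ⟨ x , y ⟩ ∷ ρ) → fun [ x ]= y
   fun-intro {x} {y} p q r = ∈sep _ ρ (∈⊗ p q) (x , y , refl , r)

   fun-elim : ∀ {x y} → fun [ x ]= y → x ∈ a × y ∈ b × ⟦ φ ⟧ (y ∷ x ∷ ⟨ x , y ⟩ ∷ ρ)
   fun-elim h with ∈sep⁻ _ ρ h
   ... | m , x , y , e , r with ⟨⟩-injective e
   ... | refl , refl = let (p , q) = ⟨⟩∈⊗⁻ m in p , q , r

   fun-pairs : ∀ p → p ∈ fun → ∃[ x ] ∃[ y ] p ≡ ⟨ x , y ⟩ × x ∈ a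
   fun-pairs p q = let (x , y , e , r , _) = ∈⊗⁻ (proj₁ (∈sep⁻ _ ρ q)) in x , y , e , r

   fun-map : (∀ x → x ∈ a → ∃[ y ] y ∈ b × ⟦ φ ⟧ (y ∷ x ∷ ⟨ x , y ⟩ ∷ ρ)) →
             (∀ x y z → x ∈ a → ⟦ φ ⟧ (y ∷ x ∷ ⟨ x , y ⟩ ∷ ρ) → ⟦ φ ⟧ (z ∷ x ∷ ⟨ x , z ⟩ ∷ ρ) → y ≡ z) →
             fun ∶ a ⟶ b
   fun-map h u = isFunctionOn-intro
     fun-pairs
     (λ x p → let (y , q , r) = h x p in y , fun-intro p q r)
     (λ x y z p q → let (r , _ , s) = fun-elim p ; (_ , _ , t) = fun-elim q in u x y z r s t)
     , λ x y p → proj₁ (proj₂ (fun-elim p))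

   axiom-of-choice : (∀ x → x ∈ a → ∃[ y ] y ∈ b × ⟦ φ ⟧ (y ∷ x ∷ ⟨ x , y ⟩ ∷ ρ)) →
     ∃[ f ] f ∶ a ⟶ b × (∀ {x y} → f [ x ]= y → x ∈ a × y ∈ b × ⟦ φ ⟧ (y ∷ x ∷ ⟨ x , y ⟩ ∷ ρ))
   axiom-of-choice h = f , (isFunctionOn-intro f-pairs f-total f-unique , λ x y p → proj₁ (proj₂ (f⊆ p))) , f⊆
     where
     fibreᶠ : Fm 2
     fibreᶠ = ∃ᶠ v1 ≈ᶠ ⟨ v2 , v0 ⟩ᵗ
     fibre : 𝕍 → 𝕍
     fibre x = sep fibreᶠ (x ∷ []) fun
     inFibre : ∀ {x y} → fun [ x ]= y → ⟨ x , y ⟩ ∈ fibre x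
     inFibre {x} {y} p = ∈sep fibreᶠ (x ∷ []) p (y , refl)
     fibre⁻ : ∀ {x z} → z ∈ fibre x → z ∈ fun × (∃[ y ] z ≡ ⟨ x , y ⟩)
     fibre⁻ {x} = ∈sep⁻ fibreᶠ (x ∷ [])
     fibresᶠ : Fm 3
     fibresᶠ = ∃ᶠ v0 ∈ᶠ v2 ∧ᶠ v1 ≈ᶠ compr fibreᶠ (v0 ∷ []) v3
     fibres : 𝕍
     fibres = sep fibresᶠ (a ∷ fun ∷ []) (𝒫 fun)
     fibres⁻ : ∀ {S} → S ∈ fibres → ∃[ x ] x ∈ a × S ≡ fibre x
     fibres⁻ q = proj₂ (∈sep⁻ fibresᶠ (a ∷ fun ∷ []) q)
     fibre∈ : ∀ x → x ∈ a → fibre x ∈ fibres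
     fibre∈ x p = ∈sep fibresᶠ (a ∷ fun ∷ []) (∈𝒫 λ z q → proj₁ (fibre⁻ q)) (x , p , refl)
     inhabited : ∀ S → S ∈ fibres → ∃[ z ] z ∈ S
     inhabited S q with fibres⁻ q
     ... | x , p , refl = let (y , r , s) = h x p in ⟨ x , y ⟩ , inFibre (fun-intro p r s)
     disjoint : ∀ S T z → S ∈ fibres → T ∈ fibres → z ∈ S → z ∈ T → S ≡ T
     disjoint S T z q r s t with fibres⁻ q | fibres⁻ r
     ... | x , _ , refl | x′ , _ , refl with fibre⁻ s | fibre⁻ t
     ... | _ , y , refl | _ , y′ , e = cong fibre (proj₁ (⟨⟩-injective e))
     chosen : ∃[ c ] (∀ S → S ∈ fibres → ∃[ z ] (z ∈ S × z ∈ c) × (∀ w → w ∈ S → w ∈ c → w ≡ z))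
     chosen = choice fibres inhabited disjoint
     c f : 𝕍
     c = proj₁ chosen
     f = sep (v0 ∈ᶠ v1) (c ∷ []) fun
     f⁻ : ∀ {p} → p ∈ f → p ∈ fun × p ∈ c
     f⁻ = ∈sep⁻ (v0 ∈ᶠ v1) (c ∷ [])
     f⊆ : ∀ {x y} → f [ x ]= y → x ∈ a × y ∈ b × ⟦ φ ⟧ (y ∷ x ∷ ⟨ x , y ⟩ ∷ ρ)
     f⊆ p = fun-elim (proj₁ (f⁻ p))
     f-pairs : ∀ p → p ∈ f → ∃[ x ] ∃[ y ] p ≡ ⟨ x , y ⟩ × x ∈ a
     f-pairs p q = fun-pairs p (proj₁ (f⁻ q))
     f-total : ∀ x → x ∈ a → ∃[ y ] f [ x ]= y
     f-total x p with proj₂ chosen (fibre x) (fibre∈ x p)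
     ... | z , (q , r) , _ with fibre⁻ q
     ... | s , y , refl = y , ∈sep (v0 ∈ᶠ v1) (c ∷ []) s r
     f-unique : ∀ x y z → f [ x ]= y → f [ x ]= z → y ≡ z
     f-unique x y z p q =
       let (p′ , p″) = f⁻ p ; (q′ , q″) = f⁻ q
           (w , _ , u) = proj₂ chosen (fibre x) (fibre∈ x (proj₁ (f⊆ p)))
       in proj₂ (⟨⟩-injective (trans (u _ (inFibre p′) p″) (sym (u _ (inFibre q′) q″))))

 -- Natural numbers

 Inductive IsNat IsOrdinal IsTransitive : 𝕍 → Set ℓ
 Inductive I    = ⟦ isInductive v0 ⟧ (I ∷ [])
 IsNat n        = ⟦ isNat v0 ⟧ (n ∷ [])
 IsTransitive a = ⟦ isTransitive v0 ⟧ (a ∷ [])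
 IsOrdinal a    = ⟦ isOrdinal v0 ⟧ (a ∷ [])

 opaque
   ω : 𝕍
   ω = sep (isNat v0) [] (proj₁ (proj₂ (proj₂ infinity)))

   ∈ω⁻ : ∀ {n} → n ∈ ω → IsNat n
   ∈ω⁻ p = proj₂ (∈sep⁻ (isNat v0) [] p)

   ∈ω : ∀ {n} → IsNat n → n ∈ ω
   ∈ω q = let (I , base , step) = proj₂ (proj₂ infinity) in
     ∈sep (isNat v0) [] (q I (base , λ x p → let (s , q , h) = step x p in
       subst (_∈ I) (ext (λ z r → ∈succ (to (h z) r)) (λ z r → from (h z) (∈succ⁻ r))) q)) q

 opaque
   0∈ω : ∅ ∈ ω
   0∈ω = ∈ω λ I → proj₁
   s∈ω : ∀ {n} → n ∈ ω → succ n ∈ ω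
   s∈ω p = ∈ω λ I h → proj₂ h _ (∈ω⁻ p I h)

 ω-ind : ∀ {k} (φ : Fm (suc k)) (ρ : Vec 𝕍 k) → ⟦ φ ⟧ (∅ ∷ ρ) →
   (∀ n → n ∈ ω → ⟦ φ ⟧ (n ∷ ρ) → ⟦ φ ⟧ (succ n ∷ ρ)) → ∀ n → n ∈ ω → ⟦ φ ⟧ (n ∷ ρ)
 ω-ind φ ρ z s n p = proj₂ (∈sep⁻ φ ρ (∈ω⁻ p (sep φ ρ ω) (∈sep φ ρ 0∈ω z ,
   λ x q → let (q₁ , q₂) = ∈sep⁻ φ ρ q in ∈sep φ ρ (s∈ω q₁) (s x q₁ q₂))))

 ω-cases : ∀ {n} → n ∈ ω → n ≡ ∅ ⊎ (∃[ m ] m ∈ ω × n ≡ succ m)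
 ω-cases {n} = ω-ind (v0 ≈ᶠ ∅ᵗ ∨ᶠ (∃ᶠ v0 ∈ᶠ v2 ∧ᶠ v1 ≈ᶠ succᵗ v0)) (ω ∷ []) (inj₁ refl) (λ n p _ → inj₂ (n , p , refl)) n

 ω-transitive : ∀ {m n} → n ∈ ω → m ∈ n → m ∈ ω
 ω-transitive {m} {n} p = ω-ind (∀ᶠ v0 ∈ᶠ v1 ⇒ᶠ v0 ∈ᶠ v2) (ω ∷ []) (λ x q → ⊥-elim (∉∅ q))
   (λ n p h x q → [ h x , (λ { refl → p }) ]′ (∈succ⁻ q)) n p m

 nat-transitive : ∀ {n} → n ∈ ω → IsTransitive n
 nat-transitive {n} = ω-ind (isTransitive v0) [] (λ x q → ⊥-elim (∉∅ q))
   (λ n p h x q y r → ∈succ (inj₁ ([ (λ s → h x s y r) , (λ { refl → r }) ]′ (∈succ⁻ q)))) n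

 Comparable : 𝕍 → 𝕍 → Set ℓ
 Comparable x y = x ∈ y ⊎ x ≡ y ⊎ y ∈ x

 trichotomy : ∀ {S} → IsTransitive S → (∀ x → x ∈ S → IsTransitive x) →
   ∀ x y → x ∈ S → y ∈ S → Comparable x y
 trichotomy {S} T h x y p q = by-contradiction λ ¬c → no-bad (∈sep bad _ p (y , q , ¬c))
   where
   bad : Fm 2
   bad = ∃ᶠ v0 ∈ᶠ v2 ∧ᶠ ¬ᶠ (v1 ∈ᶠ v0 ∨ᶠ v1 ≈ᶠ v0 ∨ᶠ v0 ∈ᶠ v1)
   no-bad : ∀ {x} → ¬ x ∈ sep bad (S ∷ []) S
   no-bad x∈ with least x∈
   ... | x , x-bad , minx with ∈sep⁻ _ _ x-bad
   ... | x∈S , y , y∈S , ¬c with least {sep (¬ᶠ (v1 ∈ᶠ v0 ∨ᶠ v1 ≈ᶠ v0 ∨ᶠ v0 ∈ᶠ v1)) (x ∷ []) S} (∈sep _ _ y∈S ¬c)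
   ... | y , y-bad , miny with ∈sep⁻ _ _ y-bad
   ... | y∈S , ¬c = ¬c (inj₂ (inj₁ (ext below above)))
     where
     below : ∀ z → z ∈ x → z ∈ y
     below z r = by-contradiction λ z∉y → minx z r (∈sep _ _ (T x x∈S z r)
       (y , y∈S , [ z∉y , [ (λ { refl → ¬c (inj₂ (inj₂ r)) }) , (λ s → ¬c (inj₂ (inj₂ (h x x∈S z r y s)))) ]′ ]′))
     above : ∀ z → z ∈ y → z ∈ x
     above z r = by-contradiction λ z∉x → miny z r (∈sep _ _ (T y y∈S z r)
       [ (λ s → ¬c (inj₁ (h y y∈S z r x s))) , [ (λ { refl → ¬c (inj₁ r) }) , z∉x ]′ ]′)

 ω-trichotomy : ∀ {m n} → m ∈ ω → n ∈ ω → Comparable m n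
 ω-trichotomy = trichotomy (λ n p m q → ω-transitive p q) (λ n p → nat-transitive p) _ _

 ω⊆infinite : ∀ {κ} → IsOrdinal κ → (∀ n → n ∈ ω → ¬ n ≡ κ) → ω ⊆ κ
 ω⊆infinite {κ} (t , h) k n p with trichotomy {succ κ ∪ ω}
     (λ x q y r → ∈∪ ([ (λ s → inj₁ (∈succ ([ (λ s′ → inj₁ (t x s′ y r)) , (λ { refl → inj₁ r }) ]′ (∈succ⁻ s))))
       , (λ s → inj₂ (ω-transitive s r)) ]′ (∈∪⁻ q)))
     (λ x q → [ (λ s → [ h x , (λ { refl → t }) ]′ (∈succ⁻ s)) , nat-transitive ]′ (∈∪⁻ q))
     n κ (∈∪ (inj₂ p)) (∈∪ (inj₁ (∈succ (inj₂ refl))))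
 ... | inj₁ q        = q
 ... | inj₂ (inj₁ e) = ⊥-elim (k n p e)
 ... | inj₂ (inj₂ q) = ⊥-elim (k κ (ω-transitive p q) refl)

 0∈succ : ∀ {n} → n ∈ ω → ∅ ∈ succ n
 0∈succ {n} = ω-ind (∅ᵗ ∈ᶠ succᵗ v0) [] (∈succ (inj₂ refl)) (λ n p h → ∈succ (inj₁ h)) n

 succ-injective : ∀ {m n} → succ m ≡ succ n → m ≡ n
 succ-injective {m} {n} e with ∈succ⁻ {n} {m} (subst (m ∈_) e (∈succ (inj₂ refl)))
   | ∈succ⁻ {m} {n} (subst (n ∈_) (sym e) (∈succ (inj₂ refl)))
 ... | inj₂ e | _ = e
 ... | inj₁ _ | inj₂ e = sym e
 ... | inj₁ p | inj₁ q = ⊥-elim (∈-asym p q)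

 succ≢∅ : ∀ {n} → ¬ succ n ≡ ∅
 succ≢∅ {n} e = ∉∅ (subst (n ∈_) e (∈succ (inj₂ refl)))

 Iterate : (𝕍 → 𝕍 → 𝕍 → Set ℓ) → 𝕍 → 𝕍 → 𝕍 → Set ℓ
 Iterate Step a n b = ∃[ s ] IsFunctionOn s (succ n) × s [ ∅ ]= a × s [ n ]= b ×
   (∀ i x y → i ∈ n → s [ i ]= x → s [ succ i ]= y → Step i x y)

 module _ {Step : 𝕍 → 𝕍 → 𝕍 → Set ℓ} {a : 𝕍} where
   iterate-0 : Iterate Step a ∅ a
   iterate-0 = s , isFunctionOn-intro
     (λ p q → ∅ , a , ∈⁅a⁆ q , ∈succ (inj₂ refl))
     (λ x p → [ (λ q → ⊥-elim (∉∅ q)) , (λ { refl → a , ∈⁅⁆₁ }) ]′ (∈succ⁻ p))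
     (λ x y z p q → trans (proj₂ (⟨⟩-injective (∈⁅a⁆ p))) (sym (proj₂ (⟨⟩-injective (∈⁅a⁆ q)))))
     , ∈⁅⁆₁ , ∈⁅⁆₁ , λ i x y p → ⊥-elim (∉∅ p)
     where
     s : 𝕍
     s = ⁅ ⟨ ∅ , a ⟩ , ⟨ ∅ , a ⟩ ⁆

   iterate-0⁻ : ∀ {b} → Iterate Step a ∅ b → b ≡ a
   iterate-0⁻ (s , F , p , q , _) = functional F q p

   iterate-s : ∀ {n x y} → Iterate Step a n x → Step n x y → Iterate Step a (succ n) y
   iterate-s {n} {x} {y} (s , F , p , q , h) r = s′ , isFunctionOn-intro
     (λ z m → [ (λ m′ → let (u , v , e , d) = proj₁ F z m′ in u , v , e , ∈succ (inj₁ d))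
              , (λ m′ → succ n , y , ∈⁅a⁆ m′ , ∈succ (inj₂ refl)) ]′ (∈∪⁻ m))
     (λ u m → [ (λ m′ → let (v , k) = value F m′ in v , ∈∪ (inj₁ k)) , (λ { refl → y , new }) ]′ (∈succ⁻ m))
     (λ u v w k l → unique (cases k) (cases l))
     , ∈∪ (inj₁ p) , new , step
     where
     s′ : 𝕍
     s′ = s ∪ ⁅ ⟨ succ n , y ⟩ , ⟨ succ n , y ⟩ ⁆
     new : s′ [ succ n ]= y
     new = ∈∪ (inj₂ ∈⁅⁆₁)
     cases : ∀ {u v} → s′ [ u ]= v → s [ u ]= v ⊎ (u ≡ succ n × v ≡ y)
     cases m = [ inj₁ , (λ m′ → inj₂ (⟨⟩-injective (∈⁅a⁆ m′))) ]′ (∈∪⁻ m)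
     unique : ∀ {u v w} → s [ u ]= v ⊎ (u ≡ succ n × v ≡ y) → s [ u ]= w ⊎ (u ≡ succ n × w ≡ y) → v ≡ w
     unique (inj₁ k) (inj₁ l) = functional F k l
     unique (inj₁ k) (inj₂ (refl , _)) = ⊥-elim (∈-irrefl (dom F k))
     unique (inj₂ (refl , _)) (inj₁ l) = ⊥-elim (∈-irrefl (dom F l))
     unique (inj₂ (_ , refl)) (inj₂ (_ , refl)) = refl
     step : ∀ i u v → i ∈ succ n → s′ [ i ]= u → s′ [ succ i ]= v → Step i u v
     step i u v m k l with ∈succ⁻ m | cases k | cases l
     ... | inj₁ i∈n | inj₁ k′ | inj₁ l′ = h i u v i∈n k′ l′
     ... | inj₁ i∈n | inj₁ k′ | inj₂ (e , _) with succ-injective e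
     ...   | refl = ⊥-elim (∈-irrefl i∈n)
     step i u v m k l | inj₁ i∈n | inj₂ (refl , _) | _ = ⊥-elim (∈-asym i∈n (∈succ (inj₂ refl)))
     step i u v m k l | inj₂ refl | inj₂ (e , _) | _ = ⊥-elim (∈-irrefl (subst (n ∈_) (sym e) (∈succ (inj₂ refl))))
     step i u v m k l | inj₂ refl | inj₁ k′ | inj₁ l′ = ⊥-elim (∈-irrefl (dom F l′))
     step i u v m k l | inj₂ refl | inj₁ k′ | inj₂ (_ , refl) with functional F k′ q
     ...   | refl = r

   iterate-s⁻ : ∀ {n y} → n ∈ ω → Iterate Step a (succ n) y → ∃[ x ] Iterate Step a n x × Step n x y
   iterate-s⁻ {n} {y} nω (s , F , p , q , h) =
     let (x , k) = value F n∈ in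
     x , (s′ , isFunctionOn-intro
       (λ z m → proj₂ (∈sep⁻ φ (n ∷ []) m))
       (λ u m → let (v , l) = value F (∈succ (inj₁ m)) in v , restrict l m)
       (λ u v w k l → functional F (proj₁ (∈sep⁻ φ (n ∷ []) k)) (proj₁ (∈sep⁻ φ (n ∷ []) l)))
     , restrict p (0∈succ nω) , restrict k (∈succ (inj₂ refl))
     , λ i u v m k l → h i u v (∈succ (inj₁ m)) (proj₁ (∈sep⁻ φ (n ∷ []) k)) (proj₁ (∈sep⁻ φ (n ∷ []) l)))
     , h n x y (∈succ (inj₂ refl)) k q
     where
     n∈ : n ∈ succ (succ n)
     n∈ = ∈succ (inj₁ (∈succ (inj₂ refl)))
     φ : Fm 2
     φ = ∃ᶠ ∃ᶠ v2 ≈ᶠ ⟨ v1 , v0 ⟩ᵗ ∧ᶠ v1 ∈ᶠ succᵗ v3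
     s′ : 𝕍
     s′ = sep φ (n ∷ []) s
     restrict : ∀ {u v} → s [ u ]= v → u ∈ succ n → s′ [ u ]= v
     restrict k m = ∈sep φ (n ∷ []) k (_ , _ , refl , m)

 Add Mul : 𝕍 → 𝕍 → 𝕍 → Set ℓ
 Add m n k = ⟦ add v0 v1 v2 ⟧ (m ∷ n ∷ k ∷ [])
 Mul m n k = ⟦ mul v0 v1 v2 ⟧ (m ∷ n ∷ k ∷ [])

 -- As k = { x ∈ ω : x ∈ k }, a value k in ω is picked out by separation.
 plusᶠ timesᶠ : Fm 3
 plusᶠ  = ∃ᶠ add v2 v3 v0 ∧ᶠ v1 ∈ᶠ v0
 timesᶠ = ∃ᶠ mul v2 v3 v0 ∧ᶠ v1 ∈ᶠ v0

 plusᵗ timesᵗ : ∀ {n} → Tm n → Tm n → Tm n → Tm n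
 plusᵗ w s t  = compr plusᶠ (s ∷ t ∷ []) w
 timesᵗ w s t = compr timesᶠ (s ∷ t ∷ []) w

 infixl 20 _+_
 infixl 21 _*_
 _+_ _*_ : 𝕍 → 𝕍 → 𝕍
 m + n = sep plusᶠ (m ∷ n ∷ []) ω
 m * n = sep timesᶠ (m ∷ n ∷ []) ω

 private
   picks : ∀ {k m n} (φ : Fm 3) → k ∈ ω → ⟦ φ ⟧ (k ∷ m ∷ n ∷ []) → (∀ j → ⟦ φ ⟧ (j ∷ m ∷ n ∷ []) → j ≡ k) →
           {χ : Fm 3} → (∀ x → ⟦ χ ⟧ (x ∷ m ∷ n ∷ []) ⇔ (∃[ j ] ⟦ φ ⟧ (j ∷ m ∷ n ∷ []) × x ∈ j)) →
           sep χ (m ∷ n ∷ []) ω ≡ k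
   picks {k} {m} {n} φ kω h u {χ} e = ext
     (λ x p → let (j , q , r) = to (e x) (proj₂ (∈sep⁻ χ (m ∷ n ∷ []) p)) in subst (x ∈_) (u j q) r)
     (λ x p → ∈sep χ (m ∷ n ∷ []) (ω-transitive kω p) (from (e x) (k , h , p)))

 add-total : ∀ {m n} → m ∈ ω → n ∈ ω → ∃[ k ] k ∈ ω × Add m n k
 add-total {m} {n} mω = ω-ind (∃ᶠ v0 ∈ᶠ v3 ∧ᶠ add v2 v1 v0) (m ∷ ω ∷ [])
   (m , mω , iterate-0) (λ n _ (k , p , q) → succ k , s∈ω p , iterate-s q refl) n

 add-unique : ∀ {m n k k′} → n ∈ ω → Add m n k → Add m n k′ → k ≡ k′
 add-unique {m} {n} {k} {k′} nω = ω-ind (∀ᶠ ∀ᶠ add v3 v2 v1 ⇒ᶠ add v3 v2 v0 ⇒ᶠ v1 ≈ᶠ v0) (m ∷ [])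
   (λ k k′ p q → trans (iterate-0⁻ p) (sym (iterate-0⁻ q)))
   (λ n nω h k k′ p q → let (x , p′ , e) = iterate-s⁻ nω p ; (x′ , q′ , e′) = iterate-s⁻ nω q in
     trans e (trans (cong succ (h x x′ p′ q′)) (sym e′))) n nω k k′

 Add⇒+ : ∀ {m n k} → m ∈ ω → n ∈ ω → Add m n k → m + n ≡ k
 Add⇒+ {m} {n} {k} mω nω p = picks (add v1 v2 v0)
   (let (k′ , q , r) = add-total mω nω in subst (_∈ ω) (add-unique nω r p) q)
   p (λ j q → add-unique nω q p) (λ x → mk⇔ id id)

 +⇒Add : ∀ {m n} → m ∈ ω → n ∈ ω → Add m n (m + n)
 +⇒Add mω nω = let (k , _ , q) = add-total mω nω in subst (Add _ _) (sym (Add⇒+ mω nω q)) q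

 opaque
   +∈ω : ∀ {m n} → m ∈ ω → n ∈ ω → m + n ∈ ω
   +∈ω mω nω = let (k , p , q) = add-total mω nω in subst (_∈ ω) (sym (Add⇒+ mω nω q)) p

 +-0 : ∀ {m} → m ∈ ω → m + ∅ ≡ m
 +-0 mω = Add⇒+ mω 0∈ω iterate-0

 +-s : ∀ {m n} → m ∈ ω → n ∈ ω → m + succ n ≡ succ (m + n)
 +-s mω nω = Add⇒+ mω (s∈ω nω) (iterate-s (+⇒Add mω nω) refl)

 mul-total : ∀ {m n} → m ∈ ω → n ∈ ω → ∃[ k ] k ∈ ω × Mul m n k
 mul-total {m} {n} mω = ω-ind (∃ᶠ v0 ∈ᶠ v3 ∧ᶠ mul v2 v1 v0) (m ∷ ω ∷ [])
   (∅ , 0∈ω , iterate-0) (λ n _ (k , p , q) → k + m , +∈ω p mω , iterate-s q (+⇒Add p mω)) n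

 mul-∈ω-unique : ∀ {m n k k′} → m ∈ ω → n ∈ ω → Mul m n k → Mul m n k′ → k ≡ k′
 mul-∈ω-unique {m} {n} {k} {k′} mω nω = ω-ind (∀ᶠ ∀ᶠ mul v3 v2 v1 ⇒ᶠ mul v3 v2 v0 ⇒ᶠ v1 ≈ᶠ v0) (m ∷ [])
   (λ k k′ p q → trans (iterate-0⁻ p) (sym (iterate-0⁻ q)))
   (λ n nω h k k′ p q → let (x , p′ , a) = iterate-s⁻ nω p ; (x′ , q′ , a′) = iterate-s⁻ nω q in
     add-unique mω a (subst (λ z → Add z m k′) (h x′ x q′ p′) a′)) n nω k k′

 Mul⇒* : ∀ {m n k} → m ∈ ω → n ∈ ω → Mul m n k → m * n ≡ k
 Mul⇒* {m} {n} {k} mω nω p = picks (mul v1 v2 v0)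
   (let (k′ , q , r) = mul-total mω nω in subst (_∈ ω) (mul-∈ω-unique mω nω r p) q)
   p (λ j q → mul-∈ω-unique mω nω q p) (λ x → mk⇔ id id)

 *⇒Mul : ∀ {m n} → m ∈ ω → n ∈ ω → Mul m n (m * n)
 *⇒Mul mω nω = let (k , _ , q) = mul-total mω nω in subst (Mul _ _) (sym (Mul⇒* mω nω q)) q

 opaque
   *∈ω : ∀ {m n} → m ∈ ω → n ∈ ω → m * n ∈ ω
   *∈ω mω nω = let (k , p , q) = mul-total mω nω in subst (_∈ ω) (sym (Mul⇒* mω nω q)) p

 *-0 : ∀ {m} → m ∈ ω → m * ∅ ≡ ∅
 *-0 mω = Mul⇒* mω 0∈ω iterate-0

 *-s : ∀ {m n} → m ∈ ω → n ∈ ω → m * succ n ≡ m * n + m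
 *-s mω nω = Mul⇒* mω (s∈ω nω) (iterate-s (*⇒Mul mω nω) (+⇒Add (*∈ω mω nω) mω))

 open ≡-Reasoning

 0+ : ∀ {n} → n ∈ ω → ∅ + n ≡ n
 0+ {n} = ω-ind (plusᵗ v1 ∅ᵗ v0 ≈ᶠ v0) (ω ∷ []) (+-0 0∈ω) (λ n p h → trans (+-s 0∈ω p) (cong succ h)) n

 s+ : ∀ {m n} → m ∈ ω → n ∈ ω → succ m + n ≡ succ (m + n)
 s+ {m} {n} mω = ω-ind (plusᵗ v2 (succᵗ v1) v0 ≈ᶠ succᵗ (plusᵗ v2 v1 v0)) (m ∷ ω ∷ [])
   (trans (+-0 (s∈ω mω)) (cong succ (sym (+-0 mω))))
   (λ n p h → trans (+-s (s∈ω mω) p) (cong succ (trans h (sym (+-s mω p))))) n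

 +-comm : ∀ {m n} → m ∈ ω → n ∈ ω → m + n ≡ n + m
 +-comm {m} {n} mω = ω-ind (plusᵗ v2 v1 v0 ≈ᶠ plusᵗ v2 v0 v1) (m ∷ ω ∷ [])
   (trans (+-0 mω) (sym (0+ mω))) (λ n p h → trans (+-s mω p) (trans (cong succ h) (sym (s+ p mω)))) n

 +-assoc : ∀ {m n k} → m ∈ ω → n ∈ ω → k ∈ ω → (m + n) + k ≡ m + (n + k)
 +-assoc {m} {n} {k} mω nω = ω-ind (plusᵗ v3 (plusᵗ v3 v1 v2) v0 ≈ᶠ plusᵗ v3 v1 (plusᵗ v3 v2 v0)) (m ∷ n ∷ ω ∷ [])
   (trans (+-0 (+∈ω mω nω)) (cong (m +_) (sym (+-0 nω))))
   (λ k p h → trans (+-s (+∈ω mω nω) p) (trans (cong succ h)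
     (trans (sym (+-s mω (+∈ω nω p))) (cong (m +_) (sym (+-s nω p)))))) k

 +-interchange : ∀ {a b c d} → a ∈ ω → b ∈ ω → c ∈ ω → d ∈ ω → (a + b) + (c + d) ≡ (a + c) + (b + d)
 +-interchange {a} {b} {c} {d} p q r s = begin
   (a + b) + (c + d) ≡⟨ +-assoc p q (+∈ω r s) ⟩
   a + (b + (c + d)) ≡⟨ cong (a +_) (sym (+-assoc q r s)) ⟩
   a + ((b + c) + d) ≡⟨ cong (λ x → a + (x + d)) (+-comm q r) ⟩
   a + ((c + b) + d) ≡⟨ cong (a +_) (+-assoc r q s) ⟩
   a + (c + (b + d)) ≡⟨ sym (+-assoc p r (+∈ω q s)) ⟩
   (a + c) + (b + d) ∎

 0* : ∀ {n} → n ∈ ω → ∅ * n ≡ ∅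
 0* {n} = ω-ind (timesᵗ v1 ∅ᵗ v0 ≈ᶠ ∅ᵗ) (ω ∷ []) (*-0 0∈ω)
   (λ n p h → trans (*-s 0∈ω p) (trans (cong (_+ ∅) h) (+-0 0∈ω))) n

 s* : ∀ {m n} → m ∈ ω → n ∈ ω → succ m * n ≡ m * n + n
 s* {m} {n} mω = ω-ind (timesᵗ v2 (succᵗ v1) v0 ≈ᶠ plusᵗ v2 (timesᵗ v2 v1 v0) v0) (m ∷ ω ∷ [])
   (trans (*-0 (s∈ω mω)) (sym (trans (+-0 (*∈ω mω 0∈ω)) (*-0 mω))))
   (λ n p h → begin
     succ m * succ n ≡⟨ *-s (s∈ω mω) p ⟩
     succ m * n + succ m ≡⟨ cong (_+ succ m) h ⟩
     (m * n + n) + succ m ≡⟨ +-s (+∈ω (*∈ω mω p) p) mω ⟩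
     succ ((m * n + n) + m) ≡⟨ cong succ (trans (+-assoc (*∈ω mω p) p mω) (trans (cong (m * n +_) (+-comm p mω)) (sym (+-assoc (*∈ω mω p) mω p)))) ⟩
     succ ((m * n + m) + n) ≡⟨ sym (+-s (+∈ω (*∈ω mω p) mω) p) ⟩
     (m * n + m) + succ n ≡⟨ cong (_+ succ n) (sym (*-s mω p)) ⟩
     m * succ n + succ n ∎) n

 *-comm : ∀ {m n} → m ∈ ω → n ∈ ω → m * n ≡ n * m
 *-comm {m} {n} mω = ω-ind (timesᵗ v2 v1 v0 ≈ᶠ timesᵗ v2 v0 v1) (m ∷ ω ∷ [])
   (trans (*-0 mω) (sym (0* mω)))
   (λ n p h → trans (*-s mω p) (trans (cong (_+ m) h) (sym (s* p mω)))) n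

 *-distribʳ-+ : ∀ {m n k} → m ∈ ω → n ∈ ω → k ∈ ω → (n + k) * m ≡ n * m + k * m
 *-distribʳ-+ {m} {n} {k} mω nω kω = ω-ind
   (timesᵗ v3 (plusᵗ v3 v1 v2) v0 ≈ᶠ plusᵗ v3 (timesᵗ v3 v1 v0) (timesᵗ v3 v2 v0)) (n ∷ k ∷ ω ∷ [])
   (trans (*-0 (+∈ω nω kω)) (sym (trans (cong (_+ (k * ∅)) (*-0 nω)) (trans (0+ (*∈ω kω 0∈ω)) (*-0 kω)))))
   (λ m p h → begin
     (n + k) * succ m ≡⟨ *-s (+∈ω nω kω) p ⟩
     (n + k) * m + (n + k) ≡⟨ cong (_+ (n + k)) h ⟩
     (n * m + k * m) + (n + k) ≡⟨ +-interchange (*∈ω nω p) (*∈ω kω p) nω kω ⟩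
     (n * m + n) + (k * m + k) ≡⟨ cong₂ _+_ (sym (*-s nω p)) (sym (*-s kω p)) ⟩
     n * succ m + k * succ m ∎) m mω

 *-assoc : ∀ {m n k} → m ∈ ω → n ∈ ω → k ∈ ω → (m * n) * k ≡ m * (n * k)
 *-assoc {m} {n} {k} mω nω = ω-ind (timesᵗ v3 (timesᵗ v3 v1 v2) v0 ≈ᶠ timesᵗ v3 v1 (timesᵗ v3 v2 v0)) (m ∷ n ∷ ω ∷ [])
   (trans (*-0 (*∈ω mω nω)) (sym (trans (cong (m *_) (*-0 nω)) (*-0 mω))))
   (λ k p h → begin
     (m * n) * succ k ≡⟨ *-s (*∈ω mω nω) p ⟩
     (m * n) * k + m * n ≡⟨ cong₂ _+_ (trans h (*-comm mω (*∈ω nω p))) (*-comm mω nω) ⟩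
     (n * k) * m + n * m ≡⟨ sym (*-distribʳ-+ mω (*∈ω nω p) nω) ⟩
     (n * k + n) * m ≡⟨ *-comm (+∈ω (*∈ω nω p) nω) mω ⟩
     m * (n * k + n) ≡⟨ cong (m *_) (sym (*-s nω p)) ⟩
     m * (n * succ k) ∎) k

 1* : ∀ {n} → n ∈ ω → succ ∅ * n ≡ n
 1* {n} p = trans (s* 0∈ω p) (trans (cong (_+ n) (0* p)) (0+ p))

 Nat : Set ℓ
 Nat = Σ 𝕍 (_∈ ω)

 infixl 20 _⊞_
 infixl 21 _⊠_
 _⊞_ _⊠_ : Nat → Nat → Nat
 (m , p) ⊞ (n , q) = m + n , +∈ω p q
 (m , p) ⊠ (n , q) = m * n , *∈ω p q

 0ₙ 1ₙ : Nat
 0ₙ = ∅ , 0∈ω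
 1ₙ = succ ∅ , s∈ω 0∈ω

 natSemiring : CommutativeSemiring ℓ ℓ
 natSemiring = record
   { Carrier = Nat ; _≈_ = λ x y → proj₁ x ≡ proj₁ y ; _+_ = _⊞_ ; _*_ = _⊠_ ; 0# = 0ₙ ; 1# = 1ₙ
   ; isCommutativeSemiring = isCommutativeSemiringˡ record
     { +-isCommutativeMonoid = record
       { isMonoid = record
         { isSemigroup = record
           { isMagma = record { isEquivalence = equiv ; ∙-cong = λ {(x , _)} {(y , _)} {(u , _)} {(v , _)} → cong₂ _+_ }
           ; assoc = λ (x , p) (y , q) (z , r) → +-assoc p q r }
         ; identity = (λ (x , p) → 0+ p) , (λ (x , p) → +-0 p) }
       ; comm = λ (x , p) (y , q) → +-comm p q }
     ; *-isCommutativeMonoid = record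
       { isMonoid = record
         { isSemigroup = record
           { isMagma = record { isEquivalence = equiv ; ∙-cong = λ {(x , _)} {(y , _)} {(u , _)} {(v , _)} → cong₂ _*_ }
           ; assoc = λ (x , p) (y , q) (z , r) → *-assoc p q r }
         ; identity = (λ (x , p) → 1* p) , (λ (x , p) → trans (*-comm p (s∈ω 0∈ω)) (1* p)) }
       ; comm = λ (x , p) (y , q) → *-comm p q }
     ; distribʳ = λ (x , p) (y , q) (z , r) → *-distribʳ-+ p q r
     ; zeroˡ = λ (x , p) → 0* p }
   }
   where
   open import Relation.Binary.Structures using (IsEquivalence)
   equiv : IsEquivalence {A = Nat} (λ x y → proj₁ x ≡ proj₁ y)
   equiv = record { refl = refl ; sym = sym ; trans = trans }

 <⇒∃ : ∀ {m n} → m ∈ ω → n ∈ ω → m ∈ n → ∃[ k ] k ∈ ω × n ≡ m + succ k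
 <⇒∃ {m} {n} mω nω = ω-ind (v1 ∈ᶠ v0 ⇒ᶠ (∃ᶠ v0 ∈ᶠ v3 ∧ᶠ v1 ≈ᶠ plusᵗ v3 v2 (succᵗ v0))) (m ∷ ω ∷ [])
   (λ p → ⊥-elim (∉∅ p))
   (λ n nω h p → [ (λ q → let (k , r , e) = h q in succ k , s∈ω r , trans (cong succ e) (sym (+-s mω (s∈ω r))))
                 , (λ { refl → ∅ , 0∈ω , trans (cong succ (sym (+-0 mω))) (sym (+-s mω 0∈ω)) }) ]′ (∈succ⁻ p)) n nω

 m<m+s : ∀ {m k} → m ∈ ω → k ∈ ω → m ∈ m + succ k
 m<m+s {m} {k} mω = ω-ind (v1 ∈ᶠ plusᵗ v2 v1 (succᵗ v0)) (m ∷ ω ∷ [])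
   (subst (m ∈_) (sym (trans (+-s mω 0∈ω) (cong succ (+-0 mω)))) (∈succ (inj₂ refl)))
   (λ k p h → subst (m ∈_) (sym (+-s mω (s∈ω p))) (∈succ (inj₁ h))) k

 private
   1+≡succ : ∀ {n} → n ∈ ω → succ ∅ + n ≡ succ n
   1+≡succ p = trans (s+ 0∈ω p) (cong succ (0+ p))

 open OrderedSemiring natSemiring public using (_<_; _≤_)

 ∈⇒< : ∀ {x y : Nat} → proj₁ x ∈ proj₁ y → x < y
 ∈⇒< {x , p} {y , q} h = let (k , r , e) = <⇒∃ p q h in (k , r) , trans e (cong (x +_) (sym (1+≡succ r)))

 <⇒∈ : ∀ {x y : Nat} → x < y → proj₁ x ∈ proj₁ y
 <⇒∈ {x , p} {y , q} ((k , r) , e) = subst (x ∈_) (sym (trans e (cong (x +_) (1+≡succ r)))) (m<m+s p r)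

 ∈≡⇒≤ : ∀ {x y : Nat} → proj₁ x ∈ proj₁ y ⊎ proj₁ x ≡ proj₁ y → x ≤ y
 ∈≡⇒≤ {x} {y} (inj₁ h) = let ((k , p) , e) = ∈⇒< {x} {y} h in (succ ∅ + k , +∈ω (s∈ω 0∈ω) p) , e
 ∈≡⇒≤ {x , p} (inj₂ refl) = 0ₙ , sym (+-0 p)

 ≤⇒∈≡ : ∀ {x y : Nat} → x ≤ y → proj₁ x ∈ proj₁ y ⊎ proj₁ x ≡ proj₁ y
 ≤⇒∈≡ {x , p} {y , q} ((k , r) , e) with ω-cases r
 ... | inj₁ refl = inj₂ (sym (trans e (+-0 p)))
 ... | inj₂ (j , s , refl) = inj₁ (subst (x ∈_) (sym e) (m<m+s p s))

 private
   compare : ∀ x y → x < y ⊎ proj₁ x ≡ proj₁ y ⊎ y < x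
   compare x@(_ , p) y@(_ , q) = Sum.map (∈⇒< {x} {y}) (Sum.map₂ (∈⇒< {y} {x})) (ω-trichotomy p q)

   irreflexive : ∀ x y → x < y → ¬ proj₁ x ≡ proj₁ y
   irreflexive x y h e = ∈-irrefl (subst (proj₁ x ∈_) (sym e) (<⇒∈ {x} {y} h))

 open OrderedSemiring.Linear natSemiring compare irreflexive public
   hiding (≈⇒≤; <⇒≤; ≤-or->; ≤⇒≯; *-mono-<; *-mono-≤; *-cancel-≤; *-cancel-<)
 open Fraction public

 ⌜_⌝ : Fraction → 𝕍
 ⌜ x ⌝ = ⟨ proj₁ (num x) , proj₁ (den x) ⟩

 IsFrac : 𝕍 → Set ℓ
 IsFrac x = ⟦ isFrac v0 ⟧ (x ∷ [])

 infix 4 _<Q_ _≤Q_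
 opaque
   _<Q_ _≤Q_ : 𝕍 → 𝕍 → Set ℓ
   x <Q y = ⟦ v0 <ᶠ v1 ⟧ (x ∷ y ∷ [])
   x ≤Q y = ⟦ v0 ≤ᶠ v1 ⟧ (x ∷ y ∷ [])

   AddFrac : 𝕍 → 𝕍 → 𝕍 → Set ℓ
   AddFrac x y z = ⟦ addFrac v0 v1 v2 ⟧ (x ∷ y ∷ z ∷ [])

 positive : ∀ {q} (p : q ∈ ω) → ¬ q ≡ ∅ → Positive (q , p)
 positive p h with ω-cases p
 ... | inj₁ e = ⊥-elim (h e)
 ... | inj₂ (m , r , refl) = (m , r) , sym (1+≡succ r)

 positive⁻ : ∀ {q} → Positive q → ¬ proj₁ q ≡ ∅
 positive⁻ ((j , r) , e) h = succ≢∅ (trans (sym (1+≡succ r)) (trans (sym e) h))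

 ⌜⌝-frac : ∀ x → IsFrac ⌜ x ⌝
 ⌜⌝-frac ((p , pω) / q′@(q , qω) ⟨ q>0 ⟩) = p , q , refl , ∈ω⁻ pω , ∈ω⁻ qω , positive⁻ {q′} q>0

 frac⁻ : ∀ {x} → IsFrac x → ∃[ f ] x ≡ ⌜ f ⌝
 frac⁻ (p , q , refl , pω , qω , h) = (p , ∈ω pω) / (q , ∈ω qω) ⟨ positive (∈ω qω) h ⟩ , refl

 product-value : ∀ {a b p q u} → a ∈ ω → b ∈ ω → a ≡ p → b ≡ q → Mul p q u → u ≡ a * b
 product-value aω bω refl refl m = sym (Mul⇒* aω bω m)

 Frac : 𝕍 → 𝕍 → 𝕍 → Set ℓ
 Frac x p q = ⟦ frac v0 v1 v2 ⟧ (x ∷ p ∷ q ∷ [])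

 frac-parts : ∀ x {p q} → Frac ⌜ x ⌝ p q → proj₁ (num x) ≡ p × proj₁ (den x) ≡ q
 frac-parts x (e , _) = ⟨⟩-injective e

 frac-self : ∀ x → Frac ⌜ x ⌝ (proj₁ (num x)) (proj₁ (den x))
 frac-self ((p , pω) / q′@(q , qω) ⟨ q>0 ⟩) = refl , ∈ω⁻ pω , ∈ω⁻ qω , positive⁻ {q′} q>0

 Cross : 𝕍 → 𝕍 → 𝕍 → 𝕍 → Set ℓ
 Cross x y u v = ∃[ p ] ∃[ q ] ∃[ p′ ] ∃[ q′ ] Frac x p q × Frac y p′ q′ × Mul p q′ u × Mul p′ q v

 cross⁻ : ∀ {x y u v} → Cross ⌜ x ⌝ ⌜ y ⌝ u v →
   u ≡ proj₁ (num x) * proj₁ (den y) × v ≡ proj₁ (num y) * proj₁ (den x)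
 cross⁻ {x} {y} (p , q , p′ , q′ , F , G , m , m′) =
   let (e , e′) = frac-parts x F ; (d , d′) = frac-parts y G in
   product-value (proj₂ (num x)) (proj₂ (den y)) e d′ m , product-value (proj₂ (num y)) (proj₂ (den x)) d e′ m′

 cross : ∀ x y → Cross ⌜ x ⌝ ⌜ y ⌝ (proj₁ (num x) * proj₁ (den y)) (proj₁ (num y) * proj₁ (den x))
 cross x y = _ , _ , _ , _ , frac-self x , frac-self y ,
   *⇒Mul (proj₂ (num x)) (proj₂ (den y)) , *⇒Mul (proj₂ (num y)) (proj₂ (den x))

 opaque
   unfolding _<Q_ lessᶠ addFracᶠ

   <Q⇔ : ∀ x y → x <Q y ⇔ (∃[ u ] ∃[ v ] Cross x y u v × u ∈ v)
   <Q⇔ x y = mk⇔ (λ (p , q , p′ , q′ , u , v , F , G , m , m′ , r) → u , v , (p , q , p′ , q′ , F , G , m , m′) , r)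
     (λ (u , v , (p , q , p′ , q′ , F , G , m , m′) , r) → p , q , p′ , q′ , u , v , F , G , m , m′ , r)

   ≤Q⇔ : ∀ x y → x ≤Q y ⇔ (∃[ u ] ∃[ v ] Cross x y u v × (u ∈ v ⊎ u ≡ v))
   ≤Q⇔ x y = mk⇔ (λ (p , q , p′ , q′ , u , v , F , G , m , m′ , r) → u , v , (p , q , p′ , q′ , F , G , m , m′) , r)
     (λ (u , v , (p , q , p′ , q′ , F , G , m , m′) , r) → p , q , p′ , q′ , u , v , F , G , m , m′ , r)

   AddFrac⇔ : ∀ x y z → AddFrac x y z ⇔ (∃[ p ] ∃[ q ] ∃[ p′ ] ∃[ q′ ] ∃[ u ] ∃[ v ] ∃[ n ] ∃[ d ]
     Frac x p q × Frac y p′ q′ × Mul p q′ u × Mul p′ q v × Add u v n × Mul q q′ d × Frac z n d)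
   AddFrac⇔ x y z = ≡⇒⇔ refl

 opaque
   unfolding _≤q_

   <Q⇒<q : ∀ {x y} → ⌜ x ⌝ <Q ⌜ y ⌝ → x <q y
   <Q⇒<q {x} {y} h = let (u , v , c , r) = to (<Q⇔ ⌜ x ⌝ ⌜ y ⌝) h ; (e , e′) = cross⁻ {x} {y} c in
     ∈⇒< {num x ⊠ den y} {num y ⊠ den x} (subst₂ _∈_ e e′ r)

   <q⇒<Q : ∀ {x y} → x <q y → ⌜ x ⌝ <Q ⌜ y ⌝
   <q⇒<Q {x} {y} h = from (<Q⇔ ⌜ x ⌝ ⌜ y ⌝) (_ , _ , cross x y , <⇒∈ {num x ⊠ den y} {num y ⊠ den x} h)

   ≤Q⇒≤q : ∀ {x y} → ⌜ x ⌝ ≤Q ⌜ y ⌝ → x ≤q y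
   ≤Q⇒≤q {x} {y} h = let (u , v , c , r) = to (≤Q⇔ ⌜ x ⌝ ⌜ y ⌝) h ; (e , e′) = cross⁻ {x} {y} c in
     ∈≡⇒≤ {num x ⊠ den y} {num y ⊠ den x} (subst₂ (λ u v → u ∈ v ⊎ u ≡ v) e e′ r)

   ≤q⇒≤Q : ∀ {x y} → x ≤q y → ⌜ x ⌝ ≤Q ⌜ y ⌝
   ≤q⇒≤Q {x} {y} h = from (≤Q⇔ ⌜ x ⌝ ⌜ y ⌝) (_ , _ , cross x y , ≤⇒∈≡ {num x ⊠ den y} {num y ⊠ den x} h)

   ≤Q-frac : ∀ {v w} → v ≤Q w → IsFrac v
   ≤Q-frac {v} {w} h = let (_ , _ , (p , q , _ , _ , F , _) , _) = to (≤Q⇔ v w) h in p , q , F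

   AddFrac⇒⊕ : ∀ {x y z} → AddFrac ⌜ x ⌝ ⌜ y ⌝ z → z ≡ ⌜ x ⊕ y ⌝
   AddFrac⇒⊕ {x} {y} {z} h =
     let (p , q , p′ , q′ , u , v , n , d , F , G , m , m′ , a , m″ , H) = to (AddFrac⇔ ⌜ x ⌝ ⌜ y ⌝ z) h
         (e , e′) = frac-parts x F ; (f , f′) = frac-parts y G
         u≡ = product-value (proj₂ (num x)) (proj₂ (den y)) e f′ m
         v≡ = product-value (proj₂ (num y)) (proj₂ (den x)) f e′ m′
         d≡ = product-value (proj₂ (den x)) (proj₂ (den y)) e′ f′ m″
         n≡ = Add⇒+ (proj₂ (num x ⊠ den y)) (proj₂ (num y ⊠ den x)) (subst₂ (λ u v → Add u v n) u≡ v≡ a)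
     in trans (proj₁ H) (cong₂ ⟨_,_⟩ (sym n≡) d≡)

   ⊕⇒AddFrac : ∀ x y → AddFrac ⌜ x ⌝ ⌜ y ⌝ ⌜ x ⊕ y ⌝
   ⊕⇒AddFrac x y = from (AddFrac⇔ ⌜ x ⌝ ⌜ y ⌝ ⌜ x ⊕ y ⌝) (_ , _ , _ , _ , _ , _ , _ , _ , frac-self x , frac-self y ,
     *⇒Mul (proj₂ (num x)) (proj₂ (den y)) , *⇒Mul (proj₂ (num y)) (proj₂ (den x)) ,
     +⇒Add (proj₂ (num x ⊠ den y)) (proj₂ (num y ⊠ den x)) , *⇒Mul (proj₂ (den x)) (proj₂ (den y)) , frac-self (x ⊕ y))

   ⌜·⌝ : ∀ n x → ⌜ n · x ⌝ ≡ ⟨ proj₁ n * proj₁ (num x) , proj₁ (den x) ⟩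
   ⌜·⌝ n x = refl

 -- Cuts

 record IsReal (r : 𝕍) : Set ℓ where
   field
     fracs  : ∀ v → v ∈ r → IsFrac v
     closed : ∀ v w → v ∈ r → w ≤Q v → w ∈ r
     opened : ∀ v → v ∈ r → ∃[ w ] w ∈ r × v <Q w
     bound  : ∃[ v ] IsFrac v × ¬ v ∈ r
 open IsReal

 opaque
   unfolding _<Q_ isRealᶠ

   isReal⇔ : ∀ r → IsReal r ⇔ ⟦ isReal v0 ⟧ (r ∷ [])
   isReal⇔ r = mk⇔ (λ R → fracs R , closed R , opened R , bound R)
     (λ (f , c , o , b) → record { fracs = f ; closed = c ; opened = o ; bound = b })

   cutᶠ-def : ∀ x y → x <Q y ⇔ ⟦ v0 <ᶠ v1 ⟧ (x ∷ y ∷ [])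
   cutᶠ-def x y = ≡⇒⇔ refl

 opaque
   AddReal : 𝕍 → 𝕍 → 𝕍 → Set ℓ
   AddReal r s t = ⟦ addReal v0 v1 v2 ⟧ (r ∷ s ∷ t ∷ [])

 opaque
   unfolding _<Q_ AddReal addRealᶠ

   ∈addReal : ∀ {r s t} → AddReal r s t → ∀ x → x ∈ t ⇔
     (x ∈ r ⊎ x ∈ s ⊎ (∃[ y ] ∃[ z ] ∃[ w ] y ∈ r × z ∈ s × AddFrac y z w × x ≤Q w))
   ∈addReal h = h

   addReal-intro : ∀ {r s t} → (∀ x → x ∈ t ⇔
     (x ∈ r ⊎ x ∈ s ⊎ (∃[ y ] ∃[ z ] ∃[ w ] y ∈ r × z ∈ s × AddFrac y z w × x ≤Q w))) → AddReal r s t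
   addReal-intro h = h

 infix 4 _∈ᶜ_ _∉ᶜ_
 _∈ᶜ_ _∉ᶜ_ : Fraction → 𝕍 → Set ℓ
 x ∈ᶜ r = ⌜ x ⌝ ∈ r
 x ∉ᶜ r = ¬ ⌜ x ⌝ ∈ r

 module _ {r} (R : IsReal r) where
   real-frac : ∀ {v} → v ∈ r → ∃[ x ] v ≡ ⌜ x ⌝
   real-frac p = frac⁻ (fracs R _ p)

   down : ∀ {x y} → y ≤q x → x ∈ᶜ r → y ∈ᶜ r
   down {x} {y} h p = closed R ⌜ x ⌝ ⌜ y ⌝ p (≤q⇒≤Q {y} {x} h)

   up : ∀ {x y} → x ≤q y → x ∉ᶜ r → y ∉ᶜ r
   up {x} {y} h p q = p (down {y} {x} h q)

   open-cut : ∀ {x} → x ∈ᶜ r → ∃[ y ] y ∈ᶜ r × x <q y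
   open-cut {x} p = let (v , q , h) = opened R ⌜ x ⌝ p ; (y , e) = real-frac q in
     y , subst (_∈ r) e q , <Q⇒<q {x} {y} (subst (⌜ x ⌝ <Q_) e h)

   bounded : ∃[ x ] x ∉ᶜ r
   bounded = let (v , f , q) = bound R ; (x , e) = frac⁻ f in x , λ p → q (subst (_∈ r) (sym e) p)

   ∈<∉ : ∀ {x y} → x ∈ᶜ r → y ∉ᶜ r → x <q y
   ∈<∉ {x} {y} p q = [ (λ h → ⊥-elim (q (down {x} {y} h p))) , id ]′ (≤q-or-> y x)

   almost-top : ∀ {z ε} → PositiveQ ε → z ∈ᶜ r → ∃[ x ] x ∈ᶜ r × x ⊕ ε ∉ᶜ r
   almost-top {z} {ε} ε>0 z∈ = by-contradiction λ h →
     let (b , b∉) = bounded in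
     b∉ (down {num b ⊠ den ε · ε} {b} (archimedes b {ε} ε>0) (all′ (num b ⊠ den ε) (all h (proj₁ (num b ⊠ den ε)) (proj₂ (num b ⊠ den ε)))))
     where
     p q : 𝕍
     p = proj₁ (num ε)
     q = proj₁ (den ε)
     all′ : ∀ n → ⟨ proj₁ n * p , q ⟩ ∈ r → n · ε ∈ᶜ r
     all′ n = subst (_∈ r) (sym (⌜·⌝ n ε))
     all : ¬ (∃[ x ] x ∈ᶜ r × x ⊕ ε ∉ᶜ r) → ∀ n → n ∈ ω → ⟨ n * p , q ⟩ ∈ r
     all h = ω-ind (⟨ timesᵗ v1 v0 v2 , v3 ⟩ᵗ ∈ᶠ v4) (ω ∷ p ∷ q ∷ r ∷ [])
       (subst (_∈ r) (⌜·⌝ 0ₙ ε) (down {z} {0ₙ · ε} (≤q-trans {0ₙ · ε} {0q} {z} (·-0 ε) (0≤q z)) z∈))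
       (λ n nω k → by-contradiction λ k′ → h ((n , nω) · ε , all′ (n , nω) k ,
         (λ m → k′ (subst (λ s → ⟨ s * p , q ⟩ ∈ r) (1+≡succ nω)
           (subst (_∈ r) (⌜·⌝ (1ₙ ⊞ (n , nω)) ε) (down {(n , nω) · ε ⊕ ε} {(1ₙ ⊞ (n , nω)) · ε} (·-suc (n , nω) ε) m))))))

 addReal-unique : ∀ {r s t t′} → AddReal r s t → AddReal r s t′ → t ≡ t′
 addReal-unique h k = ext (λ x p → from (∈addReal k x) (to (∈addReal h x) p)) (λ x p → from (∈addReal h x) (to (∈addReal k x) p))

 fractions : 𝕍
 fractions = sep (isFrac v0) [] (ω ⊗ ω)

 ∈fractions : ∀ x → ⌜ x ⌝ ∈ fractions
 ∈fractions x@((_ , pω) / (_ , qω) ⟨ _ ⟩) = ∈sep (isFrac v0) [] (∈⊗ pω qω) (⌜⌝-frac x)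

 ∈fractions⁻ : ∀ {v} → v ∈ fractions → ∃[ x ] v ≡ ⌜ x ⌝
 ∈fractions⁻ p = frac⁻ (proj₂ (∈sep⁻ (isFrac v0) [] p))

 cut : Fraction → 𝕍
 cut x = sep (v0 <ᶠ v1) (⌜ x ⌝ ∷ []) fractions

 ∈cut : ∀ {x y} → x <q y → x ∈ᶜ cut y
 ∈cut {x} {y} h = ∈sep (v0 <ᶠ v1) (⌜ y ⌝ ∷ []) (∈fractions x) (to (cutᶠ-def _ _) (<q⇒<Q {x} {y} h))

 ∈cut⁻ : ∀ {x y} → x ∈ᶜ cut y → x <q y
 ∈cut⁻ {x} {y} p = <Q⇒<q {x} {y} (from (cutᶠ-def _ _) (proj₂ (∈sep⁻ (v0 <ᶠ v1) (⌜ y ⌝ ∷ []) p)))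

 cut-frac : ∀ {y v} → v ∈ cut y → ∃[ x ] v ≡ ⌜ x ⌝
 cut-frac {y} p = ∈fractions⁻ (proj₁ (∈sep⁻ (v0 <ᶠ v1) (⌜ y ⌝ ∷ []) p))

 between : ∀ {x y} → x <q y → ∃[ z ] x <q z × z <q y
 between {x} {y} h = let (ε , ε>0 , k) = gap {x} {y} h ; η = half ε in x ⊕ η ,
   x<x⊕ε x {η} (half-positive {ε} ε>0) ,
   <q-≤q-trans {x ⊕ η} {(x ⊕ η) ⊕ η} {y} (x<x⊕ε (x ⊕ η) {η} (half-positive {ε} ε>0))
     (≤q-trans {(x ⊕ η) ⊕ η} {x ⊕ (η ⊕ η)} {y} (⊕-assoc x η η)
     (≤q-trans {x ⊕ (η ⊕ η)} {x ⊕ ε} {y} (⊕-mono-≤ {x} {x} {η ⊕ η} {ε} (≤q-refl {x}) (half-⊕ ε)) k))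

 cut-real : ∀ y → IsReal (cut y)
 cut-real y = record { fracs = fracs′ ; closed = closed′ ; opened = opened′ ; bound = ⌜ y ⌝ , ⌜⌝-frac y , λ p → ≤q⇒≯ {y} {y} (≤q-refl {y}) (∈cut⁻ {y} {y} p) }
   where
   fracs′ : ∀ v → v ∈ cut y → IsFrac v
   fracs′ v p = let (x , e) = cut-frac {y} p in subst IsFrac (sym e) (⌜⌝-frac x)
   closed′ : ∀ v w → v ∈ cut y → w ≤Q v → w ∈ cut y
   closed′ v w p h = let (x , e) = cut-frac {y} p ; (z , e′) = frac⁻ (≤Q-frac h) in
     subst (_∈ cut y) (sym e′) (∈cut {z} {y} (≤q-<q-trans {z} {x} {y}
       (≤Q⇒≤q {z} {x} (subst₂ _≤Q_ e′ e h)) (∈cut⁻ {x} {y} (subst (_∈ cut y) e p))))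
   opened′ : ∀ v → v ∈ cut y → ∃[ w ] w ∈ cut y × v <Q w
   opened′ v p = let (x , e) = cut-frac {y} p ; (z , h , k) = between {x} {y} (∈cut⁻ {x} {y} (subst (_∈ cut y) e p)) in
     ⌜ z ⌝ , ∈cut {z} {y} k , subst (_<Q ⌜ z ⌝) (sym e) (<q⇒<Q {x} {z} h)

 sumᶠ : Fm 3
 sumᶠ = v0 ∈ᶠ v1 ∨ᶠ v0 ∈ᶠ v2 ∨ᶠ (∃ᶠ ∃ᶠ ∃ᶠ v2 ∈ᶠ v4 ∧ᶠ v1 ∈ᶠ v5 ∧ᶠ addFrac v2 v1 v0 ∧ᶠ v3 ≤ᶠ v0)

 infixl 20 _+ᴿ_
 _+ᴿ_ : 𝕍 → 𝕍 → 𝕍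
 r +ᴿ s = sep sumᶠ (r ∷ s ∷ []) fractions

 module _ {r s} (R : IsReal r) (S : IsReal s) where
   private
     Sum : 𝕍 → Set ℓ
     Sum x = x ∈ r ⊎ x ∈ s ⊎ (∃[ y ] ∃[ z ] ∃[ w ] y ∈ r × z ∈ s × AddFrac y z w × x ≤Q w)

     sum-fraction : ∀ {x} → Sum x → IsFrac x
     sum-fraction {x} h = [ fracs R x , [ fracs S x , (λ (y , z , w , _ , _ , _ , k) → ≤Q-frac k) ]′ ]′ h

     opaque
       unfolding _<Q_
       sum⇔ : ∀ x → Sum x ⇔ ⟦ sumᶠ ⟧ (x ∷ r ∷ s ∷ [])
       sum⇔ x = ≡⇒⇔ refl

   ∈+ᴿ⇔ : ∀ x → x ∈ r +ᴿ s ⇔ Sum x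
   ∈+ᴿ⇔ x = mk⇔ (λ p → from (sum⇔ x) (proj₂ (∈sep⁻ sumᶠ (r ∷ s ∷ []) p)))
     (λ h → let (f , e) = frac⁻ (sum-fraction h) in
       ∈sep sumᶠ (r ∷ s ∷ []) (subst (_∈ fractions) (sym e) (∈fractions f)) (to (sum⇔ x) h))

   +ᴿ-addReal : AddReal r s (r +ᴿ s)
   +ᴿ-addReal = addReal-intro ∈+ᴿ⇔

   ∈+ᴿˡ : r ⊆ r +ᴿ s
   ∈+ᴿˡ x p = from (∈+ᴿ⇔ x) (inj₁ p)
   ∈+ᴿʳ : s ⊆ r +ᴿ s
   ∈+ᴿʳ x p = from (∈+ᴿ⇔ x) (inj₂ (inj₁ p))
   ∈+ᴿ : ∀ {x y z} → x ∈ᶜ r → y ∈ᶜ s → z ≤q x ⊕ y → z ∈ᶜ r +ᴿ s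
   ∈+ᴿ {x} {y} {z} p q h = from (∈+ᴿ⇔ ⌜ z ⌝) (inj₂ (inj₂ (⌜ x ⌝ , ⌜ y ⌝ , ⌜ x ⊕ y ⌝ , p , q , ⊕⇒AddFrac x y , ≤q⇒≤Q {z} {x ⊕ y} h)))

   ∈+ᴿ⁻ : ∀ {v} → v ∈ r +ᴿ s → v ∈ r ⊎ v ∈ s ⊎
     (∃[ z ] ∃[ x ] ∃[ y ] v ≡ ⌜ z ⌝ × x ∈ᶜ r × y ∈ᶜ s × z ≤q x ⊕ y)
   ∈+ᴿ⁻ {v} p = Sum.map₂ (Sum.map₂ λ (x , y , w , q , q′ , a , k) →
     let (x , e) = real-frac R q ; (y , e′) = real-frac S q′ ; (z , e″) = frac⁻ (≤Q-frac k)
         e‴ = AddFrac⇒⊕ {x} {y} (subst₂ (λ x y → AddFrac x y w) e e′ a) in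
     z , x , y , e″ , subst (_∈ r) e q , subst (_∈ s) e′ q′ , ≤Q⇒≤q {z} {x ⊕ y} (subst₂ _≤Q_ e″ e‴ k))
     (to (∈+ᴿ⇔ v) p)

   ∉+ᴿ : ∀ {x y} → x ∉ᶜ r → y ∉ᶜ s → x ⊕ y ∉ᶜ r +ᴿ s
   ∉+ᴿ {x} {y} p q h = [ (λ h → p (down R {x ⊕ y} {x} (x≤x⊕y x y) h)) , [ (λ h → q (down S {x ⊕ y} {y} (y≤x⊕y x y) h)) ,
     (λ (z , x′ , y′ , e , p′ , q′ , k) → ≤q⇒≯ {x ⊕ y} {x′ ⊕ y′}
       (≤Q⇒≤q {x ⊕ y} {x′ ⊕ y′} (subst (_≤Q ⌜ x′ ⊕ y′ ⌝) (sym e) (≤q⇒≤Q {z} {x′ ⊕ y′} k)))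
       (⊕-mono-<-≤ {x′} {x} {y′} {y} (∈<∉ R {x′} {x} p′ p) (<q⇒≤q {y′} {y} (∈<∉ S {y′} {y} q′ q)))) ]′ ]′ (∈+ᴿ⁻ h)

   +ᴿ-real : IsReal (r +ᴿ s)
   +ᴿ-real = record { fracs = λ v p → sum-fraction (to (∈+ᴿ⇔ v) p) ; closed = closed′ ; opened = opened′
     ; bound = (let (x , p) = bounded R ; (y , q) = bounded S in ⌜ x ⊕ y ⌝ , ⌜⌝-frac (x ⊕ y) , ∉+ᴿ {x} {y} p q) }
     where
     closed′ : ∀ v w → v ∈ r +ᴿ s → w ≤Q v → w ∈ r +ᴿ s
     closed′ v w p h = [ (λ q → ∈+ᴿˡ w (closed R v w q h)) , [ (λ q → ∈+ᴿʳ w (closed S v w q h)) ,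
       (λ (z , x , y , e , q , q′ , k) → let (f , e′) = frac⁻ (≤Q-frac h) in
         subst (_∈ r +ᴿ s) (sym e′) (∈+ᴿ {x} {y} {f} q q′
           (≤q-trans {f} {z} {x ⊕ y} (≤Q⇒≤q {f} {z} (subst₂ _≤Q_ e′ e h)) k))) ]′ ]′ (∈+ᴿ⁻ p)
     opened′ : ∀ v → v ∈ r +ᴿ s → ∃[ w ] w ∈ r +ᴿ s × v <Q w
     opened′ v p = [ (λ q → let (w , q′ , h) = opened R v q in w , ∈+ᴿˡ w q′ , h)
                   , [ (λ q → let (w , q′ , h) = opened S v q in w , ∈+ᴿʳ w q′ , h) , above v ]′ ]′ (∈+ᴿ⁻ p)
       where
       above : ∀ v → (∃[ z ] ∃[ x ] ∃[ y ] v ≡ ⌜ z ⌝ × x ∈ᶜ r × y ∈ᶜ s × z ≤q x ⊕ y) → ∃[ w ] w ∈ r +ᴿ s × v <Q w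
       above v (z , x , y , e , q , q′ , k) = let (x′ , t , h) = open-cut R {x} q in
         ⌜ x′ ⊕ y ⌝ , ∈+ᴿ {x′} {y} {x′ ⊕ y} t q′ (≤q-refl {x′ ⊕ y}) ,
         subst (_<Q ⌜ x′ ⊕ y ⌝) (sym e)
           (<q⇒<Q {z} {x′ ⊕ y} (≤q-<q-trans {z} {x ⊕ y} {x′ ⊕ y} k (⊕-monoˡ-< {x} {x′} y h)))

 IsBijection IsComposite : 𝕍 → 𝕍 → 𝕍 → Set ℓ
 IsBijection f a b = ⟦ isBijection v0 v1 v2 ⟧ (f ∷ a ∷ b ∷ [])
 IsComposite h g f = ⟦ isComposite v0 v1 v2 ⟧ (h ∷ g ∷ f ∷ [])

 composite-∈ : ∀ {h g f x y z} → IsComposite h g f → f [ x ]= y → g [ y ]= z → h [ x ]= z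
 composite-∈ c p q = from (c _) (_ , _ , _ , refl , p , q)

 composite-∈⁻ : ∀ {h g f x z} → IsComposite h g f → h [ x ]= z → ∃[ y ] f [ x ]= y × g [ y ]= z
 composite-∈⁻ c p with to (c _) p
 ... | x , y , z , e , q , r with ⟨⟩-injective e
 ... | refl , refl = y , q , r

 composite-unique : ∀ {h h′ g f} → IsComposite h g f → IsComposite h′ g f → h ≡ h′
 composite-unique c d = ext (λ p q → from (d p) (to (c p) q)) (λ p q → from (c p) (to (d p) q))

 compose : ∀ {n a b f g} → f ∶ n ⟶ a → g ∶ a ⟶ b → ∃[ h ] h ∶ n ⟶ b × IsComposite h g f
 compose {n} {a} {b} {f} {g} F G = fun , fun-map
     (λ x p → let (y , q) = value (proj₁ F) p ; (z , r) = value (proj₁ G) (proj₂ F x y q) in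
       z , proj₂ G y z r , y , q , r)
     (λ x z z′ p (y , q , r) (y′ , q′ , r′) → both-values (functional (proj₁ F) q q′) r r′)
   , λ p → mk⇔
     (λ q → let (x , z , e , _) = fun-pairs p q in decompose e (subst (_∈ fun) e q))
     (λ { (x , y , z , refl , q , r) → fun-intro (dom (proj₁ F) q) (proj₂ G y z r) (y , q , r) })
   where
   φ : Fm 5
   φ = ∃ᶠ v4 [ v2 ]ᶠ= v0 ∧ᶠ v5 [ v0 ]ᶠ= v1
   open Graph φ (f ∷ g ∷ []) n b
   both-values : ∀ {y y′ z z′} → y ≡ y′ → g [ y ]= z → g [ y′ ]= z′ → z ≡ z′
   both-values refl = functional (proj₁ G)
   decompose : ∀ {p x z} → p ≡ ⟨ x , z ⟩ → fun [ x ]= z → ∃[ x ] ∃[ y ] ∃[ z ] p ≡ ⟨ x , z ⟩ × f [ x ]= y × g [ y ]= z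
   decompose {x = x} {z} e q = let (_ , _ , y , r , s) = fun-elim q in x , y , z , e , r , s

 IsRelationalLanguage : 𝕍 → Set ℓ
 IsRelationalLanguage 𝓛 = ⟦ isRelationalLanguage v0 ⟧ (𝓛 ∷ [])

 infixl 7 _∩_ _∖_
 _∩_ _∖_ : 𝕍 → 𝕍 → 𝕍
 a ∩ b = sep (v0 ∈ᶠ v1) (b ∷ []) a
 a ∖ b = sep (¬ᶠ (v0 ∈ᶠ v1)) (b ∷ []) a

 module _ {a b x : 𝕍} where
   ∈∩ : x ∈ a → x ∈ b → x ∈ a ∩ b
   ∈∩ p q = ∈sep (v0 ∈ᶠ v1) (b ∷ []) p q
   ∈∩⁻ : x ∈ a ∩ b → x ∈ a × x ∈ b
   ∈∩⁻ p = ∈sep⁻ (v0 ∈ᶠ v1) (b ∷ []) p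
   ∈∖ : x ∈ a → x ∉ b → x ∈ a ∖ b
   ∈∖ p q = ∈sep (¬ᶠ (v0 ∈ᶠ v1)) (b ∷ []) p q
   ∈∖⁻ : x ∈ a ∖ b → x ∈ a × x ∉ b
   ∈∖⁻ p = ∈sep⁻ (¬ᶠ (v0 ∈ᶠ v1)) (b ∷ []) p

 Even : 𝕍 → Set ℓ
 Even k = ⟦ even v0 ⟧ (k ∷ [])

 even-∅ : Even ∅
 even-∅ = ∅ , ∈ω⁻ 0∈ω , iterate-0

 identity : ∀ n → ∃[ f ] f ∶ n ⟶ n × (∀ x → x ∈ n → f [ x ]= x) × (∀ x y → f [ x ]= y → y ≡ x)
 identity n = G.fun , G.fun-map (λ x p → x , p , refl) (λ x y z p e e′ → trans e (sym e′)) ,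
   (λ x p → G.fun-intro p p refl) , λ x y p → proj₂ (proj₂ (G.fun-elim p))
   where module G = Graph (v0 ≈ᶠ v1) [] n n

 valueᶠ : Fm 3
 valueᶠ = ∃ᶠ v2 [ v3 ]ᶠ= v0 ∧ᶠ v1 ∈ᶠ v0

 val : 𝕍 → 𝕍 → 𝕍
 val μ A = sep valueᶠ (μ ∷ A ∷ []) fractions

 valᵗ : ∀ {n} → Tm n → Tm n → Tm n → Tm n
 valᵗ fracs μ A = compr valueᶠ (μ ∷ A ∷ []) fracs

 ∅-addReal : ∀ r → AddReal ∅ r r
 ∅-addReal r = addReal-intro λ x → mk⇔ (λ p → inj₂ (inj₁ p))
   [ (λ p → ⊥-elim (∉∅ p)) , [ id , (λ (y , z , w , p , _) → ⊥-elim (∉∅ p)) ]′ ]′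

 addReal-⊆ : ∀ {r r′ s t} → IsReal r′ → IsReal s → r ⊆ r′ → AddReal r s t → t ⊆ r′ +ᴿ s
 addReal-⊆ R S h a x p = from (∈addReal (+ᴿ-addReal R S) x)
   (Sum.map (h x) (Sum.map₂ λ (y , z , w , q , r) → y , z , w , h y q , r) (to (∈addReal a x) p))

 addReal-∅ : ∀ {r t} → AddReal r ∅ t → t ⊆ r
 addReal-∅ a x p = [ id , [ (λ q → ⊥-elim (∉∅ q)) , (λ (y , z , w , _ , q , _) → ⊥-elim (∉∅ q)) ]′ ]′ (to (∈addReal a x) p)

 addReal-∅ˡ : ∀ {r s t} → r ⊆ ∅ → AddReal r s t → t ⊆ s
 addReal-∅ˡ h a x p = [ (λ q → ⊥-elim (∉∅ (h x q))) , [ id , (λ (y , z , w , q , _) → ⊥-elim (∉∅ (h y q))) ]′ ]′ (to (∈addReal a x) p)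

 +ᴿ-comm-⊆ : ∀ {r s} → IsReal r → IsReal s → r +ᴿ s ⊆ s +ᴿ r
 +ᴿ-comm-⊆ {r} {s} R S v p = [ ∈+ᴿʳ S R v , [ ∈+ᴿˡ S R v , swap v ]′ ]′ (∈+ᴿ⁻ R S p)
   where
   swap : ∀ v → (∃[ z ] ∃[ x ] ∃[ y ] v ≡ ⌜ z ⌝ × x ∈ᶜ r × y ∈ᶜ s × z ≤q x ⊕ y) → v ∈ s +ᴿ r
   swap v (z , x , y , e , q , q′ , k) = subst (_∈ s +ᴿ r) (sym e)
     (∈+ᴿ S R {y} {x} {z} q′ q (≤q-trans {z} {x ⊕ y} {y ⊕ x} k (⊕-comm x y)))

 restrict : 𝕍 → 𝕍 → 𝕍
 restrict f n = sep (∃ᶠ ∃ᶠ v2 ≈ᶠ ⟨ v1 , v0 ⟩ᵗ ∧ᶠ v1 ∈ᶠ v3) (n ∷ []) f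

 module _ {f n : 𝕍} where
   private
     φ : Fm 2
     φ = ∃ᶠ ∃ᶠ v2 ≈ᶠ ⟨ v1 , v0 ⟩ᵗ ∧ᶠ v1 ∈ᶠ v3

   restrict-at : ∀ {x y} → x ∈ n → f [ x ]= y → restrict f n [ x ]= y
   restrict-at p q = ∈sep φ (n ∷ []) q (_ , _ , refl , p)

   restrict-at⁻ : ∀ {x y} → restrict f n [ x ]= y → x ∈ n × f [ x ]= y
   restrict-at⁻ h = let (q , _ , _ , e , p) = ∈sep⁻ φ (n ∷ []) h in subst (_∈ n) (sym (proj₁ (⟨⟩-injective e))) p , q

   restrict-map : ∀ {I b} → f ∶ I ⟶ b → n ⊆ I → restrict f n ∶ n ⟶ b
   restrict-map F n⊆I = isFunctionOn-intro
     (λ p q → proj₂ (∈sep⁻ φ (n ∷ []) q))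
     (λ x p → let (y , q) = value (proj₁ F) (n⊆I x p) in y , restrict-at p q)
     (λ x y z p q → functional (proj₁ F) (proj₂ (restrict-at⁻ p)) (proj₂ (restrict-at⁻ q)))
     , λ x y p → proj₂ F x y (proj₂ (restrict-at⁻ p))

 module _ {S c s₀} (C : c ∶ S ⟶ S) (s₀∈ : s₀ ∈ S) where
   private
     Chain : 𝕍 → 𝕍 → Set ℓ
     Chain = Iterate (λ _ x y → c [ x ]= y) s₀
     φ : Fm 5
     φ = iterate (λ ↑ᵏ _ x y → ↑ᵏ v3 [ x ]ᶠ= y) v4 v1 v0
     module R = Graph φ (c ∷ s₀ ∷ []) ω S
     chain-exists : ∀ n → n ∈ ω → ∃[ y ] y ∈ S × Chain n y
     chain-exists = ω-ind (∃ᶠ v0 ∈ᶠ v2 ∧ᶠ iterate (λ ↑ᵏ _ x y → ↑ᵏ v3 [ x ]ᶠ= y) v4 v1 v0) (S ∷ c ∷ s₀ ∷ [])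
       (s₀ , s₀∈ , iterate-0)
       (λ n nω (x , x∈ , it) → let (y , p) = value (proj₁ C) x∈ in y , proj₂ C x y p , iterate-s it p)
     chain-unique : ∀ n → n ∈ ω → ∀ y z → Chain n y → Chain n z → y ≡ z
     chain-unique = ω-ind (∀ᶠ ∀ᶠ iterate (λ ↑ᵏ _ x y → ↑ᵏ v3 [ x ]ᶠ= y) v4 v2 v1 ⇒ᶠ iterate (λ ↑ᵏ _ x y → ↑ᵏ v3 [ x ]ᶠ= y) v4 v2 v0 ⇒ᶠ v1 ≈ᶠ v0) (c ∷ s₀ ∷ [])
       (λ y z p q → trans (iterate-0⁻ p) (sym (iterate-0⁻ q)))
       (λ n nω h y z p q → let (x , p′ , e) = iterate-s⁻ nω p ; (x′ , q′ , e′) = iterate-s⁻ nω q in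
         functional (proj₁ C) (subst (λ x → c [ x ]= y) (h x x′ p′ q′) e) e′)

   recursion : ∃[ f ] f ∶ ω ⟶ S × f [ ∅ ]= s₀ × (∀ n x y → f [ n ]= x → f [ succ n ]= y → c [ x ]= y)
   recursion = R.fun , R.fun-map chain-exists (λ n y z p → chain-unique n p y z) , R.fun-intro 0∈ω s₀∈ iterate-0 ,
     λ n x y p q → let (nω , _ , it) = R.fun-elim p ; (_ , _ , it′) = R.fun-elim q
                       (x′ , it″ , e) = iterate-s⁻ nω it′
                   in subst (λ x → c [ x ]= y) (chain-unique n nω x′ x it″ it) e

 Pos : 𝕍
 Pos = sep (v1 <ᶠ v0) (⌜ 0q ⌝ ∷ []) fractions

 0<positive : ∀ {ε} → PositiveQ ε → 0q <q ε
 0<positive {ε} h = <q-≤q-trans {0q} {0q ⊕ ε} {ε} (x<x⊕ε 0q {ε} h)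
   (≤q-trans {0q ⊕ ε} {ε ⊕ 0q} {ε} (⊕-comm 0q ε) (⊕-0 ε))

 ∈Pos : ∀ {ε} → PositiveQ ε → ⌜ ε ⌝ ∈ Pos
 ∈Pos {ε} h = ∈sep (v1 <ᶠ v0) (⌜ 0q ⌝ ∷ []) (∈fractions ε) (to (pos⇔ ⌜ ε ⌝) (<q⇒<Q {0q} {ε} (0<positive {ε} h)))
   where
   opaque
     unfolding _<Q_
     pos⇔ : ∀ v → ⌜ 0q ⌝ <Q v ⇔ ⟦ v1 <ᶠ v0 ⟧ (v ∷ ⌜ 0q ⌝ ∷ [])
     pos⇔ v = ≡⇒⇔ refl

 ∈Pos⁻ : ∀ {v} → v ∈ Pos → ∃[ ε ] v ≡ ⌜ ε ⌝ × PositiveQ ε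
 ∈Pos⁻ {v} p = let (q , r) = ∈sep⁻ (v1 <ᶠ v0) (⌜ 0q ⌝ ∷ []) p ; (ε , e) = ∈fractions⁻ q in
   ε , e , positive-above {0q} {ε} (<Q⇒<q {0q} {ε} (subst (⌜ 0q ⌝ <Q_) e (from (pos⇔ v) r)))
   where
   opaque
     unfolding _<Q_
     pos⇔ : ∀ v → ⌜ 0q ⌝ <Q v ⇔ ⟦ v1 <ᶠ v0 ⟧ (v ∷ ⌜ 0q ⌝ ∷ [])
     pos⇔ v = ≡⇒⇔ refl

 infixl 7 _△_
 _△_ : 𝕍 → 𝕍 → 𝕍
 a △ b = (a ∖ b) ∪ (b ∖ a)

 △ᵗ : ∀ {n} → Tm n → Tm n → Tm n
 △ᵗ a b = compr (¬ᶠ (v0 ∈ᶠ v1)) (b ∷ []) a ∪ᵗ compr (¬ᶠ (v0 ∈ᶠ v1)) (a ∷ []) b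

 module _ {a b x : 𝕍} where
   ∈△ : (x ∈ a × x ∉ b) ⊎ (x ∈ b × x ∉ a) → x ∈ a △ b
   ∈△ h = ∈∪ (Sum.map (λ (p , q) → ∈∖ p q) (λ (p , q) → ∈∖ p q) h)
   ∈△⁻ : x ∈ a △ b → (x ∈ a × x ∉ b) ⊎ (x ∈ b × x ∉ a)
   ∈△⁻ p = Sum.map ∈∖⁻ ∈∖⁻ (∈∪⁻ p)

 excluded : ∀ {a b x} → x ∈ a → x ∈ b ⊎ (x ∈ a × x ∉ b)
 excluded {a} {b} {x} p with dec (x ∈ b)
 ... | yes q = inj₁ q
 ... | no q  = inj₂ (p , q)

 △-agree : ∀ {a b x} → x ∉ a △ b → (x ∈ a → x ∈ b) × (x ∈ b → x ∈ a)
 △-agree n = (λ p → by-contradiction λ q → n (∈△ (inj₁ (p , q)))) , (λ p → by-contradiction λ q → n (∈△ (inj₂ (p , q))))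

 △-transfer : ∀ {a b c d e f} → (∀ x → (x ∈ c → x ∈ d) × (x ∈ d → x ∈ c) → (x ∈ e → x ∈ f) × (x ∈ f → x ∈ e) →
   (x ∈ a → x ∈ b) × (x ∈ b → x ∈ a)) → ∀ x → x ∈ a △ b → x ∈ c △ d ⊎ x ∈ e △ f
 △-transfer {c = c} {d} {e} {f} h x p = by-contradiction λ n →
   let (k , l) = h x (△-agree (λ q → n (inj₁ q))) (△-agree (λ q → n (inj₂ q))) in
   [ (λ (q , r) → r (k q)) , (λ (q , r) → r (l q)) ]′ (∈△⁻ p)

 Halving : 𝕍 → Set ℓ
 Halving δ = ∀ n ε ε′ → δ [ n ]= ⌜ ε ⌝ → δ [ succ n ]= ⌜ ε′ ⌝ → ε′ ⊕ ε′ ≤q ε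

 -- Positive lower bounds of a sequence with 2 δ(n + 1) ≤ δ(n) would form a cut closed under addition.
 module Vanishing {δ} (Δ : δ ∶ ω ⟶ Pos)
   (halving : Halving δ) where

   δ-value : ∀ n → n ∈ ω → ∃[ ε ] δ [ n ]= ⌜ ε ⌝ × PositiveQ ε
   δ-value n p = let (v , q) = value (proj₁ Δ) p ; (ε , e , ε>0) = ∈Pos⁻ (proj₂ Δ n v q) in
     ε , subst (λ v → δ [ n ]= v) e q , ε>0

   private
     Bound : Fraction → Set ℓ
     Bound y = ∀ n ε → δ [ n ]= ⌜ ε ⌝ → y ≤q ε

     boundᶠ : Fm 3
     boundᶠ = ∃ᶠ v1 <ᶠ v0 ∧ᶠ v0 ∈ᶠ v3 ∧ᶠ (∀ᶠ ∀ᶠ v4 [ v1 ]ᶠ= v0 ⇒ᶠ v2 ≤ᶠ v0)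

     r : 𝕍
     r = sep boundᶠ (δ ∷ fractions ∷ []) fractions

     opaque
       unfolding _<Q_
       bound-unfold : ∀ v → ⟦ boundᶠ ⟧ (v ∷ δ ∷ fractions ∷ []) ⇔
         (∃[ y ] v <Q y × y ∈ fractions × (∀ n d → δ [ n ]= d → y ≤Q d))
       bound-unfold v = ≡⇒⇔ refl

     ∈r : ∀ {x y} → x <q y → Bound y → x ∈ᶜ r
     ∈r {x} {y} h k = ∈sep boundᶠ (δ ∷ fractions ∷ []) (∈fractions x) (from (bound-unfold ⌜ x ⌝)
       (⌜ y ⌝ , <q⇒<Q {x} {y} h , ∈fractions y , λ n d p → let (ε , e , _) = ∈Pos⁻ (proj₂ Δ n d p) in
         subst (⌜ y ⌝ ≤Q_) (sym e) (≤q⇒≤Q {y} {ε} (k n ε (subst (λ d → δ [ n ]= d) e p)))))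

     ∈r⁻ : ∀ {v} → v ∈ r → ∃[ x ] ∃[ y ] v ≡ ⌜ x ⌝ × x <q y × Bound y
     ∈r⁻ {v} p = let (v∈ , h) = ∈sep⁻ boundᶠ (δ ∷ fractions ∷ []) p
                     (x , e) = ∈fractions⁻ v∈
                     (w , v<w , w∈ , k) = to (bound-unfold v) h
                     (y , e′) = ∈fractions⁻ w∈
                 in x , y , e , <Q⇒<q {x} {y} (subst₂ _<Q_ e e′ v<w) ,
                    λ n ε q → ≤Q⇒≤q {y} {ε} (subst (_≤Q ⌜ ε ⌝) e′ (k n ⌜ ε ⌝ q))

     ⌜⌝∈r⁻ : ∀ {x} → x ∈ᶜ r → ∃[ y ] x <q y × Bound y
     ⌜⌝∈r⁻ {x} p = let (x′ , y , e , h , k) = ∈r⁻ p in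
       y , <Q⇒<q {x} {y} (subst (_<Q ⌜ y ⌝) (sym e) (<q⇒<Q {x′} {y} h)) , k

     r-real : IsReal r
     r-real = record
       { fracs = λ v p → let (x , _ , e , _) = ∈r⁻ p in subst IsFrac (sym e) (⌜⌝-frac x)
       ; closed = closed′
       ; opened = opened′
       ; bound = (let (ε , p , ε>0) = δ-value ∅ 0∈ω in ⌜ ε ⌝ , ⌜⌝-frac ε , λ q → let (y , h , k) = ⌜⌝∈r⁻ {ε} q in ≤q⇒≯ {y} {ε} (k ∅ ε p) h)
       }
       where
       closed′ : ∀ v w → v ∈ r → w ≤Q v → w ∈ r
       closed′ v w p h = let (x , y , e , l , k) = ∈r⁻ p ; (z , e′) = frac⁻ (≤Q-frac h) in
         subst (_∈ r) (sym e′) (∈r {z} {y} (≤q-<q-trans {z} {x} {y} (≤Q⇒≤q {z} {x} (subst₂ _≤Q_ e′ e h)) l) k)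
       opened′ : ∀ v → v ∈ r → ∃[ w ] w ∈ r × v <Q w
       opened′ v p = let (x , y , e , l , k) = ∈r⁻ p ; (z , x<z , z<y) = between {x} {y} l in
         ⌜ z ⌝ , ∈r {z} {y} z<y k , subst (_<Q ⌜ z ⌝) (sym e) (<q⇒<Q {x} {z} x<z)

     double : ∀ {y z} → Bound y → Bound z → Bound (y ⊕ z)
     double {y} {z} h k n ε p = let (ε′ , q , _) = δ-value (succ n) (s∈ω (dom (proj₁ Δ) p)) in
       ≤q-trans {y ⊕ z} {ε′ ⊕ ε′} {ε} (⊕-mono-≤ {y} {ε′} {z} {ε′} (h (succ n) ε′ q) (k (succ n) ε′ q)) (halving n ε ε′ p q)

   vanishing : ∀ {ε} → PositiveQ ε → ∃[ n ] ∃[ η ] δ [ n ]= ⌜ η ⌝ × PositiveQ η × η <q ε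
   vanishing {ε} ε>0 = by-contradiction λ h → contradict (none h)
     where
     positive-at : ∀ {n η} → δ [ n ]= ⌜ η ⌝ → PositiveQ η
     positive-at {n} {η} p = let (ε′ , e , ε′>0) = ∈Pos⁻ (proj₂ Δ n ⌜ η ⌝ p) in
       positive-above {0q} {η} (<Q⇒<q {0q} {η} (subst (⌜ 0q ⌝ <Q_) (sym e) (<q⇒<Q {0q} {ε′} (0<positive {ε′} ε′>0))))
     Below : 𝕍 → Fraction → Set ℓ
     Below n η = δ [ n ]= ⌜ η ⌝ × PositiveQ η × η <q ε
     none : ¬ (∃[ n ] ∃[ η ] Below n η) → Bound ε
     none h n η p = [ id , (λ q → ⊥-elim (h (n , η , below q))) ]′ (≤q-or-> ε η)
       where
       below : η <q ε → Below n η
       below q = p , positive-at {n} {η} p , q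
     contradict : Bound ε → ⊥
     contradict bound =
       let η = half ε
           η<ε = <q-≤q-trans {η} {η ⊕ η} {ε} (x<x⊕ε η {η} (half-positive {ε} ε>0)) (half-⊕ ε)
           (x , x∈ , x+η∉) = almost-top r-real {η} {η} (half-positive {ε} ε>0) (∈r {η} {ε} η<ε bound)
           (y , x<y , k) = ⌜⌝∈r⁻ {x} x∈
       in x+η∉ (∈r {x ⊕ η} {y ⊕ ε} (⊕-mono-<-≤ {x} {y} {η} {ε} x<y (<q⇒≤q {η} {ε} η<ε)) (double {y} {ε} k bound))

 -- A branch of R from s₀ exists as soon as s₀ is outside the domain of F: on that domain F is a
 -- rank function, which witnesses in every larger model that there is no branch.
 module Tree {S R} (R⊆ : R ⊆ S ⊗ S) where
   private
     Attempt : 𝕍 → Set ℓ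
     Attempt f = ∀ z v → f [ z ]= v → z ∈ S × (∀ z′ → R [ z ]= z′ → ∃[ u ] f [ z′ ]= u) ×
       (∀ u → u ∈ v ⇔ (∃[ z′ ] R [ z ]= z′ × f [ z′ ]= u))

     attempt : ∀ {n} → Tm n → Tm n → Tm n → Fm n
     attempt S R f = ∀ᶠ ∀ᶠ ↑² f [ v1 ]ᶠ= v0 ⇒ᶠ v1 ∈ᶠ ↑² S ∧ᶠ (∀ᶠ ↑³ R [ v2 ]ᶠ= v0 ⇒ᶠ (∃ᶠ ↑⁴ f [ v1 ]ᶠ= v0)) ∧ᶠ
       (∀ᶠ v0 ∈ᶠ v1 ⇔ᶠ (∃ᶠ ↑⁴ R [ v3 ]ᶠ= v0 ∧ᶠ ↑⁴ f [ v0 ]ᶠ= v1))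

     value∈⋃⋃ : ∀ {f z v} → f [ z ]= v → v ∈ ⋃ (⋃ f)
     value∈⋃⋃ p = ∈⋃ (∈⋃ p ∈⁅⁆₂) ∈⁅⁆₂

     unique : ∀ {f g} → Attempt f → Attempt g → ∀ {z v w} → f [ z ]= v → g [ z ]= w → v ≡ w
     unique {f} {g} Af Ag {z} {v} {w} p q = by-contradiction λ n → no-bad (∈sep φ ρ (value∈⋃⋃ p) (z , w , p , q , n))
       where
       φ : Fm 3
       φ = ∃ᶠ ∃ᶠ v3 [ v1 ]ᶠ= v2 ∧ᶠ v4 [ v1 ]ᶠ= v0 ∧ᶠ ¬ᶠ (v2 ≈ᶠ v0)
       ρ : Vec 𝕍 2
       ρ = f ∷ g ∷ []
       no-bad : ∀ {v} → v ∉ sep φ ρ (⋃ (⋃ f))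
       no-bad b = let (v , v∈ , least-v) = least b
                      (_ , z , w , p , q , n) = ∈sep⁻ φ ρ v∈
                      (_ , total , v⇔) = Af z v p
                      (_ , total′ , w⇔) = Ag z w q
                      same : ∀ z′ u u′ → R [ z ]= z′ → f [ z′ ]= u → g [ z′ ]= u′ → u ≡ u′
                      same z′ u u′ r p′ q′ = by-contradiction λ n′ → least-v u (from (v⇔ u) (z′ , r , p′))
                        (∈sep φ ρ (value∈⋃⋃ p′) (z′ , u′ , p′ , q′ , n′))
                  in n (ext
                    (λ u u∈ → let (z′ , r , p′) = to (v⇔ u) u∈ ; (u′ , q′) = total′ z′ r in
                       from (w⇔ u) (z′ , r , subst (λ u → g [ z′ ]= u) (sym (same z′ u u′ r p′ q′)) q′))
                    (λ u u∈ → let (z′ , r , q′) = to (w⇔ u) u∈ ; (u′ , p′) = total z′ r in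
                       from (v⇔ u) (z′ , r , subst (λ u → f [ z′ ]= u) (same z′ u′ u r p′ q′) p′)))

     Val : 𝕍 → 𝕍 → Set ℓ
     Val z v = ∃[ f ] Attempt f × f [ z ]= v

     val-unique : ∀ {z v w} → Val z v → Val z w → v ≡ w
     val-unique (f , Af , p) (g , Ag , q) = unique Af Ag p q

     domᶠ : Fm 3
     domᶠ = ∃ᶠ ∃ᶠ attempt v3 v4 v0 ∧ᶠ v0 [ v2 ]ᶠ= v1

     W : 𝕍
     W = sep domᶠ (S ∷ R ∷ []) S

     val∈W : ∀ {z v} → Val z v → z ∈ W
     val∈W {z} {v} (f , Af , p) = ∈sep domᶠ (S ∷ R ∷ []) (proj₁ (Af z v p)) (v , f , Af , p)

     pairs : ∃[ b ] (∀ y → y ∈ b ⇔ (∃[ x ] x ∈ W × (∃[ v ] y ≡ ⟨ x , v ⟩ × Val x v)))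
     pairs = replace (∃ᶠ v2 ≈ᶠ ⟨ v1 , v0 ⟩ᵗ ∧ᶠ (∃ᶠ attempt v4 v5 v0 ∧ᶠ v0 [ v2 ]ᶠ= v1)) (S ∷ R ∷ []) W
       (λ x p → let (_ , v , h) = ∈sep⁻ domᶠ (S ∷ R ∷ []) p in ⟨ x , v ⟩ , (v , refl , h) ,
         λ { z (w , e , k) → trans e (cong ⟨ x ,_⟩ (val-unique k h)) })

   F : 𝕍
   F = proj₁ pairs

   private
     F⁻ : ∀ {z v} → F [ z ]= v → Val z v
     F⁻ p = let (x , _ , w , e , h) = to (proj₂ pairs _) p ; (e₁ , e₂) = ⟨⟩-injective e in
       subst₂ Val (sym e₁) (sym e₂) h

     F⁺ : ∀ {z v} → Val z v → F [ z ]= v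
     F⁺ {z} {v} h = from (proj₂ pairs _) (z , val∈W h , v , refl , h)

     F-attempt : Attempt F
     F-attempt z v p = let (f , Af , q) = F⁻ p ; (z∈ , total , v⇔) = Af z v q in
       z∈ , (λ z′ r → let (u , s) = total z′ r in u , F⁺ (f , Af , s)) ,
       λ u → mk⇔ (λ u∈ → let (z′ , r , s) = to (v⇔ u) u∈ in z′ , r , F⁺ (f , Af , s))
                 (λ (z′ , r , s) → let (u′ , s′) = total z′ r in
                    from (v⇔ u) (z′ , r , subst (λ u → f [ z′ ]= u) (val-unique (f , Af , s′) (F⁻ s)) s′))

   F-decreasing : ∀ {z z′ v} → F [ z ]= v → R [ z ]= z′ → ∃[ u ] F [ z′ ]= u × u ∈ v
   F-decreasing {z} {z′} {v} p r = let (_ , total , v⇔) = F-attempt z v p ; (u , q) = total z′ r in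
     u , q , from (v⇔ u) (z′ , r , q)

   Unranked : 𝕍 → Set ℓ
   Unranked z = ∀ v → ¬ F [ z ]= v

   unranked-successor : ∀ {z} → z ∈ S → Unranked z → ∃[ z′ ] R [ z ]= z′ × Unranked z′
   unranked-successor {z} z∈ n = by-contradiction λ h → n _ (F⁺ (F′ , F′-attempt h , ∈∪ (inj₂ ∈⁅⁆₁)))
     where
     φ : Fm 4
     φ = ∃ᶠ v3 [ v2 ]ᶠ= v0 ∧ᶠ v4 [ v0 ]ᶠ= v1
     ρ : Vec 𝕍 3
     ρ = z ∷ R ∷ F ∷ []
     v F′ : 𝕍
     v = sep φ ρ (⋃ (⋃ F))
     F′ = F ∪ ⁅ ⟨ z , v ⟩ , ⟨ z , v ⟩ ⁆
     split : ∀ {x y} → F′ [ x ]= y → F [ x ]= y ⊎ (x ≡ z × y ≡ v)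
     split p = [ inj₁ , (λ q → inj₂ (⟨⟩-injective (∈⁅a⁆ q))) ]′ (∈∪⁻ p)
     F′-attempt : ¬ (∃[ z′ ] R [ z ]= z′ × Unranked z′) → Attempt F′
     F′-attempt h x y p = [ old x y , (λ (e , e′) → subst₂ Ok (sym e) (sym e′) new) ]′ (split p)
       where
       Ok : 𝕍 → 𝕍 → Set ℓ
       Ok x y = x ∈ S × (∀ z′ → R [ x ]= z′ → ∃[ u ] F′ [ z′ ]= u) × (∀ u → u ∈ y ⇔ (∃[ z′ ] R [ x ]= z′ × F′ [ z′ ]= u))
       ranked : ∀ z′ → R [ z ]= z′ → ∃[ u ] F [ z′ ]= u
       ranked z′ r = by-contradiction λ k → h (z′ , r , λ u p → k (u , p))
       old : ∀ x y → F [ x ]= y → Ok x y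
       old x y p = let (x∈ , total , y⇔) = F-attempt x y p in
         x∈ , (λ z′ r → let (u , q) = total z′ r in u , ∈∪ (inj₁ q)) ,
         λ u → mk⇔ (λ u∈ → let (z′ , r , q) = to (y⇔ u) u∈ in z′ , r , ∈∪ (inj₁ q))
           (λ (z′ , r , q) → from (y⇔ u) (z′ , r , [ id , (λ (e , _) → let (u′ , q′) = total z′ r in
              ⊥-elim (n u′ (subst (λ z → F [ z ]= u′) e q′))) ]′ (split q)))
       new : Ok z v
       new = z∈ , (λ z′ r → let (u , q) = ranked z′ r in u , ∈∪ (inj₁ q)) ,
         λ u → mk⇔ (λ u∈ → let (_ , z′ , r , q) = ∈sep⁻ φ ρ u∈ in z′ , r , ∈∪ (inj₁ q))
           (λ (z′ , r , q) → [ (λ q′ → ∈sep φ ρ (value∈⋃⋃ q′) (z′ , r , q′))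
                             , (λ (e , _) → let (u′ , q′) = ranked z′ r in ⊥-elim (n u′ (subst (λ z → F [ z ]= u′) e q′))) ]′ (split q))

   branch : ∀ {s₀} → s₀ ∈ S → Unranked s₀ →
     ∃[ c ] c ∶ ω ⟶ S × c [ ∅ ]= s₀ × (∀ n x y → c [ n ]= x → c [ succ n ]= y → R [ x ]= y)
   branch {s₀} s₀∈ n =
     let (t , t-map , t⊆) = C.axiom-of-choice λ x p → let (x∈ , k) = ∈sep⁻ φ (F ∷ []) p
                                                          (y , r , l) = unranked-successor x∈ k
                                                      in y , ∈sep φ (F ∷ []) (proj₂ (⟨⟩∈⊗⁻ (R⊆ _ r))) l , r
         (c , c-map , c₀ , cₛ) = recursion t-map (∈sep φ (F ∷ []) s₀∈ n)
     in c , (proj₁ c-map , λ k x p → proj₁ (∈sep⁻ φ (F ∷ []) (proj₂ c-map k x p))) , c₀ ,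
        λ k x y p q → proj₂ (proj₂ (t⊆ (cₛ k x y p q)))
     where
     φ : Fm 2
     φ = ∀ᶠ ¬ᶠ (v2 [ v1 ]ᶠ= v0)
     T : 𝕍
     T = sep φ (F ∷ []) S
     module C = Graph (⟨ v1 , v0 ⟩ᵗ ∈ᶠ v3) (R ∷ []) T T

 half≤ : ∀ ε → half ε ≤q ε
 half≤ ε = ≤q-trans {half ε} {half ε ⊕ half ε} {ε} (x≤x⊕y (half ε) (half ε)) (half-⊕ ε)

 ≤half : ∀ {x y} → x ⊕ x ≤q y → x ≤q half y
 ≤half {x} {y} h = [ id , (λ k → ⊥-elim (≤q⇒≯ {x ⊕ x} {half y ⊕ half y}
   (≤q-trans {x ⊕ x} {y} {half y ⊕ half y} h (half-⊕⁻ y)) (⊕-mono-<-≤ {half y} {x} {half y} {x} k (<q⇒≤q {half y} {x} k)))) ]′ (≤q-or-> x (half y))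

 half-mono : ∀ {x y} → x ≤q y → half x ≤q half y
 half-mono {x} {y} h = ≤half {half x} {y} (≤q-trans {half x ⊕ half x} {x} {y} (half-⊕ x) h)

 module Domain (X : 𝕍) where

   IsPermutation : 𝕍 → Set ℓ
   IsPermutation g = IsBijection g X X

   identity-permutation : ∃[ g ] IsPermutation g
   identity-permutation = let (f , F , at , at⁻) = identity X in
     f , F , (λ x x′ y p q → trans (sym (at⁻ x y p)) (at⁻ x′ y q)) , λ y p → y , at y p

   -- g followed by the transposition of y and y′
   swap : ∀ {g y y′} → IsPermutation g → y ∈ X → y′ ∈ X →
     ∃[ h ] IsPermutation h × (∀ x z → g [ x ]= z → ¬ z ≡ y → ¬ z ≡ y′ → h [ x ]= z) × (∀ x → g [ x ]= y′ → h [ x ]= y)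
   swap {g} {y} {y′} (G , inj , surj) y∈ y′∈ = S.fun , (h-map , h-injective , h-surjective) ,
       (λ x z p n n′ → S.fun-intro (dom (proj₁ G) p) (proj₂ G x z p) (z , p , inj₂ (inj₂ (n , n′ , refl)))) ,
       (λ x p → S.fun-intro (dom (proj₁ G) p) y∈ (y′ , p , inj₂ (inj₁ (refl , refl))))
     where
     φ : Fm 6
     φ = ∃ᶠ v4 [ v2 ]ᶠ= v0 ∧ᶠ ((v0 ≈ᶠ v5 ∧ᶠ v1 ≈ᶠ v6) ∨ᶠ (v0 ≈ᶠ v6 ∧ᶠ v1 ≈ᶠ v5) ∨ᶠ (¬ᶠ (v0 ≈ᶠ v5) ∧ᶠ ¬ᶠ (v0 ≈ᶠ v6) ∧ᶠ v1 ≈ᶠ v0))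
     module S = Graph φ (g ∷ y ∷ y′ ∷ []) X X
     Swap : 𝕍 → 𝕍 → Set ℓ
     Swap u w = (u ≡ y × w ≡ y′) ⊎ (u ≡ y′ × w ≡ y) ⊎ (¬ u ≡ y × ¬ u ≡ y′ × w ≡ u)
     swap-sym : ∀ {u w} → Swap u w → Swap w u
     swap-sym (inj₁ (e , e′))          = inj₂ (inj₁ (e′ , e))
     swap-sym (inj₂ (inj₁ (e , e′)))   = inj₁ (e′ , e)
     swap-sym (inj₂ (inj₂ (n , n′ , refl))) = inj₂ (inj₂ (n , n′ , refl))
     swap-functional : ∀ {u w w′} → Swap u w → Swap u w′ → w ≡ w′
     swap-functional (inj₁ (_ , e)) (inj₁ (_ , e′)) = trans e (sym e′)
     swap-functional (inj₁ (e , f)) (inj₂ (inj₁ (e′ , f′))) = trans f (trans (sym e′) (trans e (sym f′)))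
     swap-functional (inj₁ (e , _)) (inj₂ (inj₂ (n , _))) = ⊥-elim (n e)
     swap-functional (inj₂ (inj₁ (e , f))) (inj₁ (e′ , f′)) = trans f (trans (sym e′) (trans e (sym f′)))
     swap-functional (inj₂ (inj₁ (_ , e))) (inj₂ (inj₁ (_ , e′))) = trans e (sym e′)
     swap-functional (inj₂ (inj₁ (e , _))) (inj₂ (inj₂ (_ , n , _))) = ⊥-elim (n e)
     swap-functional (inj₂ (inj₂ (n , _))) (inj₁ (e , _)) = ⊥-elim (n e)
     swap-functional (inj₂ (inj₂ (_ , n , _))) (inj₂ (inj₁ (e , _))) = ⊥-elim (n e)
     swap-functional (inj₂ (inj₂ (_ , _ , e))) (inj₂ (inj₂ (_ , _ , e′))) = trans e (sym e′)
     swap-total : ∀ {u} → u ∈ X → ∃[ w ] w ∈ X × Swap u w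
     swap-total {u} u∈ with dec (u ≡ y) | dec (u ≡ y′)
     ... | yes e | _ = y′ , y′∈ , inj₁ (e , refl)
     ... | no n  | yes e = y , y∈ , inj₂ (inj₁ (e , refl))
     ... | no n  | no n′ = u , u∈ , inj₂ (inj₂ (n , n′ , refl))
     h-map : S.fun ∶ X ⟶ X
     h-map = S.fun-map
       (λ x p → let (u , q) = value (proj₁ G) p ; (w , w∈ , s) = swap-total (proj₂ G x u q) in w , w∈ , u , q , s)
       (λ x w w′ p (u , q , s) (u′ , q′ , s′) → swap-functional s (subst (λ u → Swap u w′) (functional (proj₁ G) q′ q) s′))
     h-injective : Injective S.fun
     h-injective x x′ w p p′ = let (_ , _ , u , q , s) = S.fun-elim p ; (_ , _ , u′ , q′ , s′) = S.fun-elim p′ in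
       inj x x′ u q (subst (λ u → g [ x′ ]= u) (swap-functional (swap-sym s′) (swap-sym s)) q′)
     h-surjective : ∀ w → w ∈ X → ∃[ x ] S.fun [ x ]= w
     h-surjective w w∈ = let (u , u∈ , s) = swap-total w∈ ; (x , p) = surj u u∈ in
       x , S.fun-intro (dom (proj₁ G) p) w∈ (u , p , swap-sym s)

   Agree : 𝕍 → 𝕍 → 𝕍 → Set ℓ
   Agree g h s = ∀ x y → x ∈ s → g [ x ]= y → h [ x ]= y

   singleton : 𝕍 → 𝕍
   singleton a = ⁅ a , a ⁆

   private
     Closed : 𝕍 → Set ℓ
     Closed F = ∅ ∈ F × (∀ s x → s ∈ F → x ∈ X → s ∪ singleton x ∈ F)
     finᶠ : Fm 3
     finᶠ = ∀ᶠ v0 ∈ᶠ v3 ⇒ᶠ (∅ᵗ ∈ᶠ v0 ∧ᶠ (∀ᶠ ∀ᶠ v1 ∈ᶠ v2 ⇒ᶠ v0 ∈ᶠ v4 ⇒ᶠ v1 ∪ᵗ ⁅ v0 , v0 ⁆ᵗ ∈ᶠ v2)) ⇒ᶠ v1 ∈ᶠ v0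

   finiteSubsets : 𝕍
   finiteSubsets = sep finᶠ (X ∷ 𝒫 (𝒫 X) ∷ []) (𝒫 X)

   private
     ∅∈𝒫 : ∅ ∈ 𝒫 X
     ∅∈𝒫 = ∈𝒫 λ x p → ⊥-elim (∉∅ p)
     insert∈𝒫 : ∀ {s x} → s ∈ 𝒫 X → x ∈ X → s ∪ singleton x ∈ 𝒫 X
     insert∈𝒫 p x∈ = ∈𝒫 λ z q → [ ∈𝒫⁻ p z , (λ r → subst (_∈ X) (sym (∈⁅a⁆ r)) x∈) ]′ (∈∪⁻ q)
     fin⁻ : ∀ {s} → s ∈ finiteSubsets → s ∈ 𝒫 X × (∀ F → F ∈ 𝒫 (𝒫 X) → Closed F → s ∈ F)
     fin⁻ = ∈sep⁻ finᶠ (X ∷ 𝒫 (𝒫 X) ∷ [])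

   fin-∅ : ∅ ∈ finiteSubsets
   fin-∅ = ∈sep finᶠ (X ∷ 𝒫 (𝒫 X) ∷ []) ∅∈𝒫 λ F _ c → proj₁ c

   fin-insert : ∀ {s x} → s ∈ finiteSubsets → x ∈ X → s ∪ singleton x ∈ finiteSubsets
   fin-insert {s} {x} p x∈ = ∈sep finᶠ (X ∷ 𝒫 (𝒫 X) ∷ []) (insert∈𝒫 (proj₁ (fin⁻ p)) x∈)
     λ F F∈ c → proj₂ c s x (proj₂ (fin⁻ p) F F∈ c) x∈

   fin-ind : ∀ {k} (φ : Fm (suc k)) (ρ : Vec 𝕍 k) → ⟦ φ ⟧ (∅ ∷ ρ) →
     (∀ s x → s ∈ finiteSubsets → x ∈ X → ⟦ φ ⟧ (s ∷ ρ) → ⟦ φ ⟧ (s ∪ singleton x ∷ ρ)) → ∀ s → s ∈ finiteSubsets → ⟦ φ ⟧ (s ∷ ρ)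
   fin-ind φ ρ z i s p = proj₂ (∈sep⁻ φ ρ (proj₂ (fin⁻ p) (sep φ ρ finiteSubsets)
     (∈𝒫 λ t q → proj₁ (fin⁻ (proj₁ (∈sep⁻ φ ρ q))))
     (∈sep φ ρ fin-∅ z , λ t x q x∈ → let (t∈ , h) = ∈sep⁻ φ ρ q in ∈sep φ ρ (fin-insert t∈ x∈) (i t x t∈ x∈ h))))

   fin-∪ : ∀ {s t} → s ∈ finiteSubsets → t ∈ finiteSubsets → s ∪ t ∈ finiteSubsets
   fin-∪ {s} {t} p = fin-ind (v1 ∪ᵗ v0 ∈ᶠ v2) (s ∷ finiteSubsets ∷ [])
     (subst (_∈ finiteSubsets) (ext (λ x q → ∈∪ (inj₁ q)) (λ x q → [ id , (λ r → ⊥-elim (∉∅ r)) ]′ (∈∪⁻ q))) p)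
     (λ t x _ x∈ h → subst (_∈ finiteSubsets) (ext
       (λ z q → [ (λ r → [ (λ r′ → ∈∪ (inj₁ r′)) , (λ r′ → ∈∪ (inj₂ (∈∪ (inj₁ r′)))) ]′ (∈∪⁻ r)) , (λ r → ∈∪ (inj₂ (∈∪ (inj₂ r)))) ]′ (∈∪⁻ q))
       (λ z q → [ (λ r → ∈∪ (inj₁ (∈∪ (inj₁ r)))) , (λ r → [ (λ r′ → ∈∪ (inj₁ (∈∪ (inj₂ r′)))) , (λ r′ → ∈∪ (inj₂ r′)) ]′ (∈∪⁻ r)) ]′ (∈∪⁻ q)))
       (fin-insert h x∈)) t

   fin-range : ∀ {n t} → n ∈ ω → t ∶ n ⟶ X → ∃[ s ] s ∈ finiteSubsets × (∀ i x → t [ i ]= x → x ∈ s)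
   fin-range {n} {t} nω = ω-ind (∀ᶠ isMap v0 v1 v2 ⇒ᶠ (∃ᶠ v0 ∈ᶠ v4 ∧ᶠ (∀ᶠ ∀ᶠ v3 [ v1 ]ᶠ= v0 ⇒ᶠ v0 ∈ᶠ v2))) (X ∷ finiteSubsets ∷ [])
     (λ t T → ∅ , fin-∅ , λ i x p → ⊥-elim (∉∅ (dom (proj₁ T) p)))
     (λ n nω h t T → let (s , s∈ , k) = h (restrict t n) (restrict-map T (λ i p → ∈succ (inj₁ p)))
                         (x , p) = value (proj₁ T) (∈succ (inj₂ refl))
                     in s ∪ singleton x , fin-insert s∈ (proj₂ T n x p) , λ i z q →
                        [ (λ i∈ → ∈∪ (inj₁ (k i z (restrict-at i∈ q))))
                        , (λ e → ∈∪ (inj₂ (subst (_∈ singleton x) (functional (proj₁ T) p (subst (λ i → t [ i ]= z) e q)) ∈⁅⁆₁))) ]′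
                        (∈succ⁻ (dom (proj₁ T) q)))
     n nω t

 one : 𝕍
 one = succ ∅

 ¬even-1 : ¬ Even one
 ¬even-1 (m , mω , h) = [ (λ e → succ≢∅ (trans (sym (m+m≡1 (∈ω mω))) (trans (cong (λ m → m + m) e) (+-0 0∈ω))))
   , (λ (j , jω , e) → succ≢∅ (succ-injective (trans (sym (step jω)) (trans (cong (λ m → m + m) (sym e)) (m+m≡1 (∈ω mω)))))) ]′ (ω-cases (∈ω mω))
   where
   m+m≡1 : m ∈ ω → m + m ≡ one
   m+m≡1 p = Add⇒+ p p h
   step : ∀ {j} → j ∈ ω → succ j + succ j ≡ succ (succ (j + j))
   step jω = trans (+-s (s∈ω jω) jω) (cong succ (s+ jω jω))

 _▹_↦_ : 𝕍 → 𝕍 → 𝕍 → 𝕍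
 f ▹ n ↦ y = f ∪ ⁅ ⟨ n , y ⟩ , ⟨ n , y ⟩ ⁆

 module _ {f n y : 𝕍} where
   ▹-new : (f ▹ n ↦ y) [ n ]= y
   ▹-new = ∈∪ (inj₂ ∈⁅⁆₁)

   ▹-old : f ⊆ f ▹ n ↦ y
   ▹-old _ p = ∈∪ (inj₁ p)

   ▹-split : ∀ {i z} → (f ▹ n ↦ y) [ i ]= z → f [ i ]= z ⊎ (i ≡ n × z ≡ y)
   ▹-split p = [ inj₁ , (λ q → inj₂ (⟨⟩-injective (∈⁅a⁆ q))) ]′ (∈∪⁻ p)

   ▹-function : IsFunctionOn f n → IsFunctionOn (f ▹ n ↦ y) (succ n)
   ▹-function F = isFunctionOn-intro
     (λ p q → [ (λ r → let (x , z , e , x∈) = proj₁ F p r in x , z , e , ∈succ (inj₁ x∈))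
              , (λ r → n , y , ∈⁅a⁆ r , ∈succ (inj₂ refl)) ]′ (∈∪⁻ q))
     (λ x p → [ (λ x∈ → let (z , q) = value F x∈ in z , ∈∪ (inj₁ q)) , (λ e → y , subst (λ x → (f ▹ n ↦ y) [ x ]= y) (sym e) ▹-new) ]′ (∈succ⁻ p))
     (λ x z z′ p q → unique (▹-split p) (▹-split q))
     where
     unique : ∀ {x z z′} → f [ x ]= z ⊎ (x ≡ n × z ≡ y) → f [ x ]= z′ ⊎ (x ≡ n × z′ ≡ y) → z ≡ z′
     unique (inj₁ p) (inj₁ q) = functional F p q
     unique (inj₁ p) (inj₂ (e , _)) = ⊥-elim (∈-irrefl (subst (_∈ n) e (dom F p)))
     unique (inj₂ (e , _)) (inj₁ q) = ⊥-elim (∈-irrefl (subst (_∈ n) e (dom F q)))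
     unique (inj₂ (_ , e)) (inj₂ (_ , e′)) = trans e (sym e′)

   ▹-map : ∀ {b} → f ∶ n ⟶ b → y ∈ b → f ▹ n ↦ y ∶ succ n ⟶ b
   ▹-map {b} F y∈ = ▹-function (proj₁ F) , λ x z p → [ proj₂ F x z , (λ (_ , e) → subst (_∈ b) (sym e) y∈) ]′ (▹-split p)

 infinite⇒ω⊆ : ∀ {κ} → IsOrdinal κ → ⟦ infinite v0 ⟧ (κ ∷ []) → ω ⊆ κ
 infinite⇒ω⊆ {κ} ordinal h = ω⊆infinite ordinal λ n p e →
   let (g , G) = Domain.identity-permutation n in
   h n g (∈ω⁻ p) (subst (IsBijection g n) e G)

 opaque
   unfolding isConjunctionSetᶠ
   conjunctionSet-unique : ∀ {X 𝓛 a c A B} → ⟦ isConjunctionSet v0 v1 v2 v3 v4 ⟧ (X ∷ 𝓛 ∷ a ∷ c ∷ A ∷ []) →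
     ⟦ isConjunctionSet v0 v1 v2 v3 v4 ⟧ (X ∷ 𝓛 ∷ a ∷ c ∷ B ∷ []) → A ≡ B
   conjunctionSet-unique h k = ext (λ M p → from (k M) (to (h M) p)) (λ M p → from (h M) (to (k M) p))

 record Signature : Set ℓ where
   field
     κ X 𝓛 : 𝕍
     language : IsRelationalLanguage 𝓛
     κ-ordinal : IsOrdinal κ
     ω⊆κ : ω ⊆ κ

 module Space (𝓢 : Signature) where
  open Signature 𝓢

  Symbols : 𝕍
  Symbols = proj₁ language

  arity-function : IsFunctionOn 𝓛 Symbols
  arity-function = proj₁ (proj₂ language)

  arity∈ω : ∀ {R n} → 𝓛 [ R ]= n → n ∈ ω
  arity∈ω p = ∈ω (proj₂ (proj₂ language) _ _ p)

  tuples : 𝕍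
  tuples = 𝒫 (ω ⊗ X)

  map∈tuples : ∀ {n t} → n ∈ ω → t ∶ n ⟶ X → t ∈ tuples
  map∈tuples {n} {t} nω T = ∈𝒫 λ p q → inside (proj₁ (proj₁ T) p q) q
    where
    inside : ∀ {p} → (∃[ x ] ∃[ y ] p ≡ ⟨ x , y ⟩ × x ∈ n) → p ∈ t → p ∈ ω ⊗ X
    inside (x , y , refl , x∈) q = ∈⊗ (ω-transitive nω x∈) (proj₂ T x y q)

  IsAtom : 𝕍 → 𝕍 → Set ℓ
  IsAtom R t = ∃[ n ] 𝓛 [ R ]= n × t ∶ n ⟶ X

  atomᶠ : Fm 3
  atomᶠ = ∃ᶠ ∃ᶠ ∃ᶠ v3 ≈ᶠ ⟨ v2 , v1 ⟩ᵗ ∧ᶠ v5 [ v2 ]ᶠ= v0 ∧ᶠ isMap v1 v0 v4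

  Atoms : 𝕍
  Atoms = sep atomᶠ (X ∷ 𝓛 ∷ []) (Symbols ⊗ tuples)

  ∈Atoms : ∀ {R t} → IsAtom R t → ⟨ R , t ⟩ ∈ Atoms
  ∈Atoms {R} {t} (n , p , T) = ∈sep atomᶠ (X ∷ 𝓛 ∷ []) (∈⊗ (dom arity-function p) (map∈tuples (arity∈ω p) T)) (R , t , n , refl , p , T)

  ∈Atoms⁻ : ∀ {p} → p ∈ Atoms → ∃[ R ] ∃[ t ] p ≡ ⟨ R , t ⟩ × IsAtom R t
  ∈Atoms⁻ q = let (_ , R , t , n , e , p , T) = ∈sep⁻ atomᶠ (X ∷ 𝓛 ∷ []) q in R , t , e , n , p , T

  ⟨⟩∈Atoms⁻ : ∀ {R t} → ⟨ R , t ⟩ ∈ Atoms → IsAtom R t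
  ⟨⟩∈Atoms⁻ q = let (R , t , e , a) = ∈Atoms⁻ q ; (e₁ , e₂) = ⟨⟩-injective e in
    subst₂ IsAtom (sym e₁) (sym e₂) a

  Holds : 𝕍 → 𝕍 → 𝕍 → Set ℓ
  Holds M R t = ∃[ P ] M [ R ]= P × t ∈ P

  opaque
    IsStructure : 𝕍 → Set ℓ
    IsStructure M = ⟦ isStructure v0 v1 v2 ⟧ (X ∷ 𝓛 ∷ M ∷ [])

    structure-def : ∀ M → IsStructure M ⇔ ⟦ isStructure v0 v1 v2 ⟧ (X ∷ 𝓛 ∷ M ∷ [])
    structure-def M = ≡⇒⇔ refl

  opaque
    unfolding IsStructure isStructureᶠ

    structure-spec : ∀ M → IsStructure M ⇔
      ((∀ p → p ∈ M → ∃[ R ] ∃[ n ] ∃[ P ] p ≡ ⟨ R , P ⟩ × 𝓛 [ R ]= n) ×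
       (∀ R n → 𝓛 [ R ]= n → ∃[ P ] M [ R ]= P × (∀ Q → M [ R ]= Q → Q ≡ P) × (∀ t → t ∈ P → t ∶ n ⟶ X)))
    structure-spec M = ≡⇒⇔ refl

  module _ {M} (S : IsStructure M) where
    private
      parts = to (structure-spec M) S

    relation-unique : ∀ {R P Q} → M [ R ]= P → M [ R ]= Q → P ≡ Q
    relation-unique {R} p q = let (R′ , n , P′ , e , r) = proj₁ parts _ p
                                  (_ , _ , u , _) = proj₂ parts R n (subst (λ R → 𝓛 [ R ]= n) (sym (proj₁ (⟨⟩-injective e))) r)
                              in trans (u _ p) (sym (u _ q))

    holds-atom : ∀ {R t} → Holds M R t → IsAtom R t
    holds-atom {R} {t} (P , p , q) =
      let (R′ , n , P′ , e , r) = proj₁ parts _ p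
          r′ = subst (λ R → 𝓛 [ R ]= n) (sym (proj₁ (⟨⟩-injective e))) r
          (P″ , p″ , u , m) = proj₂ parts R n r′
      in n , r′ , m t (subst (t ∈_) (relation-unique p p″) q)

    structure∈ : M ∈ 𝒫 (Symbols ⊗ 𝒫 tuples)
    structure∈ = ∈𝒫 λ p q → let (R , n , P , e , r) = proj₁ parts p q in
      subst (_∈ Symbols ⊗ 𝒫 tuples) (sym e) (∈⊗ (dom arity-function r)
        (∈𝒫 λ t t∈ → let (n , r , T) = holds-atom (P , subst (_∈ M) e q , t∈) in map∈tuples (arity∈ω r) T))

  Str : 𝕍
  Str = sep (isStructure v1 v2 v0) (X ∷ 𝓛 ∷ []) (𝒫 (Symbols ⊗ 𝒫 tuples))

  ∈Str : ∀ {M} → IsStructure M → M ∈ Str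
  ∈Str {M} S = ∈sep (isStructure v1 v2 v0) (X ∷ 𝓛 ∷ []) (structure∈ S) (to (structure-def M) S)

  ∈Str⁻ : ∀ {M} → M ∈ Str → IsStructure M
  ∈Str⁻ {M} p = from (structure-def M) (proj₂ (∈sep⁻ (isStructure v1 v2 v0) (X ∷ 𝓛 ∷ []) p))

  structure-ext : ∀ {M N} → M ∈ Str → N ∈ Str → (∀ R t → IsAtom R t → Holds M R t → Holds N R t) →
    (∀ R t → IsAtom R t → Holds N R t → Holds M R t) → M ≡ N
  structure-ext p q h k = ext (one-way (∈Str⁻ p) (∈Str⁻ q) h k) (one-way (∈Str⁻ q) (∈Str⁻ p) k h)
    where
    one-way : ∀ {M N} → IsStructure M → IsStructure N → (∀ R t → IsAtom R t → Holds M R t → Holds N R t) →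
      (∀ R t → IsAtom R t → Holds N R t → Holds M R t) → ∀ p → p ∈ M → p ∈ N
    one-way {M} {N} S T h k p q =
      let (R , n , P , e , r) = proj₁ (to (structure-spec M) S) p q
          q′ = subst (_∈ M) e q
          (Q , s , _) = proj₂ (to (structure-spec N) T) R n r
          P≡Q = ext (λ t t∈ → let (Q′ , s′ , t∈Q′) = h R t (holds-atom S (P , q′ , t∈)) (P , q′ , t∈) in
                                subst (t ∈_) (relation-unique T s′ s) t∈Q′)
                    (λ t t∈ → let (P′ , q″ , t∈P′) = k R t (holds-atom T (Q , s , t∈)) (Q , s , t∈) in
                                subst (t ∈_) (relation-unique S q″ q′) t∈P′)
      in subst (_∈ N) (sym (trans e (cong ⟨ R ,_⟩ P≡Q))) s

  -- The structure whose true atoms are those in S.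
  fromAtoms : 𝕍 → 𝕍
  fromAtoms S = graph (v0 ≈ᶠ compr (⟨ v1 , v0 ⟩ᵗ ∈ᶠ v2) (v1 ∷ v3 ∷ []) v4) (S ∷ tuples ∷ []) Symbols (𝒫 tuples)

  module _ {S} (S⊆ : S ⊆ Atoms) where
    private
      module G = Graph (v0 ≈ᶠ compr (⟨ v1 , v0 ⟩ᵗ ∈ᶠ v2) (v1 ∷ v3 ∷ []) v4) (S ∷ tuples ∷ []) Symbols (𝒫 tuples)
      section : 𝕍 → 𝕍
      section R = sep (⟨ v1 , v0 ⟩ᵗ ∈ᶠ v2) (R ∷ S ∷ []) tuples
      ∈section⁻ : ∀ {R t} → t ∈ section R → ⟨ R , t ⟩ ∈ S
      ∈section⁻ {R} p = proj₂ (∈sep⁻ (⟨ v1 , v0 ⟩ᵗ ∈ᶠ v2) (R ∷ S ∷ []) p)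
      ∈section : ∀ {R t} → ⟨ R , t ⟩ ∈ S → t ∈ section R
      ∈section {R} p = let (n , r , T) = ⟨⟩∈Atoms⁻ (S⊆ _ p) in
        ∈sep (⟨ v1 , v0 ⟩ᵗ ∈ᶠ v2) (R ∷ S ∷ []) (map∈tuples (arity∈ω r) T) p
      isMap′ : fromAtoms S ∶ Symbols ⟶ 𝒫 tuples
      isMap′ = G.fun-map
        (λ R p → section R , ∈𝒫 (λ t q → proj₁ (∈sep⁻ (⟨ v1 , v0 ⟩ᵗ ∈ᶠ v2) (R ∷ S ∷ []) q)) , refl)
        (λ R P Q p e e′ → trans e (sym e′))
      at : ∀ {R} → R ∈ Symbols → fromAtoms S [ R ]= section R
      at {R} p = let (P , q) = value (proj₁ isMap′) p in subst (λ P → fromAtoms S [ R ]= P) (proj₂ (proj₂ (G.fun-elim q))) q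

    fromAtoms-holds : ∀ {R t} → ⟨ R , t ⟩ ∈ S → Holds (fromAtoms S) R t
    fromAtoms-holds {R} p = section R , at (proj₁ (⟨⟩∈⊗⁻ (proj₁ (∈sep⁻ atomᶠ (X ∷ 𝓛 ∷ []) (S⊆ _ p))))) , ∈section p

    fromAtoms-holds⁻ : ∀ {R t} → Holds (fromAtoms S) R t → ⟨ R , t ⟩ ∈ S
    fromAtoms-holds⁻ {R} {t} (P , p , q) = ∈section⁻ (subst (t ∈_) (proj₂ (proj₂ (G.fun-elim p))) q)

    fromAtoms∈Str : fromAtoms S ∈ Str
    fromAtoms∈Str = ∈Str (from (structure-spec (fromAtoms S))
      ( (λ p q → let (R , P , e , r) = G.fun-pairs p q ; (n , s) = value arity-function r in R , n , P , e , s)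
      , (λ R n r → section R , at (dom arity-function r) ,
          (λ Q q → proj₂ (proj₂ (G.fun-elim q))) ,
          λ t q → let (n′ , r′ , T) = ⟨⟩∈Atoms⁻ (S⊆ _ (∈section⁻ q)) in
            subst (λ n → t ∶ n ⟶ X) (functional arity-function r′ r) T)))

  -- The action of the symmetric group

  IsSym : 𝕍 → Set ℓ
  IsSym g = IsBijection g X X

  opaque
    IsAction : 𝕍 → 𝕍 → 𝕍 → Set ℓ
    IsAction g M N = ⟦ isAction v0 v1 v2 v3 v4 ⟧ (X ∷ 𝓛 ∷ g ∷ M ∷ N ∷ [])

  opaque
    unfolding IsAction isActionᶠ

    action-spec : ∀ g M N → IsAction g M N ⇔ (⟦ isStructure v0 v1 v2 ⟧ (X ∷ 𝓛 ∷ N ∷ []) ×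
      (∀ R n t u → 𝓛 [ R ]= n → t ∶ n ⟶ X → IsComposite u g t → Holds N R u ⇔ Holds M R t))
    action-spec g M N = ≡⇒⇔ refl

  module Action {g} (G : IsSym g) where

    action-Str : ∀ {M N} → IsAction g M N → N ∈ Str
    action-Str {M} {N} A = ∈Str (from (structure-def N) (proj₁ (to (action-spec g M N) A)))

    action-holds : ∀ {M N R t u} → IsAction g M N → IsAtom R t → IsComposite u g t → Holds N R u ⇔ Holds M R t
    action-holds {M} {N} A (n , r , T) c = proj₂ (to (action-spec g M N) A) _ n _ _ r T c

    action-intro : ∀ {M N} → N ∈ Str → (∀ R t u → IsAtom R t → IsComposite u g t → Holds N R u ⇔ Holds M R t) → IsAction g M N
    action-intro {M} {N} p h = from (action-spec g M N) (to (structure-def N) (∈Str⁻ p) ,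
      λ R n t u r T c → h R t u (n , r , T) c)

    atom-image : ∀ {R t} → IsAtom R t → ∃[ u ] IsAtom R u × IsComposite u g t
    atom-image (n , r , T) = let (u , U , c) = compose T (proj₁ G) in u , (n , r , U) , c

    act-surjective : ∀ {N} → N ∈ Str → ∃[ M ] M ∈ Str × IsAction g M N
    act-surjective {N} p = fromAtoms S , fromAtoms∈Str S⊆ , action-intro p λ R t u a c → mk⇔
        (λ h → fromAtoms-holds S⊆ (∈sep φ ρ (∈Atoms a) (R , t , u , refl , h , c)))
        (λ h → back c (fromAtoms-holds⁻ S⊆ h))
      where
      φ : Fm 3
      φ = ∃ᶠ ∃ᶠ ∃ᶠ v3 ≈ᶠ ⟨ v2 , v1 ⟩ᵗ ∧ᶠ holds v4 v2 v0 ∧ᶠ isComposite v0 v5 v1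
      ρ : Vec 𝕍 2
      ρ = N ∷ g ∷ []
      S : 𝕍
      S = sep φ ρ Atoms
      S⊆ : S ⊆ Atoms
      S⊆ x q = proj₁ (∈sep⁻ φ ρ q)
      back : ∀ {R t u} → IsComposite u g t → ⟨ R , t ⟩ ∈ S → Holds N R u
      back {R} {t} {u} c q = let (_ , R′ , t′ , u′ , e , h , c′) = ∈sep⁻ φ ρ q
                                 (e₁ , e₂) = ⟨⟩-injective e
                                 c″ = subst (λ t → IsComposite u′ g t) (sym e₂) c′
                             in subst₂ (Holds N) (sym e₁) (composite-unique {u′} {u} {g} {t} c″ c) h

    act-injective : ∀ {M M′ N} → M ∈ Str → M′ ∈ Str → IsAction g M N → IsAction g M′ N → M ≡ M′
    act-injective {N = N} p q A B = structure-ext p q (one-way A B) (one-way B A)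
      where
      one-way : ∀ {M M′} → IsAction g M N → IsAction g M′ N → ∀ R t → IsAtom R t → Holds M R t → Holds M′ R t
      one-way A B R t a h = let (u , _ , c) = atom-image a in to (action-holds B a c) (from (action-holds A a c) h)

  atomSet : 𝕍 → 𝕍 → 𝕍
  atomSet R t = sep (holds v0 v1 v2) (R ∷ t ∷ []) Str

  ∈atomSet : ∀ {M R t} → M ∈ Str → Holds M R t → M ∈ atomSet R t
  ∈atomSet {R = R} {t} p h = ∈sep (holds v0 v1 v2) (R ∷ t ∷ []) p h

  ∈atomSet⁻ : ∀ {M R t} → M ∈ atomSet R t → M ∈ Str × Holds M R t
  ∈atomSet⁻ {R = R} {t} p = ∈sep⁻ (holds v0 v1 v2) (R ∷ t ∷ []) p

  opaque
    SatAtomic SatLiteral : 𝕍 → 𝕍 → 𝕍 → Set ℓ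
    SatAtomic M a α  = ⟦ satAtomic v0 v1 v2 ⟧ (M ∷ a ∷ α ∷ [])
    SatLiteral M a φ = ⟦ satLiteral v0 v1 v2 ⟧ (M ∷ a ∷ φ ∷ [])

    satAtomic-spec : ∀ M a α → SatAtomic M a α ⇔
      ((∃[ i ] ∃[ j ] ∃[ x ] α ≡ ⟨ ∅ , ⟨ i , j ⟩ ⟩ × a [ i ]= x × a [ j ]= x) ⊎
       (∃[ R ] ∃[ s ] ∃[ t ] α ≡ ⟨ succ ∅ , ⟨ R , s ⟩ ⟩ × IsComposite t a s × Holds M R t))
    satAtomic-spec M a α = ≡⇒⇔ refl

    satLiteral-spec : ∀ M a φ → SatLiteral M a φ ⇔ (∃[ k ] ∃[ α ] φ ≡ ⟨ k , α ⟩ × (Even k ⇔ SatAtomic M a α))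
    satLiteral-spec M a φ = ≡⇒⇔ refl

    IsAtomic : 𝕍 → 𝕍 → Set ℓ
    IsAtomic n α = ⟦ isAtomic v0 v1 v2 ⟧ (𝓛 ∷ n ∷ α ∷ [])

    atomic-spec : ∀ n α → IsAtomic n α ⇔
      ((∃[ i ] ∃[ j ] α ≡ ⟨ ∅ , ⟨ i , j ⟩ ⟩ × i ∈ n × j ∈ n) ⊎
       (∃[ R ] ∃[ s ] ∃[ m ] α ≡ ⟨ succ ∅ , ⟨ R , s ⟩ ⟩ × 𝓛 [ R ]= m × s ∶ m ⟶ n))
    atomic-spec n α = ≡⇒⇔ refl

  opaque
    IsLiteralSet : 𝕍 → Set ℓ
    IsLiteralSet A = ⟦ isLiteralSet v0 v1 v2 ⟧ (X ∷ 𝓛 ∷ A ∷ [])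

    literalSet-def : ∀ A → IsLiteralSet A ⇔ ⟦ isLiteralSet v0 v1 v2 ⟧ (X ∷ 𝓛 ∷ A ∷ [])
    literalSet-def A = ≡⇒⇔ refl

  opaque
    unfolding SatLiteral IsLiteralSet isLiteralSetᶠ

    literalSet-spec : ∀ A → IsLiteralSet A ⇔ (∃[ n ] ∃[ a ] ∃[ φ ] (IsNat n × a ∶ n ⟶ X) ×
      (∃[ k ] ∃[ α ] φ ≡ ⟨ k , α ⟩ × IsNat k × IsAtomic n α) ×
      (∀ M → M ∈ A ⇔ (⟦ isStructure v0 v1 v2 ⟧ (X ∷ 𝓛 ∷ M ∷ []) × SatLiteral M a φ)))
    literalSet-spec A = ≡⇒⇔ refl

  satLiteral⇔ : ∀ {M a φ k α} → φ ≡ ⟨ k , α ⟩ → SatLiteral M a φ ⇔ (Even k ⇔ SatAtomic M a α)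
  satLiteral⇔ {M} {a} {φ} {k} {α} e = mk⇔
    (λ s → let (k′ , α′ , e′ , h) = to (satLiteral-spec M a φ) s ; (e₁ , e₂) = ⟨⟩-injective (trans (sym e′) e) in
      subst₂ (λ k α → Even k ⇔ SatAtomic M a α) e₁ e₂ h)
    (λ h → from (satLiteral-spec M a φ) (k , α , e , h))

  satEquality⇔ : ∀ {M a α i j} → α ≡ ⟨ ∅ , ⟨ i , j ⟩ ⟩ → SatAtomic M a α ⇔ (∃[ x ] a [ i ]= x × a [ j ]= x)
  satEquality⇔ {M} {a} {α} {i} {j} e = mk⇔
    (λ s → [ (λ (i′ , j′ , x , e′ , p , q) → let (e₁ , e₂) = ⟨⟩-injective (proj₂ (⟨⟩-injective (trans (sym e′) e))) in
               x , subst (λ i → a [ i ]= x) e₁ p , subst (λ i → a [ i ]= x) e₂ q)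
           , (λ (R , s , t , e′ , _) → ⊥-elim (succ≢∅ (proj₁ (⟨⟩-injective (trans (sym e′) e))))) ]′ (to (satAtomic-spec M a α) s))
    (λ (x , p , q) → from (satAtomic-spec M a α) (inj₁ (i , j , x , e , p , q)))

  satRelation⇔ : ∀ {M a α R s t} → α ≡ ⟨ succ ∅ , ⟨ R , s ⟩ ⟩ → IsComposite t a s → SatAtomic M a α ⇔ Holds M R t
  satRelation⇔ {M} {a} {α} {R} {s} {t} e c = mk⇔
    (λ s → [ (λ (i′ , j′ , x , e′ , p , q) → ⊥-elim (succ≢∅ (proj₁ (⟨⟩-injective (trans (sym e) e′)))))
           , (λ (R′ , s′ , t′ , e′ , c′ , h) → relation-case (⟨⟩-injective (proj₂ (⟨⟩-injective (trans (sym e′) e)))) c′ h) ]′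
           (to (satAtomic-spec M a α) s))
    (λ h → from (satAtomic-spec M a α) (inj₂ (R , s , t , e , c , h)))
    where
    relation-case : ∀ {R′ s′ t′} → R′ ≡ R × s′ ≡ s → IsComposite t′ a s′ → Holds M R′ t′ → Holds M R t
    relation-case {t′ = t′} (refl , refl) c′ h = subst (Holds M R) (composite-unique {t′} {t} {a} {s} c′ c) h

  atom-literalSet : ∀ {R t} → IsAtom R t → IsLiteralSet (atomSet R t)
  atom-literalSet {R} {t} (n , r , T) = from (literalSet-spec _) (n , t , φ , (∈ω⁻ (arity∈ω r) , T) ,
      (∅ , α , refl , ∈ω⁻ 0∈ω , from (atomic-spec n α) (inj₂ (R , s , n , refl , r , proj₁ (proj₂ ident)))) ,
      λ M → mk⇔
        (λ p → let (q , h) = ∈atomSet⁻ p in to (structure-def M) (∈Str⁻ q) ,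
          from (satLiteral⇔ {M} {t} {φ} refl) (mk⇔ (λ _ → from (satRelation⇔ refl c) h) (λ _ → even-∅)))
        (λ (S , h) → ∈atomSet (∈Str (from (structure-def M) S)) (to (satRelation⇔ refl c) (to (to (satLiteral⇔ {M} {t} {φ} refl) h) even-∅))))
    where
    ident = identity n
    s α φ : 𝕍
    s = proj₁ ident
    α = ⟨ succ ∅ , ⟨ R , s ⟩ ⟩
    φ = ⟨ ∅ , α ⟩
    c : IsComposite t t s
    c p = mk⇔ (λ q → forth (proj₁ (proj₁ T) p q) q)
      (λ { (x , y , z , refl , q , r) → subst (λ x → t [ x ]= z) (proj₂ (proj₂ (proj₂ ident)) x y q) r })
      where
      forth : ∀ {p} → (∃[ x ] ∃[ z ] p ≡ ⟨ x , z ⟩ × x ∈ n) → p ∈ t → ∃[ x ] ∃[ y ] ∃[ z ] p ≡ ⟨ x , z ⟩ × s [ x ]= y × t [ y ]= z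
      forth (x , z , refl , x∈) q = x , x , z , refl , proj₁ (proj₂ (proj₂ ident)) x x∈ , q

  literalSet-cases : ∀ {A} → IsLiteralSet A →
    A ≡ ∅ ⊎ A ≡ Str ⊎ (∃[ R ] ∃[ t ] IsAtom R t × (A ≡ atomSet R t ⊎ A ≡ Str ∖ atomSet R t))
  literalSet-cases {A} L =
    let (n , a , φ , (nω , T) , (k , α , e , _ , at) , h) = to (literalSet-spec A) L in
    [ (λ (i , j , e′ , _) → constant e e′ h) , (λ (R , s , m , e′ , r , S) → relation (proj₁ T) e e′ h
        (let (t , T′ , c) = compose S T in t , (m , r , T′) , c)) ]′ (to (atomic-spec n α) at)
    where
    Spec : 𝕍 → 𝕍 → Set ℓ
    Spec a φ = ∀ M → M ∈ A ⇔ (⟦ isStructure v0 v1 v2 ⟧ (X ∷ 𝓛 ∷ M ∷ []) × SatLiteral M a φ)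
    Result : Set ℓ
    Result = A ≡ ∅ ⊎ A ≡ Str ⊎ (∃[ R ] ∃[ t ] IsAtom R t × (A ≡ atomSet R t ⊎ A ≡ Str ∖ atomSet R t))
    A⊆ : ∀ {a φ} → Spec a φ → ∀ M → M ∈ A → M ∈ Str
    A⊆ h M p = ∈Str (from (structure-def M) (proj₁ (to (h M) p)))
    A∋ : ∀ {a φ M} → Spec a φ → M ∈ Str → SatLiteral M a φ → M ∈ A
    A∋ {M = M} h p s = from (h M) (to (structure-def M) (∈Str⁻ p) , s)
    constant : ∀ {a φ k α i j} → φ ≡ ⟨ k , α ⟩ → α ≡ ⟨ ∅ , ⟨ i , j ⟩ ⟩ → Spec a φ → Result
    constant {a} {φ} {k} {α} {i} {j} e e′ h with dec (Even k ⇔ (∃[ x ] a [ i ]= x × a [ j ]= x))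
    ... | yes q = inj₂ (inj₁ (ext (A⊆ h) λ M p → A∋ h p (from (satLiteral⇔ e)
      (mk⇔ (λ ev → from (satEquality⇔ e′) (to q ev)) (λ s → from q (to (satEquality⇔ e′) s))))))
    ... | no ¬q = inj₁ (≡∅ λ M p → let s = to (satLiteral⇔ e) (proj₂ (to (h M) p)) in
                    ¬q (mk⇔ (λ ev → to (satEquality⇔ e′) (to s ev)) (λ x → from s (from (satEquality⇔ e′) x))))
    relation : ∀ {a φ k α n R s} → IsFunctionOn a n → φ ≡ ⟨ k , α ⟩ → α ≡ ⟨ succ ∅ , ⟨ R , s ⟩ ⟩ → Spec a φ →
      (∃[ t ] IsAtom R t × IsComposite t a s) → Result
    relation {k = k} {R = R} F e e′ h (t , at , c) with dec (Even k)
    ... | yes ev = inj₂ (inj₂ (R , t , at , inj₁ (ext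
            (λ M p → ∈atomSet (A⊆ h M p) (to (satRelation⇔ e′ c) (to (to (satLiteral⇔ e) (proj₂ (to (h M) p))) ev)))
            (λ M p → let (q , r) = ∈atomSet⁻ p in A∋ h q (from (satLiteral⇔ e)
               (mk⇔ (λ _ → from (satRelation⇔ e′ c) r) (λ _ → ev)))))))
    ... | no ¬ev = inj₂ (inj₂ (R , t , at , inj₂ (ext
            (λ M p → ∈∖ (A⊆ h M p) (λ q → ¬ev (from (to (satLiteral⇔ e) (proj₂ (to (h M) p))) (from (satRelation⇔ e′ c) (proj₂ (∈atomSet⁻ q))))))
            (λ M p → let (q , r) = ∈∖⁻ p in A∋ h q (from (satLiteral⇔ e)
               (mk⇔ (λ ev → ⊥-elim (¬ev ev)) (λ s → ⊥-elim (r (∈atomSet q (to (satRelation⇔ e′ c) s))))))))))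

  opaque
    IsClosedFamily Measurable : 𝕍 → Set ℓ
    IsClosedFamily F = ⟦ isClosedFamily v0 v1 v2 v3 ⟧ (κ ∷ X ∷ 𝓛 ∷ F ∷ [])
    Measurable A     = ⟦ measurable v0 v1 v2 v3 ⟧ (κ ∷ X ∷ 𝓛 ∷ A ∷ [])

    measurable-def : ∀ A → Measurable A ⇔ ⟦ measurable v0 v1 v2 v3 ⟧ (κ ∷ X ∷ 𝓛 ∷ A ∷ [])
    measurable-def A = ≡⇒⇔ refl

  opaque
    unfolding Measurable measurableᶠ

    measurable-spec : ∀ A → Measurable A ⇔ (∀ F → IsClosedFamily F → A ∈ F)
    measurable-spec A = ≡⇒⇔ refl

  opaque
    unfolding IsClosedFamily isClosedFamilyᶠ

    private
      IsStructureᶠ : 𝕍 → Set ℓ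
      IsStructureᶠ M = ⟦ isStructure v0 v1 v2 ⟧ (X ∷ 𝓛 ∷ M ∷ [])
      IsLiteralSetᶠ : 𝕍 → Set ℓ
      IsLiteralSetᶠ A = ⟦ isLiteralSet v0 v1 v2 ⟧ (X ∷ 𝓛 ∷ A ∷ [])

    closedFamily-unfold : ∀ F → IsClosedFamily F ⇔
      ((∀ A → A ∈ F → ∀ M → M ∈ A → IsStructureᶠ M) ×
       (∀ A → IsLiteralSetᶠ A → A ∈ F) ×
       (∀ A B → A ∈ F → (∀ M → M ∈ B ⇔ (IsStructureᶠ M × ¬ M ∈ A)) → B ∈ F) ×
       (∀ G g B → G ⊆ F → g ∶ G ⟶ κ → Injective g → (∀ M → M ∈ B ⇔ (∃[ A ] A ∈ G × M ∈ A)) → B ∈ F))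
    closedFamily-unfold F = ≡⇒⇔ refl

    closedFamily-spec : ∀ F → IsClosedFamily F ⇔
      ((∀ A → A ∈ F → A ⊆ Str) ×
       (∀ A → IsLiteralSet A → A ∈ F) ×
       (∀ A → A ∈ F → Str ∖ A ∈ F) ×
       (∀ G g → G ⊆ F → g ∶ G ⟶ κ → Injective g → ⋃ G ∈ F))
    closedFamily-spec F = mk⇔
      (λ c → let (s , l , k , u) = to (closedFamily-unfold F) c in
        (λ A p M q → ∈Str (from (structure-def M) (s A p M q))) ,
        (λ A L → l A (to (literalSet-def A) L)) ,
        (λ A p → k A (Str ∖ A) p λ M → mk⇔
          (λ q → to (structure-def M) (∈Str⁻ (proj₁ (∈∖⁻ q))) , proj₂ (∈∖⁻ q))
          (λ (q , r) → ∈∖ (∈Str (from (structure-def M) q)) r)) ,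
        (λ G g p q r → u G g (⋃ G) p q r λ M → mk⇔ ∈⋃⁻ (λ (A , s , t) → ∈⋃ s t)))
      (λ (s , l , k , u) → from (closedFamily-unfold F)
        ((λ A p M q → to (structure-def M) (∈Str⁻ (s A p M q))) ,
        (λ A L → l A (from (literalSet-def A) L)) ,
        (λ A B p h → subst (_∈ F) (ext
          (λ M q → let (r , t) = ∈∖⁻ q in from (h M) (to (structure-def M) (∈Str⁻ r) , t))
          (λ M q → let (r , t) = to (h M) q in ∈∖ (∈Str (from (structure-def M) r)) t)) (k A p)) ,
        (λ G g B p q r h → subst (_∈ F) (ext
          (λ M s → from (h M) (∈⋃⁻ s)) (λ M s → let (A , t , t′) = to (h M) s in ∈⋃ t t′)) (u G g p q r))))

  closed-family : ∀ {F} → (∀ A → A ∈ F → A ⊆ Str) → (∀ R t → IsAtom R t → atomSet R t ∈ F) →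
    (∀ A → A ∈ F → Str ∖ A ∈ F) → (∀ G g → G ⊆ F → g ∶ G ⟶ κ → Injective g → ⋃ G ∈ F) → IsClosedFamily F
  closed-family {F} s l k u = from (closedFamily-spec F) (s ,
    (λ A L → [ (λ e → subst (_∈ F) (sym e) ∅∈)
             , [ (λ e → subst (_∈ F) (trans (ext (λ M q → proj₁ (∈∖⁻ q)) (λ M q → ∈∖ q ∉∅)) (sym e)) (k ∅ ∅∈))
             , (λ (R , t , a , h) → [ (λ e → subst (_∈ F) (sym e) (l R t a)) , (λ e → subst (_∈ F) (sym e) (k _ (l R t a))) ]′ h) ]′ ]′
             (literalSet-cases L)) , k , u)
    where
    empty-map : ∅ ∶ ∅ ⟶ κ
    empty-map = isFunctionOn-intro (λ p q → ⊥-elim (∉∅ q)) (λ x q → ⊥-elim (∉∅ q)) (λ x y z q → ⊥-elim (∉∅ q)) , λ x y q → ⊥-elim (∉∅ q)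
    ∅∈ : ∅ ∈ F
    ∅∈ = subst (_∈ F) (≡∅ λ M q → let (A , r , _) = ∈⋃⁻ q in ∉∅ r)
      (u ∅ ∅ (λ x q → ⊥-elim (∉∅ q)) empty-map (λ x y z q → ⊥-elim (∉∅ q)))

  Meas : 𝕍
  Meas = sep (measurable v1 v2 v3 v0) (κ ∷ X ∷ 𝓛 ∷ []) (𝒫 Str)

  private
    𝒫Str-closed : IsClosedFamily (𝒫 Str)
    𝒫Str-closed = closed-family (λ A p → ∈𝒫⁻ p) (λ R t a → ∈𝒫 λ M q → proj₁ (∈atomSet⁻ q))
      (λ A p → ∈𝒫 λ M q → proj₁ (∈∖⁻ q))
      (λ G g p _ _ → ∈𝒫 λ M q → let (A , r , s) = ∈⋃⁻ q in ∈𝒫⁻ (p A r) M s)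

  ∈Meas : ∀ {A} → Measurable A → A ∈ Meas
  ∈Meas {A} m = ∈sep (measurable v1 v2 v3 v0) (κ ∷ X ∷ 𝓛 ∷ []) (to (measurable-spec A) m (𝒫 Str) 𝒫Str-closed) (to (measurable-def A) m)

  ∈Meas⁻ : ∀ {A} → A ∈ Meas → Measurable A
  ∈Meas⁻ {A} p = from (measurable-def A) (proj₂ (∈sep⁻ (measurable v1 v2 v3 v0) (κ ∷ X ∷ 𝓛 ∷ []) p))

  meas⊆Str : ∀ {A} → A ∈ Meas → A ⊆ Str
  meas⊆Str p = ∈𝒫⁻ (proj₁ (∈sep⁻ (measurable v1 v2 v3 v0) (κ ∷ X ∷ 𝓛 ∷ []) p))

  private
    in-all : ∀ {A} → (∀ F → IsClosedFamily F → A ∈ F) → A ∈ Meas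
    in-all {A} h = ∈Meas (from (measurable-spec A) h)
    all-in : ∀ {A} → A ∈ Meas → ∀ F → IsClosedFamily F → A ∈ F
    all-in {A} p = to (measurable-spec A) (∈Meas⁻ p)

  meas-atom : ∀ {R t} → IsAtom R t → atomSet R t ∈ Meas
  meas-atom a = in-all λ F c → proj₁ (proj₂ (to (closedFamily-spec F) c)) _ (atom-literalSet a)

  meas-∁ : ∀ {A} → A ∈ Meas → Str ∖ A ∈ Meas
  meas-∁ p = in-all λ F c → proj₁ (proj₂ (proj₂ (to (closedFamily-spec F) c))) _ (all-in p F c)

  meas-⋃ : ∀ {G g} → G ⊆ Meas → g ∶ G ⟶ κ → Injective g → ⋃ G ∈ Meas
  meas-⋃ p q r = in-all λ F c → proj₂ (proj₂ (proj₂ (to (closedFamily-spec F) c))) _ _ (λ A s → all-in (p A s) F c) q r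

  meas-ind : ∀ {k} (φ : Fm (suc k)) (ρ : Vec 𝕍 k) →
    (∀ R t → IsAtom R t → ⟦ φ ⟧ (atomSet R t ∷ ρ)) →
    (∀ A → A ∈ Meas → ⟦ φ ⟧ (A ∷ ρ) → ⟦ φ ⟧ (Str ∖ A ∷ ρ)) →
    (∀ G g → G ⊆ Meas → (∀ A → A ∈ G → ⟦ φ ⟧ (A ∷ ρ)) → g ∶ G ⟶ κ → Injective g → ⟦ φ ⟧ (⋃ G ∷ ρ)) →
    ∀ A → A ∈ Meas → ⟦ φ ⟧ (A ∷ ρ)
  meas-ind φ ρ l k u A p = proj₂ (∈sep⁻ φ ρ (all-in p (sep φ ρ Meas) (closed-family
    (λ A q → meas⊆Str (proj₁ (∈sep⁻ φ ρ q)))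
    (λ R t a → ∈sep φ ρ (meas-atom a) (l R t a))
    (λ A q → let (q₁ , q₂) = ∈sep⁻ φ ρ q in ∈sep φ ρ (meas-∁ q₁) (k A q₁ q₂))
    (λ G g q r s → ∈sep φ ρ (meas-⋃ (λ A t → proj₁ (∈sep⁻ φ ρ (q A t))) r s)
      (u G g (λ A t → proj₁ (∈sep⁻ φ ρ (q A t))) (λ A t → proj₂ (∈sep⁻ φ ρ (q A t))) r s)))))

  range : 𝕍 → 𝕍 → 𝕍 → 𝕍
  range f I b = sep (∃ᶠ v0 ∈ᶠ v3 ∧ᶠ v2 [ v0 ]ᶠ= v1) (f ∷ I ∷ []) b

  ⋃[_] : 𝕍 → 𝕍
  ⋃[ f ] = sep (∃ᶠ ∃ᶠ v3 [ v1 ]ᶠ= v0 ∧ᶠ v2 ∈ᶠ v0) (f ∷ []) Str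

  ∈⋃[]⁻ : ∀ {f M} → M ∈ ⋃[ f ] → ∃[ i ] ∃[ A ] f [ i ]= A × M ∈ A
  ∈⋃[]⁻ {f} p = proj₂ (∈sep⁻ (∃ᶠ ∃ᶠ v3 [ v1 ]ᶠ= v0 ∧ᶠ v2 ∈ᶠ v0) (f ∷ []) p)

  module Indexed {f I} (I⊆κ : I ⊆ κ) (F : f ∶ I ⟶ Meas) where

    ∈⋃[] : ∀ {i A M} → f [ i ]= A → M ∈ A → M ∈ ⋃[ f ]
    ∈⋃[] {i} {A} p q = ∈sep (∃ᶠ ∃ᶠ v3 [ v1 ]ᶠ= v0 ∧ᶠ v2 ∈ᶠ v0) (f ∷ []) (meas⊆Str (proj₂ F i A p) _ q) (i , A , p , q)

    private
      G : 𝕍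
      G = range f I Meas
      rangeᶠ : Fm 3
      rangeᶠ = ∃ᶠ v0 ∈ᶠ v3 ∧ᶠ v2 [ v0 ]ᶠ= v1
      ∈G : ∀ {i A} → f [ i ]= A → A ∈ G
      ∈G {i} {A} p = ∈sep rangeᶠ (f ∷ I ∷ []) (proj₂ F i A p) (i , dom (proj₁ F) p , p)
      ∈G⁻ : ∀ {A} → A ∈ G → A ∈ Meas × (∃[ i ] i ∈ I × f [ i ]= A)
      ∈G⁻ p = ∈sep⁻ rangeᶠ (f ∷ I ∷ []) p
      leastᶠ : Fm 4
      leastᶠ = v3 [ v0 ]ᶠ= v1 ∧ᶠ (∀ᶠ v0 ∈ᶠ v1 ⇒ᶠ ¬ᶠ (v4 [ v0 ]ᶠ= v2))
      module L = Graph leastᶠ (f ∷ []) G κ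
      least-index : ∀ {A} → A ∈ G → ∃[ i ] i ∈ κ × f [ i ]= A × (∀ j → j ∈ i → ¬ f [ j ]= A)
      least-index {A} p =
        let (_ , i , i∈ , q) = ∈G⁻ p
            (m , m∈ , h) = least {sep (v1 [ v0 ]ᶠ= v2) (f ∷ A ∷ []) I} (∈sep (v1 [ v0 ]ᶠ= v2) (f ∷ A ∷ []) i∈ q)
            (m∈I , r) = ∈sep⁻ (v1 [ v0 ]ᶠ= v2) (f ∷ A ∷ []) m∈
        in m , I⊆κ m m∈I , r , λ j j∈ s → h j j∈ (∈sep (v1 [ v0 ]ᶠ= v2) (f ∷ A ∷ []) (dom (proj₁ F) s) s)
      least-unique : ∀ A i j → A ∈ G → i ∈ κ → j ∈ κ → f [ i ]= A × (∀ k → k ∈ i → ¬ f [ k ]= A) →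
        f [ j ]= A × (∀ k → k ∈ j → ¬ f [ k ]= A) → i ≡ j
      least-unique A i j _ i∈ j∈ (p , h) (q , k) = [ (λ r → ⊥-elim (k i r p)) , [ id , (λ r → ⊥-elim (h j r q)) ]′ ]′
        (trichotomy (proj₁ κ-ordinal) (proj₂ κ-ordinal) i j i∈ j∈)
      g-map : L.fun ∶ G ⟶ κ
      g-map = isFunctionOn-intro L.fun-pairs
        (λ A p → let (i , i∈ , q) = least-index p in i , L.fun-intro p i∈ q)
        (λ A i j p q → let (r , i∈ , s) = L.fun-elim p ; (_ , j∈ , t) = L.fun-elim q in least-unique A i j r i∈ j∈ s t)
        , λ A i p → proj₁ (proj₂ (L.fun-elim p))
      g-injective : Injective L.fun
      g-injective A B i p q = functional (proj₁ F) (proj₁ (proj₂ (proj₂ (L.fun-elim p)))) (proj₁ (proj₂ (proj₂ (L.fun-elim q))))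

    meas-⋃[] : ⋃[ f ] ∈ Meas
    meas-⋃[] = subst (_∈ Meas) (ext
      (λ M p → let (A , q , r) = ∈⋃⁻ p ; (_ , i , _ , s) = ∈G⁻ q in ∈⋃[] s r)
      (λ M p → let (i , A , q , r) = ∈⋃[]⁻ p in ∈⋃ (∈G q) r))
      (meas-⋃ {G} {L.fun} (λ A p → proj₁ (∈G⁻ p)) g-map g-injective)

  meas-∅ : ∅ ∈ Meas
  meas-∅ = subst (_∈ Meas) (≡∅ λ M q → let (A , r , _) = ∈⋃⁻ q in ∉∅ r)
    (meas-⋃ {∅} {∅} (λ x q → ⊥-elim (∉∅ q))
      (isFunctionOn-intro (λ p q → ⊥-elim (∉∅ q)) (λ x q → ⊥-elim (∉∅ q)) (λ x y z q → ⊥-elim (∉∅ q)) , λ x y q → ⊥-elim (∉∅ q))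
      (λ x y z q → ⊥-elim (∉∅ q)))

  meas-Str : Str ∈ Meas
  meas-Str = subst (_∈ Meas) (ext (λ M q → proj₁ (∈∖⁻ q)) (λ M q → ∈∖ q ∉∅)) (meas-∁ meas-∅)

  -- The sequence A, B, ∅, ∅, …
  module PairSequence {A B} (a : A ∈ Meas) (b : B ∈ Meas) where
    private
      φ : Fm 5
      φ = (v1 ≈ᶠ ∅ᵗ ∧ᶠ v0 ≈ᶠ v3) ∨ᶠ (v1 ≈ᶠ succᵗ ∅ᵗ ∧ᶠ v0 ≈ᶠ v4) ∨ᶠ
          (¬ᶠ (v1 ≈ᶠ ∅ᵗ) ∧ᶠ ¬ᶠ (v1 ≈ᶠ succᵗ ∅ᵗ) ∧ᶠ v0 ≈ᶠ ∅ᵗ)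
      module P = Graph φ (A ∷ B ∷ []) ω Meas
      Case : 𝕍 → 𝕍 → Set ℓ
      Case i C = (i ≡ ∅ × C ≡ A) ⊎ (i ≡ succ ∅ × C ≡ B) ⊎ (¬ i ≡ ∅ × ¬ i ≡ succ ∅ × C ≡ ∅)
      exists : ∀ i → ∃[ C ] C ∈ Meas × Case i C
      exists i with dec (i ≡ ∅) | dec (i ≡ succ ∅)
      ... | yes e | _ = A , a , inj₁ (e , refl)
      ... | no ne | yes e = B , b , inj₂ (inj₁ (e , refl))
      ... | no ne | no ne′ = ∅ , meas-∅ , inj₂ (inj₂ (ne , ne′ , refl))
      unique : ∀ {i C D} → Case i C → Case i D → C ≡ D
      unique (inj₁ (_ , refl)) (inj₁ (_ , refl)) = refl
      unique (inj₁ (refl , _)) (inj₂ (inj₁ (e , _))) = ⊥-elim (succ≢∅ (sym e))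
      unique (inj₁ (e , _)) (inj₂ (inj₂ (ne , _))) = ⊥-elim (ne e)
      unique (inj₂ (inj₁ (refl , _))) (inj₁ (e , _)) = ⊥-elim (succ≢∅ e)
      unique (inj₂ (inj₁ (_ , refl))) (inj₂ (inj₁ (_ , refl))) = refl
      unique (inj₂ (inj₁ (e , _))) (inj₂ (inj₂ (_ , ne , _))) = ⊥-elim (ne e)
      unique (inj₂ (inj₂ (ne , _))) (inj₁ (e , _)) = ⊥-elim (ne e)
      unique (inj₂ (inj₂ (_ , ne , _))) (inj₂ (inj₁ (e , _))) = ⊥-elim (ne e)
      unique (inj₂ (inj₂ (_ , _ , refl))) (inj₂ (inj₂ (_ , _ , refl))) = refl

    seq : 𝕍
    seq = P.fun

    seq-map : seq ∶ ω ⟶ Meas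
    seq-map = P.fun-map (λ i p → exists i) (λ i C D p → unique)

    seq-case : ∀ {i C} → seq [ i ]= C → Case i C
    seq-case p = proj₂ (proj₂ (P.fun-elim p))

    seq-0 : seq [ ∅ ]= A
    seq-0 = P.fun-intro 0∈ω a (inj₁ (refl , refl))

    seq-1 : seq [ succ ∅ ]= B
    seq-1 = P.fun-intro (s∈ω 0∈ω) b (inj₂ (inj₁ (refl , refl)))

    ⋃seq : ⋃[ seq ] ≡ A ∪ B
    ⋃seq = ext
      (λ M p → let (i , C , q , r) = ∈⋃[]⁻ p in ∈∪ (split (seq-case q) r))
      (λ M p → [ Indexed.∈⋃[] ω⊆κ seq-map seq-0 , Indexed.∈⋃[] ω⊆κ seq-map seq-1 ]′ (∈∪⁻ p))
      where
      split : ∀ {i C M} → Case i C → M ∈ C → M ∈ A ⊎ M ∈ B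
      split (inj₁ (_ , refl)) = inj₁
      split (inj₂ (inj₁ (_ , refl))) = inj₂
      split (inj₂ (inj₂ (_ , _ , refl))) p = ⊥-elim (∉∅ p)

  meas-∪ : ∀ {A B} → A ∈ Meas → B ∈ Meas → A ∪ B ∈ Meas
  meas-∪ a b = subst (_∈ Meas) ⋃seq (Indexed.meas-⋃[] ω⊆κ seq-map)
    where open PairSequence a b

  meas-∖ : ∀ {A B} → A ∈ Meas → B ∈ Meas → A ∖ B ∈ Meas
  meas-∖ {A} {B} a b = subst (_∈ Meas) (ext
    (λ M p → let (q , r) = ∈∖⁻ p in ∈∖ (by-contradiction λ q′ → r (∈∪ (inj₁ (∈∖ q q′)))) (λ s → r (∈∪ (inj₂ s))))
    (λ M p → let (q , r) = ∈∖⁻ p in ∈∖ (meas⊆Str a M q) (λ s → [ (λ t → proj₂ (∈∖⁻ t) q) , r ]′ (∈∪⁻ s))))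
    (meas-∁ (meas-∪ (meas-∁ a) b))

  meas-∩ : ∀ {A B} → A ∈ Meas → B ∈ Meas → A ∩ B ∈ Meas
  meas-∩ {A} {B} a b = subst (_∈ Meas) (ext
    (λ M p → let (q , r) = ∈∖⁻ p in ∈∩ q (by-contradiction λ s → r (∈∖ q s)))
    (λ M p → let (q , r) = ∈∩⁻ p in ∈∖ q (λ s → proj₂ (∈∖⁻ s) r)))
    (meas-∖ a (meas-∖ a b))

  Step : 𝕍 → 𝕍 → 𝕍 → 𝕍 → 𝕍 → 𝕍 → Set ℓ
  Step μ f e k r s = ∃[ i ] ∃[ v ] e [ k ]= i × (∃[ A ] f [ i ]= A × μ [ A ]= v) × AddReal r v s

  PartialSum : 𝕍 → 𝕍 → 𝕍 → 𝕍 → Set ℓ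
  PartialSum μ f I t = ∃[ n ] ∃[ e ] IsNat n × e ∶ n ⟶ I × Injective e × Iterate (Step μ f e) ∅ n t

  -- The two formulations of additivity: of the definition, and with the hypotheses in terms of Meas.
  Additive : 𝕍 → 𝕍 → Set ℓ
  Additive μ I = ∀ f → f ∶ I ⟶ Meas → (∀ i j A C M → f [ i ]= A → f [ j ]= C → M ∈ A → M ∈ C → i ≡ j) →
    ∀ r → μ [ ⋃[ f ] ]= r →
    (∀ t → PartialSum μ f I t → t ⊆ r) × (∀ s → IsReal s → (∀ t → PartialSum μ f I t → t ⊆ s) → r ⊆ s)

  AdditiveUnfolded : 𝕍 → 𝕍 → Set ℓ
  AdditiveUnfolded μ I = ∀ f B r → IsFunctionOn f I →
    (∀ i A → f [ i ]= A → Measurable A) → (∀ i j A C M → f [ i ]= A → f [ j ]= C → M ∈ A → M ∈ C → i ≡ j) →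
    (∀ M → M ∈ B ⇔ (∃[ i ] ∃[ A ] f [ i ]= A × M ∈ A)) → μ [ B ]= r →
    ⟦ isReal v0 ⟧ (r ∷ []) × (∀ t → PartialSum μ f I t → t ⊆ r) ×
    (∀ s → ⟦ isReal v0 ⟧ (s ∷ []) → (∀ t → PartialSum μ f I t → t ⊆ s) → r ⊆ s)

  opaque
    IsAdditive : 𝕍 → 𝕍 → Set ℓ
    IsAdditive μ I = ⟦ isAdditive v0 v1 v2 v3 v4 ⟧ (κ ∷ X ∷ 𝓛 ∷ μ ∷ I ∷ [])

    IsProbability : 𝕍 → Set ℓ
    IsProbability μ = ⟦ isProbabilityκMeasure v0 v1 v2 v3 ⟧ (κ ∷ X ∷ 𝓛 ∷ μ ∷ [])

    probability-def : ∀ μ → IsProbability μ ⇔ ⟦ isProbabilityκMeasure v0 v1 v2 v3 ⟧ (κ ∷ X ∷ 𝓛 ∷ μ ∷ [])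
    probability-def μ = ≡⇒⇔ refl

  opaque
    unfolding IsAdditive isAdditiveᶠ Measurable AddReal

    additive-unfold : ∀ μ I → IsAdditive μ I ⇔ AdditiveUnfolded μ I
    additive-unfold μ I = ≡⇒⇔ refl

  opaque
    unfolding IsAdditive IsProbability Measurable

    probability-unfold : ∀ μ → IsProbability μ ⇔
      ((∀ p → p ∈ μ → ∃[ A ] ∃[ r ] p ≡ ⟨ A , r ⟩ × Measurable A × ⟦ isReal v0 ⟧ (r ∷ [])) ×
       (∀ A → Measurable A → ∃[ r ] μ [ A ]= r × (∀ s → μ [ A ]= s → s ≡ r)) ×
       (∀ S r → (∀ M → M ∈ S ⇔ ⟦ isStructure v0 v1 v2 ⟧ (X ∷ 𝓛 ∷ M ∷ [])) → μ [ S ]= r → ⟦ isOne v0 ⟧ (r ∷ [])) ×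
       (∀ w → (∀ n → n ∈ w ⇔ IsNat n) → IsAdditive μ w) × IsAdditive μ κ)
    probability-unfold μ = ≡⇒⇔ refl

  additive-elim : ∀ {μ I} → I ⊆ κ → AdditiveUnfolded μ I → Additive μ I
  additive-elim {μ} {I} I⊆κ h f F d r p =
    let (_ , q , l) = h f ⋃[ f ] r (proj₁ F) (λ i A q → ∈Meas⁻ (proj₂ F i A q)) d
                        (λ M → mk⇔ ∈⋃[]⁻ (λ (i , A , q , s) → Indexed.∈⋃[] I⊆κ F q s)) p
    in q , λ s S → l s (to (isReal⇔ s) S)

  empty-⊆ : ∀ {t} → t ≡ ∅ → ∀ u → t ⊆ u
  empty-⊆ refl u x p = ⊥-elim (∉∅ p)

  record Measure (μ : 𝕍) : Set ℓ where
    field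
      μ-domain   : ∀ p → p ∈ μ → ∃[ A ] ∃[ r ] p ≡ ⟨ A , r ⟩ × A ∈ Meas × IsReal r
      μ-value    : ∀ A → A ∈ Meas → ∃[ r ] μ [ A ]= r
      μ-unique   : ∀ {A r s} → μ [ A ]= r → μ [ A ]= s → r ≡ s
      μ-total    : ∀ r → μ [ Str ]= r → ⟦ isOne v0 ⟧ (r ∷ [])
      ω-additive : Additive μ ω
      κ-additive : Additive μ κ

    μ-real : ∀ {A r} → μ [ A ]= r → IsReal r
    μ-real p = let (A , r , e , _ , R) = μ-domain _ p in subst IsReal (sym (proj₂ (⟨⟩-injective e))) R

  probability⇒measure : ∀ {μ} → IsProbability μ → Measure μ
  probability⇒measure {μ} P =
    let (d , f , t , σ , k) = to (probability-unfold μ) P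
    in record
      { μ-domain = λ p q → let (A , r , e , m , R) = d p q in A , r , e , ∈Meas m , from (isReal⇔ r) R
      ; μ-value = λ A m → let (r , p , _) = f A (∈Meas⁻ m) in r , p
      ; μ-unique = λ {A} {r} {s} p q → let (A′ , _ , e , m , _) = d _ p
                                           (_ , _ , u) = f A (subst Measurable (sym (proj₁ (⟨⟩-injective e))) m)
                                       in trans (u _ p) (sym (u _ q))
      ; μ-total = λ r p → t Str r (λ M → mk⇔ (λ q → to (structure-def M) (∈Str⁻ q)) (λ q → ∈Str (from (structure-def M) q))) p
      ; ω-additive = additive-elim ω⊆κ (to (additive-unfold μ ω) (σ ω λ n → mk⇔ ∈ω⁻ ∈ω))
      ; κ-additive = additive-elim (λ _ p → p) (to (additive-unfold μ κ) k)
      }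

  -- init f n is the union of the sets f(i) with i ∈ n.
  initᶠ : Fm 3
  initᶠ = ∃ᶠ ∃ᶠ v1 ∈ᶠ v4 ∧ᶠ v3 [ v1 ]ᶠ= v0 ∧ᶠ v2 ∈ᶠ v0

  init : 𝕍 → 𝕍 → 𝕍
  init f n = sep initᶠ (f ∷ n ∷ []) Str

  ∈init⁻ : ∀ {f n M} → M ∈ init f n → ∃[ i ] ∃[ A ] i ∈ n × f [ i ]= A × M ∈ A
  ∈init⁻ {f} {n} p = proj₂ (∈sep⁻ initᶠ (f ∷ n ∷ []) p)

  module Sequence {f I} (I⊆κ : I ⊆ κ) (F : f ∶ I ⟶ Meas) where
    open Indexed I⊆κ F public

    ∈init : ∀ {n i A M} → i ∈ n → f [ i ]= A → M ∈ A → M ∈ init f n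
    ∈init {n} {i} {A} p q r = ∈sep initᶠ (f ∷ n ∷ []) (meas⊆Str (proj₂ F i A q) _ r) (i , A , p , q , r)

    meas-init : ∀ {n} → n ⊆ I → init f n ∈ Meas
    meas-init {n} n⊆I = subst (_∈ Meas) (ext
      (λ M p → let (i , A , q , r) = ∈⋃[]⁻ p ; (s , t) = restrict-at⁻ q in ∈init s t r)
      (λ M p → let (i , A , s , t , r) = ∈init⁻ p in Indexed.∈⋃[] (λ x q → I⊆κ x (n⊆I x q)) (restrict-map F n⊆I) (restrict-at s t) r))
      (Indexed.meas-⋃[] (λ x q → I⊆κ x (n⊆I x q)) (restrict-map F n⊆I))

    least-index : ∀ {i A M} → f [ i ]= A → M ∈ A → ∃[ k ] ∃[ B ] f [ k ]= B × M ∈ B × ¬ M ∈ init f k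
    least-index {i} {A} {M} q r =
      let (k , k∈ , h) = least (∈sep φ ρ (dom (proj₁ F) q) (A , q , r))
          (k∈I , B , q′ , r′) = ∈sep⁻ φ ρ k∈
      in k , B , q′ , r′ , λ s → let (j , C , j∈ , t , u) = ∈init⁻ s in h j j∈ (∈sep φ ρ (dom (proj₁ F) t) (C , t , u))
      where
      φ : Fm 3
      φ = ∃ᶠ v2 [ v1 ]ᶠ= v0 ∧ᶠ v3 ∈ᶠ v0
      ρ : Vec 𝕍 2
      ρ = f ∷ M ∷ []

  Disjoint : 𝕍 → Set ℓ
  Disjoint f = ∀ i j A C M → f [ i ]= A → f [ j ]= C → M ∈ A → M ∈ C → i ≡ j

  -- Disjointification: T α (i) is f(i) minus the earlier sets for i ∈ α, and ∅ for other i.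
  module Disjointify {f} (F : f ∶ κ ⟶ Meas) where
    open Sequence (λ _ p → p) F public

    truncatedᶠ : Fm 6
    truncatedᶠ = (v1 ∈ᶠ v3 ∧ᶠ (∃ᶠ v5 [ v2 ]ᶠ= v0 ∧ᶠ v1 ≈ᶠ compr (¬ᶠ (v0 ∈ᶠ v1)) (compr initᶠ (v5 ∷ v2 ∷ []) v6 ∷ []) v0)) ∨ᶠ
      (¬ᶠ (v1 ∈ᶠ v3) ∧ᶠ v0 ≈ᶠ ∅ᵗ)

    module T (α : 𝕍) = Graph truncatedᶠ (α ∷ f ∷ Str ∷ []) κ Meas

    T-case : ∀ {α i A} → T.fun α [ i ]= A → (i ∈ α × (∃[ B ] f [ i ]= B × A ≡ B ∖ init f i)) ⊎ (¬ i ∈ α × A ≡ ∅)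
    T-case {α} p = proj₂ (proj₂ (T.fun-elim α p))

    T-map : ∀ α → T.fun α ∶ κ ⟶ Meas
    T-map α = T.fun-map α exists unique
      where
      Case : 𝕍 → 𝕍 → Set ℓ
      Case i A = (i ∈ α × (∃[ B ] f [ i ]= B × A ≡ B ∖ init f i)) ⊎ (¬ i ∈ α × A ≡ ∅)
      exists : ∀ i → i ∈ κ → ∃[ A ] A ∈ Meas × Case i A
      exists i p with dec (i ∈ α)
      ... | yes q = let (B , r) = value (proj₁ F) p in
            B ∖ init f i , meas-∖ (proj₂ F i B r) (meas-init (proj₁ κ-ordinal i p)) , inj₁ (q , B , r , refl)
      ... | no q  = ∅ , meas-∅ , inj₂ (q , refl)
      unique : ∀ i A C → i ∈ κ → Case i A → Case i C → A ≡ C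
      unique i A C p (inj₁ (_ , B , r , e)) (inj₁ (_ , D , s , e′)) = trans e (trans (cong (_∖ init f i) (functional (proj₁ F) r s)) (sym e′))
      unique i A C p (inj₁ (q , _)) (inj₂ (q′ , _)) = ⊥-elim (q′ q)
      unique i A C p (inj₂ (q , _)) (inj₁ (q′ , _)) = ⊥-elim (q q′)
      unique i A C p (inj₂ (_ , e)) (inj₂ (_ , e′)) = trans e (sym e′)

    T-piece : ∀ {α i A M} → T.fun α [ i ]= A → M ∈ A → i ∈ α × (∃[ B ] f [ i ]= B × M ∈ B) × ¬ M ∈ init f i
    T-piece {α} {i} {A} {M} p q = [ (λ (i∈ , B , r , e) → let (s , t) = ∈∖⁻ (subst (M ∈_) e q) in i∈ , (B , r , s) , t)
                                  , (λ (_ , e) → ⊥-elim (∉∅ (subst (M ∈_) e q))) ]′ (T-case p)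

    T-disjoint : ∀ α → Disjoint (T.fun α)
    T-disjoint α i j A C M p q r s =
      let (_ , (_ , p′ , r′) , ni) = T-piece p r ; (_ , (_ , q′ , s′) , nj) = T-piece q s in
      [ (λ i∈j → ⊥-elim (nj (∈init i∈j p′ r′))) , [ id , (λ j∈i → ⊥-elim (ni (∈init j∈i q′ s′))) ]′ ]′
        (trichotomy (proj₁ κ-ordinal) (proj₂ κ-ordinal) i j (dom (proj₁ F) p′) (dom (proj₁ F) q′))

    ⋃T : ∀ {α} → IsTransitive α → α ⊆ κ → ⋃[ T.fun α ] ≡ init f α
    ⋃T {α} α-trans α⊆κ = ext
      (λ M p → let (i , A , q , r) = ∈⋃[]⁻ p ; (i∈ , (B , s , t) , _) = T-piece q r in ∈init i∈ s t)
      (λ M p → let (i , A , i∈ , q , r) = ∈init⁻ p ; (k , B , s , t , n) = least-index q r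
                   k∈ = [ (λ k∈i → α-trans i i∈ k k∈i) , [ (λ e → subst (_∈ α) (sym e) i∈) , (λ i∈k → ⊥-elim (n (∈init i∈k q r))) ]′ ]′
                     (trichotomy (proj₁ κ-ordinal) (proj₂ κ-ordinal) k i (dom (proj₁ F) s) (dom (proj₁ F) q))
               in Indexed.∈⋃[] (λ _ p → p) (T-map α)
                    (T.fun-intro α (α⊆κ k k∈) (meas-∖ (proj₂ F k B s) (meas-init (proj₁ κ-ordinal k (α⊆κ k k∈)))) (inj₁ (k∈ , B , s , refl)))
                    (∈∖ t n))

    ⋃-closed : ∀ {𝒟} → ∅ ∈ 𝒟 → (∀ A B → A ∈ 𝒟 → B ∈ 𝒟 → A ∖ B ∈ 𝒟) →
      (∀ t → t ∶ κ ⟶ Meas → Disjoint t → (∀ i A → t [ i ]= A → A ∈ 𝒟) → ⋃[ t ] ∈ 𝒟) →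
      (∀ i A → f [ i ]= A → A ∈ 𝒟) → ⋃[ f ] ∈ 𝒟
    ⋃-closed {𝒟} ∅∈ ∖∈ limit f∈ = subst (_∈ 𝒟) (ext
        (λ M p → let (i , A , _ , q , r) = ∈init⁻ p in ∈⋃[] q r)
        (λ M p → let (i , A , q , r) = ∈⋃[]⁻ p in ∈init (dom (proj₁ F) q) q r))
      (all κ (∈succ (inj₂ refl)))
      where
      φ : Fm 4
      φ = ¬ᶠ (compr initᶠ (v1 ∷ v0 ∷ []) v2 ∈ᶠ v3)
      ρ : Vec 𝕍 3
      ρ = f ∷ Str ∷ 𝒟 ∷ []
      succ-κ : ∀ {α} → α ∈ succ κ → IsTransitive α × α ⊆ κ
      succ-κ p = [ (λ q → proj₂ κ-ordinal _ q , proj₁ κ-ordinal _ q) , (λ { refl → proj₁ κ-ordinal , λ _ q → q }) ]′ (∈succ⁻ p)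
      all : ∀ α → α ∈ succ κ → init f α ∈ 𝒟
      all α p = by-contradiction λ n →
        let (β , β∈ , h) = least (∈sep φ ρ p n)
            (β∈κ , nβ) = ∈sep⁻ φ ρ β∈
            (β-trans , β⊆κ) = succ-κ β∈κ
            below = λ i i∈β → by-contradiction {init f i ∈ 𝒟} λ ni → h i i∈β (∈sep φ ρ (∈succ (inj₁ (β⊆κ i i∈β))) ni)
        in nβ (subst (_∈ 𝒟) (⋃T β-trans β⊆κ) (limit (T.fun β) (T-map β) (T-disjoint β) (pieces below)))
        where
        pieces : ∀ {β} → (∀ i → i ∈ β → init f i ∈ 𝒟) → ∀ i A → T.fun β [ i ]= A → A ∈ 𝒟
        pieces below i A p = [ (λ (i∈ , B , q , e) → subst (_∈ 𝒟) (sym e) (∖∈ B (init f i) (f∈ i B q) (below i i∈)))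
          , (λ (_ , e) → subst (_∈ 𝒟) (sym e) ∅∈) ]′ (T-case p)

  -- if M ⊨ R(t) then M ∈ A else M ∈ B
  ite : 𝕍 → 𝕍 → 𝕍 → 𝕍 → 𝕍
  ite R t A B = (atomSet R t ∩ A) ∪ (B ∖ atomSet R t)

  iteᵗ : ∀ {n} → Tm n → Tm n → Tm n → Tm n → Tm n → Tm n
  iteᵗ S R t A B = compr (v0 ∈ᶠ v1) (A ∷ []) L ∪ᵗ compr (¬ᶠ (v0 ∈ᶠ v1)) (L ∷ []) B
    where L = compr (holds v0 v1 v2) (R ∷ t ∷ []) S

  -- The sets decided by at most n queries of atoms, for n ∈ ω.
  private
    queryᶠ : Fm 4
    queryᶠ = v0 ∈ᶠ v1 ∨ᶠ (∃ᶠ ∃ᶠ ∃ᶠ ∃ᶠ ⟨ v3 , v2 ⟩ᵗ ∈ᶠ v7 ∧ᶠ v1 ∈ᶠ v5 ∧ᶠ v0 ∈ᶠ v5 ∧ᶠ v4 ≈ᶠ iteᵗ v6 v3 v2 v1 v0)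
    stage-step : 𝕍 → 𝕍
    stage-step x = sep queryᶠ (x ∷ Str ∷ Atoms ∷ []) (𝒫 Str)
    module N = Graph (v0 ≈ᶠ compr queryᶠ (v1 ∷ v3 ∷ v4 ∷ []) v5) (Str ∷ Atoms ∷ 𝒫 Str ∷ []) (𝒫 (𝒫 Str)) (𝒫 (𝒫 Str))
    next-map : N.fun ∶ 𝒫 (𝒫 Str) ⟶ 𝒫 (𝒫 Str)
    next-map = N.fun-map (λ x p → stage-step x , ∈𝒫 (λ E q → proj₁ (∈sep⁻ queryᶠ (x ∷ Str ∷ Atoms ∷ []) q)) , refl)
      (λ x y z p e e′ → trans e (sym e′))
    base∈ : ⁅ ∅ , Str ⁆ ∈ 𝒫 (𝒫 Str)
    base∈ = ∈𝒫 λ E p → [ (λ { refl → ∈𝒫 (λ M q → ⊥-elim (∉∅ q)) }) , (λ { refl → ∈𝒫 (λ M q → q) }) ]′ (∈⁅⁆⁻ p)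
    rec = recursion next-map base∈

  opaque
    stages : 𝕍
    stages = proj₁ rec

    stages-map : stages ∶ ω ⟶ 𝒫 (𝒫 Str)
    stages-map = proj₁ (proj₂ rec)

    stages-0 : stages [ ∅ ]= ⁅ ∅ , Str ⁆
    stages-0 = proj₁ (proj₂ (proj₂ rec))

    private
      stages-s : ∀ {n x y} → stages [ n ]= x → stages [ succ n ]= y → y ≡ stage-step x
      stages-s p q = proj₂ (proj₂ (N.fun-elim (proj₂ (proj₂ (proj₂ rec)) _ _ _ p q)))

    stages-s⁻ : ∀ {n x y E} → stages [ n ]= x → stages [ succ n ]= y → E ∈ y →
      E ∈ x ⊎ (∃[ R ] ∃[ t ] ∃[ A ] ∃[ B ] ⟨ R , t ⟩ ∈ Atoms × A ∈ x × B ∈ x × E ≡ ite R t A B)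
    stages-s⁻ {x = x} p q r = proj₂ (∈sep⁻ queryᶠ (x ∷ Str ∷ Atoms ∷ []) (subst (_ ∈_) (stages-s p q) r))

    stages-mono : ∀ {n x y} → stages [ n ]= x → stages [ succ n ]= y → x ⊆ y
    stages-mono {n} {x} {y} p q E r = subst (E ∈_) (sym (stages-s p q))
      (∈sep queryᶠ (x ∷ Str ∷ Atoms ∷ []) (∈𝒫⁻ (proj₂ stages-map n x p) E r) (inj₁ r))

    stages-ite : ∀ {n x y R t A B} → stages [ n ]= x → stages [ succ n ]= y → ⟨ R , t ⟩ ∈ Atoms → A ∈ x → B ∈ x → ite R t A B ∈ y
    stages-ite {n} {x} {y} {R} {t} {A} {B} p q a r s = subst (ite R t A B ∈_) (sym (stages-s p q))
      (∈sep queryᶠ (x ∷ Str ∷ Atoms ∷ [])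
        (∈𝒫 λ M u → [ (λ u → proj₁ (∈atomSet⁻ (proj₁ (∈∩⁻ u)))) , (λ u → ∈𝒫⁻ (∈𝒫⁻ (proj₂ stages-map n x p) B s) M (proj₁ (∈∖⁻ u))) ]′ (∈∪⁻ u))
        (inj₂ (R , t , A , B , a , r , s , refl)))

  𝒜ᶠ : Fm 2
  𝒜ᶠ = ∃ᶠ ∃ᶠ v3 [ v1 ]ᶠ= v0 ∧ᶠ v2 ∈ᶠ v0

  𝒜 : 𝕍
  𝒜 = sep 𝒜ᶠ (stages ∷ []) (𝒫 Str)

  ∈𝒜 : ∀ {E n x} → stages [ n ]= x → E ∈ x → E ∈ 𝒜
  ∈𝒜 {E} {n} {x} p q = ∈sep 𝒜ᶠ (stages ∷ []) (∈𝒫⁻ (proj₂ stages-map n x p) E q) (n , x , p , q)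

  ∈𝒜⁻ : ∀ {E} → E ∈ 𝒜 → ∃[ n ] ∃[ x ] stages [ n ]= x × E ∈ x
  ∈𝒜⁻ p = proj₂ (∈sep⁻ 𝒜ᶠ (stages ∷ []) p)

  private

    stages-< : ∀ n → n ∈ ω → ∀ m → m ∈ n → ∀ x y E → stages [ m ]= x → stages [ n ]= y → E ∈ x → E ∈ y
    stages-< = ω-ind (∀ᶠ v0 ∈ᶠ v1 ⇒ᶠ (∀ᶠ ∀ᶠ ∀ᶠ v5 [ v3 ]ᶠ= v2 ⇒ᶠ v5 [ v4 ]ᶠ= v1 ⇒ᶠ v0 ∈ᶠ v2 ⇒ᶠ v0 ∈ᶠ v1)) (stages ∷ [])
      (λ m p → ⊥-elim (∉∅ p))
      (λ n nω h m p x y E q r s → let (z , t) = value (proj₁ stages-map) nω in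
        stages-mono t r E ([ (λ m∈n → h m m∈n x z E q t s) , (λ e → subst (E ∈_) (functional (proj₁ stages-map) (subst (λ m → stages [ m ]= x) e q) t) s) ]′ (∈succ⁻ p)))

    common : ∀ {A B} → A ∈ 𝒜 → B ∈ 𝒜 → ∃[ n ] ∃[ x ] stages [ n ]= x × A ∈ x × B ∈ x
    common {A} {B} p q = let (n , x , r , A∈) = ∈𝒜⁻ p ; (k , y , s , B∈) = ∈𝒜⁻ q
                             nω = dom (proj₁ stages-map) r ; kω = dom (proj₁ stages-map) s in
      [ (λ n∈k → k , y , s , stages-< k kω n n∈k x y A r s A∈ , B∈)
      , [ (λ e → n , x , r , A∈ , subst (B ∈_) (functional (proj₁ stages-map) s (subst (λ n → stages [ n ]= x) e r)) B∈)
        , (λ k∈n → n , x , r , A∈ , stages-< n nω k k∈n y x B s r B∈) ]′ ]′ (ω-trichotomy nω kω)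

  𝒜-∅ : ∅ ∈ 𝒜
  𝒜-∅ = ∈𝒜 stages-0 ∈⁅⁆₁

  𝒜-Str : Str ∈ 𝒜
  𝒜-Str = ∈𝒜 stages-0 ∈⁅⁆₂

  𝒜-ite : ∀ {R t A B} → IsAtom R t → A ∈ 𝒜 → B ∈ 𝒜 → ite R t A B ∈ 𝒜
  𝒜-ite a p q = let (n , x , r , A∈ , B∈) = common p q ; (y , s) = value (proj₁ stages-map) (s∈ω (dom (proj₁ stages-map) r)) in
    ∈𝒜 s (stages-ite r s (∈Atoms a) A∈ B∈)

  𝒜-ind : ∀ {k} (φ : Fm (suc k)) (ρ : Vec 𝕍 k) → ⟦ φ ⟧ (∅ ∷ ρ) → ⟦ φ ⟧ (Str ∷ ρ) →
    (∀ R t A B → IsAtom R t → A ∈ 𝒜 → B ∈ 𝒜 → ⟦ φ ⟧ (A ∷ ρ) → ⟦ φ ⟧ (B ∷ ρ) → ⟦ φ ⟧ (ite R t A B ∷ ρ)) →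
    ∀ E → E ∈ 𝒜 → ⟦ φ ⟧ (E ∷ ρ)
  𝒜-ind {k} φ ρ z s i E p = let (n , x , q , r) = ∈𝒜⁻ p in proj₂ (∈sep⁻ φ ρ (all n (dom (proj₁ stages-map) q) x q E r))
    where
    𝒯 : 𝕍
    𝒯 = sep φ ρ 𝒜
    all : ∀ n → n ∈ ω → ∀ x → stages [ n ]= x → x ⊆ 𝒯
    all = ω-ind (∀ᶠ v2 [ v1 ]ᶠ= v0 ⇒ᶠ v0 ⊆ᶠ v3) (stages ∷ 𝒯 ∷ [])
      (λ x q E r → [ (λ e → subst (_∈ 𝒯) (sym e) (∈sep φ ρ 𝒜-∅ z)) , (λ e → subst (_∈ 𝒯) (sym e) (∈sep φ ρ 𝒜-Str s)) ]′
         (∈⁅⁆⁻ (subst (E ∈_) (functional (proj₁ stages-map) q stages-0) r)))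
      (λ n nω h y q E r → let (x , t) = value (proj₁ stages-map) nω in
        [ h x t E
        , (λ (R , t′ , A , B , a , A∈ , B∈ , e) → let (p , p′) = ∈sep⁻ φ ρ (h x t A A∈) ; (q , q′) = ∈sep⁻ φ ρ (h x t B B∈) in
             subst (_∈ 𝒯) (sym e) (∈sep φ ρ (𝒜-ite (⟨⟩∈Atoms⁻ a) p q) (i R t′ A B (⟨⟩∈Atoms⁻ a) p q p′ q′))) ]′
        (stages-s⁻ t q r))

  module _ {R t A B M : 𝕍} where
    ∈ite⁻ : M ∈ ite R t A B → (M ∈ atomSet R t × M ∈ A) ⊎ (M ∉ atomSet R t × M ∈ B)
    ∈ite⁻ p = Sum.map ∈∩⁻ (λ q → let (r , s) = ∈∖⁻ q in s , r) (∈∪⁻ p)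
    ∈ite : (M ∈ atomSet R t × M ∈ A) ⊎ (M ∉ atomSet R t × M ∈ B) → M ∈ ite R t A B
    ∈ite h = ∈∪ (Sum.map (λ (p , q) → ∈∩ p q) (λ (p , q) → ∈∖ q p) h)

  𝒜⊆Meas : 𝒜 ⊆ Meas
  𝒜⊆Meas = 𝒜-ind (v0 ∈ᶠ v1) (Meas ∷ []) meas-∅ meas-Str
    (λ R t A B a _ _ p q → meas-∪ (meas-∩ (meas-atom a) p) (meas-∖ q (meas-atom a)))

  𝒜-∁ : ∀ {A} → A ∈ 𝒜 → Str ∖ A ∈ 𝒜
  𝒜-∁ {A} = 𝒜-ind (compr (¬ᶠ (v0 ∈ᶠ v1)) (v0 ∷ []) v1 ∈ᶠ v2) (Str ∷ 𝒜 ∷ [])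
    (subst (_∈ 𝒜) (ext (λ M p → ∈∖ p ∉∅) (λ M p → proj₁ (∈∖⁻ p))) 𝒜-Str)
    (subst (_∈ 𝒜) (sym (≡∅ λ M p → proj₂ (∈∖⁻ p) (proj₁ (∈∖⁻ p)))) 𝒜-∅)
    (λ R t A B a _ _ p q → subst (_∈ 𝒜) (ext
      (λ M r → [ (λ (s , u) → ∈∖ (proj₁ (∈∖⁻ u)) λ v → [ (λ (_ , w) → proj₂ (∈∖⁻ u) w) , (λ (w , _) → w s) ]′ (∈ite⁻ v))
        , (λ (s , u) → ∈∖ (proj₁ (∈∖⁻ u)) λ v → [ (λ (w , _) → s w) , (λ (_ , w) → proj₂ (∈∖⁻ u) w) ]′ (∈ite⁻ v)) ]′ (∈ite⁻ r))
      (λ M r → let (s , n) = ∈∖⁻ r in ∈ite (cases R t A B M s n)))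
      (𝒜-ite a p q)) A
    where
    cases : ∀ R t A B M → M ∈ Str → M ∉ ite R t A B → (M ∈ atomSet R t × M ∈ Str ∖ A) ⊎ (M ∉ atomSet R t × M ∈ Str ∖ B)
    cases R t A B M s n with dec (M ∈ atomSet R t)
    ... | yes p = inj₁ (p , ∈∖ s λ q → n (∈ite (inj₁ (p , q))))
    ... | no p  = inj₂ (p , ∈∖ s λ q → n (∈ite (inj₂ (p , q))))

  𝒜-∩ : ∀ {A B} → A ∈ 𝒜 → B ∈ 𝒜 → A ∩ B ∈ 𝒜
  𝒜-∩ {A} {B} a b = 𝒜-ind (compr (v0 ∈ᶠ v1) (v1 ∷ []) v0 ∈ᶠ v2) (B ∷ 𝒜 ∷ [])
    (subst (_∈ 𝒜) (sym (≡∅ λ M p → ∉∅ (proj₁ (∈∩⁻ p)))) 𝒜-∅)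
    (subst (_∈ 𝒜) (ext (λ M p → ∈∩ (meas⊆Str (𝒜⊆Meas _ b) M p) p) (λ M p → proj₂ (∈∩⁻ p))) b)
    (λ R t A C at _ _ p q → subst (_∈ 𝒜) (ext
      (λ M r → [ (λ (s , u) → let (v , w) = ∈∩⁻ u in ∈∩ (∈ite (inj₁ (s , v))) w)
               , (λ (s , u) → let (v , w) = ∈∩⁻ u in ∈∩ (∈ite (inj₂ (s , v))) w) ]′ (∈ite⁻ r))
      (λ M r → let (s , w) = ∈∩⁻ r in ∈ite (Sum.map (λ (u , v) → u , ∈∩ v w) (λ (u , v) → u , ∈∩ v w) (∈ite⁻ s))))
      (𝒜-ite at p q)) A a

  𝒜-∖ : ∀ {A B} → A ∈ 𝒜 → B ∈ 𝒜 → A ∖ B ∈ 𝒜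
  𝒜-∖ a b = subst (_∈ 𝒜) (ext
    (λ M p → let (q , r) = ∈∩⁻ p in ∈∖ q (proj₂ (∈∖⁻ r)))
    (λ M p → let (q , r) = ∈∖⁻ p in ∈∩ q (∈∖ (meas⊆Str (𝒜⊆Meas _ a) M q) r))) (𝒜-∩ a (𝒜-∁ b))

  𝒜-∪ : ∀ {A B} → A ∈ 𝒜 → B ∈ 𝒜 → A ∪ B ∈ 𝒜
  𝒜-∪ {A} {B} a b = subst (_∈ 𝒜) (ext
    (λ M p → let (s , n) = ∈∖⁻ p in by-contradiction λ k →
       n (∈∖ (∈∖ s (λ q → k (∈∪ (inj₁ q)))) (λ q → k (∈∪ (inj₂ q)))))
    (λ M p → ∈∖ ([ meas⊆Str (𝒜⊆Meas _ a) M , meas⊆Str (𝒜⊆Meas _ b) M ]′ (∈∪⁻ p))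
       λ q → let (r , s) = ∈∖⁻ q in [ proj₂ (∈∖⁻ r) , s ]′ (∈∪⁻ p)))
    (𝒜-∁ (𝒜-∖ (𝒜-∁ a) b))

  𝒜-atom : ∀ {R t} → IsAtom R t → atomSet R t ∈ 𝒜
  𝒜-atom a = subst (_∈ 𝒜) (ext (λ M p → [ proj₁ , (λ (_ , q) → ⊥-elim (∉∅ q)) ]′ (∈ite⁻ p))
    (λ M p → ∈ite (inj₁ (p , proj₁ (∈atomSet⁻ p))))) (𝒜-ite a 𝒜-Str 𝒜-∅)

  imᶠ : Fm 5
  imᶠ = ∃ᶠ v0 ∈ᶠ v3 ∧ᶠ isAction v4 v5 v2 v0 v1

  im : 𝕍 → 𝕍 → 𝕍
  im g A = sep imᶠ (g ∷ A ∷ X ∷ 𝓛 ∷ []) Str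

  opaque
    unfolding IsAction

    image-spec : ∀ {g A N} → ⟦ imᶠ ⟧ (N ∷ g ∷ A ∷ X ∷ 𝓛 ∷ []) ⇔ (∃[ M ] M ∈ A × IsAction g M N)
    image-spec = ≡⇒⇔ refl

  ∈im⁻ : ∀ {g A N} → N ∈ im g A → N ∈ Str × (∃[ M ] M ∈ A × IsAction g M N)
  ∈im⁻ {g} {A} p = let (q , r) = ∈sep⁻ imᶠ (g ∷ A ∷ X ∷ 𝓛 ∷ []) p in q , to image-spec r

  -- The sequence on κ enumerating a family along an injection, with ∅ elsewhere.
  module Enumerate {G h} (G⊆ : G ⊆ Meas) (H : h ∶ G ⟶ κ) (inj : Injective h) where
    private
      φ : Fm 5
      φ = (v0 ∈ᶠ v3 ∧ᶠ v4 [ v0 ]ᶠ= v1) ∨ᶠ (¬ᶠ (∃ᶠ v0 ∈ᶠ v4 ∧ᶠ v5 [ v0 ]ᶠ= v2) ∧ᶠ v0 ≈ᶠ ∅ᵗ)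
      module E = Graph φ (G ∷ h ∷ []) κ Meas
      Case : 𝕍 → 𝕍 → Set ℓ
      Case i A = (A ∈ G × h [ A ]= i) ⊎ (¬ (∃[ B ] B ∈ G × h [ B ]= i) × A ≡ ∅)
      exists : ∀ i → ∃[ A ] A ∈ Meas × Case i A
      exists i with dec (∃[ B ] B ∈ G × h [ B ]= i)
      ... | yes (B , p , q) = B , G⊆ B p , inj₁ (p , q)
      ... | no n = ∅ , meas-∅ , inj₂ (n , refl)
      unique : ∀ i A B → i ∈ κ → Case i A → Case i B → A ≡ B
      unique i A B _ (inj₁ (_ , p)) (inj₁ (_ , q)) = inj A B i p q
      unique i A B _ (inj₁ p) (inj₂ (n , _)) = ⊥-elim (n (A , p))
      unique i A B _ (inj₂ (n , _)) (inj₁ p) = ⊥-elim (n (B , p))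
      unique i A B _ (inj₂ (_ , e)) (inj₂ (_ , e′)) = trans e (sym e′)

    seq : 𝕍
    seq = E.fun

    seq-map : seq ∶ κ ⟶ Meas
    seq-map = E.fun-map (λ i _ → exists i) unique

    seq-value : ∀ {i A} → seq [ i ]= A → A ∈ G ⊎ A ≡ ∅
    seq-value p = Sum.map proj₁ proj₂ (proj₂ (proj₂ (E.fun-elim p)))

    ⋃seq : ⋃[ seq ] ≡ ⋃ G
    ⋃seq = ext
      (λ M p → let (i , A , q , r) = ∈⋃[]⁻ p in [ (λ A∈ → ∈⋃ A∈ r) , (λ e → ⊥-elim (∉∅ (subst (M ∈_) e r))) ]′ (seq-value q))
      (λ M p → let (A , q , r) = ∈⋃⁻ p ; (i , s) = value (proj₁ H) q in
        Indexed.∈⋃[] (λ _ p → p) seq-map (E.fun-intro (proj₂ H A i s) (G⊆ A q) (inj₁ (q , s))) r)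

  module Image {g} (Sg : IsSym g) where
    open Action Sg public

    ∈im : ∀ {A M N} → M ∈ A → IsAction g M N → N ∈ im g A
    ∈im {A} {M} p a = ∈sep imᶠ (g ∷ A ∷ X ∷ 𝓛 ∷ []) (action-Str a) (from image-spec (M , p , a))

    im⊆Str : ∀ {A} → im g A ⊆ Str
    im⊆Str N p = proj₁ (∈im⁻ p)

    im-iff : ∀ {A M N} → A ⊆ Str → M ∈ Str → IsAction g M N → N ∈ im g A → M ∈ A
    im-iff A⊆ M∈ a p = let (_ , M′ , q , a′) = ∈im⁻ p in subst (_∈ _) (act-injective (A⊆ M′ q) M∈ a′ a) q

    im-ext : ∀ {A C} → A ⊆ Str → C ⊆ Str → (∀ M N → M ∈ Str → IsAction g M N → M ∈ A ⇔ N ∈ C) → im g A ≡ C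
    im-ext A⊆ C⊆ h = ext
      (λ N p → let (_ , M , q , a) = ∈im⁻ p in to (h M N (A⊆ M q) a) q)
      (λ N p → let (M , q , a) = act-surjective (C⊆ N p) in ∈im (from (h M N q a) p) a)

    im-∅ : im g ∅ ≡ ∅
    im-∅ = im-ext (λ M p → ⊥-elim (∉∅ p)) (λ M p → ⊥-elim (∉∅ p)) λ M N _ _ → mk⇔ (λ p → ⊥-elim (∉∅ p)) (λ p → ⊥-elim (∉∅ p))

    im-Str : im g Str ≡ Str
    im-Str = im-ext (λ _ p → p) (λ _ p → p) λ M N p a → mk⇔ (λ _ → action-Str a) (λ _ → p)

    im-∖ : ∀ {A B} → A ⊆ Str → B ⊆ Str → im g (A ∖ B) ≡ im g A ∖ im g B
    im-∖ {A} {B} A⊆ B⊆ = im-ext (λ M p → A⊆ M (proj₁ (∈∖⁻ p))) (λ N p → im⊆Str N (proj₁ (∈∖⁻ p))) λ M N M∈ a → mk⇔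
      (λ p → let (q , r) = ∈∖⁻ p in ∈∖ (∈im q a) λ s → r (im-iff B⊆ M∈ a s))
      (λ p → let (q , r) = ∈∖⁻ p in ∈∖ (im-iff A⊆ M∈ a q) λ s → r (∈im s a))

    im-∪ : ∀ {A B} → A ⊆ Str → B ⊆ Str → im g (A ∪ B) ≡ im g A ∪ im g B
    im-∪ {A} {B} A⊆ B⊆ = im-ext (λ M p → [ A⊆ M , B⊆ M ]′ (∈∪⁻ p)) (λ N p → [ im⊆Str N , im⊆Str N ]′ (∈∪⁻ p)) λ M N M∈ a → mk⇔
      (λ p → ∈∪ (Sum.map (λ q → ∈im q a) (λ q → ∈im q a) (∈∪⁻ p)))
      (λ p → ∈∪ (Sum.map (im-iff A⊆ M∈ a) (im-iff B⊆ M∈ a) (∈∪⁻ p)))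

    im-atom : ∀ {R t u} → IsAtom R t → IsComposite u g t → im g (atomSet R t) ≡ atomSet R u
    im-atom at c = im-ext (λ M p → proj₁ (∈atomSet⁻ p)) (λ M p → proj₁ (∈atomSet⁻ p)) λ M N M∈ a → mk⇔
      (λ p → ∈atomSet (action-Str a) (from (action-holds a at c) (proj₂ (∈atomSet⁻ p))))
      (λ p → ∈atomSet M∈ (to (action-holds a at c) (proj₂ (∈atomSet⁻ p))))

    im-ite : ∀ {R t u A B} → IsAtom R t → IsComposite u g t → A ⊆ Str → B ⊆ Str → im g (ite R t A B) ≡ ite R u (im g A) (im g B)
    im-ite {R} {t} {u} {A} {B} at c A⊆ B⊆ = im-ext
      (λ M p → [ (λ (_ , q) → A⊆ M q) , (λ (_ , q) → B⊆ M q) ]′ (∈ite⁻ p))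
      (λ M p → [ (λ (_ , q) → im⊆Str M q) , (λ (_ , q) → im⊆Str M q) ]′ (∈ite⁻ p)) λ M N M∈ a →
      let L⊆ = λ M (p : M ∈ atomSet R t) → proj₁ (∈atomSet⁻ p)
          forth = λ (p : M ∈ atomSet R t) → subst (N ∈_) (im-atom at c) (∈im p a)
          back = λ (p : N ∈ atomSet R u) → im-iff L⊆ M∈ a (subst (N ∈_) (sym (im-atom at c)) p)
      in mk⇔
        (λ p → ∈ite (Sum.map (λ (q , r) → forth q , ∈im r a) (λ (q , r) → (λ s → q (back s)) , ∈im r a) (∈ite⁻ p)))
        (λ p → ∈ite (Sum.map (λ (q , r) → back q , im-iff A⊆ M∈ a r) (λ (q , r) → (λ s → q (forth s)) , im-iff B⊆ M∈ a r) (∈ite⁻ p)))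

    private
      mapᶠ : Fm 8
      mapᶠ = ∃ᶠ v4 [ v2 ]ᶠ= v0 ∧ᶠ v1 ≈ᶠ compr imᶠ (v5 ∷ v0 ∷ v6 ∷ v7 ∷ []) v8

    module MapImage (f I : 𝕍) = Graph mapᶠ (f ∷ g ∷ X ∷ 𝓛 ∷ Str ∷ []) I Meas

    mapImage : 𝕍 → 𝕍 → 𝕍
    mapImage f I = MapImage.fun f I

    mapImage-value : ∀ {f I i A} → f ∶ I ⟶ Meas → im g A ∈ Meas → f [ i ]= A → mapImage f I [ i ]= im g A
    mapImage-value {f} {I} F m p = MapImage.fun-intro f I (dom (proj₁ F) p) m (_ , p , refl)

    mapImage-value⁻ : ∀ {f I i B} → mapImage f I [ i ]= B → ∃[ A ] f [ i ]= A × B ≡ im g A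
    mapImage-value⁻ {f} {I} p = proj₂ (proj₂ (MapImage.fun-elim f I p))

    module _ {f I} (F : f ∶ I ⟶ Meas) (I⊆κ : I ⊆ κ) (h : ∀ i A → f [ i ]= A → im g A ∈ Meas) where
      mapImage-map : mapImage f I ∶ I ⟶ Meas
      mapImage-map = MapImage.fun-map f I
        (λ i p → let (A , q) = value (proj₁ F) p in im g A , h i A q , A , q , refl)
        (λ i B C p (A , q , e) (A′ , q′ , e′) → trans e (trans (cong (im g) (functional (proj₁ F) q q′)) (sym e′)))

      im-⋃[] : im g ⋃[ f ] ≡ ⋃[ mapImage f I ]
      im-⋃[] = im-ext
        (λ M p → let (i , A , q , r) = ∈⋃[]⁻ p in meas⊆Str (proj₂ F i A q) M r)
        (λ M p → let (i , A , q , r) = ∈⋃[]⁻ p in meas⊆Str (proj₂ mapImage-map i A q) M r) λ M N M∈ a → mk⇔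
        (λ p → let (i , A , q , r) = ∈⋃[]⁻ p in Indexed.∈⋃[] I⊆κ mapImage-map (mapImage-value F (h i A q) q) (∈im r a))
        (λ p → let (i , B , q , r) = ∈⋃[]⁻ p ; (A , s , e) = mapImage-value⁻ q in
           Indexed.∈⋃[] I⊆κ F s (im-iff (meas⊆Str (proj₂ F i A s)) M∈ a (subst (N ∈_) e r)))

    meas-im : ∀ {A} → A ∈ Meas → im g A ∈ Meas
    meas-im {A} = meas-ind (compr imᶠ (v1 ∷ v0 ∷ v2 ∷ v3 ∷ []) v4 ∈ᶠ v5) (g ∷ X ∷ 𝓛 ∷ Str ∷ Meas ∷ [])
      (λ R t a → let (u , b , c) = atom-image a in subst (_∈ Meas) (sym (im-atom a c)) (meas-atom b))
      (λ A a p → subst (_∈ Meas) (sym (trans (im-∖ (λ _ q → q) (meas⊆Str a)) (cong (_∖ im g A) im-Str))) (meas-∁ p))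
      (λ G h G⊆ im∈ H inj → let open Enumerate G⊆ H inj
                                im∈′ = λ i A q → [ im∈ A , (λ e → subst (_∈ Meas) (sym (trans (cong (im g) e) im-∅)) meas-∅) ]′ (seq-value {i} {A} q) in
        subst (λ B → im g B ∈ Meas) ⋃seq (subst (_∈ Meas) (sym (im-⋃[] seq-map (λ _ p → p) im∈′))
          (Indexed.meas-⋃[] (λ _ p → p) (mapImage-map seq-map (λ _ p → p) im∈′)))) A

    𝒜-im : ∀ {E} → E ∈ 𝒜 → im g E ∈ 𝒜
    𝒜-im {E} = 𝒜-ind (compr imᶠ (v1 ∷ v0 ∷ v2 ∷ v3 ∷ []) v4 ∈ᶠ v5) (g ∷ X ∷ 𝓛 ∷ Str ∷ 𝒜 ∷ [])
      (subst (_∈ 𝒜) (sym im-∅) 𝒜-∅) (subst (_∈ 𝒜) (sym im-Str) 𝒜-Str)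
      (λ R t A B a A∈ B∈ p q → let (u , b , c) = atom-image a in
        subst (_∈ 𝒜) (sym (im-ite a c (meas⊆Str (𝒜⊆Meas A A∈)) (meas⊆Str (𝒜⊆Meas B B∈)))) (𝒜-ite b p q)) E

    module Pullback {ν} (Mν : Measure ν) where
      open Measure Mν
      private
        φ : Fm 8
        φ = v3 [ compr imᶠ (v4 ∷ v1 ∷ v5 ∷ v6 ∷ []) v7 ]ᶠ= v0
        module P = Graph φ (ν ∷ g ∷ X ∷ 𝓛 ∷ Str ∷ []) Meas (𝒫 fractions)

      pullback : 𝕍
      pullback = P.fun

      pullback-value⁻ : ∀ {A r} → pullback [ A ]= r → A ∈ Meas × ν [ im g A ]= r
      pullback-value⁻ p = let (a , _ , q) = P.fun-elim p in a , q

      pullback-value : ∀ {A r} → A ∈ Meas → ν [ im g A ]= r → pullback [ A ]= r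
      pullback-value a p = P.fun-intro a (∈𝒫 λ v q → let (x , e) = real-frac (μ-real p) q in subst (_∈ fractions) (sym e) (∈fractions x)) p

      private
        module _ {f I} (I⊆κ : I ⊆ κ) (F : f ∶ I ⟶ Meas) where
          im∈ : ∀ i A → f [ i ]= A → im g A ∈ Meas
          im∈ i A p = meas-im (proj₂ F i A p)
          step-to : ∀ {e k r s} → Step pullback f e k r s → Step ν (mapImage f I) e k r s
          step-to (i , v , ei , (A , fi , p) , ar) =
            i , v , ei , (im g A , mapImage-value F (im∈ i A fi) fi , proj₂ (pullback-value⁻ p)) , ar
          step-from : ∀ {e k r s} → Step ν (mapImage f I) e k r s → Step pullback f e k r s
          step-from (i , v , ei , (B , fi , p) , ar) = let (A , q , e) = mapImage-value⁻ fi in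
            i , v , ei , (A , q , pullback-value (proj₂ F i A q) (subst (λ B → ν [ B ]= v) e p)) , ar
          sum-map : ∀ {e n t} {S S′ : 𝕍 → 𝕍 → 𝕍 → Set ℓ} → (∀ {k r s} → S k r s → S′ k r s) → Iterate S e n t → Iterate S′ e n t
          sum-map h (s , p , q , r , st) = s , p , q , r , λ i x y a b c → h (st i x y a b c)
          additive-pullback : Additive ν I → Disjoint f → ∀ r → pullback [ ⋃[ f ] ]= r →
            (∀ t → PartialSum pullback f I t → t ⊆ r) × (∀ s → IsReal s → (∀ t → PartialSum pullback f I t → t ⊆ s) → r ⊆ s)
          additive-pullback add d r p =
            let (q , l) = add (mapImage f I) (mapImage-map F I⊆κ im∈) disjoint′ r
                            (subst (λ A → ν [ A ]= r) (im-⋃[] F I⊆κ im∈) (proj₂ (pullback-value⁻ p)))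
            in (λ t (n , e , nω , E , inj , it) → q t (n , e , nω , E , inj , sum-map step-to it)) ,
               (λ s R h → l s R λ t (n , e , nω , E , inj , it) → h t (n , e , nω , E , inj , sum-map step-from it))
            where
            disjoint′ : Disjoint (mapImage f I)
            disjoint′ i j B C N p q r s =
              let (A , p′ , e) = mapImage-value⁻ p ; (A′ , q′ , e′) = mapImage-value⁻ q
                  (_ , M , M∈ , a) = ∈im⁻ (subst (N ∈_) e r) ; (_ , M′ , M∈′ , a′) = ∈im⁻ (subst (N ∈_) e′ s)
                  M≡ = act-injective (meas⊆Str (proj₂ F i A p′) M M∈) (meas⊆Str (proj₂ F j A′ q′) M′ M∈′) a a′
              in d i j A A′ M p′ q′ M∈ (subst (_∈ A′) (sym M≡) M∈′)

      pullback-measure : Measure pullback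
      pullback-measure = record
        { μ-domain = λ p q → let (A , r , e , a) = P.fun-pairs p q in
            A , r , e , a , μ-real (proj₂ (pullback-value⁻ (subst (_∈ pullback) e q)))
        ; μ-value = λ A a → let (r , p) = μ-value (im g A) (meas-im a) in r , pullback-value a p
        ; μ-unique = λ p q → μ-unique (proj₂ (pullback-value⁻ p)) (proj₂ (pullback-value⁻ q))
        ; μ-total = λ r p → μ-total r (subst (λ A → ν [ A ]= r) im-Str (proj₂ (pullback-value⁻ p)))
        ; ω-additive = λ f F d r p → additive-pullback ω⊆κ F ω-additive d r p
        ; κ-additive = λ f F d r p → additive-pullback (λ _ p → p) F κ-additive d r p
        }

  meas-△ : ∀ {A B} → A ∈ Meas → B ∈ Meas → A △ B ∈ Meas
  meas-△ a b = meas-∪ (meas-∖ a b) (meas-∖ b a)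

  -- An ω-sequence continued by ∅ to κ.
  module Continued {c} (C : c ∶ ω ⟶ Meas) where
    private
      φ : Fm 5
      φ = v3 [ v1 ]ᶠ= v0 ∨ᶠ (¬ᶠ (v1 ∈ᶠ v4) ∧ᶠ v0 ≈ᶠ ∅ᵗ)
      module K = Graph φ (c ∷ ω ∷ []) κ Meas
      Case : 𝕍 → 𝕍 → Set ℓ
      Case i A = c [ i ]= A ⊎ (¬ i ∈ ω × A ≡ ∅)
      exists : ∀ i → ∃[ A ] A ∈ Meas × Case i A
      exists i with dec (i ∈ ω)
      ... | yes p = let (A , q) = value (proj₁ C) p in A , proj₂ C i A q , inj₁ q
      ... | no n  = ∅ , meas-∅ , inj₂ (n , refl)
      unique : ∀ i A B → i ∈ κ → Case i A → Case i B → A ≡ B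
      unique i A B _ (inj₁ p) (inj₁ q) = functional (proj₁ C) p q
      unique i A B _ (inj₁ p) (inj₂ (n , _)) = ⊥-elim (n (dom (proj₁ C) p))
      unique i A B _ (inj₂ (n , _)) (inj₁ p) = ⊥-elim (n (dom (proj₁ C) p))
      unique i A B _ (inj₂ (_ , e)) (inj₂ (_ , e′)) = trans e (sym e′)

    seq : 𝕍
    seq = K.fun

    seq-map : seq ∶ κ ⟶ Meas
    seq-map = K.fun-map (λ i _ → exists i) unique

    seq-value : ∀ {i A} → seq [ i ]= A → c [ i ]= A ⊎ A ≡ ∅
    seq-value p = Sum.map₂ proj₂ (proj₂ (proj₂ (K.fun-elim p)))

    seq-at : ∀ {i A} → c [ i ]= A → seq [ i ]= A
    seq-at p = K.fun-intro (ω⊆κ _ (dom (proj₁ C) p)) (proj₂ C _ _ p) (inj₁ p)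

  tailᶠ : Fm 3
  tailᶠ = ∃ᶠ ∃ᶠ ¬ᶠ (v1 ∈ᶠ v4) ∧ᶠ v3 [ v1 ]ᶠ= v0 ∧ᶠ v2 ∈ᶠ v0

  tail : 𝕍 → 𝕍 → 𝕍
  tail c a = sep tailᶠ (c ∷ a ∷ []) Str

  ∈tail⁻ : ∀ {c a M} → M ∈ tail c a → ∃[ k ] ∃[ A ] k ∉ a × c [ k ]= A × M ∈ A
  ∈tail⁻ {c} {a} p = proj₂ (∈sep⁻ tailᶠ (c ∷ a ∷ []) p)

  module Tail {c} (C : c ∶ ω ⟶ Meas) where
    open Sequence ω⊆κ C

    ∈tail : ∀ {a k A M} → k ∉ a → c [ k ]= A → M ∈ A → M ∈ tail c a
    ∈tail {a} {k} {A} n p q = ∈sep tailᶠ (c ∷ a ∷ []) (meas⊆Str (proj₂ C k A p) _ q) (k , A , n , p , q)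

    private
      φ : Fm 5
      φ = (¬ᶠ (v1 ∈ᶠ v4) ∧ᶠ v3 [ v1 ]ᶠ= v0) ∨ᶠ (v1 ∈ᶠ v4 ∧ᶠ v0 ≈ᶠ ∅ᵗ)
      module K (a : 𝕍) = Graph φ (c ∷ a ∷ []) ω Meas
      Case : 𝕍 → 𝕍 → 𝕍 → Set ℓ
      Case a i A = (i ∉ a × c [ i ]= A) ⊎ (i ∈ a × A ≡ ∅)
      exists : ∀ a i → i ∈ ω → ∃[ A ] A ∈ Meas × Case a i A
      exists a i p with dec (i ∈ a)
      ... | yes q = ∅ , meas-∅ , inj₂ (q , refl)
      ... | no n  = let (A , q) = value (proj₁ C) p in A , proj₂ C i A q , inj₁ (n , q)
      unique : ∀ a i A B → i ∈ ω → Case a i A → Case a i B → A ≡ B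
      unique a i A B _ (inj₁ (_ , p)) (inj₁ (_ , q)) = functional (proj₁ C) p q
      unique a i A B _ (inj₁ (n , _)) (inj₂ (p , _)) = ⊥-elim (n p)
      unique a i A B _ (inj₂ (p , _)) (inj₁ (n , _)) = ⊥-elim (n p)
      unique a i A B _ (inj₂ (_ , e)) (inj₂ (_ , e′)) = trans e (sym e′)

    drop : 𝕍 → 𝕍
    drop a = K.fun a

    drop-map : ∀ a → drop a ∶ ω ⟶ Meas
    drop-map a = K.fun-map a (exists a) (unique a)

    drop-piece : ∀ {a i A M} → drop a [ i ]= A → M ∈ A → i ∉ a × c [ i ]= A
    drop-piece {a} {M = M} p q = [ id , (λ (_ , e) → ⊥-elim (∉∅ (subst (M ∈_) e q))) ]′ (proj₂ (proj₂ (K.fun-elim a p)))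

    drop-at : ∀ {a i A} → i ∉ a → c [ i ]= A → drop a [ i ]= A
    drop-at {a} n p = K.fun-intro a (dom (proj₁ C) p) (proj₂ C _ _ p) (inj₁ (n , p))

    ⋃drop : ∀ {a} → ⋃[ drop a ] ≡ tail c a
    ⋃drop {a} = ext
      (λ M p → let (i , A , q , r) = ∈⋃[]⁻ p ; (n , s) = drop-piece q r in ∈tail n s r)
      (λ M p → let (k , A , n , q , r) = ∈tail⁻ p in Indexed.∈⋃[] ω⊆κ (drop-map a) (drop-at n q) r)

    meas-tail : ∀ {a} → tail c a ∈ Meas
    meas-tail {a} = subst (_∈ Meas) ⋃drop (Indexed.meas-⋃[] ω⊆κ (drop-map a))

    -- the union of the c(k) with a ≤ k < n
    between′ : 𝕍 → 𝕍 → 𝕍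
    between′ a n = init (drop a) n

    meas-between : ∀ {a n} → n ∈ ω → between′ a n ∈ Meas
    meas-between {a} nω = Sequence.meas-init ω⊆κ (drop-map a) (λ k p → ω-transitive nω p)

    between-∅ : ∀ {a n} → n ⊆ a → between′ a n ≡ ∅
    between-∅ h = ≡∅ λ M p → let (i , A , q , r , s) = ∈init⁻ p in proj₁ (drop-piece r s) (h i q)

    between-succ : ∀ {a n A} → c [ n ]= A → ∀ M → M ∈ between′ a (succ n) → M ∈ between′ a n ⊎ M ∈ A
    between-succ {a} {n} {A} p M q = let (i , B , i∈ , r , s) = ∈init⁻ q in
      [ (λ i∈n → inj₁ (Sequence.∈init ω⊆κ (drop-map a) i∈n r s))
      , (λ e → inj₂ (subst (M ∈_) (functional (proj₁ C) (subst (λ i → c [ i ]= B) e (proj₂ (drop-piece r s))) p) s)) ]′ (∈succ⁻ i∈)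

  -- The set of structures that lie in infinitely many b(k).
  module LimSup {b} (B : b ∶ ω ⟶ Meas) where
    open Tail B

    private
      φ : Fm 5
      φ = v0 ≈ᶠ compr (¬ᶠ (v0 ∈ᶠ v1)) (compr tailᶠ (v3 ∷ v1 ∷ []) v4 ∷ []) v4
      module K = Graph φ (b ∷ Str ∷ []) ω Meas
      K-map : K.fun ∶ ω ⟶ Meas
      K-map = K.fun-map (λ n p → Str ∖ tail b n , meas-∁ meas-tail , refl) (λ n A C p e e′ → trans e (sym e′))

    limsup : 𝕍
    limsup = Str ∖ ⋃[ K.fun ]

    meas-limsup : limsup ∈ Meas
    meas-limsup = meas-∁ (Indexed.meas-⋃[] ω⊆κ K-map)

    limsup⊆ : limsup ⊆ Str
    limsup⊆ M p = proj₁ (∈∖⁻ p)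

    ∈limsup⁻ : ∀ {M} → M ∈ limsup → ∀ n → n ∈ ω → M ∈ tail b n
    ∈limsup⁻ p n nω = let (q , r) = ∈∖⁻ p in by-contradiction λ k →
      r (Indexed.∈⋃[] ω⊆κ K-map (K.fun-intro nω (meas-∁ meas-tail) refl) (∈∖ q k))

    ∉limsup⁻ : ∀ {M} → M ∈ Str → M ∉ limsup → ∃[ n ] n ∈ ω × M ∉ tail b n
    ∉limsup⁻ {M} p q = let (n , A , r , s) = ∈⋃[]⁻ (by-contradiction λ k → q (∈∖ p k)) ; (nω , _ , e) = K.fun-elim r in
      n , nω , proj₂ (∈∖⁻ (subst (M ∈_) e s))

  ω-max : ∀ {m n} → m ∈ ω → n ∈ ω → ∃[ k ] k ∈ ω × m ⊆ k × n ⊆ k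
  ω-max {m} {n} p q = [ (λ r → n , q , nat-transitive q m r , (λ _ s → s)) , [ (λ e → n , q , subst (_⊆ n) (sym e) (λ _ s → s) , (λ _ s → s))
    , (λ r → m , p , (λ _ s → s) , nat-transitive p n r) ]′ ]′ (ω-trichotomy p q)

  module Valuation {μ} (Mμ : Measure μ) where
    open Measure Mμ public

    m : 𝕍 → 𝕍
    m = val μ

    m-eq : ∀ {A r} → μ [ A ]= r → m A ≡ r
    m-eq {A} {r} p = ext
      (λ x q → let (s , s∈ , x∈) = proj₂ (∈sep⁻ valueᶠ (μ ∷ A ∷ []) q) in subst (x ∈_) (μ-unique s∈ p) x∈)
      (λ x q → ∈sep valueᶠ (μ ∷ A ∷ [])
        (let (f , e) = real-frac (μ-real p) q in subst (_∈ fractions) (sym e) (∈fractions f)) (r , p , q))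

    m-graph : ∀ {A} → A ∈ Meas → μ [ A ]= m A
    m-graph {A} a = let (r , p) = μ-value A a in subst (λ r → μ [ A ]= r) (sym (m-eq p)) p

    m-real : ∀ {A} → A ∈ Meas → IsReal (m A)
    m-real a = μ-real (m-graph a)

    module _ {A B} (a : A ∈ Meas) (b : B ∈ Meas) (disjoint : ∀ M → M ∈ A → ¬ M ∈ B) where
      private
        open PairSequence a b
        Case : 𝕍 → 𝕍 → Set ℓ
        Case i C = (i ≡ ∅ × C ≡ A) ⊎ (i ≡ succ ∅ × C ≡ B) ⊎ (¬ i ≡ ∅ × ¬ i ≡ succ ∅ × C ≡ ∅)
        same : ∀ {i j C D N} → Case i C → Case j D → N ∈ C → N ∈ D → i ≡ j
        same (inj₁ (refl , refl)) (inj₁ (refl , refl)) p q = refl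
        same (inj₁ (refl , refl)) (inj₂ (inj₁ (refl , refl))) p q = ⊥-elim (disjoint _ p q)
        same (inj₂ (inj₁ (refl , refl))) (inj₁ (refl , refl)) p q = ⊥-elim (disjoint _ q p)
        same (inj₂ (inj₁ (refl , refl))) (inj₂ (inj₁ (refl , refl))) p q = refl
        same (inj₂ (inj₂ (_ , _ , refl))) _ p q = ⊥-elim (∉∅ p)
        same (inj₁ _) (inj₂ (inj₂ (_ , _ , refl))) p q = ⊥-elim (∉∅ q)
        same (inj₂ (inj₁ _)) (inj₂ (inj₂ (_ , _ , refl))) p q = ⊥-elim (∉∅ q)
        seq-disjoint : ∀ i j C D N → seq [ i ]= C → seq [ j ]= D → N ∈ C → N ∈ D → i ≡ j
        seq-disjoint i j C D N p q = same (seq-case p) (seq-case q)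
        ⋃-graph : μ [ ⋃[ seq ] ]= m (A ∪ B)
        ⋃-graph = subst (λ C → μ [ C ]= m (A ∪ B)) (sym ⋃seq) (m-graph (meas-∪ a b))
        sums = ω-additive seq seq-map seq-disjoint (m (A ∪ B)) ⋃-graph
        two : 𝕍
        two = succ (succ ∅)
        two∈ω : two ∈ ω
        two∈ω = s∈ω (s∈ω 0∈ω)

      superadditive : m A +ᴿ m B ⊆ m (A ∪ B)
      superadditive = proj₁ sums (m A +ᴿ m B) (two , e , ∈ω⁻ two∈ω , e-map , e-injective ,
        iterate-s (iterate-s iterate-0 (∅ , m A , e-at (∈succ (inj₁ (∈succ (inj₂ refl)))) , (A , seq-0 , m-graph a) , ∅-addReal (m A)))
          (succ ∅ , m B , e-at (∈succ (inj₂ refl)) , (B , seq-1 , m-graph b) , +ᴿ-addReal (m-real a) (m-real b)))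
        where
        e = proj₁ (identity two)
        e-at : ∀ {x} → x ∈ two → e [ x ]= x
        e-at {x} = proj₁ (proj₂ (proj₂ (identity two))) x
        e-value : ∀ {x y} → e [ x ]= y → y ≡ x
        e-value = proj₂ (proj₂ (proj₂ (identity two))) _ _
        e-map : e ∶ two ⟶ ω
        e-map = proj₁ (proj₁ (proj₂ (identity two))) , λ x y p → ω-transitive two∈ω (proj₂ (proj₁ (proj₂ (identity two))) x y p)
        e-injective : Injective e
        e-injective x x′ y p q = trans (sym (e-value p)) (e-value q)

      private
        s₀ : 𝕍
        s₀ = m A +ᴿ m B
        R₀ : IsReal s₀
        R₀ = +ᴿ-real (m-real a) (m-real b)
        module Bound {e I} (E : e ∶ I ⟶ ω) (inj : Injective e) (m∅ : m ∅ ≡ ∅) where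
          Avoids : 𝕍 → 𝕍 → Set ℓ
          Avoids c k = ∀ j → j ∈ k → ¬ e [ j ]= c
          avoidsᶠ : ∀ {n} → Tm n → Tm n → Tm n → Fm n
          avoidsᶠ e c k = ∀ᶠ v0 ∈ᶠ ↑ k ⇒ᶠ ¬ᶠ (↑ e [ v0 ]ᶠ= ↑ c)
          Bounded : 𝕍 → 𝕍 → Set ℓ
          Bounded k t = t ⊆ s₀ × (Avoids ∅ k → t ⊆ m B) × (Avoids (succ ∅) k → t ⊆ m A) ×
            (Avoids ∅ k → Avoids (succ ∅) k → t ⊆ ∅)
          stepᶠ : ∀ {n} → Tm n → Tm n → Tm n → Tm n → Tm n → Tm n → Fm n
          stepᶠ μ f e k r s = ∃ᶠ ∃ᶠ ↑² e [ ↑² k ]ᶠ= v1 ∧ᶠ (∃ᶠ ↑³ f [ v2 ]ᶠ= v0 ∧ᶠ ↑³ μ [ v0 ]ᶠ= v1) ∧ᶠ addReal (↑² r) v0 (↑² s)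
          boundedᶠ : Fm 7
          boundedᶠ = ∀ᶠ iterate (λ ↑ᵏ k r s → stepᶠ (↑ᵏ v2) (↑ᵏ v3) (↑ᵏ v4) k r s) ∅ᵗ v1 v0 ⇒ᶠ
            v0 ⊆ᶠ v5 ∧ᶠ (avoidsᶠ v4 ∅ᵗ v1 ⇒ᶠ v0 ⊆ᶠ v7) ∧ᶠ (avoidsᶠ v4 (succᵗ ∅ᵗ) v1 ⇒ᶠ v0 ⊆ᶠ v6) ∧ᶠ
            (avoidsᶠ v4 ∅ᵗ v1 ⇒ᶠ avoidsᶠ v4 (succᵗ ∅ᵗ) v1 ⇒ᶠ v0 ⊆ᶠ ∅ᵗ)
          ρ : Vec 𝕍 6
          ρ = μ ∷ seq ∷ e ∷ s₀ ∷ m A ∷ m B ∷ []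
          opaque
            unfolding AddReal
            bounded-unfold : ∀ k → (∀ t → Iterate (Step μ seq e) ∅ k t → Bounded k t) ⇔ ⟦ boundedᶠ ⟧ (k ∷ ρ)
            bounded-unfold k = ≡⇒⇔ refl
          before : ∀ {c k} → Avoids c (succ k) → Avoids c k
          before h j p = h j (∈succ (inj₁ p))
          avoids-before : ∀ {c k} → e [ k ]= c → Avoids c k
          avoids-before p j j∈k q = ∈-irrefl (subst (_∈ _) (inj j _ _ q p) j∈k)
          step : ∀ {k r t} → Bounded k r → Step μ seq e k r t → Bounded (succ k) t
          step {k} {r} {t} (h₁ , h₂ , h₃ , h₄) (i , v , ei , (C , fi , μC) , ar) = cases (seq-case fi)
            where
            cases : Case i C → Bounded (succ k) t
            cases (inj₁ (refl , refl)) =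
              let v≡ = m-eq μC ; ar′ = subst (λ v → AddReal r v t) (sym v≡) ar ; r⊆ = h₂ (avoids-before ei) in
              (λ x p → +ᴿ-comm-⊆ (m-real b) (m-real a) x (addReal-⊆ (m-real b) (m-real a) r⊆ ar′ x p)) ,
              (λ av → ⊥-elim (av k (∈succ (inj₂ refl)) ei)) ,
              (λ av → addReal-∅ˡ (h₄ (avoids-before ei) (before av)) ar′) ,
              (λ av → ⊥-elim (av k (∈succ (inj₂ refl)) ei))
            cases (inj₂ (inj₁ (refl , refl))) =
              let v≡ = m-eq μC ; ar′ = subst (λ v → AddReal r v t) (sym v≡) ar ; r⊆ = h₃ (avoids-before ei) in
              addReal-⊆ (m-real a) (m-real b) r⊆ ar′ ,
              (λ av → addReal-∅ˡ (h₄ (before av) (avoids-before ei)) ar′) ,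
              (λ av → ⊥-elim (av k (∈succ (inj₂ refl)) ei)) ,
              (λ _ av → ⊥-elim (av k (∈succ (inj₂ refl)) ei))
            cases (inj₂ (inj₂ (_ , _ , refl))) =
              let t⊆r = addReal-∅ (subst (λ v → AddReal r v t) (trans (sym (m-eq μC)) m∅) ar) in
              (λ x p → h₁ x (t⊆r x p)) , (λ av x p → h₂ (before av) x (t⊆r x p)) ,
              (λ av x p → h₃ (before av) x (t⊆r x p)) , (λ av av′ x p → h₄ (before av) (before av′) x (t⊆r x p))
          bounded-sums : ∀ k → k ∈ ω → ∀ t → Iterate (Step μ seq e) ∅ k t → Bounded k t
          bounded-sums k kω = from (bounded-unfold k) (ω-ind boundedᶠ ρ
            (to (bounded-unfold ∅) (λ t it → let e = iterate-0⁻ it in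
               empty-⊆ e _ , (λ _ → empty-⊆ e _) , (λ _ → empty-⊆ e _) , (λ _ _ → empty-⊆ e _)))
            (λ k kω h → to (bounded-unfold (succ k)) (λ t it → let (r , it′ , st) = iterate-s⁻ kω it in
               step (from (bounded-unfold k) h r it′) st)) k kω)

      additive : m ∅ ≡ ∅ → m (A ∪ B) ≡ m A +ᴿ m B
      additive m∅ = ext (proj₂ sums s₀ R₀ λ t (n , e , nω , E , inj , it) →
        proj₁ (Bound.bounded-sums E inj m∅ n (∈ω nω) t it)) superadditive

    m-∅ : m ∅ ≡ ∅
    m-∅ = ≡∅ λ v p → let (x , e) = real-frac R p in none x (subst (_∈ m ∅) e p)
      where
      R = m-real meas-∅
      ∅∪∅ : ∅ ∪ ∅ ≡ ∅
      ∅∪∅ = ≡∅ λ x p → [ ∉∅ , ∉∅ ]′ (∈∪⁻ p)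
      none : ∀ x → ¬ x ∈ᶜ m ∅
      none x p = let (y , q , x<y) = open-cut R {x} p
                     (z , r , z+y∉) = almost-top R {x} {y} (positive-above {x} {y} x<y) p
                 in z+y∉ (subst (λ A → z ⊕ y ∈ᶜ m A) ∅∪∅
                   (superadditive meas-∅ meas-∅ (λ _ q _ → ∉∅ q) _ (∈+ᴿ R R {z} {y} {z ⊕ y} r q (≤q-refl {z ⊕ y}))))

    m-∪ : ∀ {A B} → A ∈ Meas → B ∈ Meas → (∀ M → M ∈ A → ¬ M ∈ B) → m (A ∪ B) ≡ m A +ᴿ m B
    m-∪ a b d = additive a b d m-∅

    absorb : ∀ {A C} → C ⊆ A ∪ (C ∖ A)
    absorb {A} {C} M p with dec (M ∈ A)
    ... | yes q = ∈∪ (inj₁ q)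
    ... | no q  = ∈∪ (inj₂ (∈∖ p q))

    m-∪∖ : ∀ {A C} → A ∈ Meas → C ∈ Meas → m (A ∪ (C ∖ A)) ≡ m A +ᴿ m (C ∖ A)
    m-∪∖ a c = m-∪ a (meas-∖ c a) λ M p q → proj₂ (∈∖⁻ q) p

    m-split : ∀ {A B} → A ∈ Meas → B ∈ Meas → A ⊆ B → m B ≡ m A +ᴿ m (B ∖ A)
    m-split a b A⊆B = trans (cong m (ext absorb λ M p → [ A⊆B M , (λ q → proj₁ (∈∖⁻ q)) ]′ (∈∪⁻ p))) (m-∪∖ a b)

    m-mono : ∀ {A B} → A ∈ Meas → B ∈ Meas → A ⊆ B → m A ⊆ m B
    m-mono a b A⊆B = subst (_ ⊆_) (sym (m-split a b A⊆B)) (∈+ᴿˡ (m-real a) (m-real (meas-∖ b a)))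

    m-sub : ∀ {A B C x y} → A ∈ Meas → B ∈ Meas → C ∈ Meas → (∀ M → M ∈ C → M ∈ A ⊎ M ∈ B) →
      x ∉ᶜ m A → y ∉ᶜ m B → x ⊕ y ∉ᶜ m C
    m-sub {A} {B} {C} {x} {y} a b c C⊆ p q r = ∉+ᴿ (m-real a) (m-real (meas-∖ c a)) {x} {y} p
      (λ s → q (m-mono (meas-∖ c a) b (λ M t → let (t₁ , t₂) = ∈∖⁻ t in [ (λ u → ⊥-elim (t₂ u)) , id ]′ (C⊆ M t₁)) _ s))
      (subst (λ r → x ⊕ y ∈ᶜ r) (m-∪∖ a c) (m-mono c (meas-∪ a (meas-∖ c a)) absorb _ r))

    module _ {f I} (I⊆κ : I ⊆ κ) (F : f ∶ I ⟶ Meas) (disjoint : Disjoint f)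
             {𝒬} (𝒬⊆ : 𝒬 ⊆ Meas) (∅∈𝒬 : ∅ ∈ 𝒬) (∪∈𝒬 : ∀ U i A → U ∈ 𝒬 → f [ i ]= A → U ∪ A ∈ 𝒬) where
      private
        module S = Sequence I⊆κ F
        module _ {e} (inj : Injective e) where
          Covered : 𝕍 → 𝕍 → Set ℓ
          Covered k U = ∀ M → M ∈ U → ∃[ j ] ∃[ i ] ∃[ A ] j ∈ k × e [ j ]= i × f [ i ]= A × M ∈ A
          Bounded : 𝕍 → 𝕍 → Set ℓ
          Bounded k t = ∃[ U ] U ∈ 𝒬 × Covered k U × t ⊆ m U
          stepᶠ : ∀ {n} → Tm n → Tm n → Tm n → Tm n → Tm n → Tm n → Fm n
          stepᶠ μ f e k r s = ∃ᶠ ∃ᶠ ↑² e [ ↑² k ]ᶠ= v1 ∧ᶠ (∃ᶠ ↑³ f [ v2 ]ᶠ= v0 ∧ᶠ ↑³ μ [ v0 ]ᶠ= v1) ∧ᶠ addReal (↑² r) v0 (↑² s)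
          boundedᶠ : Fm 6
          boundedᶠ = ∀ᶠ iterate (λ ↑ᵏ k r s → stepᶠ (↑ᵏ v2) (↑ᵏ v3) (↑ᵏ v4) k r s) ∅ᵗ v1 v0 ⇒ᶠ
            (∃ᶠ v0 ∈ᶠ v6 ∧ᶠ (∀ᶠ v0 ∈ᶠ v1 ⇒ᶠ (∃ᶠ ∃ᶠ ∃ᶠ v2 ∈ᶠ v6 ∧ᶠ ↑ v8 [ v2 ]ᶠ= v1 ∧ᶠ v8 [ v1 ]ᶠ= v0 ∧ᶠ v3 ∈ᶠ v0)) ∧ᶠ
              v1 ⊆ᶠ valᵗ v7 v3 v0)
          ρ : Vec 𝕍 5
          ρ = μ ∷ f ∷ e ∷ 𝒬 ∷ fractions ∷ []
          opaque
            unfolding AddReal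
            bounded-unfold : ∀ k → (∀ t → Iterate (Step μ f e) ∅ k t → Bounded k t) ⇔ ⟦ boundedᶠ ⟧ (k ∷ ρ)
            bounded-unfold k = ≡⇒⇔ refl
          step : ∀ {k r t} → Bounded k r → Step μ f e k r t → Bounded (succ k) t
          step {k} {r} {t} (U , U∈ , cov , r⊆) (i , v , ei , (A , fi , μA) , ar) =
            U ∪ A , ∪∈𝒬 U i A U∈ fi ,
            (λ M p → [ (λ q → let (j , i′ , A′ , j∈ , s) = cov M q in j , i′ , A′ , ∈succ (inj₁ j∈) , s)
                     , (λ q → k , i , A , ∈succ (inj₂ refl) , ei , fi , q) ]′ (∈∪⁻ p)) ,
            λ x p → superadditive (𝒬⊆ U U∈) (proj₂ F i A fi) apart x
              (addReal-⊆ (m-real (𝒬⊆ U U∈)) (m-real (proj₂ F i A fi)) r⊆ (subst (λ v → AddReal r v t) (sym (m-eq μA)) ar) x p)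
            where
            apart : ∀ M → M ∈ U → ¬ M ∈ A
            apart M p q = let (j , i′ , A′ , j∈ , ej , fi′ , p′) = cov M p in
              ∈-irrefl (subst (_∈ k) (inj j k i (subst (λ i → e [ j ]= i) (disjoint i′ i A′ A M fi′ fi p′ q) ej) ei) j∈)
          bounded-sums : ∀ k → k ∈ ω → ∀ t → Iterate (Step μ f e) ∅ k t → Bounded k t
          bounded-sums k kω = from (bounded-unfold k) (ω-ind boundedᶠ ρ
            (to (bounded-unfold ∅) (λ t it → ∅ , ∅∈𝒬 , (λ M p → ⊥-elim (∉∅ p)) , empty-⊆ (iterate-0⁻ it) (m ∅)))
            (λ k kω h → to (bounded-unfold (succ k)) (λ t it → let (r , it′ , st) = iterate-s⁻ kω it in
               step (from (bounded-unfold k) h r it′) st)) k kω)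

      partial-sum-bound : ∀ {t} → PartialSum μ f I t → ∃[ U ] U ∈ 𝒬 × U ⊆ ⋃[ f ] × t ⊆ m U
      partial-sum-bound {t} (n , e , nω , E , inj , it) =
        let (U , U∈ , cov , t⊆) = bounded-sums inj n (∈ω nω) t it in
        U , U∈ , (λ M p → let (_ , i , A , _ , _ , fi , q) = cov M p in S.∈⋃[] fi q) , t⊆

      module _ (additive : Additive μ I) where
        limit-bound : ∀ {s} → IsReal s → (∀ U → U ∈ 𝒬 → U ⊆ ⋃[ f ] → m U ⊆ s) → m ⋃[ f ] ⊆ s
        limit-bound {s} R h = proj₂ (additive f F disjoint (m ⋃[ f ]) (m-graph S.meas-⋃[])) s R
          λ t ps x p → let (U , U∈ , U⊆ , t⊆) = partial-sum-bound ps in h U U∈ U⊆ x (t⊆ x p)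

        limit-witness : ∀ {x} → x ∈ᶜ m ⋃[ f ] → ∃[ U ] U ∈ 𝒬 × U ⊆ ⋃[ f ] × x ∈ᶜ m U
        limit-witness {x} p = by-contradiction λ h → ≤q⇒≯ {x} {x} (≤q-refl {x}) (∈cut⁻ {x} {x}
          (limit-bound (cut-real x) (λ U U∈ U⊆ v q → let (y , e) = real-frac (m-real (𝒬⊆ U U∈)) q in
            subst (_∈ cut x) (sym e) (∈cut {y} {x} (∈<∉ (m-real (𝒬⊆ U U∈)) {y} {x} (subst (_∈ m U) e q)
              (λ r → h (U , U∈ , U⊆ , r))))) ⌜ x ⌝ p))

        approximate-below : ∀ {ε} → PositiveQ ε → ∃[ U ] U ∈ 𝒬 × U ⊆ ⋃[ f ] × ε ∉ᶜ m (⋃[ f ] ∖ U)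
        approximate-below {ε} ε>0 = choose (dec (ε ∈ᶜ m ⋃[ f ]))
          where
          R = m-real S.meas-⋃[]
          Goal : Set ℓ
          Goal = ∃[ U ] U ∈ 𝒬 × U ⊆ ⋃[ f ] × ε ∉ᶜ m (⋃[ f ] ∖ U)
          choose : Dec (ε ∈ᶜ m ⋃[ f ]) → Goal
          choose (no ε∉) = ∅ , ∅∈𝒬 , (λ M p → ⊥-elim (∉∅ p)) ,
            λ p → ε∉ (m-mono (meas-∖ S.meas-⋃[] meas-∅) S.meas-⋃[] (λ M q → proj₁ (∈∖⁻ q)) _ p)
          choose (yes ε∈) =
            let (x , x∈ , x+ε∉) = almost-top R {ε} {ε} ε>0 ε∈
                (U , U∈ , U⊆ , x∈U) = limit-witness {x} x∈
                u = 𝒬⊆ U U∈ ; u′ = meas-∖ S.meas-⋃[] u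
            in U , U∈ , U⊆ , λ p → x+ε∉ (subst (λ r → x ⊕ ε ∈ᶜ r) (sym (m-split u S.meas-⋃[] U⊆))
              (∈+ᴿ (m-real u) (m-real u′) {x} {ε} {x ⊕ ε} x∈U p (≤q-refl {x ⊕ ε})))

    ∉-mono : ∀ {A B x} → A ∈ Meas → B ∈ Meas → A ⊆ B → x ∉ᶜ m B → x ∉ᶜ m A
    ∉-mono a b A⊆B p q = p (m-mono a b A⊆B _ q)

    ∉-up : ∀ {A x y} → A ∈ Meas → x ≤q y → x ∉ᶜ m A → y ∉ᶜ m A
    ∉-up {A} {x} {y} a h p = up (m-real a) {x} {y} h p

    halves : ∀ {A B C ε} → A ∈ Meas → B ∈ Meas → C ∈ Meas → (∀ M → M ∈ C → M ∈ A ⊎ M ∈ B) →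
      half ε ∉ᶜ m A → half ε ∉ᶜ m B → ε ∉ᶜ m C
    halves {ε = ε} a b c h p q = ∉-up {x = half ε ⊕ half ε} {ε} c (half-⊕ ε) (m-sub {x = half ε} {half ε} a b c h p q)

    module _ {c} (C : c ∶ ω ⟶ Meas) where
      private
        module S = Sequence ω⊆κ C
        open Continued C
        module D = Disjointify seq-map

        𝒬ᶠ : Fm 4
        𝒬ᶠ = ∃ᶠ v0 ∈ᶠ v3 ∧ᶠ v1 ⊆ᶠ compr initᶠ (v2 ∷ v0 ∷ []) v4
        𝒬 : 𝕍
        𝒬 = sep 𝒬ᶠ (c ∷ ω ∷ Str ∷ []) Meas
        ∈𝒬 : ∀ {U n} → U ∈ Meas → n ∈ ω → U ⊆ init c n → U ∈ 𝒬
        ∈𝒬 {U} {n} u p q = ∈sep 𝒬ᶠ (c ∷ ω ∷ Str ∷ []) u (n , p , q)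
        ∈𝒬⁻ : ∀ {U} → U ∈ 𝒬 → U ∈ Meas × (∃[ n ] n ∈ ω × U ⊆ init c n)
        ∈𝒬⁻ p = ∈sep⁻ 𝒬ᶠ (c ∷ ω ∷ Str ∷ []) p
        init-mono : ∀ {m n} → m ⊆ n → init c m ⊆ init c n
        init-mono h M p = let (i , A , q , r , s) = ∈init⁻ p in S.∈init (h i q) r s
        ∅∈ : ∅ ∈ 𝒬
        ∅∈ = ∈𝒬 meas-∅ 0∈ω (λ M p → ⊥-elim (∉∅ p))
        piece⊆ : ∀ {i A} → D.T.fun κ [ i ]= A → (i ∈ ω × A ⊆ init c (succ i)) ⊎ (A ≡ ∅)
        piece⊆ {i} {A} p = [ (λ (_ , B , q , e) → [ (λ r → inj₁ (dom (proj₁ C) r , λ M s → S.∈init (∈succ (inj₂ refl)) r (proj₁ (∈∖⁻ (subst (M ∈_) e s)))))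
                                                   , (λ e′ → inj₂ (≡∅ λ M s → ∉∅ (subst (M ∈_) e′ (proj₁ (∈∖⁻ (subst (M ∈_) e s)))))) ]′ (seq-value {i} {B} q))
                           , (λ (_ , e) → inj₂ e) ]′ (D.T-case p)
        ∪∈ : ∀ U i A → U ∈ 𝒬 → D.T.fun κ [ i ]= A → U ∪ A ∈ 𝒬
        ∪∈ U i A p q = [ (λ (iω , h) → larger iω h (ω-trichotomy nω (s∈ω iω)))
                       , (λ e → ∈𝒬 m∪ nω (λ M s → [ U⊆ M , (λ t → ⊥-elim (∉∅ (subst (M ∈_) e t))) ]′ (∈∪⁻ s))) ]′ (piece⊆ q)
          where
          n = proj₁ (proj₂ (∈𝒬⁻ p))
          nω : n ∈ ω
          nω = proj₁ (proj₂ (proj₂ (∈𝒬⁻ p)))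
          U⊆ : U ⊆ init c n
          U⊆ = proj₂ (proj₂ (proj₂ (∈𝒬⁻ p)))
          m∪ : U ∪ A ∈ Meas
          m∪ = meas-∪ (proj₁ (∈𝒬⁻ p)) (proj₂ (D.T-map κ) i A q)
          larger : i ∈ ω → A ⊆ init c (succ i) → Comparable n (succ i) → U ∪ A ∈ 𝒬
          larger iω h (inj₁ n∈) = ∈𝒬 m∪ (s∈ω iω) λ M s → [ (λ t → init-mono (nat-transitive (s∈ω iω) n n∈) M (U⊆ M t)) , h M ]′ (∈∪⁻ s)
          larger iω h (inj₂ (inj₁ e)) = ∈𝒬 m∪ nω λ M s → [ U⊆ M , (λ t → subst (λ n → M ∈ init c n) (sym e) (h M t)) ]′ (∈∪⁻ s)
          larger iω h (inj₂ (inj₂ s∈)) = ∈𝒬 m∪ nω λ M s → [ U⊆ M , (λ t → init-mono (nat-transitive nω (succ i) s∈) M (h M t)) ]′ (∈∪⁻ s)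
        ⋃≡ : ⋃[ D.T.fun κ ] ≡ ⋃[ c ]
        ⋃≡ = trans (D.⋃T (proj₁ κ-ordinal) (λ _ p → p)) (ext
          (λ M p → let (i , A , _ , q , r) = ∈init⁻ p in [ (λ s → S.∈⋃[] s r) , (λ e → ⊥-elim (∉∅ (subst (M ∈_) e r))) ]′ (seq-value {i} {A} q))
          (λ M p → let (i , A , q , r) = ∈⋃[]⁻ p in D.∈init (ω⊆κ i (dom (proj₁ C) q)) (seq-at q) r))

      σ-bound : ∀ {x} → (∀ n → n ∈ ω → x ∉ᶜ m (init c n)) → x ∉ᶜ m ⋃[ c ]
      σ-bound {x} h p =
        let (U , U∈ , _ , q) = limit-witness (λ _ p → p) (D.T-map κ) (D.T-disjoint κ) (λ U p → proj₁ (∈𝒬⁻ p)) ∅∈ ∪∈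
                                 (Measure.κ-additive Mμ) {x} (subst (λ A → x ∈ᶜ m A) (sym ⋃≡) p)
            (u , n , nω , U⊆) = ∈𝒬⁻ U∈
        in h n nω (m-mono u (S.meas-init (λ k k∈ → ω-transitive nω k∈)) U⊆ _ q)

    m-sub⁻ : ∀ {A B C v} → A ∈ Meas → B ∈ Meas → C ∈ Meas → (∀ M → M ∈ C → M ∈ A ⊎ M ∈ B) → v ∈ m C →
      v ∈ m A ⊎ v ∈ m B ⊎ (∃[ z ] ∃[ x ] ∃[ y ] v ≡ ⌜ z ⌝ × x ∈ᶜ m A × y ∈ᶜ m B × z ≤q x ⊕ y)
    m-sub⁻ {A} {B} {C} {v} a b c h p = Sum.map₂ (Sum.map (B⊇ v) (λ (z , x , y , e , q , r , k) → z , x , y , e , q , B⊇ ⌜ y ⌝ r , k))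
      (∈+ᴿ⁻ (m-real a) (m-real (meas-∖ c a)) (subst (v ∈_) (m-∪∖ a c) (m-mono c (meas-∪ a (meas-∖ c a)) absorb v p)))
      where
      B⊇ : m (C ∖ A) ⊆ m B
      B⊇ = m-mono (meas-∖ c a) b (λ M q → let (r , n) = ∈∖⁻ q in [ (λ s → ⊥-elim (n s)) , id ]′ (h M r))

    module _ {c δ} (C : c ∶ ω ⟶ Meas) (Δ : δ ∶ ω ⟶ Pos)
             (halving : Halving δ)
             (small : ∀ n ε A → δ [ n ]= ⌜ ε ⌝ → c [ n ]= A → ε ∉ᶜ m A) where
      private
        open Tail C
        open Vanishing Δ halving

        module _ {a α} (aω : a ∈ ω) (α-at : δ [ a ]= ⌜ α ⌝) where
          D : Fraction
          D = α ⊕ α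

          Bounded : 𝕍 → Set ℓ
          Bounded n = n ∉ a → ∀ d s → δ [ n ]= d → AddFrac d d s →
            s ≤Q ⌜ D ⌝ × (∀ v t → v ∈ m (between′ a n) → AddFrac v s t → t ≤Q ⌜ D ⌝)

          boundedᶠ : Fm 8
          boundedᶠ = ¬ᶠ (v0 ∈ᶠ v7) ⇒ᶠ (∀ᶠ ∀ᶠ v4 [ v2 ]ᶠ= v1 ⇒ᶠ addFrac v1 v1 v0 ⇒ᶠ
            v0 ≤ᶠ v8 ∧ᶠ (∀ᶠ ∀ᶠ v1 ∈ᶠ valᵗ v8 v7 (compr initᶠ (v5 ∷ v4 ∷ []) (↑ v8)) ⇒ᶠ addFrac v1 v2 v0 ⇒ᶠ v0 ≤ᶠ ↑² v8))
          ρ : Vec 𝕍 7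
          ρ = drop a ∷ δ ∷ μ ∷ fractions ∷ Str ∷ ⌜ D ⌝ ∷ a ∷ []

          opaque
            unfolding _<Q_
            bounded-unfold : ∀ n → Bounded n ⇔ ⟦ boundedᶠ ⟧ (n ∷ ρ)
            bounded-unfold n = ≡⇒⇔ refl

          FBounded : 𝕍 → Set ℓ
          FBounded n = ∀ ε → δ [ n ]= ⌜ ε ⌝ → ε ⊕ ε ≤q D × (∀ x → x ∈ᶜ m (between′ a n) → x ⊕ (ε ⊕ ε) ≤q D)

          elim : ∀ {n} → Bounded n → n ∉ a → FBounded n
          elim h n∉a ε p =
            let (k , l) = h n∉a ⌜ ε ⌝ ⌜ ε ⊕ ε ⌝ p (⊕⇒AddFrac ε ε) in
            ≤Q⇒≤q {ε ⊕ ε} {D} k ,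
            λ x q → ≤Q⇒≤q {x ⊕ (ε ⊕ ε)} {D} (l ⌜ x ⌝ ⌜ x ⊕ (ε ⊕ ε) ⌝ q (⊕⇒AddFrac x (ε ⊕ ε)))

          intro : ∀ {n} → n ∈ ω → (n ∉ a → FBounded n) → Bounded n
          intro {n} nω h n∉a d s p add =
            let (ε , e , _) = ∈Pos⁻ (proj₂ Δ n d p)
                s≡ = AddFrac⇒⊕ {ε} {ε} (subst (λ d → AddFrac d d s) e add)
                (k , l) = h n∉a ε (subst (λ d → δ [ n ]= d) e p)
            in subst (_≤Q ⌜ D ⌝) (sym s≡) (≤q⇒≤Q {ε ⊕ ε} {D} k) , second s≡ l
            where
            second : ∀ {ε} → s ≡ ⌜ ε ⊕ ε ⌝ → (∀ x → x ∈ᶜ m (between′ a n) → x ⊕ (ε ⊕ ε) ≤q D) →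
              ∀ v t → v ∈ m (between′ a n) → AddFrac v s t → t ≤Q ⌜ D ⌝
            second {ε} s≡ l v t q add′ =
              let (x , e) = real-frac (m-real (meas-between nω)) q
                  t≡ = AddFrac⇒⊕ {x} {ε ⊕ ε} (subst₂ (λ v s → AddFrac v s t) e s≡ add′)
              in subst (_≤Q ⌜ D ⌝) (sym t≡) (≤q⇒≤Q {x ⊕ (ε ⊕ ε)} {D} (l x (subst (_∈ m (between′ a n)) e q)))

          start : ∀ {n} → n ≡ a → FBounded n
          start e ε p = same-≤ (functional (proj₁ Δ) (subst (λ n → δ [ n ]= ⌜ ε ⌝) e p) α-at) ,
            λ x q → ⊥-elim (∉∅ (subst (⌜ x ⌝ ∈_) (trans (cong m (between-∅ (λ i i∈ → subst (i ∈_) e i∈))) m-∅) q))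
            where
            same-≤ : ⌜ ε ⌝ ≡ ⌜ α ⌝ → ε ⊕ ε ≤q D
            same-≤ e = ⊕-mono-≤ {ε} {α} {ε} {α} ε≤α ε≤α
              where
              ε≤α : ε ≤q α
              ε≤α = ≤Q⇒≤q {ε} {α} (subst (_≤Q ⌜ α ⌝) (sym e) (≤q⇒≤Q {α} {α} (≤q-refl {α})))

          next : ∀ {n} → n ∈ ω → FBounded n → FBounded (succ n)
          next {n} nω h ε′ p′ = next′ (δ-value n nω) (value (proj₁ C) nω)
            where
            next′ : (∃[ ε ] δ [ n ]= ⌜ ε ⌝ × PositiveQ ε) → (∃[ A ] c [ n ]= A) →
              ε′ ⊕ ε′ ≤q D × (∀ x → x ∈ᶜ m (between′ a (succ n)) → x ⊕ (ε′ ⊕ ε′) ≤q D)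
            next′ (ε , p , _) (A , q) = ≤q-trans {ε′ ⊕ ε′} {ε} {D} 2ε′≤ε ε≤D , bound′
              where
              2ε′≤ε : ε′ ⊕ ε′ ≤q ε
              2ε′≤ε = halving n ε ε′ p p′
              2ε≤D : ε ⊕ ε ≤q D
              2ε≤D = proj₁ (h ε p)
              ε≤D : ε ≤q D
              ε≤D = ≤q-trans {ε} {ε ⊕ ε} {D} (x≤x⊕y ε ε) 2ε≤D
              A∈ : A ∈ Meas
              A∈ = proj₂ C n A q
              below-ε : ∀ {z} → z ∈ᶜ m A → z ≤q ε
              below-ε {z} r = <q⇒≤q {z} {ε} (∈<∉ (m-real A∈) {z} {ε} r (small n ε _ p q))
              bound′ : ∀ x → x ∈ᶜ m (between′ a (succ n)) → x ⊕ (ε′ ⊕ ε′) ≤q D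
              bound′ x r = [ old , [ new , (λ (z , y , w , e , s , t , k) → mixed e s t k) ]′ ]′
                  (m-sub⁻ (meas-between nω) A∈ (meas-between (s∈ω nω)) (between-succ q) r)
                where
                old : x ∈ᶜ m (between′ a n) → x ⊕ (ε′ ⊕ ε′) ≤q D
                old s = ≤q-trans {x ⊕ (ε′ ⊕ ε′)} {x ⊕ (ε ⊕ ε)} {D}
                  (⊕-mono-≤ {x} {x} {ε′ ⊕ ε′} {ε ⊕ ε} (≤q-refl {x}) (≤q-trans {ε′ ⊕ ε′} {ε} {ε ⊕ ε} 2ε′≤ε (x≤x⊕y ε ε)))
                  (proj₂ (h ε p) x s)
                new : x ∈ᶜ m A → x ⊕ (ε′ ⊕ ε′) ≤q D
                new s = ≤q-trans {x ⊕ (ε′ ⊕ ε′)} {ε ⊕ ε} {D} (⊕-mono-≤ {x} {ε} {ε′ ⊕ ε′} {ε} (below-ε {x} s) 2ε′≤ε) 2ε≤D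
                mixed : ∀ {z y w} → ⌜ x ⌝ ≡ ⌜ z ⌝ → y ∈ᶜ m (between′ a n) → w ∈ᶜ m A → z ≤q y ⊕ w → x ⊕ (ε′ ⊕ ε′) ≤q D
                mixed {z} {y} {w} e s t k =
                  ≤q-trans {x ⊕ (ε′ ⊕ ε′)} {(y ⊕ w) ⊕ ε} {D}
                    (⊕-mono-≤ {x} {y ⊕ w} {ε′ ⊕ ε′} {ε} (≤Q⇒≤q {x} {y ⊕ w} (subst (_≤Q ⌜ y ⊕ w ⌝) (sym e) (≤q⇒≤Q {z} {y ⊕ w} k))) 2ε′≤ε)
                  (≤q-trans {(y ⊕ w) ⊕ ε} {y ⊕ (w ⊕ ε)} {D} (⊕-assoc y w ε)
                  (≤q-trans {y ⊕ (w ⊕ ε)} {y ⊕ (ε ⊕ ε)} {D}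
                    (⊕-mono-≤ {y} {y} {w ⊕ ε} {ε ⊕ ε} (≤q-refl {y}) (⊕-mono-≤ {w} {ε} {ε} {ε} (below-ε {w} t) (≤q-refl {ε})))
                    (proj₂ (h ε p) y s)))

          all-bounded : ∀ n → n ∈ ω → Bounded n
          all-bounded n nω = from (bounded-unfold n) (ω-ind boundedᶠ ρ
            (to (bounded-unfold ∅) (intro 0∈ω λ ∅∉a → start (first ∅∉a (ω-cases aω))))
            (λ n nω h → to (bounded-unfold (succ n)) (intro (s∈ω nω) λ sn∉a →
              step nω (from (bounded-unfold n) h) sn∉a (ω-trichotomy nω aω))) n nω)
            where
            first : ¬ ∅ ∈ a → a ≡ ∅ ⊎ (∃[ b ] b ∈ ω × a ≡ succ b) → ∅ ≡ a
            first _ (inj₁ e) = sym e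
            first n (inj₂ (b , bω , e)) = ⊥-elim (n (subst (∅ ∈_) (sym e) (0∈succ bω)))
            step : ∀ {n} → n ∈ ω → Bounded n → succ n ∉ a → Comparable n a → FBounded (succ n)
            step nω h sn∉a (inj₂ (inj₁ e)) = next nω (elim h λ p → ∈-irrefl (subst (_ ∈_) (sym e) p))
            step nω h sn∉a (inj₂ (inj₂ q)) = next nω (elim h λ p → ∈-asym p q)
            step nω h sn∉a (inj₁ n∈a) = start ([ (λ sn∈ → ⊥-elim (sn∉a sn∈)) , [ id , (λ a∈sn → ⊥-elim ([ (λ a∈n → ∈-asym a∈n n∈a) , (λ e → ∈-irrefl (subst (_∈ a) (sym e) n∈a)) ]′ (∈succ⁻ a∈sn))) ]′ ]′
              (ω-trichotomy (s∈ω nω) aω))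

          finite : ∀ n → n ∈ ω → D ∉ᶜ m (between′ a n)
          finite n nω p = cases (dec (n ∈ a))
            where
            cases : Dec (n ∈ a) → ⊥
            cases (yes q) = ∉∅ (subst (⌜ D ⌝ ∈_) (trans (cong m (between-∅ (nat-transitive aω n q))) m-∅) p)
            cases (no q)  = let (ε , r , ε>0) = δ-value n nω in
              ≤q⇒≯ {D ⊕ (ε ⊕ ε)} {D} (proj₂ (elim (all-bounded n nω) q ε r) D p)
                (<q-≤q-trans {D} {D ⊕ ε} {D ⊕ (ε ⊕ ε)} (x<x⊕ε D {ε} ε>0)
                  (⊕-mono-≤ {D} {D} {ε} {ε ⊕ ε} (≤q-refl {D}) (x≤x⊕y ε ε)))

      tail-small : ∀ {a α} → a ∈ ω → δ [ a ]= ⌜ α ⌝ → α ⊕ α ∉ᶜ m (tail c a)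
      tail-small {a} {α} aω p q = σ-bound (drop-map a) {α ⊕ α} (finite {a} {α} aω p) (subst (λ A → α ⊕ α ∈ᶜ m A) (sym ⋃drop) q)

    Shifts : 𝕍 → 𝕍 → Set ℓ
    Shifts δ b = ∀ (n : 𝕍) (ε : Fraction) (B g : 𝕍) → δ [ n ]= ⌜ ε ⌝ → b [ n ]= B → IsSym g → ε ∉ᶜ m (B △ im g B)

    Steps : 𝕍 → 𝕍 → Set ℓ
    Steps δ b = ∀ (n : 𝕍) (ε : Fraction) (B B′ : 𝕍) → δ [ n ]= ⌜ ε ⌝ → b [ n ]= B → b [ succ n ]= B′ → ε ∉ᶜ m (B △ B′)

    Start : Fraction → Fraction → 𝕍 → Set ℓ
    Start ε η B = η ∈ᶜ m B × η ∈ᶜ m (Str ∖ B) × (ε ⊕ ε) ⊕ ε ≤q η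

    Starts : 𝕍 → 𝕍 → Set ℓ
    Starts δ b = Σ Fraction λ ε → Σ Fraction λ η → Σ 𝕍 λ B → δ [ ∅ ]= ⌜ ε ⌝ × b [ ∅ ]= B × Start ε η B

    Path : 𝕍 → 𝕍 → Set ℓ
    Path δ b = δ ∶ ω ⟶ Pos × b ∶ ω ⟶ 𝒜 × Halving δ × Shifts δ b × Steps δ b × Starts δ b

    IsNontrivialInvariant : 𝕍 → Set ℓ
    IsNontrivialInvariant A = A ∈ Meas × (∀ g → IsSym g → m (im g A △ A) ≡ ∅) × (∃[ x ] x ∈ᶜ m A) × (∃[ x ] x ∈ᶜ m (Str ∖ A))

    null : ∀ {A} → A ∈ Meas → (∀ ε → PositiveQ ε → ε ∉ᶜ m A) → m A ≡ ∅
    null {A} a h = ≡∅ λ v p → let (x , e) = real-frac (m-real a) p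
                                  (y , q , x<y) = open-cut (m-real a) {x} (subst (_∈ m A) e p)
                              in h y (positive-above {x} {y} x<y) q

    module FromPath {δ b} (P : Path δ b) where
      private
        δ-map : δ ∶ ω ⟶ Pos
        δ-map = proj₁ P
        b-map : b ∶ ω ⟶ 𝒜
        b-map = proj₁ (proj₂ P)
        halving : Halving δ
        halving = proj₁ (proj₂ (proj₂ P))
        shift : Shifts δ b
        shift = proj₁ (proj₂ (proj₂ (proj₂ P)))
        step : Steps δ b
        step = proj₁ (proj₂ (proj₂ (proj₂ (proj₂ P))))
        start : Starts δ b
        start = proj₂ (proj₂ (proj₂ (proj₂ (proj₂ P))))
        B : b ∶ ω ⟶ Meas
        B = proj₁ b-map , λ n A p → 𝒜⊆Meas A (proj₂ b-map n A p)
        open LimSup B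
        open Tail B

        module Shift {g} (Sg : IsSym g) where
          open Image Sg
          φ : Fm 8
          φ = ∃ᶠ v4 [ v2 ]ᶠ= v0 ∧ᶠ v1 ≈ᶠ △ᵗ v0 (compr imᶠ (v5 ∷ v0 ∷ v6 ∷ v7 ∷ []) v8)
          module K = Graph φ (b ∷ g ∷ X ∷ 𝓛 ∷ Str ∷ []) ω Meas
          c : 𝕍
          c = K.fun
          C : c ∶ ω ⟶ Meas
          C = K.fun-map
            (λ n p → let (A , q) = value (proj₁ B) p ; a = proj₂ B n A q in A △ im g A , meas-△ a (meas-im a) , A , q , refl)
            (λ n A A′ p (D , q , e) (D′ , q′ , e′) → trans e (trans (cong (λ D → D △ im g D) (functional (proj₁ B) q q′)) (sym e′)))
          c-at : ∀ {n A} → b [ n ]= A → c [ n ]= A △ im g A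
          c-at {n} {A} p = K.fun-intro (dom (proj₁ B) p) (meas-△ (proj₂ B n A p) (meas-im (proj₂ B n A p))) (A , p , refl)
          c-small : ∀ n ε A → δ [ n ]= ⌜ ε ⌝ → c [ n ]= A → ε ∉ᶜ m A
          c-small n ε A p q r = let (D , s , e) = proj₂ (proj₂ (K.fun-elim q)) in
            shift n ε D g p s Sg (subst (λ A → ε ∈ᶜ m A) e r)
          module TC = Tail C

          invariant⊆ : ∀ {a} → a ∈ ω → im g limsup △ limsup ⊆ tail c a
          invariant⊆ {a} aω N p = [ left , right ]′ (∈△⁻ p)
            where
            left : N ∈ im g limsup × N ∉ limsup → N ∈ tail c a
            left (q , r) = let (N∈ , M , M∈ , act) = ∈im⁻ q
                               (n , nω , N∉) = ∉limsup⁻ N∈ r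
                               (k , kω , n⊆ , a⊆) = ω-max nω aω
                               (j , A , j∉ , bj , M∈A) = ∈tail⁻ (∈limsup⁻ M∈ k kω)
                           in TC.∈tail (λ j∈a → j∉ (a⊆ j j∈a)) (c-at bj)
                             (∈△ (inj₂ (∈im M∈A act , λ N∈A → N∉ (∈tail (λ j∈n → j∉ (n⊆ j j∈n)) bj N∈A))))
            right : N ∈ limsup × N ∉ im g limsup → N ∈ tail c a
            right (q , r) = let (M , M∈ , act) = act-surjective (limsup⊆ N q)
                                (n , nω , M∉) = ∉limsup⁻ M∈ (λ s → r (∈im s act))
                                (k , kω , n⊆ , a⊆) = ω-max nω aω
                                (j , A , j∉ , bj , N∈A) = ∈tail⁻ (∈limsup⁻ q k kω)
                            in TC.∈tail (λ j∈a → j∉ (a⊆ j j∈a)) (c-at bj)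
                                (∈△ (inj₁ (N∈A , λ N∈gA → M∉ (∈tail (λ j∈n → j∉ (n⊆ j j∈n)) bj
                                   (im-iff (meas⊆Str (proj₂ B j A bj)) M∈ act N∈gA)))))

          invariant : m (im g limsup △ limsup) ≡ ∅
          invariant = null (meas-△ (meas-im meas-limsup) meas-limsup) λ ε ε>0 p →
            let (n , η , q , η>0 , η<ε) = Vanishing.vanishing δ-map halving {ε} ε>0
                nω = dom (proj₁ δ-map) q
                (ε′ , q′ , _) = Vanishing.δ-value δ-map halving (succ n) (s∈ω nω)
            in ∉-up {x = ε′ ⊕ ε′} {ε} TC.meas-tail
                 (≤q-trans {ε′ ⊕ ε′} {η} {ε} (halving n η ε′ q q′) (<q⇒≤q {η} {ε} η<ε))
                 (tail-small C δ-map halving c-small {succ n} {ε′} (s∈ω nω) q′)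
                 (m-mono (meas-△ (meas-im meas-limsup) meas-limsup) TC.meas-tail (invariant⊆ (s∈ω nω)) ⌜ ε ⌝ p)

        ψ : Fm 4
        ψ = ∃ᶠ ∃ᶠ v5 [ v3 ]ᶠ= v1 ∧ᶠ v5 [ succᵗ v3 ]ᶠ= v0 ∧ᶠ v2 ≈ᶠ △ᵗ v1 v0
        module D = Graph ψ (b ∷ []) ω Meas
        d : 𝕍
        d = D.fun
        D-map : d ∶ ω ⟶ Meas
        D-map = D.fun-map
          (λ n p → let (A , q) = value (proj₁ B) p ; (A′ , q′) = value (proj₁ B) (s∈ω p) in
            A △ A′ , meas-△ (proj₂ B n A q) (proj₂ B (succ n) A′ q′) , A , A′ , q , q′ , refl)
          (λ n E E′ p (A , A′ , q , q′ , e) (C , C′ , r , r′ , e′) →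
            trans e (trans (cong₂ _△_ (functional (proj₁ B) q r) (functional (proj₁ B) q′ r′)) (sym e′)))
        module TD = Tail D-map

        d-small : ∀ n ε A → δ [ n ]= ⌜ ε ⌝ → d [ n ]= A → ε ∉ᶜ m A
        d-small n ε _ p q r = let (A , A′ , s , s′ , e) = proj₂ (proj₂ (D.fun-elim q)) in
          step n ε A A′ p s s′ (subst (λ A → ε ∈ᶜ m A) e r)

        Agree : 𝕍 → 𝕍 → 𝕍 → Set ℓ
        Agree M A₀ n = ∀ A → b [ n ]= A → (M ∈ A → M ∈ A₀) × (M ∈ A₀ → M ∈ A)

        -- A structure outside all b(k) △ b(k + 1) lies in all b(k) or in none.
        agree : ∀ {M A₀} → b [ ∅ ]= A₀ → M ∉ tail d ∅ → ∀ n → n ∈ ω → Agree M A₀ n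
        agree {M} {A₀} b₀ M∉ = ω-ind (∀ᶠ v3 [ v1 ]ᶠ= v0 ⇒ᶠ (v2 ∈ᶠ v0 ⇒ᶠ v2 ∈ᶠ v4) ∧ᶠ (v2 ∈ᶠ v4 ⇒ᶠ v2 ∈ᶠ v0)) (M ∷ b ∷ A₀ ∷ [])
          (λ A p → let e = functional (proj₁ B) p b₀ in subst (M ∈_) e , subst (M ∈_) (sym e))
          (λ n nω h A′ q′ → let (A , q) = value (proj₁ B) nω
                                a△a′ = λ s → M∉ (TD.∈tail ∉∅ (D.fun-intro nω (meas-△ (proj₂ B n A q) (proj₂ B (succ n) A′ q′)) (A , A′ , q , q′ , refl)) s)
                                (k , l) = △-agree a△a′ ; (k′ , l′) = h A q
                            in (λ s → k′ (l s)) , (λ s → k (l′ s)))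

        near-start : ∀ {A₀} → b [ ∅ ]= A₀ → limsup △ A₀ ⊆ tail d ∅
        near-start {A₀} b₀ M p = by-contradiction λ M∉ → [
          (λ (q , r) → let (k , A , _ , bk , s) = ∈tail⁻ (∈limsup⁻ q ∅ 0∈ω) in
            r (proj₁ (agree b₀ M∉ k (dom (proj₁ B) bk) A bk) s)) ,
          (λ (q , r) → let (n , nω , M∉tail) = ∉limsup⁻ (meas⊆Str (proj₂ B ∅ A₀ b₀) M q) r
                           (A , bn) = value (proj₁ B) nω
                       in M∉tail (∈tail ∈-irrefl bn (proj₂ (agree b₀ M∉ n nω A bn) q))) ]′ (∈△⁻ p)

        positive-part : ∀ {A C η ε} → A ∈ Meas → C ∈ Meas → (∀ M → M ∈ C → M ∈ A ⊎ M ∈ tail d ∅) → η ∈ᶜ m C →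
          δ [ ∅ ]= ⌜ ε ⌝ → (ε ⊕ ε) ⊕ ε ≤q η → ε ∈ᶜ m A
        positive-part {A} {C} {η} {ε} a c h p q k = by-contradiction λ n →
          m-sub {x = ε ⊕ ε} {ε} TD.meas-tail a c (λ M r → Sum.swap (h M r))
            (tail-small D-map δ-map halving d-small {∅} {ε} 0∈ω q) n
            (down (m-real c) {η} {(ε ⊕ ε) ⊕ ε} k p)

      nontrivial-invariant : ∃[ A ] IsNontrivialInvariant A
      nontrivial-invariant =
        let (ε , η , A₀ , δ₀ , b₀ , p , q , k) = start ; a₀ = proj₂ B ∅ A₀ b₀ in
        limsup , meas-limsup , (λ g Sg → Shift.invariant Sg) ,
        (ε , positive-part {limsup} {A₀} {η} {ε} meas-limsup a₀ (λ M r → Sum.map₂ (λ s → near-start b₀ M (∈△ (inj₂ s))) (excluded r)) p δ₀ k) ,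
        (ε , positive-part {Str ∖ limsup} {Str ∖ A₀} {η} {ε} (meas-∁ meas-limsup) (meas-∁ a₀) (complement b₀) q δ₀ k)
        where
        complement : ∀ {A₀} → b [ ∅ ]= A₀ → ∀ M → M ∈ Str ∖ A₀ → M ∈ Str ∖ limsup ⊎ M ∈ tail d ∅
        complement b₀ M r = by-contradiction λ n → let (s , t) = ∈∖⁻ r in
          n (inj₁ (∈∖ s λ u → n (inj₂ (near-start b₀ M (∈△ (inj₁ (u , t)))))))

  module Pair {μ ν} (Mμ : Measure μ) (Mν : Measure ν) where
    private
      module μ = Valuation Mμ
      module ν = Valuation Mν

      Close : Fraction → 𝕍 → 𝕍 → Set ℓ
      Close ε A E = ε ∉ᶜ μ.m (A △ E) × ε ∉ᶜ ν.m (A △ E)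

      φ : Fm 6
      φ = ∀ᶠ v0 ∈ᶠ v2 ⇒ᶠ (∃ᶠ v0 ∈ᶠ v4 ∧ᶠ ¬ᶠ (v1 ∈ᶠ valᵗ v7 v5 (△ᵗ v2 v0)) ∧ᶠ ¬ᶠ (v1 ∈ᶠ valᵗ v7 v6 (△ᵗ v2 v0)))
      ρ : Vec 𝕍 5
      ρ = Pos ∷ 𝒜 ∷ μ ∷ ν ∷ fractions ∷ []

      Approximable : 𝕍 → Set ℓ
      Approximable A = ∀ ε → PositiveQ ε → ∃[ E ] E ∈ 𝒜 × Close ε A E

      φ-elim : ∀ {A} → ⟦ φ ⟧ (A ∷ ρ) → Approximable A
      φ-elim h ε ε>0 = h ⌜ ε ⌝ (∈Pos {ε} ε>0)

      φ-intro : ∀ {A} → Approximable A → ⟦ φ ⟧ (A ∷ ρ)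
      φ-intro {A} h v p = let (ε , e , ε>0) = ∈Pos⁻ p in
        subst (λ v → ∃[ E ] E ∈ 𝒜 × ¬ v ∈ μ.m (A △ E) × ¬ v ∈ ν.m (A △ E)) (sym e) (h ε ε>0)

      close-refl : ∀ {A ε} → Close ε A A
      close-refl {A} {ε} = none {μ.m} μ.m-∅ , none {ν.m} ν.m-∅
        where
        none : ∀ {r : 𝕍 → 𝕍} → r ∅ ≡ ∅ → ε ∉ᶜ r (A △ A)
        none {r} e p = ∉∅ (subst (⌜ ε ⌝ ∈_) e (subst (λ A → ε ∈ᶜ r A) (≡∅ λ M q → [ (λ (s , t) → t s) , (λ (s , t) → t s) ]′ (∈△⁻ q)) p))

      -- A △ E is contained in (B △ F) ∪ (C △ G)
      close-2 : ∀ {A E B F C G ε} → A △ E ∈ Meas → B △ F ∈ Meas → C △ G ∈ Meas →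
        (∀ x → (x ∈ B → x ∈ F) × (x ∈ F → x ∈ B) → (x ∈ C → x ∈ G) × (x ∈ G → x ∈ C) → (x ∈ A → x ∈ E) × (x ∈ E → x ∈ A)) →
        Close (half ε) B F → Close (half ε) C G → Close ε A E
      close-2 {ε = ε} a b c h (p , p′) (q , q′) =
        μ.halves {ε = ε} b c a (△-transfer h) p q , ν.halves {ε = ε} b c a (△-transfer h) p′ q′

      𝒟 : 𝕍
      𝒟 = sep φ ρ Meas
      ∈𝒟 : ∀ {A} → A ∈ Meas → Approximable A → A ∈ 𝒟
      ∈𝒟 a h = ∈sep φ ρ a (φ-intro h)
      ∈𝒟⁻ : ∀ {A} → A ∈ 𝒟 → A ∈ Meas × Approximable A
      ∈𝒟⁻ p = let (a , h) = ∈sep⁻ φ ρ p in a , φ-elim h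

      approx-𝒜 : ∀ {A} → A ∈ 𝒜 → Approximable A
      approx-𝒜 {A} a ε _ = A , a , close-refl {A} {ε}

      approx-∁ : ∀ {A} → A ∈ Meas → Approximable A → Approximable (Str ∖ A)
      approx-∁ {A} a h ε ε>0 = let (E , E∈ , p , q) = h ε ε>0 in Str ∖ E , 𝒜-∁ E∈ ,
        μ.∉-mono {x = ε} (meas-△ (meas-∁ a) (meas-∁ (𝒜⊆Meas E E∈))) (meas-△ a (𝒜⊆Meas E E∈)) sub p ,
        ν.∉-mono {x = ε} (meas-△ (meas-∁ a) (meas-∁ (𝒜⊆Meas E E∈))) (meas-△ a (𝒜⊆Meas E E∈)) sub q
        where
        sub : ∀ {E} → (Str ∖ A) △ (Str ∖ E) ⊆ A △ E
        sub {E} M p = ∈△ ([ (λ (q , r) → let (s , t) = ∈∖⁻ q in inj₂ (by-contradiction (λ u → r (∈∖ s u)) , t))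
                          , (λ (q , r) → let (s , t) = ∈∖⁻ q in inj₁ (by-contradiction (λ u → r (∈∖ s u)) , t)) ]′ (∈△⁻ p))

      𝒟-∪ : ∀ {A B} → A ∈ 𝒟 → B ∈ 𝒟 → A ∪ B ∈ 𝒟
      𝒟-∪ {A} {B} p q = let (a , h) = ∈𝒟⁻ p ; (b , k) = ∈𝒟⁻ q in ∈𝒟 (meas-∪ a b) λ ε ε>0 →
        let (E , E∈ , c) = h (half ε) (half-positive {ε} ε>0) ; (F , F∈ , d) = k (half ε) (half-positive {ε} ε>0)
            e = 𝒜⊆Meas E E∈ ; f = 𝒜⊆Meas F F∈
        in E ∪ F , 𝒜-∪ E∈ F∈ , close-2 {ε = ε} (meas-△ (meas-∪ a b) (meas-∪ e f)) (meas-△ a e) (meas-△ b f)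
          (λ x (u , u′) (v , v′) → (λ s → ∈∪ (Sum.map u v (∈∪⁻ s))) , (λ s → ∈∪ (Sum.map u′ v′ (∈∪⁻ s)))) c d

      𝒟-∖ : ∀ A B → A ∈ 𝒟 → B ∈ 𝒟 → A ∖ B ∈ 𝒟
      𝒟-∖ A B p q = let (a , h) = ∈𝒟⁻ p ; (b , k) = ∈𝒟⁻ q in ∈𝒟 (meas-∖ a b) λ ε ε>0 →
        let (E , E∈ , c) = h (half ε) (half-positive {ε} ε>0) ; (F , F∈ , d) = k (half ε) (half-positive {ε} ε>0)
            e = 𝒜⊆Meas E E∈ ; f = 𝒜⊆Meas F F∈
        in E ∖ F , 𝒜-∖ E∈ F∈ , close-2 {ε = ε} (meas-△ (meas-∖ a b) (meas-∖ e f)) (meas-△ a e) (meas-△ b f)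
             (λ x (u , u′) (v , v′) → (λ s → let (s₁ , s₂) = ∈∖⁻ s in ∈∖ (u s₁) (λ t → s₂ (v′ t)))
                                    , (λ s → let (s₁ , s₂) = ∈∖⁻ s in ∈∖ (u′ s₁) (λ t → s₂ (v t)))) c d

      𝒟-limit : ∀ t → t ∶ κ ⟶ Meas → Disjoint t → (∀ i A → t [ i ]= A → A ∈ 𝒟) → ⋃[ t ] ∈ 𝒟
      𝒟-limit t T disj t∈ = ∈𝒟 ⋃∈ λ ε ε>0 →
        combine ε (below-μ (half ε) (half-positive {ε} ε>0)) (below-ν (half ε) (half-positive {ε} ε>0)) ε>0
        where
        ⋃∈ : ⋃[ t ] ∈ Meas
        ⋃∈ = Indexed.meas-⋃[] (λ _ p → p) T
        𝒟⊆ : 𝒟 ⊆ Meas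
        𝒟⊆ A p = proj₁ (∈𝒟⁻ p)
        ∅∈ : ∅ ∈ 𝒟
        ∅∈ = ∈𝒟 meas-∅ (approx-𝒜 𝒜-∅)
        ∪∈ : ∀ U i A → U ∈ 𝒟 → t [ i ]= A → U ∪ A ∈ 𝒟
        ∪∈ U i A p q = 𝒟-∪ p (t∈ i A q)
        below-μ : ∀ η → PositiveQ η → ∃[ U ] U ∈ 𝒟 × U ⊆ ⋃[ t ] × η ∉ᶜ μ.m (⋃[ t ] ∖ U)
        below-μ η η>0 = μ.approximate-below (λ _ p → p) T disj 𝒟⊆ ∅∈ ∪∈ (Measure.κ-additive Mμ) {η} η>0
        below-ν : ∀ η → PositiveQ η → ∃[ U ] U ∈ 𝒟 × U ⊆ ⋃[ t ] × η ∉ᶜ ν.m (⋃[ t ] ∖ U)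
        below-ν η η>0 = ν.approximate-below (λ _ p → p) T disj 𝒟⊆ ∅∈ ∪∈ (Measure.κ-additive Mν) {η} η>0
        cover : ∀ {U V E} → V ⊆ ⋃[ t ] → U ⊆ V → ∀ M → M ∈ ⋃[ t ] △ E → M ∈ ⋃[ t ] ∖ U ⊎ M ∈ V △ E
        cover V⊆ U⊆V M p = by-contradiction λ n → [
          (λ (q , r) → n (inj₁ (∈∖ q (λ s → n (inj₂ (∈△ (inj₁ (U⊆V M s , r)))))))) ,
          (λ (q , r) → n (inj₂ (∈△ (inj₂ (q , λ s → r (V⊆ M s)))))) ]′ (∈△⁻ p)
        combine : ∀ ε → (∃[ U ] U ∈ 𝒟 × U ⊆ ⋃[ t ] × half ε ∉ᶜ μ.m (⋃[ t ] ∖ U)) →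
          (∃[ U ] U ∈ 𝒟 × U ⊆ ⋃[ t ] × half ε ∉ᶜ ν.m (⋃[ t ] ∖ U)) → PositiveQ ε → ∃[ E ] E ∈ 𝒜 × Close ε ⋃[ t ] E
        combine ε (U , U∈ , U⊆ , p) (W , W∈ , W⊆ , q) ε>0 =
          let (uw , h) = ∈𝒟⁻ (𝒟-∪ U∈ W∈)
              (E , E∈ , c , d) = h (half ε) (half-positive {ε} ε>0)
              e = 𝒜⊆Meas E E∈
          in E , E∈ ,
             μ.halves {ε = ε} (meas-∖ ⋃∈ (𝒟⊆ U U∈)) (meas-△ uw e) (meas-△ ⋃∈ e) (cover sub (λ M s → ∈∪ (inj₁ s))) p c ,
             ν.halves {ε = ε} (meas-∖ ⋃∈ (𝒟⊆ W W∈)) (meas-△ uw e) (meas-△ ⋃∈ e) (cover sub (λ M s → ∈∪ (inj₂ s))) q d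
          where
          sub : U ∪ W ⊆ ⋃[ t ]
          sub M s = [ U⊆ M , W⊆ M ]′ (∈∪⁻ s)

    approximation : ∀ {A} → A ∈ Meas → ∀ ε → PositiveQ ε → ∃[ E ] E ∈ 𝒜 × ε ∉ᶜ μ.m (A △ E) × ε ∉ᶜ ν.m (A △ E)
    approximation {A} a = φ-elim (meas-ind φ ρ
      (λ R t at → φ-intro (approx-𝒜 (𝒜-atom at)))
      (λ B b h → φ-intro (approx-∁ b (φ-elim h)))
      (λ G h G⊆ k H inj → let open Enumerate G⊆ H inj in
        subst (λ B → ⟦ φ ⟧ (B ∷ ρ)) ⋃seq (φ-intro (proj₂ (∈𝒟⁻ (Disjointify.⋃-closed seq-map (∈𝒟 meas-∅ (approx-𝒜 𝒜-∅)) 𝒟-∖ 𝒟-limit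
          (λ i B p → [ (λ B∈ → ∈𝒟 (G⊆ B B∈) (φ-elim (k B B∈))) , (λ e → subst (_∈ 𝒟) (sym e) (∈𝒟 meas-∅ (approx-𝒜 𝒜-∅))) ]′ (seq-value {i} {B} p)))))))
      A a)

    private
      -- If x + ε < μ A then x < μ E = ν E - and so x < ν A + ε.
      ⊆-if-agree : (∀ E → E ∈ 𝒜 → μ.m E ⊆ ν.m E) → ∀ {A} → A ∈ Meas → μ.m A ⊆ ν.m A
      ⊆-if-agree h {A} a v p = let (x , e) = real-frac (μ.m-real a) p in subst (_∈ ν.m A) (sym e) (core x (subst (_∈ μ.m A) e p))
        where
        core : ∀ x → x ∈ᶜ μ.m A → x ∈ᶜ ν.m A
        core x p = by-contradiction λ n →
          let (y , y∈ , x<y) = open-cut (μ.m-real a) {x} p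
              (δ , δ>0 , x+δ≤y) = gap {x} {y} x<y
              ε = half δ
              (E , E∈ , c , d) = approximation a ε (half-positive {δ} δ>0)
              e = 𝒜⊆Meas E E∈ ; a△e = meas-△ a e
              q : x ⊕ ε ∉ᶜ ν.m E
              q = ν.m-sub {x = x} {ε} a a△e e (λ M s → Sum.map₂ (λ t → ∈△ (inj₂ t)) (excluded s)) n d
              r : (x ⊕ ε) ⊕ ε ∉ᶜ μ.m A
              r = μ.m-sub {x = x ⊕ ε} {ε} e a△e a (λ M s → Sum.map₂ (λ t → ∈△ (inj₁ t)) (excluded s)) (λ s → q (h E E∈ _ s)) c
          in μ.∉-up {x = (x ⊕ ε) ⊕ ε} {y} a
               (≤q-trans {(x ⊕ ε) ⊕ ε} {x ⊕ (ε ⊕ ε)} {y} (⊕-assoc x ε ε)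
               (≤q-trans {x ⊕ (ε ⊕ ε)} {x ⊕ δ} {y} (⊕-mono-≤ {x} {x} {ε ⊕ ε} {δ} (≤q-refl {x}) (half-⊕ δ)) x+δ≤y)) r y∈

    below-everywhere : (∀ E → E ∈ 𝒜 → μ.m E ⊆ ν.m E) → ∀ {A} → A ∈ Meas → μ.m A ⊆ ν.m A
    below-everywhere = ⊆-if-agree

  module NearInvariant {μ} (Mμ : Measure μ)
    (invariant : ∀ {g B} → IsSym g → B ∈ Meas → Valuation.m Mμ (im g B) ≡ Valuation.m Mμ B)
    {A} (A-invariant : Valuation.IsNontrivialInvariant Mμ A) where
    open Valuation Mμ

    private
      a : A ∈ Meas
      a = proj₁ A-invariant

    Near : Fraction → 𝕍 → Set ℓ
    Near ε E = half ε ∉ᶜ m (A △ E)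

    private
      drop-null : ∀ {N C D x} → N ∈ Meas → C ∈ Meas → D ∈ Meas → m N ≡ ∅ → (∀ M → M ∈ C → M ∈ N ⊎ M ∈ D) →
        x ∉ᶜ m D → x ∉ᶜ m C
      drop-null {N} {C} {D} {x} n c d e C⊆ x∉ x∈ =
        let (y , y∈ , x<y) = open-cut (m-real c) {x} x∈
            (δ , _ , x+δ≤y) = gap {x} {y} x<y
        in ∉-up {x = x ⊕ δ} {y} c x+δ≤y
          (m-sub {x = x} {δ} d n c (λ M p → Sum.swap (C⊆ M p)) x∉ (λ p → ∉∅ (subst (⌜ δ ⌝ ∈_) e p))) y∈

    near-shift : ∀ {ε E g} → E ∈ 𝒜 → Near ε E → IsSym g → ε ∉ᶜ m (E △ im g E)
    near-shift {ε} {E} {g} E∈ near Sg =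
      halves {ε = ε} (meas-△ a e) (meas-△ a ge) (meas-△ e ge)
        (△-transfer {c = A} {E} {A} {im g E} λ x (k , l) (k′ , l′) → (λ p → k′ (l p)) , (λ p → k (l′ p)))
        near
        (drop-null {x = half ε} (meas-△ ga a) (meas-△ a ge) (meas-△ ga ge) (proj₁ (proj₂ A-invariant) g Sg)
          (△-transfer {c = im g A} {A} {im g A} {im g E} λ x (k , l) (k′ , l′) → (λ p → k′ (l p)) , (λ p → k (l′ p)))
          (λ p → near (subst (half ε ∈ᶜ_) (trans (cong m shifted) (invariant Sg (meas-△ a e))) p)))
      where
      open Image Sg
      e : E ∈ Meas
      e = 𝒜⊆Meas E E∈
      ge : im g E ∈ Meas
      ge = meas-im e
      ga : im g A ∈ Meas
      ga = meas-im a
      shifted : im g A △ im g E ≡ im g (A △ E)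
      shifted = sym (trans (im-∪ (λ M p → meas⊆Str a M (proj₁ (∈∖⁻ p))) (λ M p → meas⊆Str e M (proj₁ (∈∖⁻ p))))
        (cong₂ _∪_ (im-∖ (meas⊆Str a) (meas⊆Str e)) (im-∖ (meas⊆Str e) (meas⊆Str a))))

    near-up : ∀ {ε ε′ E} → E ∈ 𝒜 → ε ≤q ε′ → Near ε E → Near ε′ E
    near-up {ε} {ε′} {E} E∈ h near = ∉-up {x = half ε} {half ε′} (meas-△ a (𝒜⊆Meas E E∈)) (half-mono {ε} {ε′} h) near

    near-step : ∀ {ε ε′ E E′} → E ∈ 𝒜 → E′ ∈ 𝒜 → Near ε E → Near ε′ E′ → ε′ ≤q ε → ε ∉ᶜ m (E △ E′)
    near-step {ε} {ε′} {E} {E′} E∈ E′∈ near near′ ε′≤ε =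
      halves {ε = ε} (meas-△ a e) (meas-△ a e′) (meas-△ e e′)
        (△-transfer {c = A} {E} {A} {E′} λ x (k , l) (k′ , l′) → (λ p → k′ (l p)) , (λ p → k (l′ p)))
        near (near-up {ε′} {ε} E′∈ ε′≤ε near′)
      where
      e = 𝒜⊆Meas E E∈
      e′ = 𝒜⊆Meas E′ E′∈

    near-exists : ∀ ε → PositiveQ ε → ∃[ E ] E ∈ 𝒜 × Near ε E
    near-exists ε ε>0 = let (E , E∈ , p , _) = Pair.approximation Mμ Mμ a (half ε) (half-positive {ε} ε>0) in E , E∈ , p

    NearStart : Set ℓ
    NearStart = Σ Fraction λ ε → Σ Fraction λ η → Σ 𝕍 λ E → PositiveQ ε × E ∈ 𝒜 × Near ε E × Start ε η E

    private
      Bound : Fraction → Set ℓ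
      Bound y = PositiveQ y × y ∈ᶜ m A × y ∈ᶜ m (Str ∖ A)

      module WithBound (y : Fraction) (y-bound : Bound y) where
        ε η : Fraction
        ε = half (half y)
        η = (ε ⊕ ε) ⊕ ε
        ε>0 : PositiveQ ε
        ε>0 = half-positive {half y} (half-positive {y} (proj₁ y-bound))
        small : η ⊕ half ε ≤q y
        small = ≤q-trans {η ⊕ half ε} {η ⊕ ε} {y} (⊕-mono-≤ {η} {η} {half ε} {ε} (≤q-refl {η}) (half≤ ε))
          (≤q-trans {η ⊕ ε} {(ε ⊕ ε) ⊕ (ε ⊕ ε)} {y} (⊕-assoc (ε ⊕ ε) ε ε)
          (≤q-trans {(ε ⊕ ε) ⊕ (ε ⊕ ε)} {half y ⊕ half y} {y} (⊕-mono-≤ {ε ⊕ ε} {half y} {ε ⊕ ε} {half y} (half-⊕ (half y)) (half-⊕ (half y))) (half-⊕ y)))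
        beyond : ∀ {r} → η ⊕ half ε ∉ᶜ r → IsReal r → ¬ (y ∈ᶜ r)
        beyond n R p = n (down R {y} {η ⊕ half ε} small p)
        module _ {E} (E∈ : E ∈ 𝒜) (near : Near ε E) where
          e : E ∈ Meas
          e = 𝒜⊆Meas E E∈
          inside : η ∈ᶜ m E
          inside = by-contradiction λ n → beyond (m-sub {x = η} {half ε} e (meas-△ a e) a
             (λ M r → Sum.map₂ (λ t → ∈△ (inj₁ t)) (excluded r)) n near) (m-real a) (proj₁ (proj₂ y-bound))
          cover : ∀ M → M ∈ Str ∖ A → M ∈ Str ∖ E ⊎ M ∈ A △ E
          cover M r = by-contradiction λ n → let (s , t) = ∈∖⁻ r in
            n (inj₁ (∈∖ s λ u → n (inj₂ (∈△ (inj₂ (u , t))))))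
          outside : η ∈ᶜ m (Str ∖ E)
          outside = by-contradiction λ n → beyond
            (m-sub {x = η} {half ε} (meas-∁ e) (meas-△ a e) (meas-∁ a) cover n near) (m-real (meas-∁ a)) (proj₂ (proj₂ y-bound))
        result : NearStart
        result = let (E , E∈ , near) = near-exists ε ε>0 in
          ε , η , E , ε>0 , E∈ , near , inside E∈ near , outside E∈ near , ≤q-refl {η}

      smaller : ∀ y y′ → PositiveQ y → PositiveQ y′ → y ∈ᶜ m A → y′ ∈ᶜ m (Str ∖ A) → Σ Fraction Bound
      smaller y y′ y>0 y′>0 q q′ = [ left , right ]′ (≤q-or-> y y′)
        where
        left : y ≤q y′ → Σ Fraction Bound
        left h = y , y>0 , q , down (m-real (meas-∁ a)) {y′} {y} h q′
        right : y′ <q y → Σ Fraction Bound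
        right h = y′ , y′>0 , down (m-real a) {y} {y′} (<q⇒≤q {y′} {y} h) q , q′

      floor : Σ Fraction Bound
      floor = let (x , p) = proj₁ (proj₂ (proj₂ A-invariant)) ; (x′ , p′) = proj₂ (proj₂ (proj₂ A-invariant))
                  (y , q , h) = open-cut (m-real a) {x} p ; (y′ , q′ , h′) = open-cut (m-real (meas-∁ a)) {x′} p′
              in smaller y y′ (positive-above {x} {y} h) (positive-above {x′} {y′} h′) q q′

    near-start : NearStart
    near-start = WithBound.result (proj₁ floor) (proj₂ floor)

  open Domain X public

  private
    imᵗ : ∀ {n} → Tm n → Tm n → Tm n → Tm n → Tm n → Tm n
    imᵗ Str X 𝓛 g E = compr imᶠ (g ∷ E ∷ X ∷ 𝓛 ∷ []) Str

    φ : Fm 5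
    φ = ∃ᶠ v0 ∈ᶠ v5 ∧ᶠ (∀ᶠ ∀ᶠ isBijection v1 v5 v5 ⇒ᶠ isBijection v0 v5 v5 ⇒ᶠ
      (∀ᶠ ∀ᶠ v1 ∈ᶠ v4 ⇒ᶠ v3 [ v1 ]ᶠ= v0 ⇒ᶠ v2 [ v1 ]ᶠ= v0) ⇒ᶠ imᵗ v4 v5 v6 v1 v3 ≈ᶠ imᵗ v4 v5 v6 v0 v3)

  support : ∀ {E} → E ∈ 𝒜 → ∃[ s ] s ∈ finiteSubsets × (∀ g h → IsSym g → IsSym h → Agree g h s → im g E ≡ im h E)
  support {E} = 𝒜-ind φ (Str ∷ X ∷ 𝓛 ∷ finiteSubsets ∷ [])
    (∅ , fin-∅ , λ g h G H _ → trans (Image.im-∅ G) (sym (Image.im-∅ H)))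
    (∅ , fin-∅ , λ g h G H _ → trans (Image.im-Str G) (sym (Image.im-Str H)))
    (λ R t A B at A∈ B∈ (s , s∈ , hs) (s′ , s′∈ , hs′) →
      let (n , r , T) = at ; (s″ , s″∈ , k) = fin-range (arity∈ω r) T in
      (s ∪ s′) ∪ s″ , fin-∪ (fin-∪ s∈ s′∈) s″∈ , λ g h G H ag →
      combine at (meas⊆Str (𝒜⊆Meas A A∈)) (meas⊆Str (𝒜⊆Meas B B∈)) G H
        (λ i x y p → ag x y (∈∪ (inj₂ (k i x p))))
        (hs g h G H λ x y p → ag x y (∈∪ (inj₁ (∈∪ (inj₁ p)))))
        (hs′ g h G H λ x y p → ag x y (∈∪ (inj₁ (∈∪ (inj₂ p))))))
    E
    where
    combine : ∀ {R t A B g h} → IsAtom R t → A ⊆ Str → B ⊆ Str → IsSym g → IsSym h →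
      (∀ i x y → t [ i ]= x → g [ x ]= y → h [ x ]= y) → im g A ≡ im h A → im g B ≡ im h B → im g (ite R t A B) ≡ im h (ite R t A B)
    combine {R} {t} {A} {B} {g} {h} at A⊆ B⊆ G H ag e e′ =
      let (u , _ , c) = Action.atom-image G at ; (u′ , _ , c′) = Action.atom-image H at in
      trans (Image.im-ite G at c A⊆ B⊆) (trans
        (trans (cong (λ u → ite R u (im g A) (im g B)) (same-composite c c′)) (cong₂ (ite R u′) e e′))
        (sym (Image.im-ite H at c′ A⊆ B⊆)))
      where
      same-composite : ∀ {u u′} → IsComposite u g t → IsComposite u′ h t → u ≡ u′
      same-composite {u} {u′} c c′ = ext
        (λ p q → let (x , y , z , e , q′ , r) = to (c p) q in from (c′ p) (x , y , z , e , q′ , ag x y z q′ r))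
        (λ p q → let (x , y , z , e , q′ , r) = to (c′ p) q ; (w , r′) = value (proj₁ (proj₁ G)) (dom (proj₁ (proj₁ H)) r)
                 in from (c p) (x , y , z , e , q′ , subst (λ w → g [ y ]= w) (functional (proj₁ (proj₁ H)) (ag x y w q′ r′) r) r′))

  -- A tuple whose range contains that of t.
  cover-tuple : ∀ {n a k t} → n ∈ ω → a ∶ n ⟶ X → k ∈ ω → t ∶ k ⟶ X →
    ∃[ n′ ] ∃[ a′ ] ∃[ s ] n′ ∈ ω × n ⊆ n′ × a′ ∶ n′ ⟶ X × a ⊆ a′ × s ∶ k ⟶ n′ × IsComposite t a′ s
  cover-tuple {n} {a} {k} {t} nω A kω = ω-ind
    (∀ᶠ isMap v0 v1 v2 ⇒ᶠ (∃ᶠ ∃ᶠ ∃ᶠ v2 ∈ᶠ v6 ∧ᶠ v7 ⊆ᶠ v2 ∧ᶠ isMap v1 v2 v5 ∧ᶠ v8 ⊆ᶠ v1 ∧ᶠ isMap v0 v4 v2 ∧ᶠ isComposite v3 v1 v0))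
    (X ∷ ω ∷ n ∷ a ∷ [])
    (λ t T → n , a , ∅ , nω , (λ _ p → p) , A , (λ _ p → p) , empty-map , λ p → mk⇔
      (λ q → let (x , y , e , x∈) = proj₁ (proj₁ T) p q in ⊥-elim (∉∅ x∈))
      (λ (x , y , z , e , q , r) → ⊥-elim (∉∅ q)))
    (λ k kω h t T →
      let (n′ , a′ , s , n′ω , n⊆ , A′ , a⊆ , S , c) = h (restrict t k) (restrict-map T (λ i p → ∈succ (inj₁ p)))
          (x , p) = value (proj₁ T) (∈succ (inj₂ refl))
      in succ n′ , a′ ▹ n′ ↦ x , s ▹ k ↦ n′ , s∈ω n′ω , (λ i q → ∈succ (inj₁ (n⊆ i q))) ,
         ▹-map A′ (proj₂ T k x p) , (λ q r → ▹-old q (a⊆ q r)) ,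
         ▹-map {s} {k} {n′} (proj₁ S , λ i z q → ∈succ (inj₁ (proj₂ S i z q))) (∈succ (inj₂ refl)) ,
         composite T p A′ S c)
    k kω t
    where
    empty-map : ∀ {b} → ∅ ∶ ∅ ⟶ b
    empty-map = isFunctionOn-intro (λ p q → ⊥-elim (∉∅ q)) (λ x q → ⊥-elim (∉∅ q)) (λ x y z q → ⊥-elim (∉∅ q)) , λ x y q → ⊥-elim (∉∅ q)
    composite : ∀ {k t x n′ a′ s} → t ∶ succ k ⟶ X → t [ k ]= x → a′ ∶ n′ ⟶ X → s ∶ k ⟶ n′ → IsComposite (restrict t k) a′ s →
      IsComposite t (a′ ▹ n′ ↦ x) (s ▹ k ↦ n′)
    composite {k} {t} {x} {n′} {a′} {s} T tk A′ S c p = mk⇔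
      (λ q → let (i , z , e , i∈) = proj₁ (proj₁ T) p q in forth e (∈succ⁻ i∈) (subst (_∈ t) e q))
      (λ (i , j , z , e , q , r) → subst (_∈ t) (sym e) (back (▹-split q) (▹-split r)))
      where
      forth : ∀ {i z} → p ≡ ⟨ i , z ⟩ → i ∈ k ⊎ i ≡ k → t [ i ]= z →
        ∃[ i ] ∃[ j ] ∃[ z ] p ≡ ⟨ i , z ⟩ × (s ▹ k ↦ n′) [ i ]= j × (a′ ▹ n′ ↦ x) [ j ]= z
      forth {i} {z} e (inj₁ i∈) q = let (j , q′ , r) = composite-∈⁻ {restrict t k} {a′} {s} c (restrict-at i∈ q) in
        i , j , z , e , ▹-old _ q′ , ▹-old _ r
      forth {i} {z} e (inj₂ e′) q = i , n′ , z , e , subst (λ i → (s ▹ k ↦ n′) [ i ]= n′) (sym e′) ▹-new ,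
        subst (λ z → (a′ ▹ n′ ↦ x) [ n′ ]= z) (functional (proj₁ T) tk (subst (λ i → t [ i ]= z) e′ q)) ▹-new
      back : ∀ {i j z} → s [ i ]= j ⊎ (i ≡ k × j ≡ n′) → a′ [ j ]= z ⊎ (j ≡ n′ × z ≡ x) → t [ i ]= z
      back {i} {j} {z} (inj₁ q) (inj₁ r) = proj₂ (restrict-at⁻ (composite-∈ {restrict t k} {a′} {s} c q r))
      back {i} {j} {z} (inj₁ q) (inj₂ (e , _)) = ⊥-elim (∈-irrefl (subst (_∈ n′) e (proj₂ S i j q)))
      back {i} {j} {z} (inj₂ (_ , e)) (inj₁ r) = ⊥-elim (∈-irrefl (subst (_∈ n′) e (dom (proj₁ A′) r)))
      back {i} {j} {z} (inj₂ (e , _)) (inj₂ (_ , e′)) = subst₂ (λ i z → t [ i ]= z) (sym e) (sym e′) tk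

  -- The literals R(…) and ¬ … ¬ R(…)
  relationLiterals : 𝕍
  relationLiterals = ω ⊗ (ω ⊗ (Symbols ⊗ 𝒫 (ω ⊗ ω)))

  relationLiteral : 𝕍 → 𝕍 → 𝕍 → 𝕍
  relationLiteral k R s = ⟨ k , ⟨ one , ⟨ R , s ⟩ ⟩ ⟩

  opaque
    unfolding SatLiteral IsAtomic

    IsLiteral : 𝕍 → 𝕍 → Set ℓ
    IsLiteral n φ = ⟦ isLiteral v0 v1 v2 ⟧ (𝓛 ∷ n ∷ φ ∷ [])

    literal⇔ : ∀ n φ → IsLiteral n φ ⇔ (∃[ k ] ∃[ α ] φ ≡ ⟨ k , α ⟩ × IsNat k × IsAtomic n α)
    literal⇔ n φ = ≡⇒⇔ refl

    conjunction⇔ : ∀ n c → ⟦ isConjunction v0 v1 v2 ⟧ (𝓛 ∷ n ∷ c ∷ []) ⇔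
      (∃[ m ] IsNat m × IsFunctionOn c m × (∀ j φ → c [ j ]= φ → IsLiteral n φ))
    conjunction⇔ n c = ≡⇒⇔ refl

    satConjunction⇔ : ∀ M a c → ⟦ satConjunction v0 v1 v2 ⟧ (M ∷ a ∷ c ∷ []) ⇔ (∀ j φ → c [ j ]= φ → SatLiteral M a φ)
    satConjunction⇔ M a c = ≡⇒⇔ refl

  conj : 𝕍 → 𝕍 → 𝕍
  conj a c = sep (satConjunction v0 v1 v2) (a ∷ c ∷ []) Str

  ∈conj : ∀ {M a c} → M ∈ Str → (∀ j φ → c [ j ]= φ → SatLiteral M a φ) → M ∈ conj a c
  ∈conj {M} {a} {c} p h = ∈sep (satConjunction v0 v1 v2) (a ∷ c ∷ []) p (from (satConjunction⇔ M a c) h)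

  ∈conj⁻ : ∀ {M a c} → M ∈ conj a c → M ∈ Str × (∀ j φ → c [ j ]= φ → SatLiteral M a φ)
  ∈conj⁻ {M} {a} {c} p = let (q , r) = ∈sep⁻ (satConjunction v0 v1 v2) (a ∷ c ∷ []) p in q , to (satConjunction⇔ M a c) r

  conj-∅ : ∀ {a} → conj a ∅ ≡ Str
  conj-∅ = ext (λ M p → proj₁ (∈conj⁻ p)) (λ M p → ∈conj p λ j φ q → ⊥-elim (∉∅ q))

  module Extension {n a n′ a′ : 𝕍} (A : a ∶ n ⟶ X) (A′ : a′ ∶ n′ ⟶ X) (n⊆ : n ⊆ n′) (a⊆ : a ⊆ a′) where
    private
      restricted : ∀ {i x} → i ∈ n → a′ [ i ]= x → a [ i ]= x
      restricted {i} {x} p q = let (y , r) = value (proj₁ A) p in subst (λ y → a [ i ]= y) (functional (proj₁ A′) (a⊆ _ r) q) r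

      composite-extend : ∀ {t s k} → s ∶ k ⟶ n → IsComposite t a s → IsComposite t a′ s
      composite-extend S c p = mk⇔
        (λ q → let (x , y , z , e , r , u) = to (c p) q in x , y , z , e , r , a⊆ _ u)
        (λ (x , y , z , e , r , u) → from (c p) (x , y , z , e , r , restricted (proj₂ S x y r) u))

    satAtomic-extend : ∀ {M α} → IsAtomic n α → SatAtomic M a α ⇔ SatAtomic M a′ α
    satAtomic-extend {M} {α} at = [ equality , relation ]′ (to (atomic-spec n α) at)
      where
      equality : (∃[ i ] ∃[ j ] α ≡ ⟨ ∅ , ⟨ i , j ⟩ ⟩ × i ∈ n × j ∈ n) → SatAtomic M a α ⇔ SatAtomic M a′ α
      equality (i , j , e , i∈ , j∈) = mk⇔
        (λ h → let (x , p , q) = to (satEquality⇔ e) h in from (satEquality⇔ e) (x , a⊆ _ p , a⊆ _ q))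
        (λ h → let (x , p , q) = to (satEquality⇔ e) h in from (satEquality⇔ e) (x , restricted i∈ p , restricted j∈ q))
      relation : (∃[ R ] ∃[ s ] ∃[ m ] α ≡ ⟨ succ ∅ , ⟨ R , s ⟩ ⟩ × 𝓛 [ R ]= m × s ∶ m ⟶ n) → SatAtomic M a α ⇔ SatAtomic M a′ α
      relation (R , s , m , e , r , S) = let (t , T , c) = compose S A in mk⇔
        (λ h → from (satRelation⇔ {t = t} e (composite-extend {t} S c)) (to (satRelation⇔ {t = t} e c) h))
        (λ h → from (satRelation⇔ {t = t} e c) (to (satRelation⇔ {t = t} e (composite-extend {t} S c)) h))

    satLiteral-extend : ∀ {M φ} → IsLiteral n φ → SatLiteral M a φ ⇔ SatLiteral M a′ φ
    satLiteral-extend {M} {φ} L = let (k , α , e , _ , at) = to (literal⇔ n φ) L ; f = satAtomic-extend {M} at in mk⇔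
      (λ h → let g = to (satLiteral⇔ e) h in from (satLiteral⇔ e) (mk⇔ (λ ev → to f (to g ev)) (λ s → from g (from f s))))
      (λ h → let g = to (satLiteral⇔ e) h in from (satLiteral⇔ e) (mk⇔ (λ ev → from f (to g ev)) (λ s → from g (to f s))))

    literal-extend : ∀ {φ} → IsLiteral n φ → IsLiteral n′ φ
    literal-extend {φ} L = let (k , α , e , kω , at) = to (literal⇔ n φ) L in from (literal⇔ n′ φ) (k , α , e , kω ,
      from (atomic-spec n′ α) (Sum.map
        (λ (i , j , e , i∈ , j∈) → i , j , e , n⊆ i i∈ , n⊆ j j∈)
        (λ (R , s , m , e , r , S) → R , s , m , e , r , (proj₁ S , λ i z q → n⊆ z (proj₂ S i z q)))
        (to (atomic-spec n α) at)))

    module _ {c m R t s k : 𝕍} (literals : ∀ j φ → c [ j ]= φ → IsLiteral n φ) (c-function : IsFunctionOn c m)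
             (t-composite : IsComposite t a′ s) where
      private
        c′ : 𝕍
        c′ = c ▹ m ↦ relationLiteral k R s

        split : ∀ {M} → M ∈ conj a′ c′ → M ∈ conj a c × (Even k ⇔ Holds M R t)
        split p = let (q , h) = ∈conj⁻ p ; g = to (satLiteral⇔ refl) (h m _ ▹-new) in
          ∈conj q (λ j φ r → from (satLiteral-extend (literals j φ r)) (h j φ (▹-old _ r))) ,
          mk⇔ (λ ev → to (satRelation⇔ {t = t} refl t-composite) (to g ev)) (λ h → from g (from (satRelation⇔ {t = t} refl t-composite) h))

        join : ∀ {M} → M ∈ conj a c → (Even k ⇔ Holds M R t) → M ∈ conj a′ c′
        join {M} p g = let (q , h) = ∈conj⁻ p in ∈conj q λ j φ r →
          [ (λ r′ → to (satLiteral-extend (literals j φ r′)) (h j φ r′))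
          , (λ (_ , e) → from (satLiteral⇔ e) (mk⇔ (λ ev → from (satRelation⇔ {t = t} refl t-composite) (to g ev))
            (λ s → from g (to (satRelation⇔ {t = t} refl t-composite) s)))) ]′ (▹-split r)

      conj-positive : Even k → conj a′ c′ ≡ conj a c ∩ atomSet R t
      conj-positive ev = ext
        (λ M p → let (q , g) = split p in ∈∩ q (∈atomSet (proj₁ (∈conj⁻ q)) (to g ev)))
        (λ M p → let (q , r) = ∈∩⁻ p in join q (mk⇔ (λ _ → proj₂ (∈atomSet⁻ r)) (λ _ → ev)))

      conj-negative : ¬ Even k → conj a′ c′ ≡ conj a c ∖ atomSet R t
      conj-negative n = ext
        (λ M p → let (q , g) = split p in ∈∖ q (λ r → n (from g (proj₂ (∈atomSet⁻ r)))))
        (λ M p → let (q , r) = ∈∖⁻ p in join q (mk⇔ (λ ev → ⊥-elim (n ev)) (λ h → ⊥-elim (r (∈atomSet (proj₁ (∈conj⁻ q)) h)))))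

    conjunction-extend : ∀ {c m R s l k} → m ∈ ω → IsFunctionOn c m → (∀ j φ → c [ j ]= φ → IsLiteral n φ) →
      𝓛 [ R ]= l → s ∶ l ⟶ n′ → k ∈ ω → ∀ j φ → (c ▹ m ↦ relationLiteral k R s) [ j ]= φ → IsLiteral n′ φ
    conjunction-extend {R = R} {s} {l} {k} mω F literals r S kω j φ p = [ (λ q → literal-extend (literals j φ q))
      , (λ (_ , e) → from (literal⇔ n′ φ) (k , ⟨ one , ⟨ R , s ⟩ ⟩ , e , ∈ω⁻ kω ,
          from (atomic-spec n′ ⟨ one , ⟨ R , s ⟩ ⟩) (inj₂ (R , s , l , refl , r , S)))) ]′ (▹-split p)

  IsCode : 𝕍 → 𝕍 → 𝕍 → 𝕍 → Set ℓ
  IsCode n a m c = n ∈ ω × a ∶ n ⟶ X × m ∈ ω × IsFunctionOn c m ×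
    (∀ j φ → c [ j ]= φ → IsLiteral n φ) × (∀ j φ → c [ j ]= φ → φ ∈ relationLiterals)

  private
    codeᶠ : Fm 5
    codeᶠ = ∃ᶠ ∃ᶠ ∃ᶠ ∃ᶠ v4 ≈ᶠ ⟨ ⟨ v2 , v0 ⟩ᵗ , compr (satConjunction v0 v1 v2) (v2 ∷ v0 ∷ []) v7 ⟩ᵗ ∧ᶠ v3 ∈ᶠ v8 ∧ᶠ isMap v2 v3 v5 ∧ᶠ
      v1 ∈ᶠ v8 ∧ᶠ isFunctionOn v0 v1 ∧ᶠ (∀ᶠ ∀ᶠ v2 [ v1 ]ᶠ= v0 ⇒ᶠ isLiteral v8 v5 v0)

    code-parameters : Vec 𝕍 4
    code-parameters = X ∷ 𝓛 ∷ Str ∷ ω ∷ []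

    code-base : 𝕍
    code-base = (tuples ⊗ 𝒫 (ω ⊗ relationLiterals)) ⊗ 𝒫 Str

    opaque
      unfolding IsLiteral
      code-unfold : ∀ p → ⟦ codeᶠ ⟧ (p ∷ code-parameters) ⇔ (∃[ n ] ∃[ a ] ∃[ m ] ∃[ c ] p ≡ ⟨ ⟨ a , c ⟩ , conj a c ⟩ ×
        n ∈ ω × a ∶ n ⟶ X × m ∈ ω × IsFunctionOn c m × (∀ j φ → c [ j ]= φ → IsLiteral n φ))
      code-unfold p = ≡⇒⇔ refl

  -- The triples ⟨⟨ a , c ⟩ , K⟩ where K is the set of structures in which a satisfies the conjunction c.
  codes : 𝕍
  codes = sep codeᶠ code-parameters code-base

  ∈codes : ∀ {n a m c} → IsCode n a m c → ⟨ ⟨ a , c ⟩ , conj a c ⟩ ∈ codes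
  ∈codes {n} {a} {m} {c} (nω , A , mω , F , l , r) = ∈sep codeᶠ code-parameters
    (∈⊗ (∈⊗ (map∈tuples nω A) (∈𝒫 λ p q → inside (proj₁ F p q) q)) (∈𝒫 λ M p → proj₁ (∈conj⁻ p)))
    (from (code-unfold _) (n , a , m , c , refl , nω , A , mω , F , l))
    where
    inside : ∀ {p} → (∃[ x ] ∃[ y ] p ≡ ⟨ x , y ⟩ × x ∈ m) → p ∈ c → p ∈ ω ⊗ relationLiterals
    inside (x , y , e , x∈) q = subst (_∈ ω ⊗ relationLiterals) (sym e) (∈⊗ (ω-transitive mω x∈) (r x y (subst (_∈ c) e q)))

  ∈codes⁻ : ∀ {p} → p ∈ codes → ∃[ n ] ∃[ a ] ∃[ m ] ∃[ c ] p ≡ ⟨ ⟨ a , c ⟩ , conj a c ⟩ × IsCode n a m c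
  ∈codes⁻ {p} q = let (base , h) = ∈sep⁻ codeᶠ code-parameters q
                      (n , a , m , c , e , nω , A , mω , F , l) = to (code-unfold p) h
                      c∈ = proj₂ (⟨⟩∈⊗⁻ (proj₁ (⟨⟩∈⊗⁻ (subst (_∈ code-base) e base))))
                  in n , a , m , c , e , nω , A , mω , F , l , λ j φ r → proj₂ (⟨⟩∈⊗⁻ (∈𝒫⁻ c∈ _ r))

  empty-code : IsCode ∅ ∅ ∅ ∅
  empty-code = 0∈ω , (empty-function , λ x y p → ⊥-elim (∉∅ p)) , 0∈ω , empty-function ,
    (λ j φ p → ⊥-elim (∉∅ p)) , (λ j φ p → ⊥-elim (∉∅ p))
    where
    empty-function : IsFunctionOn ∅ ∅
    empty-function = isFunctionOn-intro (λ p q → ⊥-elim (∉∅ q)) (λ x q → ⊥-elim (∉∅ q)) (λ x y z q → ⊥-elim (∉∅ q))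

  extend-code : ∀ {n a m c n′ a′ R l s k} → IsCode n a m c → n′ ∈ ω → n ⊆ n′ → a′ ∶ n′ ⟶ X → a ⊆ a′ →
    𝓛 [ R ]= l → s ∶ l ⟶ n′ → k ∈ ω → IsCode n′ a′ (succ m) (c ▹ m ↦ relationLiteral k R s)
  extend-code {n} {a} {m} {c} {n′} {a′} {R} {l} {s} {k} (nω , A , mω , F , lits , rels) n′ω n⊆ A′ a⊆ r S kω =
    n′ω , A′ , s∈ω mω , ▹-function F , Extension.conjunction-extend A A′ n⊆ a⊆ mω F lits r S kω ,
    λ j φ p → [ rels j φ , (λ (_ , e) → subst (_∈ relationLiterals) (sym e) new) ]′ (▹-split p)
    where
    inside : ∀ {p} → (∃[ x ] ∃[ y ] p ≡ ⟨ x , y ⟩ × x ∈ l) → p ∈ s → p ∈ ω ⊗ ω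
    inside (x , y , e , x∈) q = subst (_∈ ω ⊗ ω) (sym e)
      (∈⊗ (ω-transitive (arity∈ω r) x∈) (ω-transitive n′ω (proj₂ S x y (subst (_∈ s) e q))))
    new : relationLiteral k R s ∈ relationLiterals
    new = ∈⊗ kω (∈⊗ (s∈ω 0∈ω) (∈⊗ (dom arity-function r) (∈𝒫 λ p q → inside (proj₁ (proj₁ S) p q) q)))

  module PathTree {μ} (Mμ : Measure μ) where
    open Valuation Mμ

    IsNode : Fraction → 𝕍 → Set ℓ
    IsNode ε E = PositiveQ ε × E ∈ 𝒜 × (∀ g → IsSym g → ε ∉ᶜ m (E △ im g E))

    Extends : Fraction → 𝕍 → Fraction → 𝕍 → Set ℓ
    Extends ε E ε′ E′ = ε′ ⊕ ε′ ≤q ε × ε ∉ᶜ m (E △ E′)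

    private
      ρ : Vec 𝕍 5
      ρ = X ∷ 𝓛 ∷ Str ∷ μ ∷ fractions ∷ []
      nodesᶠ stepsᶠ : Fm 6
      nodesᶠ = ∃ᶠ ∃ᶠ v2 ≈ᶠ ⟨ v1 , v0 ⟩ᵗ ∧ᶠ (∀ᶠ isBijection v0 v4 v4 ⇒ᶠ
        ¬ᶠ (v2 ∈ᶠ valᵗ v8 v7 (△ᵗ v1 (compr imᶠ (v0 ∷ v1 ∷ v4 ∷ v5 ∷ []) v6))))
      stepsᶠ = ∃ᶠ ∃ᶠ ∃ᶠ ∃ᶠ v4 ≈ᶠ ⟨ ⟨ v3 , v2 ⟩ᵗ , ⟨ v1 , v0 ⟩ᵗ ⟩ᵗ ∧ᶠ
        (∃ᶠ addFrac v2 v2 v0 ∧ᶠ v0 ≤ᶠ v4) ∧ᶠ ¬ᶠ (v3 ∈ᶠ valᵗ (var 9F) v8 (△ᵗ v2 v0))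

    nodes steps : 𝕍
    nodes = sep nodesᶠ ρ (Pos ⊗ 𝒜)
    steps = sep stepsᶠ ρ (nodes ⊗ nodes)

    steps⊆ : steps ⊆ nodes ⊗ nodes
    steps⊆ p q = proj₁ (∈sep⁻ stepsᶠ ρ q)

    ∈nodes : ∀ {ε E} → IsNode ε E → ⟨ ⌜ ε ⌝ , E ⟩ ∈ nodes
    ∈nodes {ε} {E} (ε>0 , E∈ , h) = ∈sep nodesᶠ ρ (∈⊗ (∈Pos {ε} ε>0) E∈) (⌜ ε ⌝ , E , refl , h)

    ∈nodes⁻ : ∀ {p} → p ∈ nodes → Σ Fraction λ ε → Σ 𝕍 λ E → p ≡ ⟨ ⌜ ε ⌝ , E ⟩ × IsNode ε E
    ∈nodes⁻ {p} q = let (p∈ , v , E , e , h) = ∈sep⁻ nodesᶠ ρ q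
                        (v∈ , E∈) = ⟨⟩∈⊗⁻ (subst (_∈ Pos ⊗ 𝒜) e p∈)
                    in node p v E e E∈ h (∈Pos⁻ v∈)
      where
      node : ∀ p v E → p ≡ ⟨ v , E ⟩ → E ∈ 𝒜 → (∀ g → IsSym g → v ∉ m (E △ im g E)) → (∃[ ε ] v ≡ ⌜ ε ⌝ × PositiveQ ε) →
        Σ Fraction λ ε → Σ 𝕍 λ E → p ≡ ⟨ ⌜ ε ⌝ , E ⟩ × IsNode ε E
      node p v E e E∈ h (ε , e′ , ε>0) = ε , E , trans e (cong ⟨_, E ⟩ e′) , ε>0 , E∈ ,
        λ g G q → h g G (subst (_∈ m (E △ im g E)) (sym e′) q)

    Double : 𝕍 → 𝕍 → Set ℓ
    Double v w = ∃[ d ] AddFrac v v d × d ≤Q w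

    double : ∀ {ε ε′} → ε′ ⊕ ε′ ≤q ε → Double ⌜ ε′ ⌝ ⌜ ε ⌝
    double {ε} {ε′} h = ⌜ ε′ ⊕ ε′ ⌝ , ⊕⇒AddFrac ε′ ε′ , ≤q⇒≤Q {ε′ ⊕ ε′} {ε} h

    double⁻ : ∀ {ε ε′} → Double ⌜ ε′ ⌝ ⌜ ε ⌝ → ε′ ⊕ ε′ ≤q ε
    double⁻ {ε} {ε′} (d , a , h) = ≤Q⇒≤q {ε′ ⊕ ε′} {ε} (subst (_≤Q ⌜ ε ⌝) (AddFrac⇒⊕ {ε′} {ε′} a) h)

    double-frac : ∀ {v w} → Double v w → ∃[ x ] v ≡ ⌜ x ⌝
    double-frac {v} (d , a , h) = let (p , q , _ , _ , _ , _ , _ , _ , F , _) = to (AddFrac⇔ v v d) a in frac⁻ (p , q , F)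

    private
      opaque
        unfolding _≤Q_
        steps-unfold : ∀ p → ⟦ stepsᶠ ⟧ (p ∷ ρ) ⇔ (∃[ v ] ∃[ E ] ∃[ v′ ] ∃[ E′ ] p ≡ ⟨ ⟨ v , E ⟩ , ⟨ v′ , E′ ⟩ ⟩ × Double v′ v × v ∉ m (E △ E′))
        steps-unfold p = ≡⇒⇔ refl

    ∈steps : ∀ {ε E ε′ E′} → IsNode ε E → IsNode ε′ E′ → Extends ε E ε′ E′ → steps [ ⟨ ⌜ ε ⌝ , E ⟩ ]= ⟨ ⌜ ε′ ⌝ , E′ ⟩
    ∈steps {ε} {E} {ε′} {E′} N N′ (h , k) = ∈sep stepsᶠ ρ (∈⊗ (∈nodes {ε} N) (∈nodes {ε′} N′))
      (from (steps-unfold _) (⌜ ε ⌝ , E , ⌜ ε′ ⌝ , E′ , refl , double {ε} {ε′} h , k))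

    ∈steps⁻ : ∀ {ε E ε′ E′} → steps [ ⟨ ⌜ ε ⌝ , E ⟩ ]= ⟨ ⌜ ε′ ⌝ , E′ ⟩ → Extends ε E ε′ E′
    ∈steps⁻ {ε} {E} {ε′} {E′} p =
      let (v , F , v′ , F′ , e , d , n) = to (steps-unfold _) (proj₂ (∈sep⁻ stepsᶠ ρ p))
          (e₁ , e₂) = ⟨⟩-injective e ; (ev , eE) = ⟨⟩-injective e₁ ; (ev′ , eE′) = ⟨⟩-injective e₂
      in double⁻ {ε} {ε′} (subst₂ Double (sym ev′) (sym ev) d) ,
         λ q → n (subst₂ (λ v A → v ∈ m A) ev (cong₂ _△_ eE eE′) q)

    module Ranks = Tree steps⊆

    module Branch {c} (c-map : c ∶ ω ⟶ nodes) (c-steps : ∀ n x y → c [ n ]= x → c [ succ n ]= y → steps [ x ]= y) where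
      private
        module Δ = Graph (∃ᶠ v4 [ v2 ]ᶠ= ⟨ v1 , v0 ⟩ᵗ) (c ∷ []) ω Pos
        module B = Graph (∃ᶠ v4 [ v2 ]ᶠ= ⟨ v0 , v1 ⟩ᵗ) (c ∷ []) ω 𝒜

        node-at : ∀ n → n ∈ ω → Σ Fraction λ ε → Σ 𝕍 λ E → c [ n ]= ⟨ ⌜ ε ⌝ , E ⟩ × IsNode ε E
        node-at n p = let (x , q) = value (proj₁ c-map) p ; (ε , E , e , N) = ∈nodes⁻ (proj₂ c-map n x q) in
          ε , E , subst (λ x → c [ n ]= x) e q , N

        Δ-map : Δ.fun ∶ ω ⟶ Pos
        Δ-map = Δ.fun-map
          (λ n p → let (ε , E , q , N) = node-at n p in ⌜ ε ⌝ , ∈Pos {ε} (proj₁ N) , E , q)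
          (λ n y z p (E , q) (E′ , q′) → proj₁ (⟨⟩-injective (functional (proj₁ c-map) q q′)))

        B-map : B.fun ∶ ω ⟶ 𝒜
        B-map = B.fun-map
          (λ n p → let (ε , E , q , N) = node-at n p in E , proj₁ (proj₂ N) , ⌜ ε ⌝ , q)
          (λ n y z p (v , q) (v′ , q′) → proj₂ (⟨⟩-injective (functional (proj₁ c-map) q q′)))

        joined : ∀ {n ε E} → Δ.fun [ n ]= ⌜ ε ⌝ → B.fun [ n ]= E → c [ n ]= ⟨ ⌜ ε ⌝ , E ⟩
        joined {n} {ε} {E} p q = let (_ , _ , E′ , r) = Δ.fun-elim p ; (_ , _ , v , s) = B.fun-elim q in
          subst (λ E → c [ n ]= ⟨ ⌜ ε ⌝ , E ⟩) (proj₂ (⟨⟩-injective (functional (proj₁ c-map) r s))) r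

        shifts : Shifts Δ.fun B.fun
        shifts n ε E g p q G r = let (ε′ , E′ , e , _ , _ , h) = ∈nodes⁻ (proj₂ c-map n _ (joined {n} {ε} {E} p q)) ; (e₁ , e₂) = ⟨⟩-injective e in
          h g G (subst₂ (λ v E → v ∈ m (E △ im g E)) e₁ e₂ r)

        extends : ∀ {n ε E ε′ E′} → Δ.fun [ n ]= ⌜ ε ⌝ → B.fun [ n ]= E → Δ.fun [ succ n ]= ⌜ ε′ ⌝ → B.fun [ succ n ]= E′ → Extends ε E ε′ E′
        extends {n} {ε} {E} {ε′} {E′} p q p′ q′ = ∈steps⁻ {ε} {E} {ε′} {E′}
          (c-steps n _ _ (joined {n} {ε} {E} p q) (joined {succ n} {ε′} {E′} p′ q′))

        halves′ : Halving Δ.fun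
        halves′ n ε ε′ p p′ = let (E , q) = value (proj₁ B-map) (dom (proj₁ Δ-map) p) ; (E′ , q′) = value (proj₁ B-map) (dom (proj₁ Δ-map) p′) in
          proj₁ (extends {n} {ε} {E} {ε′} {E′} p q p′ q′)

        steps′ : Steps Δ.fun B.fun
        steps′ n ε E E′ p q q′ = next-value (node-at (succ n) (s∈ω (dom (proj₁ Δ-map) p)))
          where
          next-value : (Σ Fraction λ ε′ → Σ 𝕍 λ E′ → c [ succ n ]= ⟨ ⌜ ε′ ⌝ , E′ ⟩ × IsNode ε′ E′) → ε ∉ᶜ m (E △ E′)
          next-value (ε′ , F , r , N) = proj₂ (extends {n} {ε} {E} {ε′} {E′} p q
            (Δ.fun-intro (s∈ω (dom (proj₁ Δ-map) p)) (∈Pos {ε′} (proj₁ N)) (F , r)) q′)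

      path : ∀ {ε η E} → c [ ∅ ]= ⟨ ⌜ ε ⌝ , E ⟩ → Start ε η E → Σ 𝕍 λ δ → Σ 𝕍 λ b → Path δ b
      path {ε} {η} {E} p st = Δ.fun , B.fun , Δ-map , B-map , halves′ , shifts , steps′ ,
        starts (∈nodes⁻ (proj₂ c-map ∅ _ p))
        where
        starts : (Σ Fraction λ ε′ → Σ 𝕍 λ E′ → ⟨ ⌜ ε ⌝ , E ⟩ ≡ ⟨ ⌜ ε′ ⌝ , E′ ⟩ × IsNode ε′ E′) → Starts Δ.fun B.fun
        starts (ε′ , E′ , e , N) = let (e₁ , e₂) = ⟨⟩-injective e in
          ε , η , E , Δ.fun-intro 0∈ω (subst (_∈ Pos) (sym e₁) (∈Pos {ε′} (proj₁ N))) (E , p) ,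
          B.fun-intro 0∈ω (subst (_∈ 𝒜) (sym e₂) (proj₁ (proj₂ N))) (⌜ ε ⌝ , p) , st

  opaque
    unfolding isConjunctionSetᶠ
    conj-spec : ∀ a c → ⟦ isConjunctionSet v0 v1 v2 v3 v4 ⟧ (X ∷ 𝓛 ∷ a ∷ c ∷ conj a c ∷ [])
    conj-spec a c M = mk⇔
      (λ p → let (q , h) = ∈conj⁻ p in to (structure-def M) (∈Str⁻ q) , from (satConjunction⇔ M a c) h)
      (λ (s , h) → ∈conj (∈Str (from (structure-def M) s)) (to (satConjunction⇔ M a c) h))

  code⇒conjunction : ∀ {n a m c} → IsCode n a m c → ⟦ isConjunction v0 v1 v2 ⟧ (𝓛 ∷ n ∷ c ∷ [])
  code⇒conjunction {n} {a} {m} {c} (_ , _ , mω , F , l , _) = from (conjunction⇔ n c) (m , ∈ω⁻ mω , F , l)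

  module Criteria {μ} (Mμ : Measure μ) where
    open Valuation Mμ

    private
      IsImage : 𝕍 → 𝕍 → 𝕍 → Set ℓ
      IsImage g A B = ∀ N → N ∈ B ⇔ ⟦ imᶠ ⟧ (N ∷ g ∷ A ∷ X ∷ 𝓛 ∷ [])

      im-image : ∀ {g A} → IsSym g → IsImage g A (im g A)
      im-image {g} {A} G N = mk⇔ (λ p → from image-spec (proj₂ (∈im⁻ p)))
        (λ h → let (M , p , a) = to image-spec h in Image.∈im G p a)

      image-unique : ∀ {g A B} → IsSym g → IsImage g A B → B ≡ im g A
      image-unique G h = ext (λ N p → from (im-image G N) (to (h N) p)) (λ N p → from (h N) (to (im-image G N) p))

      IsDifference : 𝕍 → 𝕍 → 𝕍 → Set ℓ
      IsDifference B A D = ∀ M → M ∈ D ⇔ ((M ∈ B × ¬ M ∈ A) ⊎ (M ∈ A × ¬ M ∈ B))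

      difference-unique : ∀ {A B D} → IsDifference B A D → D ≡ B △ A
      difference-unique h = ext (λ M p → ∈△ (to (h M) p)) (λ M p → from (h M) (∈△⁻ p))

      measurable⇔ : ∀ A → ⟦ measurable v0 v1 v2 v3 ⟧ (κ ∷ X ∷ 𝓛 ∷ A ∷ []) ⇔ A ∈ Meas
      measurable⇔ A = mk⇔ (λ h → ∈Meas (from (measurable-def A) h)) (λ p → to (measurable-def A) (∈Meas⁻ p))

    invariant-elim : ⟦ isInvariant v0 v1 v2 v3 ⟧ (κ ∷ X ∷ 𝓛 ∷ μ ∷ []) → ∀ {g B} → IsSym g → B ∈ Meas → m (im g B) ≡ m B
    invariant-elim h {g} {B} G b = m-eq (h g B (im g B) (m B) G (from (measurable⇔ B) b) (im-image G) (m-graph b))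

    invariant-intro : (∀ {g B} → IsSym g → B ∈ Meas → m (im g B) ≡ m B) → ⟦ isInvariant v0 v1 v2 v3 ⟧ (κ ∷ X ∷ 𝓛 ∷ μ ∷ [])
    invariant-intro h g A B r G a i p = let a′ = to (measurable⇔ A) a in
      subst₂ (λ B r → μ [ B ]= r) (sym (image-unique G i)) (trans (h G a′) (m-eq p)) (m-graph (Image.meas-im G a′))

    private
      IsOne : 𝕍 → Set ℓ
      IsOne r = ⟦ isOne v0 ⟧ (r ∷ [])

      one-unique : ∀ {r s} → IsOne r → IsOne s → r ≡ s
      one-unique h k = ext (λ x p → from (k x) (to (h x) p)) (λ x p → from (h x) (to (k x) p))

      Str-one : IsOne (m Str)
      Str-one = μ-total (m Str) (m-graph meas-Str)

      full : ∀ {A} → A ∈ Meas → IsOne (m A) → ¬ (∃[ x ] x ∈ᶜ m (Str ∖ A))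
      full {A} a h (x , p) =
        let ∁a = meas-∁ a
            (y , q , x<y) = open-cut (m-real ∁a) {x} p
            total : m A +ᴿ m (Str ∖ A) ≡ m A
            total = trans (sym (m-split a meas-Str (meas⊆Str a))) (one-unique Str-one h)
            y∈ = subst (y ∈ᶜ_) total (∈+ᴿʳ (m-real a) (m-real ∁a) ⌜ y ⌝ q)
            (z , z∈ , z+y∉) = almost-top (m-real a) {y} {y} (positive-above {x} {y} x<y) y∈
        in z+y∉ (subst (z ⊕ y ∈ᶜ_) total (∈+ᴿ (m-real a) (m-real ∁a) {z} {y} {z ⊕ y} z∈ q (≤q-refl {z ⊕ y})))

      full⁻ : ∀ {A} → A ∈ Meas → m (Str ∖ A) ≡ ∅ → IsOne (m A)
      full⁻ {A} a e = subst IsOne (ext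
        (addReal-∅ (subst₂ (AddReal (m A)) e (sym (m-split a meas-Str (meas⊆Str a))) (+ᴿ-addReal (m-real a) (m-real (meas-∁ a)))))
        (m-mono a meas-Str (meas⊆Str a))) Str-one

      inhabited : ∀ {A} → A ∈ Meas → ¬ m A ≡ ∅ → ∃[ x ] x ∈ᶜ m A
      inhabited {A} a n = let (v , p) = nonempty n ; (x , e) = real-frac (m-real a) p in x , subst (_∈ m A) e p

    opaque
      unfolding isErgodicᶠ

      ergodic-elim : ⟦ isErgodic v0 v1 v2 v3 ⟧ (κ ∷ X ∷ 𝓛 ∷ μ ∷ []) → ¬ (∃[ A ] IsNontrivialInvariant A)
      ergodic-elim (_ , h) (A , a , null-difference , (x , p) , q) =
        [ (λ r → ∉∅ (subst (⌜ x ⌝ ∈_) (m-eq r) p))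
        , (λ (r , r-one , s) → full a (subst IsOne (sym (m-eq s)) r-one) q) ]′
        (h A (from (measurable⇔ A) a) λ g B D G i d →
          subst₂ (λ D r → μ [ D ]= r) (sym (trans (difference-unique d) (cong (_△ A) (image-unique G i)))) (null-difference g G)
            (m-graph (meas-△ (Image.meas-im G a) a)))

      ergodic-intro : IsProbability μ → ⟦ isInvariant v0 v1 v2 v3 ⟧ (κ ∷ X ∷ 𝓛 ∷ μ ∷ []) → ¬ (∃[ A ] IsNontrivialInvariant A) →
        ⟦ isErgodic v0 v1 v2 v3 ⟧ (κ ∷ X ∷ 𝓛 ∷ μ ∷ [])
      ergodic-intro P I n = (to (probability-def μ) P , I) , λ A h almost → trivial (to (measurable⇔ A) h) λ g G →
        m-eq (almost g (im g A) (im g A △ A) G (im-image G) (λ M → mk⇔ ∈△⁻ ∈△))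
        where
        trivial : ∀ {A} → A ∈ Meas → (∀ g → IsSym g → m (im g A △ A) ≡ ∅) → μ [ A ]= ∅ ⊎ (∃[ r ] IsOne r × μ [ A ]= r)
        trivial {A} a h = by-contradiction λ k → n (A , a , h ,
          inhabited a (λ e → k (inj₁ (subst (λ r → μ [ A ]= r) e (m-graph a)))) ,
          inhabited (meas-∁ a) (λ e → k (inj₂ (m A , full⁻ a e , m-graph a))))

  opaque
    IsPath : 𝕍 → 𝕍 → 𝕍 → Set ℓ
    IsPath μ δ b = Σ (Measure μ) λ Mμ → Valuation.Path Mμ δ b

    path⇒isPath : ∀ {μ δ b} (Mμ : Measure μ) → Valuation.Path Mμ δ b → IsPath μ δ b
    path⇒isPath Mμ P = Mμ , P

    isPath⇒path : ∀ {μ δ b} → IsPath μ δ b → Σ (Measure μ) λ Mμ → Valuation.Path Mμ δ b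
    isPath⇒path P = P

module Extension {ℓ} (em : ExcludedMiddle ℓ) (𝕄₀ 𝕄₁ : BackgroundModel ℓ)
 (ι : BackgroundModel.Universe 𝕄₀ → BackgroundModel.Universe 𝕄₁)
 (ι-∈⇔ : ∀ x a → BackgroundModel._∈_ 𝕄₀ x a ⇔ BackgroundModel._∈_ 𝕄₁ (ι x) (ι a))
 (ι-transitive : ∀ y a → BackgroundModel._∈_ 𝕄₁ y (ι a) → ∃[ x ] y ≡ ι x) where
 module M₀ = Model em 𝕄₀
 module M₁ = Model em 𝕄₁
 open M₁

 ∈ι : ∀ {x a} → x M₀.∈ a → ι x ∈ ι a
 ∈ι {x} {a} = to (ι-∈⇔ x a)

 ι∈⁻ : ∀ {x a} → ι x ∈ ι a → x M₀.∈ a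
 ι∈⁻ {x} {a} = from (ι-∈⇔ x a)

 ∈ι⁻ : ∀ {y a} → y ∈ ι a → ∃[ x ] y ≡ ι x × x M₀.∈ a
 ∈ι⁻ {y} {a} p = let (x , e) = ι-transitive y a p in x , e , ι∈⁻ (subst (_∈ ι a) e p)

 ι-injective : ∀ {x y} → ι x ≡ ι y → x ≡ y
 ι-injective e = M₀.ext (λ z p → ι∈⁻ (subst (ι z ∈_) e (∈ι p))) (λ z p → ι∈⁻ (subst (ι z ∈_) (sym e) (∈ι p)))

 ι-ext : ∀ {a b} → (∀ x → x M₀.∈ a → ι x ∈ b) → (∀ y → y ∈ b → ∃[ x ] y ≡ ι x × x M₀.∈ a) → ι a ≡ b
 ι-ext {a} {b} h k = ext
   (λ y p → let (x , e , q) = ∈ι⁻ p in subst (_∈ b) (sym e) (h x q))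
   (λ y p → let (x , e , q) = k y p in subst (_∈ ι a) (sym e) (∈ι q))

 ι-⊆ : ∀ {a b} → a M₀.⊆ b → ι a ⊆ ι b
 ι-⊆ {a} {b} h y p = let (x , e , q) = ∈ι⁻ p in subst (_∈ ι b) (sym e) (∈ι (h x q))

 ι-∅ : ι M₀.∅ ≡ ∅
 ι-∅ = ≡∅ λ y p → let (x , _ , q) = ∈ι⁻ p in M₀.∉∅ q

 ι-⁅⁆ : ∀ a b → ι M₀.⁅ a , b ⁆ ≡ ⁅ ι a , ι b ⁆
 ι-⁅⁆ a b = ι-ext (λ x p → ∈⁅⁆ (Sum.map (cong ι) (cong ι) (M₀.∈⁅⁆⁻ p)))
   (λ y p → [ (λ e → a , e , M₀.∈⁅⁆₁) , (λ e → b , e , M₀.∈⁅⁆₂) ]′ (∈⁅⁆⁻ p))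

 ι-⟨⟩ : ∀ a b → ι M₀.⟨ a , b ⟩ ≡ ⟨ ι a , ι b ⟩
 ι-⟨⟩ a b = trans (ι-⁅⁆ _ _) (cong₂ ⁅_,_⁆ (ι-⁅⁆ a a) (ι-⁅⁆ a b))

 ι-∪ : ∀ a b → ι (a M₀.∪ b) ≡ ι a ∪ ι b
 ι-∪ a b = ι-ext (λ x p → ∈∪ (Sum.map ∈ι ∈ι (M₀.∈∪⁻ p)))
   (λ y p → [ (λ q → let (x , e , r) = ∈ι⁻ q in x , e , M₀.∈∪ (inj₁ r))
            , (λ q → let (x , e , r) = ∈ι⁻ q in x , e , M₀.∈∪ (inj₂ r)) ]′ (∈∪⁻ p))

 ι-succ : ∀ a → ι (M₀.succ a) ≡ succ (ι a)
 ι-succ a = trans (ι-∪ a _) (cong (ι a ∪_) (ι-⁅⁆ a a))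

 at : ∀ {f x y} → f M₀.[ x ]= y → ι f [ ι x ]= ι y
 at {f} {x} {y} p = subst (_∈ ι f) (ι-⟨⟩ x y) (∈ι p)

 pair⁻ : ∀ {p u v} → ι p ≡ ⟨ u , v ⟩ → ∃[ x ] ∃[ y ] u ≡ ι x × v ≡ ι y × p ≡ M₀.⟨ x , y ⟩
 pair⁻ {p} {u} {v} e =
   let (z , e′ , _) = ∈ι⁻ {⁅ u , v ⁆} {p} (subst (⁅ u , v ⁆ ∈_) (sym e) ∈⁅⁆₂)
       (x , ex , _) = ∈ι⁻ {u} {z} (subst (u ∈_) e′ ∈⁅⁆₁)
       (y , ey , _) = ∈ι⁻ {v} {z} (subst (v ∈_) e′ ∈⁅⁆₂)
   in x , y , ex , ey , ι-injective (trans e (trans (cong₂ ⟨_,_⟩ ex ey) (sym (ι-⟨⟩ x y))))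

 at-∃ : ∀ {f u v} → ι f [ u ]= v → ∃[ x ] ∃[ y ] u ≡ ι x × v ≡ ι y × f M₀.[ x ]= y
 at-∃ {f} p = let (q , e , q∈) = ∈ι⁻ p ; (x , y , e₁ , e₂ , e₃) = pair⁻ (sym e) in
   x , y , e₁ , e₂ , subst (M₀._∈ f) e₃ q∈

 at-∃ˡ : ∀ {f x v} → ι f [ ι x ]= v → ∃[ y ] v ≡ ι y × f M₀.[ x ]= y
 at-∃ˡ {f} {x} p = let (x′ , y , e , e′ , q) = at-∃ p in y , e′ , subst (λ x → f M₀.[ x ]= y) (sym (ι-injective e)) q

 at-∃ʳ : ∀ {f u y} → ι f [ u ]= ι y → ∃[ x ] u ≡ ι x × f M₀.[ x ]= y
 at-∃ʳ {f} {y = y} p = let (x , y′ , e , e′ , q) = at-∃ p in x , e , subst (λ y → f M₀.[ x ]= y) (sym (ι-injective e′)) q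

 function-up : ∀ {f a} → M₀.IsFunctionOn f a → IsFunctionOn (ι f) (ι a)
 function-up {f} {a} F = isFunctionOn-intro
   (λ p q → let (p₀ , e , q₀) = ∈ι⁻ q ; (x , y , e′ , x∈) = proj₁ F p₀ q₀ in
     ι x , ι y , trans e (trans (cong ι e′) (ι-⟨⟩ x y)) , ∈ι x∈)
   (λ u p → let (x , e , x∈) = ∈ι⁻ p ; (y , q) = M₀.value F x∈ in ι y , subst (λ u → ι f [ u ]= ι y) (sym e) (at q))
   (λ u v w p q → let (x , y , e , e′ , p₀) = at-∃ p ; (z , e″ , q₀) = at-∃ˡ (subst (λ u → ι f [ u ]= w) e q) in
     trans e′ (trans (cong ι (M₀.functional F p₀ q₀)) (sym e″)))

 function-down : ∀ {f a} → IsFunctionOn (ι f) (ι a) → M₀.IsFunctionOn f a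
 function-down {f} {a} F = M₀.isFunctionOn-intro
   (λ p q → let (u , v , e , u∈) = proj₁ F (ι p) (∈ι q) ; (x , y , e₁ , _ , e₂) = pair⁻ e in
     x , y , e₂ , ι∈⁻ (subst (_∈ ι a) e₁ u∈))
   (λ x p → let (v , q) = value F (∈ι p) ; (y , _ , r) = at-∃ˡ q in y , r)
   (λ x y z p q → ι-injective (functional F (at p) (at q)))

 map-up : ∀ {f a b} → f M₀.∶ a ⟶ b → ι f ∶ ι a ⟶ ι b
 map-up {b = b} F = function-up (proj₁ F) , λ u v p → let (x , y , _ , e , q) = at-∃ p in
   subst (_∈ ι b) (sym e) (∈ι (proj₂ F x y q))

 map-down : ∀ {f a b} → ι f ∶ ι a ⟶ ι b → f M₀.∶ a ⟶ b
 map-down F = function-down (proj₁ F) , λ x y p → ι∈⁻ (proj₂ F (ι x) (ι y) (at p))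

 injective-up : ∀ {f} → M₀.Injective f → Injective (ι f)
 injective-up {f} h u u′ v p q = let (x , y , e , e′ , r) = at-∃ p ; (x′ , e″ , r′) = at-∃ʳ (subst (λ v → ι f [ u′ ]= v) e′ q) in
   trans e (trans (cong ι (h x x′ y r r′)) (sym e″))

 bijection-up : ∀ {f a b} → M₀.IsBijection f a b → IsBijection (ι f) (ι a) (ι b)
 bijection-up {f} (F , inj , surj) = map-up F , injective-up inj , λ v p →
   let (y , e , y∈) = ∈ι⁻ p ; (x , q) = surj y y∈ in ι x , subst (λ v → ι f [ ι x ]= v) (sym e) (at q)

 composite-up : ∀ {h g f} → M₀.IsComposite h g f → IsComposite (ι h) (ι g) (ι f)
 composite-up {h} {g} {f} c p = mk⇔
   (λ q → let (p₀ , e , q₀) = ∈ι⁻ q ; (x , y , z , e′ , r , s) = to (c p₀) q₀ in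
     ι x , ι y , ι z , trans e (trans (cong ι e′) (ι-⟨⟩ x z)) , at r , at s)
   (λ (u , v , w , e , r , s) →
     let (x , y , e₁ , e₂ , r₀) = at-∃ r ; (z , e₃ , s₀) = at-∃ˡ (subst (λ v → ι g [ v ]= w) e₂ s) in
     subst (_∈ ι h) (sym (trans e (cong₂ ⟨_,_⟩ e₁ e₃))) (at (from (c M₀.⟨ x , z ⟩) (x , y , z , refl , r₀ , s₀))))

 ι-ω : ι M₀.ω ≡ ω
 ι-ω = ext (λ x p → by-contradiction λ n → no-least (∈∖ p n)) (λ x p → ∈ω⁻ p (ι M₀.ω) ω₀-closed)
   where
   ω₀-closed : Inductive (ι M₀.ω)
   ω₀-closed = subst (_∈ ι M₀.ω) ι-∅ (∈ι M₀.0∈ω) , λ x p → let (n , e , q) = ∈ι⁻ p in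
     subst (_∈ ι M₀.ω) (trans (ι-succ n) (cong succ (sym e))) (∈ι (M₀.s∈ω q))
   no-least : ∀ {x} → x ∉ ι M₀.ω ∖ ω
   no-least p =
     let (m , m∈ , h) = least p ; (m∈ω₀ , m∉ω) = ∈∖⁻ m∈ ; (n , e , n∈) = ∈ι⁻ m∈ω₀ in
     [ (λ n≡∅ → m∉ω (subst (_∈ ω) (sym (trans e (trans (cong ι n≡∅) ι-∅))) 0∈ω))
     , (λ (k , k∈ , n≡) → let m≡ = trans e (trans (cong ι n≡) (ι-succ k)) in
         m∉ω (subst (_∈ ω) (sym m≡) (s∈ω (by-contradiction λ k∉ →
           h (ι k) (subst (ι k ∈_) (sym m≡) (∈succ (inj₂ refl))) (∈∖ (∈ι k∈) k∉))))) ]′ (M₀.ω-cases n∈)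

 ω-up : ∀ {n} → n M₀.∈ M₀.ω → ι n ∈ ω
 ω-up {n} p = subst (ι n ∈_) ι-ω (∈ι p)

 ω⁻ : ∀ {n} → n ∈ ω → ∃[ k ] n ≡ ι k × k M₀.∈ M₀.ω
 ω⁻ {n} p = ∈ι⁻ (subst (n ∈_) (sym ι-ω) p)

 ι-▹ : ∀ f n y → ι (f M₀.▹ n ↦ y) ≡ ι f ▹ ι n ↦ ι y
 ι-▹ f n y = trans (ι-∪ f _) (cong (ι f ∪_) (trans (ι-⁅⁆ _ _) (cong (λ p → ⁅ p , p ⁆) (ι-⟨⟩ n y))))

 finite-sequence : ∀ {n t X} → n ∈ ω → t ∶ n ⟶ ι X → ∃[ t₀ ] t ≡ ι t₀
 finite-sequence {n} {t} {X} nω T = first (∈ι⁻ (ω-ind (∀ᶠ isMap v0 v1 v2 ⇒ᶠ v0 ∈ᶠ v3) (ι X ∷ ι P ∷ [])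
     (λ t T → subst (_∈ ι P) (trans ι-∅ (sym (≡∅ λ p q → let (x , y , e , x∈) = proj₁ (proj₁ T) p q in ∉∅ x∈)))
       (∈ι (M₀.∈𝒫 λ x p → ⊥-elim (M₀.∉∅ p))))
     (λ n nω h t T → extended nω T (∈ι⁻ (h (restrict t n) (restrict-map T λ i p → ∈succ (inj₁ p))))) n nω t T))
   where
   P : M₀.𝕍
   P = M₀.𝒫 (M₀.ω M₀.⊗ X)
   first : (∃[ t₀ ] t ≡ ι t₀ × t₀ M₀.∈ P) → ∃[ t₀ ] t ≡ ι t₀
   first (t₀ , e , _) = t₀ , e
   extended : ∀ {n t} → n ∈ ω → t ∶ succ n ⟶ ι X → (∃[ t₀ ] restrict t n ≡ ι t₀ × t₀ M₀.∈ P) → t ∈ ι P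
   extended {n} {t} nω T (t₀ , e , t₀∈) =
     let (k , n≡ , k∈) = ω⁻ nω
         (v , p) = value (proj₁ T) (∈succ (inj₂ refl))
         (x , v≡ , x∈) = ∈ι⁻ (proj₂ T n v p)
         t≡ : t ≡ restrict t n ▹ n ↦ v
         t≡ = function-ext (proj₁ T) (▹-function (proj₁ (restrict-map T λ i p → ∈succ (inj₁ p)))) λ i z q →
           [ (λ i∈ → ▹-old _ (restrict-at i∈ q))
           , (λ i≡ → subst₂ (λ i z → (restrict t n ▹ n ↦ v) [ i ]= z) (sym i≡)
               (functional (proj₁ T) p (subst (λ i → t [ i ]= z) i≡ q)) ▹-new) ]′ (∈succ⁻ (dom (proj₁ T) q))
     in subst (_∈ ι P) (sym (trans t≡ (trans (cong₂ (λ f n → f ▹ n ↦ v) e n≡) (trans (cong (ι t₀ ▹ ι k ↦_) v≡) (sym (ι-▹ t₀ k x))))))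
       (∈ι (M₀.∈𝒫 λ q r → [ M₀.∈𝒫⁻ t₀∈ q , (λ s → subst (M₀._∈ M₀.ω M₀.⊗ X) (sym (M₀.∈⁅a⁆ s)) (M₀.∈⊗ k∈ x∈)) ]′ (M₀.∈∪⁻ r)))

 iterate-up : ∀ {S₀ S₁ a n b} → (∀ i x y → S₀ i x y → S₁ (ι i) (ι x) (ι y)) → M₀.Iterate S₀ a n b → Iterate S₁ (ι a) (ι n) (ι b)
 iterate-up {S₀} {S₁} {a} {n} {b} h (s , F , p , q , st) =
   ι s , subst (IsFunctionOn (ι s)) (ι-succ n) (function-up F) , subst (λ z → ι s [ z ]= ι a) ι-∅ (at p) , at q , steps
   where
   steps : ∀ i x y → i ∈ ι n → ι s [ i ]= x → ι s [ succ i ]= y → S₁ i x y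
   steps i x y i∈ p q =
     let (i₀ , ei , i₀∈) = ∈ι⁻ i∈
         (x₀ , ex , p₀) = at-∃ˡ (subst (λ i → ι s [ i ]= x) ei p)
         (y₀ , ey , q₀) = at-∃ˡ (subst (λ i → ι s [ i ]= y) (trans (cong succ ei) (sym (ι-succ i₀))) q)
     in subst₂ (λ i x → S₁ i x y) (sym ei) (sym ex) (subst (S₁ (ι i₀) (ι x₀)) (sym ey) (h i₀ x₀ y₀ (st i₀ x₀ y₀ i₀∈ p₀ q₀)))

 add-up : ∀ {m n k} → M₀.Add m n k → Add (ι m) (ι n) (ι k)
 add-up = iterate-up λ i x y e → trans (cong ι e) (ι-succ x)

 mul-up : ∀ {m n k} → M₀.Mul m n k → Mul (ι m) (ι n) (ι k)
 mul-up {m} {n} {k} h = subst (λ z → Iterate (λ _ x y → Add x (ι m) y) z (ι n) (ι k)) ι-∅ (iterate-up (λ i x y → add-up) h)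

 nat-up : ∀ {n} → M₀.IsNat n → IsNat (ι n)
 nat-up h = ∈ω⁻ (ω-up (M₀.∈ω h))

 frac-up : ∀ {x p q} → M₀.Frac x p q → Frac (ι x) (ι p) (ι q)
 frac-up (e , p , q , n) = trans (cong ι e) (ι-⟨⟩ _ _) , nat-up p , nat-up q , λ h → n (ι-injective (trans h (sym ι-∅)))

 isFrac-up : ∀ {x} → M₀.IsFrac x → IsFrac (ι x)
 isFrac-up (p , q , h) = ι p , ι q , frac-up h

 isFrac-down : ∀ {v} → IsFrac v → ∃[ x ] v ≡ ι M₀.⌜ x ⌝
 isFrac-down {v} (p , q , e , pω , qω , n) = pulled (ω⁻ (∈ω pω)) (ω⁻ (∈ω qω))
   where
   pulled : (∃[ p₀ ] p ≡ ι p₀ × p₀ M₀.∈ M₀.ω) → (∃[ q₀ ] q ≡ ι q₀ × q₀ M₀.∈ M₀.ω) → ∃[ x ] v ≡ ι M₀.⌜ x ⌝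
   pulled (p₀ , ep , p₀ω) (q₀ , eq , q₀ω) = proj₁ f , trans e (trans (cong₂ ⟨_,_⟩ ep eq) (trans (sym (ι-⟨⟩ p₀ q₀)) (cong ι (proj₂ f))))
     where
     q₀≢∅ : ¬ q₀ ≡ M₀.∅
     q₀≢∅ h = n (trans eq (trans (cong ι h) ι-∅))
     f : ∃[ x ] M₀.⟨ p₀ , q₀ ⟩ ≡ M₀.⌜ x ⌝
     f = M₀.frac⁻ (p₀ , q₀ , refl , M₀.∈ω⁻ p₀ω , M₀.∈ω⁻ q₀ω , q₀≢∅)

 cross-up : ∀ {x y u v} → M₀.Cross x y u v → Cross (ι x) (ι y) (ι u) (ι v)
 cross-up (p , q , p′ , q′ , F , G , m , m′) = ι p , ι q , ι p′ , ι q′ , frac-up F , frac-up G , mul-up m , mul-up m′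

 <Q-up : ∀ {x y} → x M₀.<Q y → ι x <Q ι y
 <Q-up {x} {y} h = let (u , v , c , r) = to (M₀.<Q⇔ x y) h in from (<Q⇔ (ι x) (ι y)) (ι u , ι v , cross-up c , ∈ι r)

 ≤Q-up : ∀ {x y} → x M₀.≤Q y → ι x ≤Q ι y
 ≤Q-up {x} {y} h = let (u , v , c , r) = to (M₀.≤Q⇔ x y) h in
   from (≤Q⇔ (ι x) (ι y)) (ι u , ι v , cross-up c , Sum.map ∈ι (cong ι) r)

 addFrac-up : ∀ {x y z} → M₀.AddFrac x y z → AddFrac (ι x) (ι y) (ι z)
 addFrac-up {x} {y} {z} h = let (p , q , p′ , q′ , u , v , n , d , F , G , m , m′ , a , m″ , H) = to (M₀.AddFrac⇔ x y z) h in
   from (AddFrac⇔ (ι x) (ι y) (ι z)) (ι p , ι q , ι p′ , ι q′ , ι u , ι v , ι n , ι d ,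
     frac-up F , frac-up G , mul-up m , mul-up m′ , add-up a , mul-up m″ , frac-up H)

 opaque
   lift : M₀.Fraction → Fraction
   lift x = proj₁ (frac⁻ (isFrac-up (M₀.⌜⌝-frac x)))

   lift-⌜⌝ : ∀ x → ι M₀.⌜ x ⌝ ≡ ⌜ lift x ⌝
   lift-⌜⌝ x = proj₂ (frac⁻ (isFrac-up (M₀.⌜⌝-frac x)))

 <q-up : ∀ {x y} → x M₀.<q y → lift x <q lift y
 <q-up {x} {y} h = <Q⇒<q {lift x} {lift y} (subst₂ _<Q_ (lift-⌜⌝ x) (lift-⌜⌝ y) (<Q-up (M₀.<q⇒<Q {x} {y} h)))

 ≤q-up : ∀ {x y} → x M₀.≤q y → lift x ≤q lift y
 ≤q-up {x} {y} h = ≤Q⇒≤q {lift x} {lift y} (subst₂ _≤Q_ (lift-⌜⌝ x) (lift-⌜⌝ y) (≤Q-up (M₀.≤q⇒≤Q {x} {y} h)))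

 ≤Q-down : ∀ x y → ι M₀.⌜ x ⌝ ≤Q ι M₀.⌜ y ⌝ → x M₀.≤q y
 ≤Q-down x y h = [ id , (λ k → ⊥-elim (≤q⇒≯ {lift x} {lift y} lifted (<q-up {y} {x} k))) ]′ (M₀.≤q-or-> x y)
   where
   lifted : lift x ≤q lift y
   lifted = ≤Q⇒≤q {lift x} {lift y} (subst₂ _≤Q_ (lift-⌜⌝ x) (lift-⌜⌝ y) h)

 lift-⊕ : ∀ x y → ι M₀.⌜ x M₀.⊕ y ⌝ ≡ ⌜ lift x ⊕ lift y ⌝
 lift-⊕ x y = AddFrac⇒⊕ {lift x} {lift y} (subst₂ (λ u v → AddFrac u v (ι M₀.⌜ x M₀.⊕ y ⌝)) (lift-⌜⌝ x) (lift-⌜⌝ y)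
   (addFrac-up (M₀.⊕⇒AddFrac x y)))

 ⊕-up : ∀ x y → lift x ⊕ lift y ≤q lift (x M₀.⊕ y)
 ⊕-up x y = ≤Q⇒≤q {lift x ⊕ lift y} {lift (x M₀.⊕ y)} (subst (⌜ lift x ⊕ lift y ⌝ ≤Q_) (trans (sym (lift-⊕ x y)) (lift-⌜⌝ (x M₀.⊕ y)))
   (≤q⇒≤Q {lift x ⊕ lift y} {lift x ⊕ lift y} (≤q-refl {lift x ⊕ lift y})))

 positive-up : ∀ {ε} → M₀.PositiveQ ε → PositiveQ (lift ε)
 positive-up {ε} h = positive-above {lift M₀.0q} {lift ε} (<q-up {M₀.0q} {ε} (M₀.0<positive {ε} h))

 addReal-up : ∀ {r s t} → M₀.IsReal r → M₀.IsReal s → M₀.AddReal r s t → AddReal (ι r) (ι s) (ι t)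
 addReal-up {r} {s} {t} R S h = addReal-intro λ v → mk⇔ (forth v) (back v)
   where
   Sum₁ : 𝕍 → Set ℓ
   Sum₁ v = v ∈ ι r ⊎ v ∈ ι s ⊎ (∃[ y ] ∃[ z ] ∃[ w ] y ∈ ι r × z ∈ ι s × AddFrac y z w × v ≤Q w)
   forth : ∀ v → v ∈ ι t → Sum₁ v
   forth v p = let (x , e , q) = ∈ι⁻ p in subst Sum₁ (sym e) (Sum.map ∈ι (Sum.map ∈ι
     λ (y , z , w , y∈ , z∈ , a , k) → ι y , ι z , ι w , ∈ι y∈ , ∈ι z∈ , addFrac-up a , ≤Q-up k) (to (M₀.∈addReal h x) q))
   below : ∀ v f g w → M₀.⌜ f ⌝ M₀.∈ r → M₀.⌜ g ⌝ M₀.∈ s → AddFrac (ι M₀.⌜ f ⌝) (ι M₀.⌜ g ⌝) w → v ≤Q w → v ∈ ι t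
   below v f g w f∈ g∈ a k =
     let w≡ = trans (AddFrac⇒⊕ {lift f} {lift g} (subst₂ (λ y z → AddFrac y z w) (lift-⌜⌝ f) (lift-⌜⌝ g) a)) (sym (lift-⊕ f g))
         (x , e) = isFrac-down (≤Q-frac k)
         x≤ = ≤Q-down x (f M₀.⊕ g) (subst₂ _≤Q_ e w≡ k)
     in subst (_∈ ι t) (sym e) (∈ι (from (M₀.∈addReal h M₀.⌜ x ⌝)
       (inj₂ (inj₂ (M₀.⌜ f ⌝ , M₀.⌜ g ⌝ , M₀.⌜ f M₀.⊕ g ⌝ , f∈ , g∈ , M₀.⊕⇒AddFrac f g , M₀.≤q⇒≤Q {x} {f M₀.⊕ g} x≤)))))
   generic : ∀ v → (∃[ y ] ∃[ z ] ∃[ w ] y ∈ ι r × z ∈ ι s × AddFrac y z w × v ≤Q w) → v ∈ ι t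
   generic v (y , z , w , y∈ , z∈ , a , k) =
     let (y₀ , ey , y₀∈) = ∈ι⁻ y∈ ; (z₀ , ez , z₀∈) = ∈ι⁻ z∈
         (f , ef) = M₀.real-frac R y₀∈ ; (g , eg) = M₀.real-frac S z₀∈
     in below v f g w (subst (M₀._∈ r) ef y₀∈) (subst (M₀._∈ s) eg z₀∈)
       (subst₂ (λ y z → AddFrac y z w) (trans ey (cong ι ef)) (trans ez (cong ι eg)) a) k
   back : ∀ v → Sum₁ v → v ∈ ι t
   back v = [ (λ p → let (x , e , q) = ∈ι⁻ p in subst (_∈ ι t) (sym e) (∈ι (from (M₀.∈addReal h x) (inj₁ q))))
            , [ (λ p → let (x , e , q) = ∈ι⁻ p in subst (_∈ ι t) (sym e) (∈ι (from (M₀.∈addReal h x) (inj₂ (inj₁ q))))) , generic v ]′ ]′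

 language-up : ∀ {𝓛} → M₀.IsRelationalLanguage 𝓛 → IsRelationalLanguage (ι 𝓛)
 language-up (S , F , arity) = ι S , function-up F , λ R n p → let (R₀ , n₀ , _ , e , q) = at-∃ p in
   subst IsNat (sym e) (nat-up (arity R₀ n₀ q))

 transitive-up : ∀ {a} → M₀.IsTransitive a → IsTransitive (ι a)
 transitive-up {a} h x p y q = let (x₀ , e , p₀) = ∈ι⁻ p ; (y₀ , e′ , q₀) = ∈ι⁻ (subst (y ∈_) e q) in
   subst (_∈ ι a) (sym e′) (∈ι (h x₀ p₀ y₀ q₀))

 ordinal-up : ∀ {a} → M₀.IsOrdinal a → IsOrdinal (ι a)
 ordinal-up (t , h) = transitive-up t , λ x p → let (x₀ , e , p₀) = ∈ι⁻ p in subst IsTransitive (sym e) (transitive-up (h x₀ p₀))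

 same-≤ : ∀ {x y : Fraction} → ⌜ x ⌝ ≡ ⌜ y ⌝ → x ≤q y
 same-≤ {x} {y} e = ≤Q⇒≤q {x} {y} (subst (_≤Q ⌜ y ⌝) (sym e) (≤q⇒≤Q {y} {y} (≤q-refl {y})))

 ⊕-up⁻ : ∀ x y → lift (x M₀.⊕ y) ≤q lift x ⊕ lift y
 ⊕-up⁻ x y = same-≤ {lift (x M₀.⊕ y)} {lift x ⊕ lift y} (trans (sym (lift-⌜⌝ (x M₀.⊕ y))) (lift-⊕ x y))

 ≤q-down : ∀ x y → lift x ≤q lift y → x M₀.≤q y
 ≤q-down x y h = [ id , (λ k → ⊥-elim (≤q⇒≯ {lift x} {lift y} h (<q-up {y} {x} k))) ]′ (M₀.≤q-or-> x y)

 lower : ∀ x → ∃[ x₀ ] ⌜ x ⌝ ≡ ⌜ lift x₀ ⌝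
 lower x = let (x₀ , e) = isFrac-down (⌜⌝-frac x) in x₀ , trans e (lift-⌜⌝ x₀)

 positive-down : ∀ {x} → PositiveQ (lift x) → M₀.PositiveQ x
 positive-down {x} h = [ zero-case , M₀.positive-above {M₀.0q} {x} ]′ (M₀.≤q-or-> x M₀.0q)
   where
   zero-case : x M₀.≤q M₀.0q → M₀.PositiveQ x
   zero-case x≤0 = ⊥-elim (≤q⇒≯ {lift x ⊕ lift x} {lift x}
     (≤q-trans {lift x ⊕ lift x} {lift (x M₀.⊕ x)} {lift x} (⊕-up x x) (≤q-up {x M₀.⊕ x} {x}
       (M₀.≤q-trans {x M₀.⊕ x} {x M₀.⊕ M₀.0q} {x} (M₀.⊕-mono-≤ {x} {x} {x} {M₀.0q} (M₀.≤q-refl {x}) x≤0) (M₀.⊕-0 x))))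
     (x<x⊕ε (lift x) {lift x} h))

 module Spaces (𝓢 : M₀.Signature) where
  open M₀.Signature 𝓢

  𝓢₁ : Signature
  𝓢₁ = record
    { κ = ι κ ; X = ι X ; 𝓛 = ι 𝓛
    ; language = language-up language
    ; κ-ordinal = ordinal-up κ-ordinal
    ; ω⊆κ = subst (_⊆ ι κ) ι-ω (ι-⊆ ω⊆κ)
    }

  module S₀ = M₀.Space 𝓢
  module S₁ = M₁.Space 𝓢₁
  open S₁

  atom-up : ∀ {R t} → S₀.IsAtom R t → IsAtom (ι R) (ι t)
  atom-up (n , r , T) = ι n , at r , map-up T

  atom-down : ∀ {R t} → IsAtom R t → ∃[ R₀ ] ∃[ t₀ ] R ≡ ι R₀ × t ≡ ι t₀ × S₀.IsAtom R₀ t₀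
  atom-down {R} {t} (n , r , T) =
    let (R₀ , n₀ , eR , en , r₀) = at-∃ r ; (t₀ , et) = finite-sequence (arity∈ω r) T in
    R₀ , t₀ , eR , et , n₀ , r₀ , map-down (subst₂ (λ t n → t ∶ n ⟶ ι X) et en T)

  holds-up : ∀ {M R t} → S₀.Holds M R t → Holds (ι M) (ι R) (ι t)
  holds-up (P , p , q) = ι P , at p , ∈ι q

  holds-down : ∀ {M R t} → Holds (ι M) (ι R) (ι t) → S₀.Holds M R t
  holds-down {t = t} (P , p , q) = let (P₀ , e , p₀) = at-∃ˡ p in P₀ , p₀ , ι∈⁻ (subst (ι t ∈_) e q)

  structure-up : ∀ {M} → S₀.IsStructure M → IsStructure (ι M)
  structure-up {M} h = from (structure-spec (ι M)) (relations , relation-at)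
    where
    spec = to (S₀.structure-spec M) h
    relations : ∀ p → p ∈ ι M → ∃[ R ] ∃[ n ] ∃[ P ] p ≡ ⟨ R , P ⟩ × ι 𝓛 [ R ]= n
    relations p q = let (p₀ , e , q₀) = ∈ι⁻ q ; (R , n , P , e′ , r) = proj₁ spec p₀ q₀ in
      ι R , ι n , ι P , trans e (trans (cong ι e′) (ι-⟨⟩ R P)) , at r
    Value : 𝕍 → 𝕍 → Set ℓ
    Value R n = ∃[ P ] ι M [ R ]= P × (∀ Q → ι M [ R ]= Q → Q ≡ P) × (∀ t → t ∈ P → t ∶ n ⟶ ι X)
    relation-at : ∀ R n → ι 𝓛 [ R ]= n → Value R n
    relation-at R n r = let (R₀ , n₀ , eR , en , r₀) = at-∃ r ; (P , p , u , k) = proj₂ spec R₀ n₀ r₀ in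
      subst₂ Value (sym eR) (sym en) (ι P , at p ,
        (λ Q q → let (Q₀ , e , q₀) = at-∃ˡ q in trans e (cong ι (u Q₀ q₀))) ,
        λ t t∈ → let (t₀ , e , t₀∈) = ∈ι⁻ t∈ in subst (λ t → t ∶ ι n₀ ⟶ ι X) (sym e) (map-up (k t₀ t₀∈)))

  str-up : ∀ {M} → M M₀.∈ S₀.Str → ι M ∈ Str
  str-up p = ∈Str (structure-up (S₀.∈Str⁻ p))

  action-up : ∀ {g M N} → S₀.IsSym g → M M₀.∈ S₀.Str → S₀.IsAction g M N → IsAction (ι g) (ι M) (ι N)
  action-up {g} {M} {N} G M∈ A = Action.action-intro (bijection-up G) (str-up (S₀.Action.action-Str G A)) λ R t u a c →
    let (R₀ , t₀ , eR , et , a₀) = atom-down a in holds⇔ eR et a₀ c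
    where
    holds⇔ : ∀ {R t u R₀ t₀} → R ≡ ι R₀ → t ≡ ι t₀ → S₀.IsAtom R₀ t₀ → IsComposite u (ι g) t → Holds (ι N) R u ⇔ Holds (ι M) R t
    holds⇔ {R} {t} {u} {R₀} {t₀} eR et a₀ c =
      let (u₀ , _ , c₀) = S₀.Action.atom-image G a₀
          eu : u ≡ ι u₀
          eu = composite-unique {u} {ι u₀} {ι g} {t} c (subst (IsComposite (ι u₀) (ι g)) (sym et) (composite-up {u₀} {g} {t₀} c₀))
          h = S₀.Action.action-holds G A a₀ c₀
      in mk⇔ (λ p → subst₂ (Holds (ι M)) (sym eR) (sym et) (holds-up (to h (holds-down (subst₂ (Holds (ι N)) eR eu p)))))
        (λ p → subst₂ (Holds (ι N)) (sym eR) (sym eu) (holds-up (from h (holds-down (subst₂ (Holds (ι M)) eR et p)))))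

  -- E is the set of structures of the small model that lie in A.
  Trace : 𝕍 → M₀.𝕍 → Set ℓ
  Trace A E = A ∩ ι S₀.Str ≡ ι E

  module _ {A E} (T : Trace A E) where
    trace-in : ∀ {M} → M M₀.∈ S₀.Str → ι M ∈ A → M M₀.∈ E
    trace-in {M} p q = ι∈⁻ (subst (ι M ∈_) T (∈∩ q (∈ι p)))

    trace-out : ∀ {M} → M M₀.∈ E → ι M ∈ A
    trace-out {M} p = proj₁ (∈∩⁻ (subst (ι M ∈_) (sym T) (∈ι p)))

    trace⊆Str : E M₀.⊆ S₀.Str
    trace⊆Str M p = ι∈⁻ (proj₂ (∈∩⁻ (subst (ι M ∈_) (sym T) (∈ι p))))

  trace-intro : ∀ {A E} → E M₀.⊆ S₀.Str → (∀ M → M M₀.∈ S₀.Str → ι M ∈ A → M M₀.∈ E) → (∀ M → M M₀.∈ E → ι M ∈ A) → Trace A E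
  trace-intro {A} {E} E⊆ h k = ext
    (λ N p → let (q , r) = ∈∩⁻ p ; (M , e , M∈) = ∈ι⁻ r in subst (_∈ ι E) (sym e) (∈ι (h M M∈ (subst (_∈ A) e q))))
    (λ N p → let (M , e , M∈) = ∈ι⁻ p in subst (_∈ A ∩ ι S₀.Str) (sym e) (∈∩ (k M M∈) (∈ι (E⊆ M M∈))))

  trace-∅ : Trace ∅ M₀.∅
  trace-∅ = trace-intro (λ M p → ⊥-elim (M₀.∉∅ p)) (λ M _ p → ⊥-elim (∉∅ p)) (λ M p → ⊥-elim (M₀.∉∅ p))

  trace-Str : Trace Str S₀.Str
  trace-Str = trace-intro (λ _ p → p) (λ M p _ → p) (λ M p → str-up p)

  trace-atom : ∀ {R t} → Trace (atomSet (ι R) (ι t)) (S₀.atomSet R t)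
  trace-atom = trace-intro (λ M p → proj₁ (S₀.∈atomSet⁻ p)) (λ M p q → S₀.∈atomSet p (holds-down (proj₂ (∈atomSet⁻ q))))
    (λ M p → let (q , r) = S₀.∈atomSet⁻ p in ∈atomSet (str-up q) (holds-up r))

  module _ {A B E F} (T : Trace A E) (U : Trace B F) where
    trace-∩ : Trace (A ∩ B) (E M₀.∩ F)
    trace-∩ = trace-intro (λ M p → trace⊆Str T M (proj₁ (M₀.∈∩⁻ p)))
      (λ M p q → let (r , s) = ∈∩⁻ q in M₀.∈∩ (trace-in T p r) (trace-in U p s))
      (λ M p → let (r , s) = M₀.∈∩⁻ p in ∈∩ (trace-out T r) (trace-out U s))

    trace-∪ : Trace (A ∪ B) (E M₀.∪ F)
    trace-∪ = trace-intro (λ M p → [ trace⊆Str T M , trace⊆Str U M ]′ (M₀.∈∪⁻ p))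
      (λ M p q → M₀.∈∪ (Sum.map (trace-in T p) (trace-in U p) (∈∪⁻ q)))
      (λ M p → ∈∪ (Sum.map (trace-out T) (trace-out U) (M₀.∈∪⁻ p)))

    trace-∖ : Trace (A ∖ B) (E M₀.∖ F)
    trace-∖ = trace-intro (λ M p → trace⊆Str T M (proj₁ (M₀.∈∖⁻ p)))
      (λ M p q → let (r , s) = ∈∖⁻ q in M₀.∈∖ (trace-in T p r) (λ u → s (trace-out U u)))
      (λ M p → let (r , s) = M₀.∈∖⁻ p in ∈∖ (trace-out T r) (λ u → s (trace-in U (trace⊆Str T M r) u)))

  trace-△ : ∀ {A B E F} → Trace A E → Trace B F → Trace (A △ B) (E M₀.△ F)
  trace-△ T U = trace-∪ (trace-∖ T U) (trace-∖ U T)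

  trace-ite : ∀ {R t A B E F} → Trace A E → Trace B F → Trace (ite (ι R) (ι t) A B) (S₀.ite R t E F)
  trace-ite T U = trace-∪ (trace-∩ trace-atom T) (trace-∖ U trace-atom)

  trace-im : ∀ {g A E} → S₀.IsSym g → A ⊆ Str → Trace A E → Trace (im (ι g) A) (S₀.im g E)
  trace-im {g} {A} {E} G A⊆ T = trace-intro (λ M p → proj₁ (S₀.∈im⁻ p))
    (λ N N∈ p → let (_ , M₁ , M₁∈ , a₁) = ∈im⁻ p ; (M , M∈ , a) = S₀.Image.act-surjective G N∈ in
      S₀.Image.∈im G (trace-in T M∈ (subst (_∈ A)
        (Image.act-injective (bijection-up G) (A⊆ M₁ M₁∈) (str-up M∈) a₁ (action-up G M∈ a)) M₁∈)) a)
    (λ N p → let (_ , M , M∈ , a) = S₀.∈im⁻ p in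
      Image.∈im (bijection-up G) (trace-out T M∈) (action-up G (trace⊆Str T M M∈) a))

  𝒜-lift : ∀ {E} → E M₀.∈ S₀.𝒜 → ∃[ A ] A ∈ 𝒜 × Trace A E
  𝒜-lift {E} p = let (n , x , q , r) = S₀.∈𝒜⁻ p in
    all (ι n) (ω-up (M₀.dom (proj₁ S₀.stages-map) q)) (ι x) (ι E) (at q) (∈ι r)
    where
    Lifted : 𝕍 → Set ℓ
    Lifted E = ∃[ A ] A ∈ 𝒜 × A ∩ ι S₀.Str ≡ E
    all : ∀ n → n ∈ ω → ∀ x E → ι S₀.stages [ n ]= x → E ∈ x → Lifted E
    all = ω-ind (∀ᶠ ∀ᶠ v3 [ v2 ]ᶠ= v1 ⇒ᶠ v0 ∈ᶠ v1 ⇒ᶠ (∃ᶠ v0 ∈ᶠ v5 ∧ᶠ compr (v0 ∈ᶠ v1) (v6 ∷ []) v0 ≈ᶠ v1)) (ι S₀.stages ∷ 𝒜 ∷ ι S₀.Str ∷ [])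
      (λ x E q r → let (x₀ , ex , q₀) = at-∃ˡ (subst (λ n → ι S₀.stages [ n ]= x) (sym ι-∅) q)
                       (E₀ , eE , r₀) = ∈ι⁻ (subst (E ∈_) ex r)
                   in subst Lifted (sym eE) (base (M₀.∈⁅⁆⁻ (subst (E₀ M₀.∈_) (M₀.functional (proj₁ S₀.stages-map) q₀ S₀.stages-0) r₀))))
      (λ n nω h x E q r → let (n₀ , en , n₀ω) = ω⁻ nω
                              (x₀ , ex , q₀) = at-∃ˡ (subst (λ n → ι S₀.stages [ n ]= x) (trans (cong succ en) (sym (ι-succ n₀))) q)
                              (E₀ , eE , r₀) = ∈ι⁻ (subst (E ∈_) ex r)
                              (y , s) = M₀.value (proj₁ S₀.stages-map) n₀ω
                          in subst Lifted (sym eE) (step (λ F F∈ → h (ι y) (ι F) (subst (λ n → ι S₀.stages [ n ]= ι y) (sym en) (at s)) (∈ι F∈))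
                            (S₀.stages-s⁻ s q₀ r₀)))
      where
      base : ∀ {E} → E ≡ M₀.∅ ⊎ E ≡ S₀.Str → Lifted (ι E)
      base = [ (λ e → ∅ , 𝒜-∅ , trans trace-∅ (cong ι (sym e))) , (λ e → Str , 𝒜-Str , trans trace-Str (cong ι (sym e))) ]′
      step : ∀ {y E} → (∀ F → F M₀.∈ y → Lifted (ι F)) →
        E M₀.∈ y ⊎ (∃[ R ] ∃[ t ] ∃[ A ] ∃[ B ] M₀.⟨ R , t ⟩ M₀.∈ S₀.Atoms × A M₀.∈ y × B M₀.∈ y × E ≡ S₀.ite R t A B) → Lifted (ι E)
      step h = [ h _ , (λ (R , t , A , B , a , A∈ , B∈ , e) →
        let (A₁ , A₁∈ , T) = h A A∈ ; (B₁ , B₁∈ , U) = h B B∈ in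
        ite (ι R) (ι t) A₁ B₁ , 𝒜-ite (atom-up (S₀.⟨⟩∈Atoms⁻ a)) A₁∈ B₁∈ , trans (trace-ite {R} {t} T U) (cong ι (sym e))) ]′

  literal-up : ∀ {n φ} → S₀.IsLiteral n φ → IsLiteral (ι n) (ι φ)
  literal-up {n} {φ} h = let (k , α , e , kω , a) = to (S₀.literal⇔ n φ) h in
    from (literal⇔ (ι n) (ι φ)) (ι k , ι α , trans (cong ι e) (ι-⟨⟩ k α) , nat-up kω ,
      from (atomic-spec (ι n) (ι α)) (Sum.map equality relation (to (S₀.atomic-spec n α) a)))
    where
    code-up : ∀ k i j → ι M₀.⟨ k , M₀.⟨ i , j ⟩ ⟩ ≡ ⟨ ι k , ⟨ ι i , ι j ⟩ ⟩
    code-up k i j = trans (ι-⟨⟩ k _) (cong ⟨ ι k ,_⟩ (ι-⟨⟩ i j))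
    equality : ∀ {α} → (∃[ i ] ∃[ j ] α ≡ M₀.⟨ M₀.∅ , M₀.⟨ i , j ⟩ ⟩ × i M₀.∈ n × j M₀.∈ n) →
      ∃[ i ] ∃[ j ] ι α ≡ ⟨ ∅ , ⟨ i , j ⟩ ⟩ × i ∈ ι n × j ∈ ι n
    equality (i , j , e , i∈ , j∈) = ι i , ι j ,
      trans (cong ι e) (trans (code-up M₀.∅ i j) (cong (λ z → ⟨ z , ⟨ ι i , ι j ⟩ ⟩) ι-∅)) , ∈ι i∈ , ∈ι j∈
    relation : ∀ {α} → (∃[ R ] ∃[ s ] ∃[ m ] α ≡ M₀.⟨ M₀.succ M₀.∅ , M₀.⟨ R , s ⟩ ⟩ × 𝓛 M₀.[ R ]= m × s M₀.∶ m ⟶ n) →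
      ∃[ R ] ∃[ s ] ∃[ m ] ι α ≡ ⟨ succ ∅ , ⟨ R , s ⟩ ⟩ × ι 𝓛 [ R ]= m × s ∶ m ⟶ ι n
    relation (R , s , m , e , r , S) = ι R , ι s , ι m ,
      trans (cong ι e) (trans (code-up M₀.one R s) (cong (λ z → ⟨ z , ⟨ ι R , ι s ⟩ ⟩) (trans (ι-succ M₀.∅) (cong succ ι-∅)))) ,
      at r , map-up S

  ι-one : ι M₀.one ≡ one
  ι-one = trans (ι-succ M₀.∅) (cong succ ι-∅)

  ι-relationLiteral : ∀ k R s → ι (S₀.relationLiteral k R s) ≡ relationLiteral (ι k) (ι R) (ι s)
  ι-relationLiteral k R s = trans (ι-⟨⟩ k _) (cong ⟨ ι k ,_⟩ (trans (ι-⟨⟩ M₀.one _) (cong₂ ⟨_,_⟩ ι-one (ι-⟨⟩ R s))))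

  -- K is defined by a conjunction with parameters from the small model.
  IsCoded : 𝕍 → Set ℓ
  IsCoded K = ∃[ n ] ∃[ a ] ∃[ m ] ∃[ c ] S₀.IsCode n a m c × K ≡ conj (ι a) (ι c) × Trace K (S₀.conj a c) × S₀.conj a c M₀.∈ S₀.Meas

  private
    codedᶠ : Fm 5
    codedᶠ = ∃ᶠ ∃ᶠ ∃ᶠ ⟨ ⟨ v2 , v1 ⟩ᵗ , v0 ⟩ᵗ ∈ᶠ v4 ∧ᶠ v3 ≈ᶠ compr (satConjunction v0 v1 v2) (v2 ∷ v1 ∷ []) v7 ∧ᶠ
      compr (v0 ∈ᶠ v1) (v5 ∷ []) v3 ≈ᶠ v0 ∧ᶠ v0 ∈ᶠ v6
    parameters : Vec 𝕍 4
    parameters = ι S₀.codes ∷ ι S₀.Str ∷ ι S₀.Meas ∷ Str ∷ []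

  coded : 𝕍
  coded = sep codedᶠ parameters Meas

  ∈coded : ∀ {K} → K ∈ Meas → IsCoded K → K ∈ coded
  ∈coded {K} p (n , a , m , c , C , e , T , q) = ∈sep codedᶠ parameters p (ι a , ι c , ι (S₀.conj a c) ,
    subst (_∈ ι S₀.codes) (trans (ι-⟨⟩ _ _) (cong (λ x → ⟨ x , ι (S₀.conj a c) ⟩) (ι-⟨⟩ a c))) (∈ι (S₀.∈codes C)) , e , T , ∈ι q)

  ∈coded⁻ : ∀ {K} → K ∈ coded → K ∈ Meas × IsCoded K
  ∈coded⁻ {K} p =
    let (q , a , c , K₀ , r , e , T , s) = ∈sep⁻ codedᶠ parameters p
        (x , ex , x∈) = ∈ι⁻ r
        (n , a₀ , m , c₀ , ex₀ , C) = S₀.∈codes⁻ x∈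
        (e₁ , e₂) = ⟨⟩-injective (trans ex (trans (cong ι ex₀) (ι-⟨⟩ _ _)))
        (e₃ , e₄) = ⟨⟩-injective (trans e₁ (ι-⟨⟩ a₀ c₀))
    in q , n , a₀ , m , c₀ , C , trans e (cong₂ conj e₃ e₄) , trans T e₂ , ι∈⁻ (subst (_∈ ι S₀.Meas) e₂ s)

  coded-Str : Str ∈ coded
  coded-Str = ∈coded meas-Str (M₀.∅ , M₀.∅ , M₀.∅ , M₀.∅ , S₀.empty-code ,
    sym (trans (cong (conj (ι M₀.∅)) ι-∅) conj-∅) , trans trace-Str (cong ι (sym S₀.conj-∅)) , subst (M₀._∈ S₀.Meas) (sym S₀.conj-∅) S₀.meas-Str)

  module _ {R t} (R-atom : S₀.IsAtom R t) {K} (K∈ : K ∈ coded) where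
    private
      L : 𝕍
      L = atomSet (ι R) (ι t)
      L₀ : M₀.𝕍
      L₀ = S₀.atomSet R t

      extended : ∀ {n a m c l} → S₀.IsCode n a m c → K ≡ conj (ι a) (ι c) → Trace K (S₀.conj a c) → S₀.conj a c M₀.∈ S₀.Meas →
        𝓛 M₀.[ R ]= l → (∃[ n′ ] ∃[ a′ ] ∃[ s ] n′ M₀.∈ M₀.ω × n M₀.⊆ n′ × a′ M₀.∶ n′ ⟶ X × a M₀.⊆ a′ × s M₀.∶ l ⟶ n′ × M₀.IsComposite t a′ s) →
        IsCoded (K ∩ L) × IsCoded (K ∖ L)
      extended {n} {a} {m} {c} {l} C@(nω , A , mω , F , lits , _) e T q r (n′ , a′ , s , n′ω , n⊆ , A′ , a⊆ , S , comp) =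
        (n′ , a′ , M₀.succ m , c′ M₀.∅ , code M₀.0∈ω ,
          trans (cong (_∩ L) e) (sym (trans (cong (conj (ι a′)) (c′-up M₀.∅))
            (E₁.conj-positive {k = ι M₀.∅} lits-up (function-up F) (composite-up {t} {a′} {s} comp) (subst Even (sym ι-∅) even-∅)))) ,
          trans (trace-∩ T trace-atom) (cong ι (sym conj-∩)) , subst (M₀._∈ S₀.Meas) (sym conj-∩) (S₀.meas-∩ q (S₀.meas-atom R-atom))) ,
        (n′ , a′ , M₀.succ m , c′ M₀.one , code (M₀.s∈ω M₀.0∈ω) ,
          trans (cong (_∖ L) e) (sym (trans (cong (conj (ι a′)) (c′-up M₀.one))
            (E₁.conj-negative {k = ι M₀.one} lits-up (function-up F) (composite-up {t} {a′} {s} comp) (λ h → ¬even-1 (subst Even ι-one h))))) ,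
          trans (trace-∖ T trace-atom) (cong ι (sym conj-∖)) , subst (M₀._∈ S₀.Meas) (sym conj-∖) (S₀.meas-∖ q (S₀.meas-atom R-atom)))
        where
        c′ : M₀.𝕍 → M₀.𝕍
        c′ k = c M₀.▹ m ↦ S₀.relationLiteral k R s
        code : ∀ {k} → k M₀.∈ M₀.ω → S₀.IsCode n′ a′ (M₀.succ m) (c′ k)
        code kω = S₀.extend-code C n′ω n⊆ A′ a⊆ r S kω
        c′-up : ∀ k → ι (c′ k) ≡ ι c ▹ ι m ↦ relationLiteral (ι k) (ι R) (ι s)
        c′-up k = trans (ι-▹ c m _) (cong (ι c ▹ ι m ↦_) (ι-relationLiteral k R s))
        module E₀ = S₀.Extension A A′ n⊆ a⊆
        module E₁ = S₁.Extension (map-up A) (map-up A′) (ι-⊆ n⊆) (ι-⊆ a⊆)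
        lits-up : ∀ j φ → ι c [ j ]= φ → IsLiteral (ι n) φ
        lits-up j φ p = let (j₀ , φ₀ , _ , e , p₀) = at-∃ p in subst (IsLiteral (ι n)) (sym e) (literal-up (lits j₀ φ₀ p₀))
        conj-∩ : S₀.conj a′ (c′ M₀.∅) ≡ S₀.conj a c M₀.∩ L₀
        conj-∩ = E₀.conj-positive lits F comp M₀.even-∅
        conj-∖ : S₀.conj a′ (c′ M₀.one) ≡ S₀.conj a c M₀.∖ L₀
        conj-∖ = E₀.conj-negative lits F comp M₀.¬even-1

      both-coded : IsCoded (K ∩ L) × IsCoded (K ∖ L)
      both-coded = let (_ , n , a , m , c , C , e , T , q) = ∈coded⁻ K∈ ; (l , r , U) = R-atom in
        extended {n} {a} {m} {c} {l} C e T q r (S₀.cover-tuple (proj₁ C) (proj₁ (proj₂ C)) (S₀.arity∈ω r) U)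

    coded-∩ : K ∩ L ∈ coded
    coded-∩ = ∈coded (meas-∩ (proj₁ (∈coded⁻ K∈)) (meas-atom (atom-up R-atom))) (proj₁ both-coded)

    coded-∖ : K ∖ L ∈ coded
    coded-∖ = ∈coded (meas-∖ (proj₁ (∈coded⁻ K∈)) (meas-atom (atom-up R-atom))) (proj₂ both-coded)

  private
    permutations : M₀.𝕍
    permutations = M₀.sep (isBijection v0 v1 v1) (X ∷ []) (M₀.𝒫 (X M₀.⊗ X))

    ∈permutations : ∀ {g} → S₀.IsSym g → g M₀.∈ permutations
    ∈permutations {g} G = M₀.∈sep (isBijection v0 v1 v1) (X ∷ []) (M₀.∈𝒫 λ p q → inside (proj₁ (proj₁ (proj₁ G)) p q) q) G
      where
      inside : ∀ {p} → (∃[ x ] ∃[ y ] p ≡ M₀.⟨ x , y ⟩ × x M₀.∈ X) → p M₀.∈ g → p M₀.∈ X M₀.⊗ X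
      inside (x , y , e , x∈) q = subst (M₀._∈ X M₀.⊗ X) (sym e) (M₀.∈⊗ x∈ (proj₂ (proj₁ G) x y (subst (M₀._∈ g) e q)))

    ∈permutations⁻ : ∀ {g} → g M₀.∈ permutations → S₀.IsSym g
    ∈permutations⁻ p = proj₂ (M₀.∈sep⁻ (isBijection v0 v1 v1) (X ∷ []) p)

  approximate-permutation : ∀ s → s ∈ finiteSubsets → ∀ g → IsSym g → ∃[ h ] S₀.IsSym h × Agree g (ι h) s
  approximate-permutation s s∈ g G = let (h , h∈ , ag) = all s s∈ g G ; (h₀ , e , h₀∈) = ∈ι⁻ h∈ in
    h₀ , ∈permutations⁻ h₀∈ , subst (λ h → Agree g h s) e ag
    where
    Approximated : 𝕍 → 𝕍 → Set ℓ
    Approximated g s = ∃[ h ] h ∈ ι permutations × Agree g h s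
    insert-point : ∀ {s g x} → IsSym g → x ∈ ι X → Approximated g s → Approximated g (s ∪ singleton x)
    insert-point {s} {g} {x} G x∈ (h , h∈ , ag) =
      let (y , gx) = value (proj₁ (proj₁ G)) x∈
          (x₀ , ex , x₀∈) = ∈ι⁻ x∈ ; (y₀ , ey , y₀∈) = ∈ι⁻ (proj₂ (proj₁ G) x y gx)
          (h₀ , eh , h₀∈) = ∈ι⁻ h∈ ; H = ∈permutations⁻ h₀∈
          (z₀ , hx) = M₀.value (proj₁ (proj₁ H)) x₀∈
      in adjusted {x₀} {y₀} {z₀} {h₀} H (subst₂ (λ x y → g [ x ]= y) ex ey gx) ex y₀∈ hx (subst (λ h → Agree g h s) eh ag) (dec (z₀ ≡ y₀))
      where
      adjusted : ∀ {x₀ y₀ z₀ h₀} → S₀.IsSym h₀ → g [ ι x₀ ]= ι y₀ → x ≡ ι x₀ → y₀ M₀.∈ X → h₀ M₀.[ x₀ ]= z₀ → Agree g (ι h₀) s →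
        Dec (z₀ ≡ y₀) → Approximated g (s ∪ singleton x)
      adjusted {x₀} {y₀} {z₀} {h₀} H gx ex y₀∈ hx ag (yes e) = ι h₀ , ∈ι (∈permutations H) , λ u v u∈ gu →
        [ (λ u∈s → ag u v u∈s gu)
        , (λ u∈x → let u≡ = trans (∈⁅a⁆ u∈x) ex in
             subst₂ (λ u v → ι h₀ [ u ]= v) (sym u≡)
               (trans (cong ι e) (functional (proj₁ (proj₁ G)) gx (subst (λ u → g [ u ]= v) u≡ gu))) (at hx)) ]′ (∈∪⁻ u∈)
      adjusted {x₀} {y₀} {z₀} {h₀} H gx ex y₀∈ hx ag (no n) =
        let (k , K , elsewhere , moved) = S₀.swap H y₀∈ (proj₂ (proj₁ H) x₀ z₀ hx) in
        ι k , ∈ι (∈permutations K) , λ u v u∈ gu →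
        [ (λ u∈s → old k elsewhere u v (ag u v u∈s gu) gu)
        , (λ u∈x → let u≡ = trans (∈⁅a⁆ u∈x) ex in
             subst₂ (λ u v → ι k [ u ]= v) (sym u≡) (functional (proj₁ (proj₁ G)) gx (subst (λ u → g [ u ]= v) u≡ gu)) (at (moved x₀ hx))) ]′ (∈∪⁻ u∈)
        where
        old : ∀ k → (∀ x z → h₀ M₀.[ x ]= z → ¬ z ≡ y₀ → ¬ z ≡ z₀ → k M₀.[ x ]= z) → ∀ u v → ι h₀ [ u ]= v → g [ u ]= v → ι k [ u ]= v
        old k elsewhere u v hu gu =
          let (u₀ , v₀ , eu , ev , hu₀) = at-∃ hu
              same-point = λ (e : v₀ ≡ y₀) → ι-injective (trans (sym eu) (proj₁ (proj₂ G) u (ι x₀) (ι y₀) (subst (λ v → g [ u ]= v) (trans ev (cong ι e)) gu) gx))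
              apart : ¬ u₀ ≡ x₀
              apart e = n (M₀.functional (proj₁ (proj₁ H)) hx (subst₂ (λ u v → h₀ M₀.[ u ]= v) e
                (ι-injective (trans (sym ev) (functional (proj₁ (proj₁ G)) gu (subst (λ u → g [ u ]= ι y₀) (sym (trans eu (cong ι e))) gx)))) hu₀))
          in subst₂ (λ u v → ι k [ u ]= v) (sym eu) (sym ev) (at (elsewhere u₀ v₀ hu₀
               (λ e → apart (same-point e))
               (λ e → apart (proj₁ (proj₂ H) u₀ x₀ z₀ (subst (λ v → h₀ M₀.[ u₀ ]= v) e hu₀) hx))))
    all : ∀ s → s ∈ finiteSubsets → ∀ g → IsSym g → Approximated g s
    all = fin-ind (∀ᶠ isBijection v0 v2 v2 ⇒ᶠ (∃ᶠ v0 ∈ᶠ v4 ∧ᶠ (∀ᶠ ∀ᶠ v1 ∈ᶠ v4 ⇒ᶠ v3 [ v1 ]ᶠ= v0 ⇒ᶠ v2 [ v1 ]ᶠ= v0))) (ι X ∷ ι permutations ∷ [])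
      (λ g G → let (h , H) = S₀.identity-permutation in ι h , ∈ι (∈permutations H) , λ x y x∈ → ⊥-elim (∉∅ x∈))
      (λ s x _ x∈ k g G → insert-point G x∈ (k g G))

  𝒜-△ : ∀ {A B} → A ∈ 𝒜 → B ∈ 𝒜 → A △ B ∈ 𝒜
  𝒜-△ a b = 𝒜-∪ (𝒜-∖ a b) (𝒜-∖ b a)

  small-permutation : ∀ {g E} → IsSym g → E ∈ 𝒜 → ∃[ g₀ ] S₀.IsSym g₀ × im g E ≡ im (ι g₀) E
  small-permutation {g} {E} G E∈ = let (s , s∈ , h) = support E∈ ; (g₀ , G₀ , ag) = approximate-permutation s s∈ g G in
    g₀ , G₀ , h g (ι g₀) G (bijection-up G₀) ag

  module Transfer {μ ν} (Mμ : S₀.Measure μ) (Mν : Measure ν)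
    (relative : ∀ {n a m c r} → S₀.IsCode n a m c → μ M₀.[ S₀.conj a c ]= r → ν [ conj (ι a) (ι c) ]= ι r)
    (μ-invariant : ∀ {g B} → S₀.IsSym g → B M₀.∈ S₀.Meas → S₀.Valuation.m Mμ (S₀.im g B) ≡ S₀.Valuation.m Mμ B) where
    module μ = S₀.Valuation Mμ
    module ν = S₁.Valuation Mν

    +ᴿ-up : ∀ {r s} → M₀.IsReal r → M₀.IsReal s → IsReal (ι r) → IsReal (ι s) → ι (r M₀.+ᴿ s) ≡ ι r +ᴿ ι s
    +ᴿ-up R S R′ S′ = addReal-unique (addReal-up R S (M₀.+ᴿ-addReal R S)) (+ᴿ-addReal R′ S′)

    private
      -- The measures agree on E ∩ K for every coded K; only then does the claim pass from A and B to "if R(t) then A else B".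
      Transfers : 𝕍 → Set ℓ
      Transfers E = E ∩ ι S₀.Str ∈ ι S₀.𝒜 × (∀ K → K ∈ coded → ∀ r → ι μ [ (E ∩ K) ∩ ι S₀.Str ]= r → ν [ E ∩ K ]= r)

      transfersᶠ : Fm 6
      transfersᶠ = compr (v0 ∈ᶠ v1) (v1 ∷ []) v0 ∈ᶠ v2 ∧ᶠ (∀ᶠ v0 ∈ᶠ v4 ⇒ᶠ
        (∀ᶠ v6 [ compr (v0 ∈ᶠ v1) (v3 ∷ []) (compr (v0 ∈ᶠ v1) (v1 ∷ []) v2) ]ᶠ= v0 ⇒ᶠ v7 [ compr (v0 ∈ᶠ v1) (v1 ∷ []) v2 ]ᶠ= v0))

      value-of : ∀ {A E} → Trace A E → ∀ {r} → ι μ [ A ∩ ι S₀.Str ]= r → ∃[ r₀ ] r ≡ ι r₀ × μ M₀.[ E ]= r₀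
      value-of {A} {E} T {r} p = at-∃ˡ (subst (λ B → ι μ [ B ]= r) T p)

      at-trace : ∀ {A E} → Trace A E → E M₀.∈ S₀.Meas → ι μ [ A ∩ ι S₀.Str ]= ι (μ.m E)
      at-trace {A} {E} T e = subst (λ B → ι μ [ B ]= ι (μ.m E)) (sym T) (at (μ.m-graph e))

      transfers-∅ : Transfers ∅
      transfers-∅ = subst (_∈ ι S₀.𝒜) (sym trace-∅) (∈ι S₀.𝒜-∅) , λ K K∈ r p →
        let (r₀ , e , q) = value-of ∅∩-trace p in
        subst₂ (λ A r → ν [ A ]= r) (sym ∅∩) (sym (trans e (trans (cong ι (trans (sym (μ.m-eq q)) μ.m-∅)) ι-∅)))
          (subst (λ r → ν [ ∅ ]= r) ν.m-∅ (ν.m-graph meas-∅))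
        where
        ∅∩ : ∀ {K} → ∅ ∩ K ≡ ∅
        ∅∩ = ≡∅ λ M p → ∉∅ (proj₁ (∈∩⁻ p))
        ∅∩-trace : ∀ {K} → Trace (∅ ∩ K) M₀.∅
        ∅∩-trace = subst (λ A → Trace A M₀.∅) (sym ∅∩) trace-∅

      transfers-Str : Transfers Str
      transfers-Str = subst (_∈ ι S₀.𝒜) (sym trace-Str) (∈ι S₀.𝒜-Str) , λ K K∈ r p →
        let (K-meas , n , a , m , c , C , e , T , _) = ∈coded⁻ K∈
            Str∩ = ext (λ M q → proj₂ (∈∩⁻ q)) (λ M q → ∈∩ (meas⊆Str K-meas M q) q)
            (r₀ , er , q) = value-of (subst (λ A → Trace A (S₀.conj a c)) (sym Str∩) T) p
        in subst₂ (λ A r → ν [ A ]= r) (sym (trans Str∩ e)) (sym er) (relative C q)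

      transfers-ite : ∀ R t A B → IsAtom R t → A ∈ 𝒜 → B ∈ 𝒜 → Transfers A → Transfers B → Transfers (ite R t A B)
      transfers-ite R t A B a A∈ B∈ (A-trace , hA) (B-trace , hB) =
        let (R₀ , t₀ , eR , et , a₀) = atom-down a
            (A₀ , TA , A₀∈) = ∈ι⁻ A-trace ; (B₀ , TB , B₀∈) = ∈ι⁻ B-trace
        in subst₂ (λ R t → Transfers (ite R t A B)) (sym eR) (sym et) (core a₀ TA A₀∈ TB B₀∈)
        where
        core : ∀ {R t A₀ B₀} → S₀.IsAtom R t → Trace A A₀ → A₀ M₀.∈ S₀.𝒜 → Trace B B₀ → B₀ M₀.∈ S₀.𝒜 → Transfers (ite (ι R) (ι t) A B)
        core {R} {t} {A₀} {B₀} a₀ TA A₀∈ TB B₀∈ =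
          subst (_∈ ι S₀.𝒜) (sym (trace-ite {R} {t} TA TB)) (∈ι (S₀.𝒜-ite a₀ A₀∈ B₀∈)) , measures
          where
          L = atomSet (ι R) (ι t)
          L₀ = S₀.atomSet R t
          measures : ∀ K → K ∈ coded → ∀ r → ι μ [ (ite (ι R) (ι t) A B ∩ K) ∩ ι S₀.Str ]= r → ν [ ite (ι R) (ι t) A B ∩ K ]= r
          measures K K∈ r p =
            let (K-meas , n , c , m , d , C , e , TK , K₀-meas) = ∈coded⁻ K∈ in with-trace K₀-meas TK p
            where
            P Q : 𝕍
            P = A ∩ (K ∩ L)
            Q = B ∩ (K ∖ L)
            split : ite (ι R) (ι t) A B ∩ K ≡ P ∪ Q
            split = ext
              (λ M p → let (q , k) = ∈∩⁻ p in [ (λ (l , x) → ∈∪ (inj₁ (∈∩ x (∈∩ k l)))) , (λ (l , x) → ∈∪ (inj₂ (∈∩ x (∈∖ k l)))) ]′ (∈ite⁻ q))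
              (λ M p → [ (λ q → let (x , kl) = ∈∩⁻ q ; (k , l) = ∈∩⁻ kl in ∈∩ (∈ite (inj₁ (l , x))) k)
                       , (λ q → let (x , kl) = ∈∩⁻ q ; (k , l) = ∈∖⁻ kl in ∈∩ (∈ite (inj₂ (l , x))) k) ]′ (∈∪⁻ p))
            kl∈ : K ∩ L ∈ coded
            kl∈ = coded-∩ a₀ K∈
            k¬l∈ : K ∖ L ∈ coded
            k¬l∈ = coded-∖ a₀ K∈
            P-meas : P ∈ Meas
            P-meas = meas-∩ (𝒜⊆Meas A A∈) (proj₁ (∈coded⁻ kl∈))
            Q-meas : Q ∈ Meas
            Q-meas = meas-∩ (𝒜⊆Meas B B∈) (proj₁ (∈coded⁻ k¬l∈))
            with-trace : ∀ {K₀} → K₀ M₀.∈ S₀.Meas → Trace K K₀ →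
              ι μ [ (ite (ι R) (ι t) A B ∩ K) ∩ ι S₀.Str ]= r → ν [ ite (ι R) (ι t) A B ∩ K ]= r
            with-trace {K₀} K₀-meas TK p =
              let (r₀ , er , q) = value-of (subst (λ Z → Trace Z (P₀ M₀.∪ Q₀)) (sym split) (trace-∪ TP TQ)) p in
              subst₂ (λ Z r → ν [ Z ]= r) (sym split) (sym (trans er (trans (cong ι (sym (μ.m-eq q))) sums))) (ν.m-graph (meas-∪ P-meas Q-meas))
              where
              P₀ Q₀ : M₀.𝕍
              P₀ = A₀ M₀.∩ (K₀ M₀.∩ L₀)
              Q₀ = B₀ M₀.∩ (K₀ M₀.∖ L₀)
              TP : Trace P P₀
              TP = trace-∩ TA (trace-∩ TK trace-atom)
              TQ : Trace Q Q₀
              TQ = trace-∩ TB (trace-∖ TK trace-atom)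
              P₀-meas : P₀ M₀.∈ S₀.Meas
              P₀-meas = S₀.meas-∩ (S₀.𝒜⊆Meas A₀ A₀∈) (S₀.meas-∩ K₀-meas (S₀.meas-atom a₀))
              Q₀-meas : Q₀ M₀.∈ S₀.Meas
              Q₀-meas = S₀.meas-∩ (S₀.𝒜⊆Meas B₀ B₀∈) (S₀.meas-∖ K₀-meas (S₀.meas-atom a₀))
              νP : ν.m P ≡ ι (μ.m P₀)
              νP = ν.m-eq (hA (K ∩ L) kl∈ _ (at-trace TP P₀-meas))
              νQ : ν.m Q ≡ ι (μ.m Q₀)
              νQ = ν.m-eq (hB (K ∖ L) k¬l∈ _ (at-trace TQ Q₀-meas))
              sums : ι (μ.m (P₀ M₀.∪ Q₀)) ≡ ν.m (P ∪ Q)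
              sums = trans (cong ι (μ.m-∪ P₀-meas Q₀-meas (λ M p q → proj₂ (M₀.∈∖⁻ (proj₂ (M₀.∈∩⁻ q))) (proj₂ (M₀.∈∩⁻ (proj₂ (M₀.∈∩⁻ p)))))))
                (trans (+ᴿ-up (μ.m-real P₀-meas) (μ.m-real Q₀-meas) (subst IsReal νP (ν.m-real P-meas)) (subst IsReal νQ (ν.m-real Q-meas)))
                (trans (cong₂ _+ᴿ_ (sym νP) (sym νQ))
                  (sym (ν.m-∪ P-meas Q-meas (λ M p q → proj₂ (∈∖⁻ (proj₂ (∈∩⁻ q))) (proj₂ (∈∩⁻ (proj₂ (∈∩⁻ p)))))))))

      transfers : ∀ E → E ∈ 𝒜 → Transfers E
      transfers = 𝒜-ind transfersᶠ (ι S₀.Str ∷ ι S₀.𝒜 ∷ coded ∷ ι μ ∷ ν ∷ []) transfers-∅ transfers-Str transfers-ite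

    𝒜-trace : ∀ {E} → E ∈ 𝒜 → ∃[ E₀ ] E₀ M₀.∈ S₀.𝒜 × Trace E E₀
    𝒜-trace {E} p = let (E₀ , e , q) = ∈ι⁻ (proj₁ (transfers E p)) in E₀ , q , e

    m-trace : ∀ {E E₀} → E ∈ 𝒜 → E₀ M₀.∈ S₀.Meas → Trace E E₀ → ν.m E ≡ ι (μ.m E₀)
    m-trace {E} {E₀} E∈ E₀∈ T = ν.m-eq (subst (λ A → ν [ A ]= ι (μ.m E₀)) E∩Str
      (proj₂ (transfers E E∈) Str coded-Str _ (at-trace (subst (λ A → Trace A E₀) (sym E∩Str) T) E₀∈)))
      where
      E∩Str : E ∩ Str ≡ E
      E∩Str = ext (λ M p → proj₁ (∈∩⁻ p)) (λ M p → ∈∩ p (meas⊆Str (𝒜⊆Meas E E∈) M p))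

    ν-invariant-𝒜 : ∀ {g E} → IsSym g → E ∈ 𝒜 → ν.m (im g E) ≡ ν.m E
    ν-invariant-𝒜 {g} {E} G E∈ =
      let (g₀ , G₀ , e) = small-permutation G E∈
          (E₀ , E₀∈ , T) = 𝒜-trace E∈
          e₀ = S₀.𝒜⊆Meas E₀ E₀∈
      in trans (cong ν.m e) (trans
           (m-trace (Image.𝒜-im (bijection-up G₀) E∈) (S₀.Image.meas-im G₀ e₀) (trace-im G₀ (meas⊆Str (𝒜⊆Meas E E∈)) T))
           (trans (cong ι (μ-invariant G₀ e₀)) (sym (m-trace E∈ e₀ T))))

    ν-invariant : ∀ {g B} → IsSym g → B ∈ Meas → ν.m (im g B) ≡ ν.m B
    ν-invariant {g} {B} G b = trans (sym (pulled b)) (ext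
      (Pair.below-everywhere pullback-measure Mν (λ E E∈ v p → subst (v ∈_) (trans (pulled (𝒜⊆Meas E E∈)) (ν-invariant-𝒜 G E∈)) p) b)
      (Pair.below-everywhere Mν pullback-measure (λ E E∈ v p → subst (v ∈_) (sym (trans (pulled (𝒜⊆Meas E E∈)) (ν-invariant-𝒜 G E∈))) p) b))
      where
      open Image G
      open Pullback Mν
      module P = S₁.Valuation pullback-measure
      pulled : ∀ {A} → A ∈ Meas → P.m A ≡ ν.m (im g A)
      pulled a = P.m-eq (pullback-value a (ν.m-graph (meas-im a)))

    ∈m-up : ∀ {x E E₀} → E ∈ 𝒜 → E₀ M₀.∈ S₀.Meas → Trace E E₀ → x M₀.∈ᶜ μ.m E₀ → lift x ∈ᶜ ν.m E
    ∈m-up {x} E∈ e₀ T p = subst₂ _∈_ (lift-⌜⌝ x) (sym (m-trace E∈ e₀ T)) (∈ι p)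

    ∈m-down : ∀ {x E E₀} → E ∈ 𝒜 → E₀ M₀.∈ S₀.Meas → Trace E E₀ → lift x ∈ᶜ ν.m E → x M₀.∈ᶜ μ.m E₀
    ∈m-down {x} E∈ e₀ T p = ι∈⁻ (subst₂ _∈_ (sym (lift-⌜⌝ x)) (m-trace E∈ e₀ T) p)

    -- A path of the small model is lifted pointwise: by choice, each set of the path is the trace of a set of 𝒜.
    module Lifted {δ b} (P : μ.Path δ b) where
      private
        δ-map = proj₁ P
        b-map = proj₁ (proj₂ P)
        module B = Graph (∃ᶠ v4 [ v2 ]ᶠ= v0 ∧ᶠ compr (v0 ∈ᶠ v1) (v5 ∷ []) v1 ≈ᶠ v0) (ι b ∷ ι S₀.Str ∷ []) ω 𝒜

        opaque
          chosen : ∃[ f ] f ∶ ω ⟶ 𝒜 × (∀ {x y} → f [ x ]= y → x ∈ ω × y ∈ 𝒜 × (∃[ E ] ι b [ x ]= E × y ∩ ι S₀.Str ≡ E))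
          chosen = B.axiom-of-choice λ n p →
            let (n₀ , en , n₀ω) = ω⁻ p ; (E₀ , q) = M₀.value (proj₁ b-map) n₀ω ; (A , A∈ , T) = 𝒜-lift (proj₂ b-map n₀ E₀ q) in
            A , A∈ , ι E₀ , subst (λ n → ι b [ n ]= ι E₀) (sym en) (at q) , T

        b₁ : 𝕍
        b₁ = proj₁ chosen

        b₁-map : b₁ ∶ ω ⟶ 𝒜
        b₁-map = proj₁ (proj₂ chosen)

        b₁-trace : ∀ {n A} → b₁ [ ι n ]= A → ∃[ E ] b M₀.[ n ]= E × A ∈ 𝒜 × E M₀.∈ S₀.𝒜 × Trace A E
        b₁-trace {n} {A} p = let (_ , A∈ , E , q , T) = proj₂ (proj₂ chosen) p ; (E₀ , e , q₀) = at-∃ˡ q in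
          E₀ , q₀ , A∈ , proj₂ b-map n E₀ q₀ , trans T e

        δ₁-map : ι δ ∶ ω ⟶ Pos
        δ₁-map = subst (IsFunctionOn (ι δ)) ι-ω (function-up (proj₁ δ-map)) , λ n v p →
          let (n₀ , v₀ , _ , ev , q) = at-∃ p ; (ε , e , ε>0) = M₀.∈Pos⁻ (proj₂ δ-map n₀ v₀ q) in
          subst (_∈ Pos) (sym (trans ev (trans (cong ι e) (lift-⌜⌝ ε)))) (∈Pos {lift ε} (positive-up {ε} ε>0))

        δ-at : ∀ {n ε} → ι δ [ ι n ]= ⌜ ε ⌝ → ∃[ ε₀ ] δ M₀.[ n ]= M₀.⌜ ε₀ ⌝ × ⌜ ε ⌝ ≡ ⌜ lift ε₀ ⌝
        δ-at {n} {ε} p = let (v₀ , ev , q) = at-∃ˡ p ; (ε₀ , e , _) = M₀.∈Pos⁻ (proj₂ δ-map n v₀ q) in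
          ε₀ , subst (λ v → δ M₀.[ n ]= v) e q , trans ev (trans (cong ι e) (lift-⌜⌝ ε₀))

        index : ∀ {n v} → ι δ [ n ]= v → ∃[ n₀ ] n ≡ ι n₀
        index p = let (n₀ , _ , e , _) = at-∃ p in n₀ , e

        halving-at : ∀ n ε ε′ → ι δ [ ι n ]= ⌜ ε ⌝ → ι δ [ succ (ι n) ]= ⌜ ε′ ⌝ → ε′ ⊕ ε′ ≤q ε
        halving-at n ε ε′ p p′ = with-values (δ-at {n} {ε} p) (δ-at {M₀.succ n} {ε′} (subst (λ n → ι δ [ n ]= ⌜ ε′ ⌝) (sym (ι-succ n)) p′))
          where
          with-values : (∃[ ε₀ ] δ M₀.[ n ]= M₀.⌜ ε₀ ⌝ × ⌜ ε ⌝ ≡ ⌜ lift ε₀ ⌝) →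
            (∃[ ε₀ ] δ M₀.[ M₀.succ n ]= M₀.⌜ ε₀ ⌝ × ⌜ ε′ ⌝ ≡ ⌜ lift ε₀ ⌝) → ε′ ⊕ ε′ ≤q ε
          with-values (ε₀ , q , e) (ε₀′ , q′ , e′) =
            ≤q-trans {ε′ ⊕ ε′} {lift ε₀′ ⊕ lift ε₀′} {ε} (⊕-mono-≤ {ε′} {lift ε₀′} {ε′} {lift ε₀′} (same-≤ {ε′} {lift ε₀′} e′) (same-≤ {ε′} {lift ε₀′} e′))
            (≤q-trans {lift ε₀′ ⊕ lift ε₀′} {lift (ε₀′ M₀.⊕ ε₀′)} {ε} (⊕-up ε₀′ ε₀′)
            (≤q-trans {lift (ε₀′ M₀.⊕ ε₀′)} {lift ε₀} {ε} (≤q-up {ε₀′ M₀.⊕ ε₀′} {ε₀} (proj₁ (proj₂ (proj₂ P)) n ε₀ ε₀′ q q′)) (same-≤ {lift ε₀} {ε} (sym e))))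

        shift-at : ∀ n ε A g → ι δ [ ι n ]= ⌜ ε ⌝ → b₁ [ ι n ]= A → IsSym g → ε ∉ᶜ ν.m (A △ im g A)
        shift-at n ε A g p q G r =
          let (ε₀ , p₀ , e) = δ-at {n} {ε} p
              (E , q₀ , A∈ , E∈ , T) = b₁-trace q
              (g₀ , G₀ , eg) = small-permutation G A∈
              T△ = trace-△ T (trace-im G₀ (meas⊆Str (𝒜⊆Meas A A∈)) T)
          in proj₁ (proj₂ (proj₂ (proj₂ P))) n ε₀ E g₀ p₀ q₀ G₀
               (∈m-down {ε₀} (𝒜-△ A∈ (Image.𝒜-im (bijection-up G₀) A∈)) (S₀.meas-△ (S₀.𝒜⊆Meas E E∈) (S₀.Image.meas-im G₀ (S₀.𝒜⊆Meas E E∈))) T△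
                 (subst₂ (λ v B → v ∈ ν.m (A △ B)) e eg r))

        step-at : ∀ n ε A A′ → ι δ [ ι n ]= ⌜ ε ⌝ → b₁ [ ι n ]= A → b₁ [ succ (ι n) ]= A′ → ε ∉ᶜ ν.m (A △ A′)
        step-at n ε A A′ p q q′ r =
          let (ε₀ , p₀ , e) = δ-at {n} {ε} p
              (E , q₀ , A∈ , E∈ , T) = b₁-trace q
              (E′ , q₀′ , A′∈ , E′∈ , T′) = b₁-trace (subst (λ n → b₁ [ n ]= A′) (sym (ι-succ n)) q′)
          in proj₁ (proj₂ (proj₂ (proj₂ (proj₂ P)))) n ε₀ E E′ p₀ q₀ q₀′
               (∈m-down {ε₀} (𝒜-△ A∈ A′∈) (S₀.meas-△ (S₀.𝒜⊆Meas E E∈) (S₀.𝒜⊆Meas E′ E′∈)) (trace-△ T T′)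
                 (subst (_∈ ν.m (A △ A′)) e r))

        at-∅ : ∀ {f y} → ι f [ ι M₀.∅ ]= y → ι f [ ∅ ]= y
        at-∅ {f} {y} = subst (λ n → ι f [ n ]= y) ι-∅

        3ε≤η-up : ∀ ε η → (ε M₀.⊕ ε) M₀.⊕ ε M₀.≤q η → (lift ε ⊕ lift ε) ⊕ lift ε ≤q lift η
        3ε≤η-up ε η h =
          ≤q-trans {(lift ε ⊕ lift ε) ⊕ lift ε} {lift (ε M₀.⊕ ε) ⊕ lift ε} {lift η}
            (⊕-mono-≤ {lift ε ⊕ lift ε} {lift (ε M₀.⊕ ε)} {lift ε} {lift ε} (⊕-up ε ε) (≤q-refl {lift ε}))
            (≤q-trans {lift (ε M₀.⊕ ε) ⊕ lift ε} {lift ((ε M₀.⊕ ε) M₀.⊕ ε)} {lift η} (⊕-up (ε M₀.⊕ ε) ε) (≤q-up {(ε M₀.⊕ ε) M₀.⊕ ε} {η} h))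

        start-up : ∀ ε η {A E} → A ∈ 𝒜 → E M₀.∈ S₀.Meas → Trace A E → μ.Start ε η E → ν.Start (lift ε) (lift η) A
        start-up ε η {A} {E} A∈ e T (k , l , h) = inside , outside , 3ε≤η-up ε η h
          where
          inside : lift η ∈ᶜ ν.m A
          inside = ∈m-up {η} A∈ e T k
          outside : lift η ∈ᶜ ν.m (Str ∖ A)
          outside = ∈m-up {η} {Str ∖ A} {S₀.Str M₀.∖ E} (𝒜-∁ A∈) (S₀.meas-∁ e) (trace-∖ trace-Str T) l

        first-set : ∀ {E} → b M₀.[ M₀.∅ ]= E → ∃[ A ] b₁ [ ∅ ]= A × A ∈ 𝒜 × Trace A E
        first-set {E} q =
          let (A , r) = value {b₁} {ω} (proj₁ b₁-map) {∅} 0∈ω in A , r , with-trace (b₁-trace {M₀.∅} {A} (subst (λ n → b₁ [ n ]= A) (sym ι-∅) r))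
          where
          with-trace : ∀ {A} → (∃[ E′ ] b M₀.[ M₀.∅ ]= E′ × A ∈ 𝒜 × E′ M₀.∈ S₀.𝒜 × Trace A E′) → A ∈ 𝒜 × Trace A E
          with-trace {A} (E′ , q′ , A∈ , _ , T) = A∈ , subst (Trace A) (M₀.functional (proj₁ b-map) q′ q) T

        starts : ν.Starts (ι δ) b₁
        starts = from-start (proj₂ (proj₂ (proj₂ (proj₂ (proj₂ P)))))
          where
          from-start : μ.Starts δ b → ν.Starts (ι δ) b₁
          from-start (ε , η , E , p , q , st) = with-first (first-set q)
            where
            δ-value : ι δ [ ∅ ]= ⌜ lift ε ⌝
            δ-value = at-∅ {δ} {⌜ lift ε ⌝} (subst (λ v → ι δ [ ι M₀.∅ ]= v) (lift-⌜⌝ ε) (at p))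
            with-first : (∃[ A ] b₁ [ ∅ ]= A × A ∈ 𝒜 × Trace A E) → ν.Starts (ι δ) b₁
            with-first (A , r , A∈ , T) = lift ε , lift η , A , δ-value , r ,
              start-up ε η A∈ (S₀.𝒜⊆Meas E (proj₂ b-map M₀.∅ E q)) T st

      lifted-path : ν.Path (ι δ) b₁
      lifted-path = δ₁-map , b₁-map ,
        (λ n ε ε′ p p′ → let (n₀ , e) = index p in
           halving-at n₀ ε ε′ (subst (λ n → ι δ [ n ]= ⌜ ε ⌝) e p) (subst (λ n → ι δ [ succ n ]= ⌜ ε′ ⌝) e p′)) ,
        (λ n ε A g p q → let (n₀ , e) = index p in
           shift-at n₀ ε A g (subst (λ n → ι δ [ n ]= ⌜ ε ⌝) e p) (subst (λ n → b₁ [ n ]= A) e q)) ,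
        (λ n ε A A′ p q q′ → let (n₀ , e) = index p in
           step-at n₀ ε A A′ (subst (λ n → ι δ [ n ]= ⌜ ε ⌝) e p) (subst (λ n → b₁ [ n ]= A) e q) (subst (λ n → b₁ [ succ n ]= A′) e q′)) ,
        starts

    lift-nontrivial : ∀ {δ b} → μ.Path δ b → ∃[ A ] ν.IsNontrivialInvariant A
    lift-nontrivial {δ} {b} P = ν.FromPath.nontrivial-invariant (Lifted.lifted-path P)

    -- The traces of approximations to A form a subtree without terminal nodes of a tree of the small model.  Were its
    -- root in the domain of the rank function, the ranks of its nodes would have no ∈-least element.
    module Descent {A} (A-invariant : ν.IsNontrivialInvariant A) where
      private
        module N = S₁.NearInvariant Mν ν-invariant A-invariant
        module PT₀ = S₀.PathTree Mμ
        module PT₁ = S₁.PathTree Mν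
        module Rank = PT₀.Ranks

        ρ : Vec 𝕍 5
        ρ = 𝒜 ∷ ι S₀.Str ∷ ν ∷ fractions ∷ A ∷ []

        tᶠ : Fm 6
        tᶠ = ∃ᶠ ∃ᶠ ∃ᶠ ∃ᶠ v4 ≈ᶠ ⟨ v3 , v2 ⟩ᵗ ∧ᶠ v1 ∈ᶠ v5 ∧ᶠ compr (v0 ∈ᶠ v1) (v6 ∷ []) v1 ≈ᶠ v2 ∧ᶠ
          (∃ᶠ addFrac v1 v1 v0 ∧ᶠ v0 ≤ᶠ v4) ∧ᶠ ¬ᶠ (v0 ∈ᶠ valᵗ v8 v7 (△ᵗ (var 9F) v1))

        opaque
          unfolding M₁._≤Q_
          t-unfold : ∀ p → ⟦ tᶠ ⟧ (p ∷ ρ) ⇔ (∃[ v ] ∃[ E ] ∃[ B ] ∃[ η ] p ≡ ⟨ v , E ⟩ × B ∈ 𝒜 × B ∩ ι S₀.Str ≡ E × PT₁.Double η v × η ∉ ν.m (A △ B))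
          t-unfold p = ≡⇒⇔ refl

        T : 𝕍
        T = sep tᶠ ρ (ι PT₀.nodes)

        Approximant : M₀.Fraction → M₀.𝕍 → 𝕍 → Set ℓ
        Approximant ε E B = PT₀.IsNode ε E × B ∈ 𝒜 × Trace B E × N.Near (lift ε) B

        pair : M₀.Fraction → M₀.𝕍 → M₀.𝕍
        pair ε E = M₀.⟨ M₀.⌜ ε ⌝ , E ⟩

        ∈T : ∀ {ε E B} → Approximant ε E B → ι (pair ε E) ∈ T
        ∈T {ε} {E} {B} (node , B∈ , tr , near) = ∈sep tᶠ ρ (∈ι (PT₀.∈nodes {ε} node)) (from (t-unfold _)
          (⌜ lift ε ⌝ , ι E , B , ⌜ half (lift ε) ⌝ , trans (ι-⟨⟩ _ _) (cong ⟨_, ι E ⟩ (lift-⌜⌝ ε)) , B∈ , tr ,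
           PT₁.double {lift ε} {half (lift ε)} (half-⊕ (lift ε)) , near))

        ∈T⁻ : ∀ {p} → p ∈ T → Σ M₀.Fraction λ ε → Σ M₀.𝕍 λ E → Σ 𝕍 λ B → p ≡ ι (pair ε E) × Approximant ε E B
        ∈T⁻ {p} q =
          let (p∈ , h) = ∈sep⁻ tᶠ ρ q ; (p₀ , e , p₀∈) = ∈ι⁻ p∈ in
          with-node e (PT₀.∈nodes⁻ p₀∈) (to (t-unfold p) h)
          where
          with-node : ∀ {p₀} → p ≡ ι p₀ → (Σ M₀.Fraction λ ε → Σ M₀.𝕍 λ E → p₀ ≡ pair ε E × PT₀.IsNode ε E) →
            (∃[ v ] ∃[ E ] ∃[ B ] ∃[ η ] p ≡ ⟨ v , E ⟩ × B ∈ 𝒜 × B ∩ ι S₀.Str ≡ E × PT₁.Double η v × η ∉ ν.m (A △ B)) →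
            Σ M₀.Fraction λ ε → Σ M₀.𝕍 λ E → Σ 𝕍 λ B → p ≡ ι (pair ε E) × Approximant ε E B
          with-node {p₀} e (ε , E , e₀ , node) (v , F , B , η , e′ , B∈ , tr , d , n) = ε , E , B , trans e (cong ι e₀) , node , B∈ ,
            trans tr (sym (proj₂ parts)) , near (PT₁.double-frac d)
            where
            parts : ⌜ lift ε ⌝ ≡ v × ι E ≡ F
            parts = ⟨⟩-injective (trans (sym (trans (cong ι e₀) (trans (ι-⟨⟩ _ _) (cong ⟨_, ι E ⟩ (lift-⌜⌝ ε))))) (trans (sym e) e′))
            near : (∃[ h ] η ≡ ⌜ h ⌝) → N.Near (lift ε) B
            near (h , eη) = ν.∉-up {x = h} {half (lift ε)} (meas-△ (proj₁ A-invariant) (𝒜⊆Meas B B∈))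
              (≤half {h} {lift ε} (PT₁.double⁻ {lift ε} {h} (subst₂ PT₁.Double eη (sym (proj₁ parts)) d)))
              (λ q → n (subst (_∈ ν.m (A △ B)) (sym eη) q))

        approximant : ∀ {ε B} → M₀.PositiveQ ε → B ∈ 𝒜 → N.Near (lift ε) B → Σ M₀.𝕍 λ E → Approximant ε E B
        approximant {ε} {B} ε>0 B∈ near = let (E , E∈ , tr) = 𝒜-trace B∈ in E , (ε>0 , E∈ , shift E∈ tr) , B∈ , tr , near
          where
          shift : ∀ {E} → E M₀.∈ S₀.𝒜 → Trace B E → ∀ g → S₀.IsSym g → ε M₀.∉ᶜ μ.m (E M₀.△ S₀.im g E)
          shift {E} E∈ tr g G p = N.near-shift {lift ε} B∈ near (bijection-up G)
            (∈m-up {ε} (𝒜-△ B∈ (Image.𝒜-im (bijection-up G) B∈)) (S₀.meas-△ e (S₀.Image.meas-im G e))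
              (trace-△ tr (trace-im G (meas⊆Str (𝒜⊆Meas B B∈)) tr)) p)
            where
            e : E M₀.∈ S₀.Meas
            e = S₀.𝒜⊆Meas E E∈

        successor : ∀ {ε E B} → Approximant ε E B → Σ M₀.Fraction λ ε′ → Σ M₀.𝕍 λ E′ → Σ 𝕍 λ B′ → Approximant ε′ E′ B′ × PT₀.Extends ε E ε′ E′
        successor {ε} {E} {B} ((ε>0 , E∈ , _) , B∈ , tr , near) =
          let (B′ , B′∈ , near′) = N.near-exists (lift ε′) (positive-up {ε′} ε′>0) in with-next B′∈ near′ (approximant {ε′} ε′>0 B′∈ near′)
          where
          ε′ : M₀.Fraction
          ε′ = M₀.half ε
          ε′>0 : M₀.PositiveQ ε′
          ε′>0 = M₀.half-positive {ε} ε>0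
          with-next : ∀ {B′} → B′ ∈ 𝒜 → N.Near (lift ε′) B′ → (Σ M₀.𝕍 λ E′ → Approximant ε′ E′ B′) →
            Σ M₀.Fraction λ ε′ → Σ M₀.𝕍 λ E′ → Σ 𝕍 λ B′ → Approximant ε′ E′ B′ × PT₀.Extends ε E ε′ E′
          with-next {B′} B′∈ near′ (E′ , ap@((_ , E′∈ , _) , _ , tr′ , _)) = ε′ , E′ , B′ , ap , M₀.half-⊕ ε , λ p →
            N.near-step {lift ε} {lift ε′} B∈ B′∈ near near′ (≤q-up {ε′} {ε} (M₀.half≤ ε))
              (∈m-up {ε} (𝒜-△ B∈ B′∈) (S₀.meas-△ (S₀.𝒜⊆Meas E E∈) (S₀.𝒜⊆Meas E′ E′∈)) (trace-△ tr tr′) p)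

        no-rank : ∀ {ε E B} → Approximant ε E B → Rank.Unranked (pair ε E)
        no-rank {ε} {E} ap v p = none (∈sep rankᶠ (T ∷ ι Rank.F ∷ []) (∈ranks (at p)) (ι (pair ε E) , ∈T {ε} ap , at p))
          where
          rankᶠ : Fm 3
          rankᶠ = ∃ᶠ v0 ∈ᶠ v2 ∧ᶠ v3 [ v0 ]ᶠ= v1
          ∈ranks : ∀ {x v} → ι Rank.F [ x ]= v → v ∈ ⋃ (⋃ (ι Rank.F))
          ∈ranks q = ∈⋃ (∈⋃ q ∈⁅⁆₂) ∈⁅⁆₂
          none : ∀ {v} → v ∉ sep rankᶠ (T ∷ ι Rank.F ∷ []) (⋃ (⋃ (ι Rank.F)))
          none v∈ = let (v , v∈ , minimal) = least v∈ ; (_ , x , x∈ , q) = ∈sep⁻ rankᶠ (T ∷ ι Rank.F ∷ []) v∈ in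
            descend minimal q (∈T⁻ x∈)
            where
            descend : ∀ {v x} → (∀ u → u ∈ v → u ∉ sep rankᶠ (T ∷ ι Rank.F ∷ []) (⋃ (⋃ (ι Rank.F)))) → ι Rank.F [ x ]= v →
              (Σ M₀.Fraction λ ε → Σ M₀.𝕍 λ E → Σ 𝕍 λ B → x ≡ ι (pair ε E) × Approximant ε E B) → ⊥
            descend {v} {x} minimal q (ε , E , B , e , ap) = below (successor {ε} ap) (at-∃ˡ (subst (λ x → ι Rank.F [ x ]= v) e q))
              where
              below : (Σ M₀.Fraction λ ε′ → Σ M₀.𝕍 λ E′ → Σ 𝕍 λ B′ → Approximant ε′ E′ B′ × PT₀.Extends ε E ε′ E′) →
                (∃[ v₀ ] v ≡ ι v₀ × Rank.F M₀.[ pair ε E ]= v₀) → ⊥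
              below (ε′ , E′ , B′ , ap′ , ex) (v₀ , ev , q₀) =
                let (u , r , u∈) = Rank.F-decreasing q₀ (PT₀.∈steps {ε} {E} {ε′} {E′} (proj₁ ap) (proj₁ ap′) ex) in
                minimal (ι u) (subst (ι u ∈_) (sym ev) (∈ι u∈))
                  (∈sep rankᶠ (T ∷ ι Rank.F ∷ []) (∈ranks (at r)) (ι (pair ε′ E′) , ∈T {ε′} ap′ , at r))

        SmallStart : Set ℓ
        SmallStart = Σ M₀.Fraction λ ε → Σ M₀.Fraction λ η → Σ M₀.𝕍 λ E → Σ 𝕍 λ B → Approximant ε E B × μ.Start ε η E

        small-start : N.NearStart → SmallStart
        small-start (ε₁ , η₁ , B , ε₁>0 , B∈ , near , k , l , h) = with-lower (lower ε₁) (lower η₁)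
          where
          with-lower : (∃[ ε ] ⌜ ε₁ ⌝ ≡ ⌜ lift ε ⌝) → (∃[ η ] ⌜ η₁ ⌝ ≡ ⌜ lift η ⌝) → SmallStart
          with-lower (ε , e) (η , e′) = with-trace (approximant {ε} ε>0 B∈ (N.near-up {ε₁} {lift ε} B∈ ε₁≤ near))
            where
            ε₁≤ : ε₁ ≤q lift ε
            ε₁≤ = same-≤ {ε₁} {lift ε} e
            ε≤ : lift ε ≤q ε₁
            ε≤ = same-≤ {lift ε} {ε₁} (sym e)
            ε>0 : M₀.PositiveQ ε
            ε>0 = positive-down {ε} (positive-above {0q} {lift ε} (<q-≤q-trans {0q} {ε₁} {lift ε} (0<positive {ε₁} ε₁>0) ε₁≤))
            bound₀ : (ε M₀.⊕ ε) M₀.⊕ ε M₀.≤q η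
            bound₀ = ≤q-down ((ε M₀.⊕ ε) M₀.⊕ ε) η
              (≤q-trans {lift ((ε M₀.⊕ ε) M₀.⊕ ε)} {lift (ε M₀.⊕ ε) ⊕ lift ε} {lift η} (⊕-up⁻ (ε M₀.⊕ ε) ε)
              (≤q-trans {lift (ε M₀.⊕ ε) ⊕ lift ε} {(ε₁ ⊕ ε₁) ⊕ ε₁} {lift η}
                (⊕-mono-≤ {lift (ε M₀.⊕ ε)} {ε₁ ⊕ ε₁} {lift ε} {ε₁}
                  (≤q-trans {lift (ε M₀.⊕ ε)} {lift ε ⊕ lift ε} {ε₁ ⊕ ε₁} (⊕-up⁻ ε ε) (⊕-mono-≤ {lift ε} {ε₁} {lift ε} {ε₁} ε≤ ε≤)) ε≤)
              (≤q-trans {(ε₁ ⊕ ε₁) ⊕ ε₁} {η₁} {lift η} h (same-≤ {η₁} {lift η} e′))))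
            with-trace : (Σ M₀.𝕍 λ E → Approximant ε E B) → SmallStart
            with-trace (E , ap@((_ , E∈ , _) , _ , tr , _)) = ε , η , E , B , ap ,
              ∈m-down {η} B∈ (S₀.𝒜⊆Meas E E∈) tr (subst (_∈ ν.m B) e′ k) ,
              ∈m-down {η} (𝒜-∁ B∈) (S₀.meas-∁ (S₀.𝒜⊆Meas E E∈)) (trace-∖ trace-Str tr) (subst (_∈ ν.m (Str ∖ B)) e′ l) ,
              bound₀

      small-path : Σ M₀.𝕍 λ δ → Σ M₀.𝕍 λ b → μ.Path δ b
      small-path = from-start (small-start N.near-start)
        where
        from-start : SmallStart → Σ M₀.𝕍 λ δ → Σ M₀.𝕍 λ b → μ.Path δ b
        from-start (ε , η , E , B , ap , st) =
          let (c , c-map , c₀ , c-steps) = Rank.branch (PT₀.∈nodes {ε} (proj₁ ap)) (no-rank {ε} ap) in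
          PT₀.Branch.path c-map c-steps {ε} {η} {E} c₀ st

  module Comparison
    {μ : M₀.𝕍} {ν : 𝕍}
    (μ-probability : M₀.⟦ isProbabilityκMeasure v0 v1 v2 v3 ⟧ (κ ∷ X ∷ 𝓛 ∷ μ ∷ []))
    (μ-invariant : M₀.⟦ isInvariant v0 v1 v2 v3 ⟧ (κ ∷ X ∷ 𝓛 ∷ μ ∷ []))
    (ν-probability : ⟦ isProbabilityκMeasure v0 v1 v2 v3 ⟧ (ι κ ∷ ι X ∷ ι 𝓛 ∷ ν ∷ []))
    where
    Mμ : S₀.Measure μ
    Mμ = S₀.probability⇒measure (from (S₀.probability-def μ) μ-probability)

    Mν : Measure ν
    Mν = probability⇒measure (from (probability-def ν) ν-probability)

    SmallPath : Set ℓ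
    SmallPath = ∃[ δ ] ∃[ b ] S₀.IsPath μ δ b

    Ergodic₀ Ergodic₁ : Set ℓ
    Ergodic₀ = M₀.⟦ isErgodic v0 v1 v2 v3 ⟧ (κ ∷ X ∷ 𝓛 ∷ μ ∷ [])
    Ergodic₁ = ⟦ isErgodic v0 v1 v2 v3 ⟧ (ι κ ∷ ι X ∷ ι 𝓛 ∷ ν ∷ [])

    path⇒¬ergodic₀ : SmallPath → ¬ Ergodic₀
    path⇒¬ergodic₀ (δ , b , P) E = let (M , Q) = S₀.isPath⇒path P in
      S₀.Criteria.ergodic-elim M E (S₀.Valuation.FromPath.nontrivial-invariant M Q)

    module _ (relative : ∀ n a c A B r → M₀.⟦ isTuple v0 v1 v2 ⟧ (X ∷ n ∷ a ∷ []) → M₀.⟦ isConjunction v0 v1 v2 ⟧ (𝓛 ∷ n ∷ c ∷ []) →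
        M₀.⟦ isConjunctionSet v0 v1 v2 v3 v4 ⟧ (X ∷ 𝓛 ∷ a ∷ c ∷ A ∷ []) →
        ⟦ isConjunctionSet v0 v1 v2 v3 v4 ⟧ (ι X ∷ ι 𝓛 ∷ ι a ∷ ι c ∷ B ∷ []) →
        M₀.⟦ v0 [ v1 ]ᶠ= v2 ⟧ (μ ∷ A ∷ r ∷ []) → ⟦ v0 [ v1 ]ᶠ= v2 ⟧ (ν ∷ B ∷ ι r ∷ [])) where
      private
        relative-code : ∀ {n a m c r} → S₀.IsCode n a m c → μ M₀.[ S₀.conj a c ]= r → ν [ conj (ι a) (ι c) ]= ι r
        relative-code {n} {a} {m} {c} {r} code@(nω , A , _) p = relative n a c (S₀.conj a c) (conj (ι a) (ι c)) r
          (M₀.∈ω⁻ {n} nω , A) (S₀.code⇒conjunction {n} {a} {m} {c} code) (S₀.conj-spec a c) (conj-spec (ι a) (ι c)) p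

        module D (Mμ : S₀.Measure μ) = Transfer Mμ Mν
          (λ {n} {a} {m} {c} {r} → relative-code {n} {a} {m} {c} {r}) (S₀.Criteria.invariant-elim Mμ μ-invariant)

      path⇒¬ergodic₁ : SmallPath → ¬ Ergodic₁
      path⇒¬ergodic₁ (δ , b , P) E = let (M , Q) = S₀.isPath⇒path P in Criteria.ergodic-elim Mν E (D.lift-nontrivial M Q)

      ¬ergodic₁⇒path : ¬ Ergodic₁ → SmallPath
      ¬ergodic₁⇒path n =
        let (A , A-invariant) = by-contradiction λ k →
              n (Criteria.ergodic-intro Mν (from (probability-def ν) ν-probability) (Criteria.invariant-intro Mν (D.ν-invariant Mμ)) k)
            (δ , b , P) = D.Descent.small-path Mμ A-invariant
        in δ , b , S₀.path⇒isPath Mμ P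

module _ {ℓ} (em : ExcludedMiddle ℓ) (𝔹 : BackgroundModel ℓ) (V₀ V₁ : TransitiveModel 𝔹) (V₀⊑V₁ : V₀ ⊑ V₁)
 (κ X 𝓛 μ : TransitiveModel.Element V₀) (ν : TransitiveModel.Element V₁)
 (κ-ordinal : Internal.IsOrdinal V₀ κ) (κ-infinite : Internal.Infinite V₀ κ) (language : Internal.IsRelationalLanguage V₀ 𝓛)
 (μ-invariant : Internal.Structures.IsInvariantMeasure V₀ κ X 𝓛 μ) (relative : IsRelativization V₀⊑V₁ κ X 𝓛 μ ν) where
 private
   i : TransitiveModel.Element V₀ → TransitiveModel.Element V₁
   i = ι V₀⊑V₁

   module Z₀ = Strictification em V₀
   module Z₁ = Strictification em V₁
   module U₀ = Unfolding V₀ κ X 𝓛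
   module U₁ = Unfolding V₁ (i κ) (i X) (i 𝓛)

   ι′ : Z₀.Strict → Z₁.Strict
   ι′ (x , c) = x , squash (_⊑_.inclusion V₀⊑V₁ x (Z₀.unsq c))

   ι′-transitive : ∀ y a → BackgroundModel._∈_ Z₁.𝕄 y (ι′ a) → ∃[ x ] y ≡ ι′ x
   ι′-transitive (y , _) (a , c) p = (y , squash (TransitiveModel.transitive V₀ a y (Z₀.unsq c) p)) , refl

   κ′ X′ 𝓛′ μ′ : Z₀.Strict
   κ′ = Z₀.strict κ
   X′ = Z₀.strict X
   𝓛′ = Z₀.strict 𝓛
   μ′ = Z₀.strict μ

   ν′ : Z₁.Strict
   ν′ = Z₁.strict ν

   ι′-∈⇔ : ∀ x a → BackgroundModel._∈_ Z₀.𝕄 x a ⇔ BackgroundModel._∈_ Z₁.𝕄 (ι′ x) (ι′ a)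
   ι′-∈⇔ _ _ = mk⇔ id id

   id-∈⇔ : ∀ x a → BackgroundModel._∈_ Z₀.𝕄 x a ⇔ BackgroundModel._∈_ Z₀.𝕄 x a
   id-∈⇔ _ _ = mk⇔ id id

   id-transitive : ∀ y a → BackgroundModel._∈_ Z₀.𝕄 y a → ∃[ x ] y ≡ x
   id-transitive y _ _ = y , refl

   κ-ordinal′ : Model.IsOrdinal em Z₀.𝕄 κ′
   κ-ordinal′ = to (Z₀.transport (isOrdinal v0) (κ ∷ []) (κ′ ∷ []) refl) κ-ordinal

   𝓢₀ : Model.Signature em Z₀.𝕄
   𝓢₀ = record
     { κ = κ′ ; X = X′ ; 𝓛 = 𝓛′
     ; language = to (Z₀.transport (isRelationalLanguage v0) (𝓛 ∷ []) (𝓛′ ∷ []) refl) language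
     ; κ-ordinal = κ-ordinal′
     ; ω⊆κ = Model.infinite⇒ω⊆ em Z₀.𝕄 {κ′} κ-ordinal′ (to (Z₀.transport (infinite v0) (κ ∷ []) (κ′ ∷ []) refl) κ-infinite)
     }

   strictly₀ : ∀ φ → Semantics.⟦_⟧ (subStructure 𝔹 (TransitiveModel.Class V₀)) (TransitiveModel.zfc V₀) φ (κ ∷ X ∷ 𝓛 ∷ μ ∷ []) ⇔
     Model.⟦_⟧ em Z₀.𝕄 φ (κ′ ∷ X′ ∷ 𝓛′ ∷ μ′ ∷ [])
   strictly₀ φ = Z₀.transport φ (κ ∷ X ∷ 𝓛 ∷ μ ∷ []) (κ′ ∷ X′ ∷ 𝓛′ ∷ μ′ ∷ []) refl

   strictly₁ : ∀ φ → Semantics.⟦_⟧ (subStructure 𝔹 (TransitiveModel.Class V₁)) (TransitiveModel.zfc V₁) φ (i κ ∷ i X ∷ i 𝓛 ∷ ν ∷ []) ⇔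
     Model.⟦_⟧ em Z₁.𝕄 φ (ι′ κ′ ∷ ι′ X′ ∷ ι′ 𝓛′ ∷ ν′ ∷ [])
   strictly₁ φ = Z₁.transport φ (i κ ∷ i X ∷ i 𝓛 ∷ ν ∷ []) (ι′ κ′ ∷ ι′ X′ ∷ ι′ 𝓛′ ∷ ν′ ∷ []) refl

   probability : Model.⟦_⟧ em Z₀.𝕄 (isProbabilityκMeasure v0 v1 v2 v3) (κ′ ∷ X′ ∷ 𝓛′ ∷ μ′ ∷ [])
   probability = to (strictly₀ (isProbabilityκMeasure v0 v1 v2 v3)) (to (U₀.probability⇔ μ) (proj₁ μ-invariant))

   invariant : Model.⟦_⟧ em Z₀.𝕄 (isInvariant v0 v1 v2 v3) (κ′ ∷ X′ ∷ 𝓛′ ∷ μ′ ∷ [])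
   invariant = to (strictly₀ (isInvariant v0 v1 v2 v3)) (to (U₀.invariant⇔ μ) (proj₂ μ-invariant))

   probability₁ : Model.⟦_⟧ em Z₁.𝕄 (isProbabilityκMeasure v0 v1 v2 v3) (ι′ κ′ ∷ ι′ X′ ∷ ι′ 𝓛′ ∷ ν′ ∷ [])
   probability₁ = to (strictly₁ (isProbabilityκMeasure v0 v1 v2 v3)) (to (U₁.probability⇔ ν) (proj₁ relative))

   u : Z₀.Strict → TransitiveModel.Element V₀
   u = Z₀.unstrict

   u₁ : Z₁.Strict → TransitiveModel.Element V₁
   u₁ = Z₁.unstrict

   relative′ : ∀ n a c A B r → Model.⟦_⟧ em Z₀.𝕄 (isTuple v0 v1 v2) (X′ ∷ n ∷ a ∷ []) →
     Model.⟦_⟧ em Z₀.𝕄 (isConjunction v0 v1 v2) (𝓛′ ∷ n ∷ c ∷ []) →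
     Model.⟦_⟧ em Z₀.𝕄 (isConjunctionSet v0 v1 v2 v3 v4) (X′ ∷ 𝓛′ ∷ a ∷ c ∷ A ∷ []) →
     Model.⟦_⟧ em Z₁.𝕄 (isConjunctionSet v0 v1 v2 v3 v4) (ι′ X′ ∷ ι′ 𝓛′ ∷ ι′ a ∷ ι′ c ∷ B ∷ []) →
     Model.⟦_⟧ em Z₀.𝕄 (v0 [ v1 ]ᶠ= v2) (μ′ ∷ A ∷ r ∷ []) → Model.⟦_⟧ em Z₁.𝕄 (v0 [ v1 ]ᶠ= v2) (ν′ ∷ B ∷ ι′ r ∷ [])
   relative′ n a c A B r T C S₀ S₁ p =
     to (Z₁.transport (v0 [ v1 ]ᶠ= v2) (ν ∷ u₁ B ∷ i (u r) ∷ []) (ν′ ∷ B ∷ ι′ r ∷ []) refl) (to (U₁.value⇔ ν (u₁ B) (i (u r)))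
       (proj₂ relative (u n) (u a) (u c) (u A) (u₁ B) (u r)
         (U₀.tuple⇐ (u n) (u a) (from (Z₀.transport (isTuple v0 v1 v2) (X ∷ u n ∷ u a ∷ []) (X′ ∷ n ∷ a ∷ []) refl) T))
         (U₀.conjunction⇐ (u n) (u c) (from (Z₀.transport (isConjunction v0 v1 v2) (𝓛 ∷ u n ∷ u c ∷ []) (𝓛′ ∷ n ∷ c ∷ []) refl) C))
         (U₀.conjunctionSet⇐ (u a) (u c) (u A) (from (Z₀.transport (isConjunctionSet v0 v1 v2 v3 v4)
           (X ∷ 𝓛 ∷ u a ∷ u c ∷ u A ∷ []) (X′ ∷ 𝓛′ ∷ a ∷ c ∷ A ∷ []) refl) S₀))
         (U₁.conjunctionSet⇐ (i (u a)) (i (u c)) (u₁ B) (from (Z₁.transport (isConjunctionSet v0 v1 v2 v3 v4)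
           (i X ∷ i 𝓛 ∷ i (u a) ∷ i (u c) ∷ u₁ B ∷ []) (ι′ X′ ∷ ι′ 𝓛′ ∷ ι′ a ∷ ι′ c ∷ B ∷ []) refl) S₁))
         (from (U₀.value⇔ μ (u A) (u r)) (from (Z₀.transport (v0 [ v1 ]ᶠ= v2) (μ ∷ u A ∷ u r ∷ []) (μ′ ∷ A ∷ r ∷ []) refl) p))))

   relative-to-itself : ∀ n a c A B r → Model.⟦_⟧ em Z₀.𝕄 (isTuple v0 v1 v2) (X′ ∷ n ∷ a ∷ []) →
     Model.⟦_⟧ em Z₀.𝕄 (isConjunction v0 v1 v2) (𝓛′ ∷ n ∷ c ∷ []) →
     Model.⟦_⟧ em Z₀.𝕄 (isConjunctionSet v0 v1 v2 v3 v4) (X′ ∷ 𝓛′ ∷ a ∷ c ∷ A ∷ []) →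
     Model.⟦_⟧ em Z₀.𝕄 (isConjunctionSet v0 v1 v2 v3 v4) (X′ ∷ 𝓛′ ∷ a ∷ c ∷ B ∷ []) →
     Model.⟦_⟧ em Z₀.𝕄 (v0 [ v1 ]ᶠ= v2) (μ′ ∷ A ∷ r ∷ []) → Model.⟦_⟧ em Z₀.𝕄 (v0 [ v1 ]ᶠ= v2) (μ′ ∷ B ∷ r ∷ [])
   relative-to-itself n a c A B r _ _ S S′ = subst (λ C → Model.⟦_⟧ em Z₀.𝕄 (v0 [ v1 ]ᶠ= v2) (μ′ ∷ C ∷ r ∷ []))
     (Model.conjunctionSet-unique em Z₀.𝕄 {X′} {𝓛′} {a} {c} {A} {B} S S′)

   SmallPath Ergodic₀ Ergodic₁ : Set ℓ
   SmallPath = ∃[ δ ] ∃[ b ] Model.Space.IsPath em Z₀.𝕄 𝓢₀ μ′ δ b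
   Ergodic₀ = Model.⟦_⟧ em Z₀.𝕄 (isErgodic v0 v1 v2 v3) (κ′ ∷ X′ ∷ 𝓛′ ∷ μ′ ∷ [])
   Ergodic₁ = Model.⟦_⟧ em Z₁.𝕄 (isErgodic v0 v1 v2 v3) (ι′ κ′ ∷ ι′ X′ ∷ ι′ 𝓛′ ∷ ν′ ∷ [])

   ergodic₀⇔ : Internal.Structures.IsErgodic V₀ κ X 𝓛 μ ⇔ Ergodic₀
   ergodic₀⇔ = mk⇔ (λ e → to (strictly₀ (isErgodic v0 v1 v2 v3)) (to (U₀.ergodic⇔ μ) e))
     (λ e → from (U₀.ergodic⇔ μ) (from (strictly₀ (isErgodic v0 v1 v2 v3)) e))

   ergodic₁⇔ : Internal.Structures.IsErgodic V₁ (i κ) (i X) (i 𝓛) ν ⇔ Ergodic₁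
   ergodic₁⇔ = mk⇔ (λ e → to (strictly₁ (isErgodic v0 v1 v2 v3)) (to (U₁.ergodic⇔ ν) e))
     (λ e → from (U₁.ergodic⇔ ν) (from (strictly₁ (isErgodic v0 v1 v2 v3)) e))

   path⇒¬ergodic₀ : SmallPath → ¬ Ergodic₀
   path⇒¬ergodic₀ = Extension.Spaces.Comparison.path⇒¬ergodic₀ em Z₀.𝕄 Z₁.𝕄 ι′ ι′-∈⇔ ι′-transitive 𝓢₀ {μ′} {ν′}
     probability invariant probability₁

   path⇒¬ergodic₁ : SmallPath → ¬ Ergodic₁
   path⇒¬ergodic₁ = Extension.Spaces.Comparison.path⇒¬ergodic₁ em Z₀.𝕄 Z₁.𝕄 ι′ ι′-∈⇔ ι′-transitive 𝓢₀ {μ′} {ν′}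
     probability invariant probability₁ relative′

   ¬ergodic₁⇒path : ¬ Ergodic₁ → SmallPath
   ¬ergodic₁⇒path = Extension.Spaces.Comparison.¬ergodic₁⇒path em Z₀.𝕄 Z₁.𝕄 ι′ ι′-∈⇔ ι′-transitive 𝓢₀ {μ′} {ν′}
     probability invariant probability₁ relative′

   ¬ergodic₀⇒path : ¬ Ergodic₀ → SmallPath
   ¬ergodic₀⇒path = Extension.Spaces.Comparison.¬ergodic₁⇒path em Z₀.𝕄 Z₀.𝕄 id id-∈⇔ id-transitive 𝓢₀ {μ′} {μ′}
     probability invariant probability relative-to-itself

 ergodic-absolute : Internal.Structures.IsErgodic V₀ κ X 𝓛 μ ⇔ Internal.Structures.IsErgodic V₁ (i κ) (i X) (i 𝓛) ν
 ergodic-absolute = mk⇔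
   (λ e → from ergodic₁⇔ (Model.by-contradiction em Z₁.𝕄 λ n → path⇒¬ergodic₀ (¬ergodic₁⇒path n) (to ergodic₀⇔ e)))
   (λ e → from ergodic₀⇔ (Model.by-contradiction em Z₀.𝕄 λ n → path⇒¬ergodic₁ (¬ergodic₀⇒path n) (to ergodic₁⇔ e)))

proposition5p22 :
  ∀ {ℓ} → ExcludedMiddle ℓ →
  (𝔹 : BackgroundModel ℓ) (V₀ V₁ : TransitiveModel 𝔹) (V₀⊑V₁ : V₀ ⊑ V₁)
  (κ X 𝓛 μ : TransitiveModel.Element V₀) (ν : TransitiveModel.Element V₁) →
  Internal.IsOrdinal V₀ κ → Internal.Infinite V₀ κ →
  Internal.Infinite V₀ X → Internal.IsRelationalLanguage V₀ 𝓛 →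
  Internal.Structures.IsInvariantMeasure V₀ κ X 𝓛 μ →
  IsRelativization V₀⊑V₁ κ X 𝓛 μ ν →
  Internal.Structures.IsErgodic V₀ κ X 𝓛 μ ⇔
  Internal.Structures.IsErgodic V₁ (ι V₀⊑V₁ κ) (ι V₀⊑V₁ X) (ι V₀⊑V₁ 𝓛) ν
proposition5p22 em 𝔹 V₀ V₁ V₀⊑V₁ κ X 𝓛 μ ν κ-ordinal κ-infinite _ language μ-invariant relative =
  ergodic-absolute em 𝔹 V₀ V₁ V₀⊑V₁ κ X 𝓛 μ ν κ-ordinal κ-infinite language μ-invariant relative
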